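{- The problem Cycle Graph-Inclusive Vertex Splitting is solvable in polynomial time.
   Context: All graphs are finite, simple and undirected. An inclusive vertex split of a vertex $v$ in a graph $G$ removes $v$ and adds two new vertices $v_1,v_2$ with $N(v_1)\cup N(v_2)=N(v)$ ($N(v_1)$ and $N(v_2)$ may intersect); no other adjacencies change. A cycle graph is a disjoint union of cycles. Cycle Graph-Inclusive Vertex Splitting: given an undirected graph $G$ and a positive integer $k$, decide whether some sequence of at most $k$ inclusive vertex splits transforms $G$ into a cycle graph. -}

module Defs where

open import Data.Nat using (ℕ; zero; suc; _+_; _*_; _^_; _≤_)
open import Data.Nat.Binary.Base using (ℕᵇ; 2[1+_]; 1+[2_]) renaming (zero to zeroᵇ; fromℕ to toBin)
open import Data.Fin using (Fin; _≟_)
open import Data.Bool using (Bool; true; false; if_then_else_)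
open import Data.List using (List; []; _∷_; _++_; map; concatMap; allFin; length)
open import Data.Product using (Σ; ∃; ∃-syntax; _×_; _,_)
open import Data.Sum using (_⊎_)
open import Relation.Nullary using (¬_; yes; no)
open import Relation.Binary.PropositionalEquality using (_≡_; _≢_)

record Graph : Set where
  field
    n      : ℕ
    adj    : Fin n → Fin n → Bool
    sym    : ∀ a b → adj a b ≡ adj b a
    irrefl : ∀ a → adj a a ≡ false

open Graph public

-- Inclusive vertex split (up to isomorphism of the result).
-- H arises from G by an inclusive split of v : Fin (n G), witnessed by a
-- map f from V(H) to V(G) sending the two new vertices v₁ v₂ to v and
-- every other vertex of H bijectively to V(G) ∖ {v}.

record InclusiveSplit (G H : Graph) : Set where
  field
    f        : Fin (n H) → Fin (n G)
    v        : Fin (n G)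
    v₁ v₂    : Fin (n H)
    v₁≢v₂    : v₁ ≢ v₂
    fv₁      : f v₁ ≡ v
    fv₂      : f v₂ ≡ v
    fiber-v  : ∀ a → f a ≡ v → a ≡ v₁ ⊎ a ≡ v₂
    surj     : ∀ u → ∃[ a ] f a ≡ u
    inj-off  : ∀ a b → f a ≢ v → f a ≡ f b → a ≡ b
    adj-off  : ∀ a b → f a ≢ v → f b ≢ v → adj H a b ≡ adj G (f a) (f b)
    -- N(v₁), N(v₂) ⊆ N(v)   (in particular v₁, v₂ are non-adjacent)
    adj-new  : ∀ a b → f a ≡ v → adj H a b ≡ true → adj G v (f b) ≡ true
    cover    : ∀ b → adj G v (f b) ≡ true → adj H v₁ b ≡ true ⊎ adj H v₂ b ≡ true

data SplitsAtMost : ℕ → Graph → Graph → Set where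
  done : ∀ {k G} → SplitsAtMost k G G
  step : ∀ {k G G′ H} → InclusiveSplit G G′ → SplitsAtMost k G′ H → SplitsAtMost (suc k) G H

-- Cycle graph: disjoint union of cycles.  The cycles are given by a
-- permutation σ of the vertex set, each of whose orbits (of length ≥ 3)
-- is one cycle; the edges are exactly the pairs {a , σ a}.

record IsCycleGraph (G : Graph) : Set where
  field
    σ        : Fin (n G) → Fin (n G)
    σ⁻¹      : Fin (n G) → Fin (n G)
    inv₁     : ∀ a → σ⁻¹ (σ a) ≡ a
    inv₂     : ∀ a → σ (σ⁻¹ a) ≡ a
    len≥3₁   : ∀ a → σ a ≢ a
    len≥3₂   : ∀ a → σ (σ a) ≢ a
    edges    : ∀ a b → adj G a b ≡ true → b ≡ σ a ⊎ a ≡ σ b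
    edges′   : ∀ a → adj G a (σ a) ≡ true

CGIVS : Graph → ℕ → Set
CGIVS G k = ∃[ H ] (SplitsAtMost k G H × IsCycleGraph H)

data Sym : Set where
  𝟎 𝟏 ♯ : Sym

data Γ (m : ℕ) : Set where
  blank : Γ m
  inp   : Sym → Γ m
  ext   : Fin m → Γ m

data Move : Set where
  L R S : Move

record TM : Set where
  field
    Q       : ℕ
    m       : ℕ
    δ       : Fin Q → Γ m → Fin Q × Γ m × Move
    start   : Fin Q
    accept  : Fin Q
    reject  : Fin Q
    acc≢rej : accept ≢ reject

record Config (M : TM) : Set where
  constructor ⟨_,_,_,_⟩
  field
    state : Fin (TM.Q M)
    left  : List (Γ (TM.m M))   -- cells left of the head, nearest first
    head  : Γ (TM.m M)
    right : List (Γ (TM.m M))   -- cells right of the head, nearest first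

move : ∀ {M} → Fin (TM.Q M) → List (Γ (TM.m M)) → Γ (TM.m M) → List (Γ (TM.m M)) → Move → Config M
move q l       x r       S = ⟨ q , l , x , r ⟩
move q []      x r       L = ⟨ q , [] , blank , x ∷ r ⟩
move q (y ∷ l) x r       L = ⟨ q , l , y , x ∷ r ⟩
move q l       x []      R = ⟨ q , x ∷ l , blank , [] ⟩
move q l       x (y ∷ r) R = ⟨ q , x ∷ l , y , r ⟩

stepTM : ∀ {M} → Config M → Config M
stepTM {M} c@(⟨ q , l , x , r ⟩) with q ≟ TM.accept M | q ≟ TM.reject M
... | yes _ | _     = c
... | no _  | yes _ = c
... | no _  | no _  with TM.δ M q x
...   | (q′ , y , d) = move {M} q′ l y r d

run : ∀ {M} → ℕ → Config M → Config M
run zero    c = c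
run (suc t) c = run t (stepTM c)

initial : (M : TM) → List Sym → Config M
initial M []      = ⟨ TM.start M , [] , blank , [] ⟩
initial M (s ∷ w) = ⟨ TM.start M , [] , inp s , map inp w ⟩

HaltsWith : (M : TM) → List Sym → ℕ → Bool → Set
HaltsWith M w t b =
  Config.state (run t (initial M w)) ≡ (if b then TM.accept M else TM.reject M)

-- Encoding of an instance (G , k): k in (bijective) binary, then ♯, then
-- the rows of the adjacency matrix, each terminated by ♯.

encBin : ℕᵇ → List Sym
encBin zeroᵇ     = []
encBin 2[1+ x ]  = 𝟎 ∷ encBin x
encBin 1+[2 x ]  = 𝟏 ∷ encBin x

bit : Bool → Sym
bit true  = 𝟏
bit false = 𝟎

encode : Graph → ℕ → List Sym
encode G k =
  encBin (toBin k) ++ ♯ ∷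
  concatMap (λ i → map (λ j → bit (adj G i j)) (allFin (n G)) ++ ♯ ∷ []) (allFin (n G))

PolyTimeDecidable : (Graph → ℕ → Set) → Set
PolyTimeDecidable P =
  Σ TM λ M → Σ ℕ λ c → Σ ℕ λ d →
    ∀ G k → 1 ≤ k →
      Σ ℕ λ t → Σ Bool λ b →
        t ≤ c * length (encode G k) ^ d + c
        × HaltsWith M (encode G k) t b
        × (b ≡ true → P G k)
        × (P G k → b ≡ true)

-- Inclusive splits of G produce exactly the graphs H with a homomorphism
-- H → G that is onto the vertices and onto the edges.  If H is a disjoint
-- union of cycles, the images of its cycles are closed walks that cover G;
-- the edges traversed an even number of times form a T-join J, where T is
-- the set of vertices of odd degree, and a component K₂ is traversed at
-- least four times because cycles have length at least three.  Conversely,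
-- the multigraph formed by E, J and two more copies of every K₂ component
-- has even degrees, hence decomposes into closed walks, and closed walks of
-- length two can be removed by exchanging successors at a common vertex.
-- So (G , k) is a yes-instance iff G has no isolated vertex and
-- |E| + |J| + 2 κ ≤ n + k for some T-join J, κ being the number of K₂
-- components.
--
-- A minimum T-join is found by local search.  A table stores, for all
-- p, q, r, s, a join whose boundary is T + p + q + r + s; an apex vertex
-- joined to all others by expensive edges makes every such join exist.  An
-- entry is improved by splitting the sum of two other entries along a trail
-- and toggling single edges.  In a table without improvement the costs
-- define, at each threshold, an equivalence of vertices whose classes cut
-- the entry J for the empty boundary at most once, and comparing these cuts
-- with those of any other T-join shows that J is minimum.
--
-- Reading the input, the search and the final comparison are written as one
-- formula of a first-order logic with counting and bounded iteration of
-- relations.  Formulas compile to programs over counters and bit arrays,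
-- and a Turing machine executes every operation of such a program in one
-- pass over its tape.

module Submission where

open import Defs
open import Data.Nat using (ℕ; zero; suc; _+_; _*_; _≤_; _<_; _<ᵇ_; _≡ᵇ_; z≤n; s≤s; _^_; _∸_; _≤ᵇ_; _⊓_)
open import Data.Bool using (Bool; true; false; not; if_then_else_; T; _∧_; _xor_)
open import Data.Bool.Properties using (xor-same; ∧-zeroʳ; ∧-comm; xor-identityʳ)
open import Data.Fin using (Fin; zero; suc; toℕ; fromℕ<)
open import Data.List using (List; []; _∷_; _++_; length)
open import Data.Maybe using (Maybe; just; nothing)
open import Data.Product using (∃; _×_; _,_; proj₁; proj₂)
open import Data.Sum using (_⊎_; inj₁; inj₂)
open import Data.Unit using (⊤; tt)
open import Data.Empty using (⊥; ⊥-elim)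
open import Function using (_∘_; id)
open import Relation.Nullary using (¬_; yes; no)
open import Relation.Binary.Definitions using (tri<; tri≈; tri>)
open import Relation.Binary.PropositionalEquality using (_≡_; _≢_; refl; cong; cong₂; subst; trans; module ≡-Reasoning; subst₂; setoid) renaming (sym to ≡sym)
open import Data.List.Properties using (++-identityʳ)
open import Data.Nat.Properties
open import Data.Nat.Tactic.RingSolver using (solve-∀)
import Data.Fin.Properties as FP
import Data.List.Properties as LP
open import Algebra.Properties.CommutativeMonoid.Sum +-0-commutativeMonoid using (sum; sum-cong-≗; ∑-distrib-+; ∑-comm; ∑-permute)

-- The usual route to a minimum T-join, shortest paths followed by a minimum weight perfect
-- matching, would require a verified blossom algorithm. The table avoids it. Its entries carry four
-- extra boundary vertices because the proof that two edges of J never meet the same cut compares J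
-- with J minus both edges, a join with four changed ends. Optimality is certified by weighted cuts
-- read off from the entry costs; they occur in the proof only and are never computed. The search
-- graph lives on the positions of the input word. There are more positions than entries of the
-- adjacency matrix, so an isolated position is left for the apex, and one apex edge can be priced
-- above all edges of the graph together. Cardinalities of edge sets are counts of darts, that is,
-- of ordered pairs, so both sides of the inequality appear doubled. The search is bounded by
-- counting: the costs in the table add up to at most N^7, and N^8 sweeps are made. Boolean
-- operations on relations are written exactly as the formulas evaluate, so that most of the
-- correspondence between algorithm and formula is definitional.

-- Programs over counters and bit arrays, and their control-flow graphs.

module Programs where

  open import Data.Nat using (_⊔_)
  open import Data.Fin using (splitAt; join; combine; remQuot)
  open import Data.Fin.Properties using (splitAt-join; remQuot-combine)
  open import Data.Vec using (Vec; []; _∷_)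

  -- A retract of `Fin size` rather than a bijection: states and tape symbols are only ever coded
  -- and decoded again.
  record Finite (A : Set) : Set where
    field
      size    : ℕ
      enc     : A → Fin size
      dec     : Fin size → A
      dec-enc : ∀ a → dec (enc a) ≡ a

  open Finite public

  retract : ∀ {A B : Set} → Finite B → (f : A → B) (g : B → A) → (∀ a → g (f a) ≡ a) → Finite A
  retract F f g h = record
    { size = size F ; enc = enc F ∘ f ; dec = g ∘ dec F
    ; dec-enc = λ a → trans (cong g (dec-enc F (f a))) (h a) }

  ⊤-finite : Finite ⊤
  ⊤-finite = record { size = 1 ; enc = λ _ → zero ; dec = λ _ → tt ; dec-enc = λ _ → refl }

  ⊎-finite : ∀ {A B} → Finite A → Finite B → Finite (A ⊎ B)
  ⊎-finite {A} {B} F G = record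
    { size = size F + size G
    ; enc = λ x → join (size F) (size G) (to x)
    ; dec = λ i → from (splitAt (size F) i)
    ; dec-enc = λ x → trans (cong from (splitAt-join (size F) (size G) (to x))) (from-to x) }
    where
    to : A ⊎ B → Fin (size F) ⊎ Fin (size G)
    to (inj₁ a) = inj₁ (enc F a)
    to (inj₂ b) = inj₂ (enc G b)
    from : Fin (size F) ⊎ Fin (size G) → A ⊎ B
    from (inj₁ i) = inj₁ (dec F i)
    from (inj₂ j) = inj₂ (dec G j)
    from-to : ∀ x → from (to x) ≡ x
    from-to (inj₁ a) = cong inj₁ (dec-enc F a)
    from-to (inj₂ b) = cong inj₂ (dec-enc G b)

  ×-finite : ∀ {A B} → Finite A → Finite B → Finite (A × B)
  ×-finite {A} {B} F G = record
    { size = size F * size G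
    ; enc = λ x → combine (enc F (proj₁ x)) (enc G (proj₂ x))
    ; dec = λ i → from (remQuot (size G) i)
    ; dec-enc = λ x → trans (cong from (remQuot-combine (enc F (proj₁ x)) (enc G (proj₂ x))))
                            (cong₂ _,_ (dec-enc F (proj₁ x)) (dec-enc G (proj₂ x))) }
    where
    from : Fin (size F) × Fin (size G) → A × B
    from (i , j) = dec F i , dec G j

  Maybe-finite : ∀ {A} → Finite A → Finite (Maybe A)
  Maybe-finite {A} F = retract (⊎-finite ⊤-finite F) to from from-to
    where
    to : Maybe A → ⊤ ⊎ A
    to nothing  = inj₁ tt
    to (just a) = inj₂ a
    from : ⊤ ⊎ A → Maybe A
    from (inj₁ _) = nothing
    from (inj₂ a) = just a
    from-to : ∀ a → from (to a) ≡ a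
    from-to nothing  = refl
    from-to (just _) = refl

  Bool-finite : Finite Bool
  Bool-finite = retract (Maybe-finite ⊤-finite) to from from-to
    where
    to : Bool → Maybe ⊤
    to false = nothing
    to true  = just tt
    from : Maybe ⊤ → Bool
    from nothing  = false
    from (just _) = true
    from-to : ∀ b → from (to b) ≡ b
    from-to false = refl
    from-to true  = refl

  Sym-finite : Finite Sym
  Sym-finite = retract (Maybe-finite Bool-finite) to from from-to
    where
    to : Sym → Maybe Bool
    to ♯ = nothing
    to 𝟎 = just false
    to 𝟏 = just true
    from : Maybe Bool → Sym
    from nothing      = ♯
    from (just false) = 𝟎
    from (just true)  = 𝟏
    from-to : ∀ b → from (to b) ≡ b
    from-to 𝟎 = refl
    from-to 𝟏 = refl
    from-to ♯ = refl

  Vec-finite : ∀ {A} → Finite A → ∀ m → Finite (Vec A m)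
  Vec-finite F zero    = retract ⊤-finite (λ _ → tt) (λ _ → []) (λ { [] → refl })
  Vec-finite F (suc m) = retract (×-finite F (Vec-finite F m)) (λ { (x ∷ xs) → x , xs }) (λ { (x , xs) → x ∷ xs }) (λ { (x ∷ xs) → refl })

  -- Programs over a store of counters and of unary-indexed bit arrays.

  data Act : Set where
    incr     : Act
    put      : ℕ → Bool → Act
    less get : ℕ → Act
    sym?     : Sym → Act
    inWord   : Act

  data Op : Set where
    clear : ℕ → Op
    at    : ℕ → Act → Op

  data Prog : Set where
    op    : Op → Prog
    ite   : Prog → Prog → Prog → Prog
    while : Prog → Prog → Prog
    neg   : Prog → Prog

  record Store : Set where
    constructor store
    field
      ctr : ℕ → ℕ
      arr : ℕ → ℕ → Bool

  open Store public

  upd : ∀ {A : Set} → (ℕ → A) → ℕ → A → ℕ → A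
  upd f x a y = if x ≡ᵇ y then a else f y

  symAt : List Sym → ℕ → Maybe Sym
  symAt []      _       = nothing
  symAt (s ∷ w) zero    = just s
  symAt (s ∷ w) (suc i) = symAt w i

  isSym : Sym → Maybe Sym → Bool
  isSym 𝟎 (just 𝟎) = true
  isSym 𝟏 (just 𝟏) = true
  isSym ♯ (just ♯) = true
  isSym _ _        = false

  defined : Maybe Sym → Bool
  defined (just _) = true
  defined nothing  = false

  actS : List Sym → ℕ → Act → Store → Store × Bool
  actS w x incr      σ = store (upd (ctr σ) x (suc (ctr σ x))) (arr σ) , true
  actS w x (put r b) σ = store (ctr σ) (upd (arr σ) r (upd (arr σ r) (ctr σ x) b)) , true
  actS w x (less y)  σ = σ , (ctr σ x <ᵇ ctr σ y)
  actS w x (get r)   σ = σ , arr σ r (ctr σ x)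
  actS w x (sym? s)  σ = σ , isSym s (symAt w (ctr σ x))
  actS w x inWord    σ = σ , defined (symAt w (ctr σ x))

  opS : List Sym → Op → Store → Store × Bool
  opS w (clear x) σ = store (upd (ctr σ) x 0) (arr σ) , false
  opS w (at x a)  σ = actS w x a σ

  -- The last index counts executed operations. Branching is free because the successor function of
  -- the control-flow graph resolves it.
  data Run (w : List Sym) : Prog → Store → Bool → Store → ℕ → Set where
    r-op : ∀ {o σ} → Run w (op o) σ (proj₂ (opS w o σ)) (proj₁ (opS w o σ)) 1
    r-t  : ∀ {p q r σ σ′ σ″ b t t′} → Run w p σ true σ′ t → Run w q σ′ b σ″ t′ → Run w (ite p q r) σ b σ″ (t + t′)
    r-f  : ∀ {p q r σ σ′ σ″ b t t′} → Run w p σ false σ′ t → Run w r σ′ b σ″ t′ → Run w (ite p q r) σ b σ″ (t + t′)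
    w-f  : ∀ {p q σ σ′ t} → Run w p σ false σ′ t → Run w (while p q) σ false σ′ t
    w-t  : ∀ {p q σ σ₁ σ₂ σ₃ b b′ t₁ t₂ t₃} → Run w p σ true σ₁ t₁ → Run w q σ₁ b σ₂ t₂ →
           Run w (while p q) σ₂ b′ σ₃ t₃ → Run w (while p q) σ b′ σ₃ (t₁ + (t₂ + t₃))
    r-neg : ∀ {p σ b σ′ t} → Run w p σ b σ′ t → Run w (neg p) σ (not b) σ′ t

  BelowA : ℕ → Act → Set
  BelowA m incr      = ⊤
  BelowA m (put r b) = r < m
  BelowA m (less y)  = y < m
  BelowA m (get r)   = r < m
  BelowA m (sym? s)  = ⊤
  BelowA m inWord    = ⊤

  BelowO : ℕ → Op → Set
  BelowO m (clear x) = x < m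
  BelowO m (at x a)  = x < m × BelowA m a

  Below : ℕ → Prog → Set
  Below m (op o)      = BelowO m o
  Below m (ite p q r) = Below m p × Below m q × Below m r
  Below m (while p q) = Below m p × Below m q
  Below m (neg p)     = Below m p

  widthA : Act → ℕ
  widthA incr      = 0
  widthA (put r b) = suc r
  widthA (less y)  = suc y
  widthA (get r)   = suc r
  widthA (sym? s)  = 0
  widthA inWord    = 0

  width : Prog → ℕ
  width (op (clear x)) = suc x
  width (op (at x a))  = suc x ⊔ widthA a
  width (ite p q r)    = width p ⊔ (width q ⊔ width r)
  width (while p q)    = width p ⊔ width q
  width (neg p)        = width p

  below-width : ∀ {m} p → width p ≤ m → Below m p
  below-width (op (clear x)) h = h
  below-width {m} (op (at x a)) h = m⊔n≤o⇒m≤o (suc x) (widthA a) h , act a (m⊔n≤o⇒n≤o (suc x) (widthA a) h)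
    where
    act : ∀ a → widthA a ≤ m → BelowA m a
    act incr      h = tt
    act (put r b) h = h
    act (less y)  h = h
    act (get r)   h = h
    act (sym? s)  h = tt
    act inWord    h = tt
  below-width (ite p q r) h =
    below-width p (m⊔n≤o⇒m≤o (width p) _ h) ,
    below-width q (m⊔n≤o⇒m≤o (width q) _ (m⊔n≤o⇒n≤o (width p) _ h)) ,
    below-width r (m⊔n≤o⇒n≤o (width q) _ (m⊔n≤o⇒n≤o (width p) _ h))
  below-width (while p q) h = below-width p (m⊔n≤o⇒m≤o (width p) _ h) , below-width q (m⊔n≤o⇒n≤o (width p) _ h)
  below-width (neg p) h = below-width p h

  -- The control-flow graph of a program: one node per operation; a
  -- successor is a node or an exit labelled with the outcome.

  data Node : Prog → Set where
    here  : ∀ {o} → Node (op o)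
    cond  : ∀ {p q r} → Node p → Node (ite p q r)
    thenN : ∀ {p q r} → Node q → Node (ite p q r)
    elseN : ∀ {p q r} → Node r → Node (ite p q r)
    test  : ∀ {p q} → Node p → Node (while p q)
    body  : ∀ {p q} → Node q → Node (while p q)
    negN  : ∀ {p} → Node p → Node (neg p)

  Node-finite : ∀ p → Finite (Node p)
  Node-finite (op o) = retract ⊤-finite (λ _ → tt) (λ _ → here) (λ { here → refl })
  Node-finite (ite p q r) =
    retract (⊎-finite (Node-finite p) (⊎-finite (Node-finite q) (Node-finite r)))
      (λ { (cond x) → inj₁ x ; (thenN x) → inj₂ (inj₁ x) ; (elseN x) → inj₂ (inj₂ x) })
      (λ { (inj₁ x) → cond x ; (inj₂ (inj₁ x)) → thenN x ; (inj₂ (inj₂ x)) → elseN x })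
      (λ { (cond x) → refl ; (thenN x) → refl ; (elseN x) → refl })
  Node-finite (while p q) =
    retract (⊎-finite (Node-finite p) (Node-finite q))
      (λ { (test x) → inj₁ x ; (body x) → inj₂ x })
      (λ { (inj₁ x) → test x ; (inj₂ x) → body x })
      (λ { (test x) → refl ; (body x) → refl })
  Node-finite (neg p) = retract (Node-finite p) (λ { (negN x) → x }) negN (λ { (negN x) → refl })

  entry : ∀ p → Node p
  entry (op o)      = here
  entry (ite p q r) = cond (entry p)
  entry (while p q) = test (entry p)
  entry (neg p)     = negN (entry p)

  opOf : ∀ {p} → Node p → Op
  opOf (here {o}) = o
  opOf (cond x)   = opOf x
  opOf (thenN x)  = opOf x
  opOf (elseN x)  = opOf x
  opOf (test x)   = opOf x
  opOf (body x)   = opOf x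
  opOf (negN x)   = opOf x

  below-node : ∀ {m p} → Below m p → (x : Node p) → BelowO m (opOf x)
  below-node h here = h
  below-node h (cond x)  = below-node (proj₁ h) x
  below-node h (thenN x) = below-node (proj₁ (proj₂ h)) x
  below-node h (elseN x) = below-node (proj₂ (proj₂ h)) x
  below-node h (test x)  = below-node (proj₁ h) x
  below-node h (body x)  = below-node (proj₂ h) x
  below-node h (negN x)  = below-node h x

  -- The maps `condK` to `negK` redirect the exits of a subprogram to the place where control
  -- continues in the enclosing program.
  condK : ∀ {p q r} → Node p ⊎ Bool → Node (ite p q r) ⊎ Bool
  condK (inj₁ x)     = inj₁ (cond x)
  condK (inj₂ true)  = inj₁ (thenN (entry _))
  condK (inj₂ false) = inj₁ (elseN (entry _))

  thenK : ∀ {p q r} → Node q ⊎ Bool → Node (ite p q r) ⊎ Bool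
  thenK (inj₁ x) = inj₁ (thenN x)
  thenK (inj₂ b) = inj₂ b

  elseK : ∀ {p q r} → Node r ⊎ Bool → Node (ite p q r) ⊎ Bool
  elseK (inj₁ x) = inj₁ (elseN x)
  elseK (inj₂ b) = inj₂ b

  testK : ∀ {p q} → Node p ⊎ Bool → Node (while p q) ⊎ Bool
  testK (inj₁ x)     = inj₁ (test x)
  testK (inj₂ true)  = inj₁ (body (entry _))
  testK (inj₂ false) = inj₂ false

  bodyK : ∀ {p q} → Node q ⊎ Bool → Node (while p q) ⊎ Bool
  bodyK (inj₁ x) = inj₁ (body x)
  bodyK (inj₂ b) = inj₁ (test (entry _))

  negK : ∀ {p} → Node p ⊎ Bool → Node (neg p) ⊎ Bool
  negK (inj₁ x) = inj₁ (negN x)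
  negK (inj₂ b) = inj₂ (not b)

  next : ∀ {p} → Node p → Bool → Node p ⊎ Bool
  next here      b = inj₂ b
  next (cond x)  b = condK (next x b)
  next (thenN x) b = thenK (next x b)
  next (elseN x) b = elseK (next x b)
  next (test x)  b = testK (next x b)
  next (body x)  b = bodyK (next x b)
  next (negN x)  b = negK (next x b)

  data Flow (w : List Sym) {p : Prog} : Node p ⊎ Bool → Store → Node p ⊎ Bool → Store → ℕ → Set where
    stop : ∀ {x σ} → Flow w x σ x σ 0
    go   : ∀ {x y σ σ′ t} → Flow w (next x (proj₂ (opS w (opOf x) σ))) (proj₁ (opS w (opOf x) σ)) y σ′ t →
           Flow w (inj₁ x) σ y σ′ (suc t)

  flow-++ : ∀ {w p} {x y z : Node p ⊎ Bool} {σ σ′ σ″ t t′} →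
            Flow w x σ y σ′ t → Flow w y σ′ z σ″ t′ → Flow w x σ z σ″ (t + t′)
  flow-++ stop   g = g
  flow-++ (go f) g = go (flow-++ f g)

  -- A subprogram runs unchanged inside its context as soon as the redirection of its exits commutes
  -- with `next`; for every constructor this holds by reflexivity.
  flow-lift : ∀ {w p q} (i : Node p → Node q) (K : Node p ⊎ Bool → Node q ⊎ Bool) →
              (∀ x → K (inj₁ x) ≡ inj₁ (i x)) → (∀ x → opOf (i x) ≡ opOf x) → (∀ x b → next (i x) b ≡ K (next x b)) →
              ∀ {x y σ σ′ t} → Flow w x σ y σ′ t → Flow w (K x) σ (K y) σ′ t
  flow-lift i K e o h stop = stop
  flow-lift {w} i K e o h {σ = σ} (go {x} {y} {σ′ = σ′} {t} f) =
    subst (λ u → Flow w u σ (K y) σ′ (suc t)) (≡sym (e x))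
      (go (subst (λ u → Flow w u (proj₁ (opS w (opOf (i x)) σ)) (K y) σ′ t) (≡sym (h x (proj₂ (opS w (opOf (i x)) σ))))
        (subst (λ o′ → Flow w (K (next x (proj₂ (opS w o′ σ)))) (proj₁ (opS w o′ σ)) (K y) σ′ t) (≡sym (o x))
          (flow-lift i K e o h f))))

  cond-lift : ∀ {w p q r x y σ σ′ t} → Flow w {p} x σ y σ′ t → Flow w {ite p q r} (condK x) σ (condK y) σ′ t
  cond-lift = flow-lift cond condK (λ _ → refl) (λ _ → refl) (λ _ _ → refl)

  then-lift : ∀ {w p q r x y σ σ′ t} → Flow w {q} x σ y σ′ t → Flow w {ite p q r} (thenK x) σ (thenK y) σ′ t
  then-lift = flow-lift thenN thenK (λ _ → refl) (λ _ → refl) (λ _ _ → refl)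

  else-lift : ∀ {w p q r x y σ σ′ t} → Flow w {r} x σ y σ′ t → Flow w {ite p q r} (elseK x) σ (elseK y) σ′ t
  else-lift = flow-lift elseN elseK (λ _ → refl) (λ _ → refl) (λ _ _ → refl)

  test-lift : ∀ {w p q x y σ σ′ t} → Flow w {p} x σ y σ′ t → Flow w {while p q} (testK x) σ (testK y) σ′ t
  test-lift = flow-lift test testK (λ _ → refl) (λ _ → refl) (λ _ _ → refl)

  body-lift : ∀ {w p q x y σ σ′ t} → Flow w {q} x σ y σ′ t → Flow w {while p q} (bodyK x) σ (bodyK y) σ′ t
  body-lift = flow-lift body bodyK (λ _ → refl) (λ _ → refl) (λ _ _ → refl)

  neg-lift : ∀ {w p x y σ σ′ t} → Flow w {p} x σ y σ′ t → Flow w {neg p} (negK x) σ (negK y) σ′ t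
  neg-lift = flow-lift negN negK (λ _ → refl) (λ _ → refl) (λ _ _ → refl)

  flow-run : ∀ {w p σ b σ′ t} → Run w p σ b σ′ t → Flow w {p} (inj₁ (entry p)) σ (inj₂ b) σ′ t
  flow-run r-op           = go stop
  flow-run (r-t d e)      = flow-++ (cond-lift (flow-run d)) (then-lift (flow-run e))
  flow-run (r-f d e)      = flow-++ (cond-lift (flow-run d)) (else-lift (flow-run e))
  flow-run (w-f d)        = test-lift (flow-run d)
  flow-run (w-t d e f)    = flow-++ (test-lift (flow-run d)) (flow-++ (body-lift (flow-run e)) (flow-run f))
  flow-run (r-neg d)      = neg-lift (flow-run d)

-- Stores laid out on a tape, and operations as single passes.

module Tapes where

  open Programs
  open import Data.Vec using (Vec; []; _∷_)

  <ᵇ-true : ∀ {i j} → i < j → (i <ᵇ j) ≡ true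
  <ᵇ-true {zero}  (s≤s _) = refl
  <ᵇ-true {suc i} (s≤s h) = <ᵇ-true {i} h

  <ᵇ-false : ∀ {i j} → j ≤ i → (i <ᵇ j) ≡ false
  <ᵇ-false {i}     z≤n     = refl
  <ᵇ-false {suc i} (s≤s h) = <ᵇ-false h

  ≡ᵇ-refl : ∀ x → (x ≡ᵇ x) ≡ true
  ≡ᵇ-refl zero    = refl
  ≡ᵇ-refl (suc x) = ≡ᵇ-refl x

  ≡ᵇ-sound : ∀ x y → (x ≡ᵇ y) ≡ true → x ≡ y
  ≡ᵇ-sound zero    zero    _ = refl
  ≡ᵇ-sound (suc x) (suc y) h = cong suc (≡ᵇ-sound x y h)

  ≡ᵇ-false : ∀ {x y} → x ≢ y → (x ≡ᵇ y) ≡ false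
  ≡ᵇ-false {x} {y} h with x ≡ᵇ y in e
  ... | true  = ⊥-elim (h (≡ᵇ-sound x y e))
  ... | false = refl

  upd-same : ∀ {A : Set} (f : ℕ → A) x a → upd f x a x ≡ a
  upd-same f x a rewrite ≡ᵇ-refl x = refl

  upd-other : ∀ {A : Set} (f : ℕ → A) {x y} a → x ≢ y → upd f x a y ≡ f y
  upd-other f a h rewrite ≡ᵇ-false h = refl

  tab : ∀ m → (ℕ → Bool) → Vec Bool m
  tab zero    f = []
  tab (suc m) f = f 0 ∷ tab m (f ∘ suc)

  getB : ∀ {m} → Vec Bool m → ℕ → Bool
  getB []      x       = false
  getB (b ∷ v) zero    = b
  getB (b ∷ v) (suc x) = getB v x

  setB : ∀ {m} → Vec Bool m → ℕ → Bool → Vec Bool m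
  setB []      x       c = []
  setB (b ∷ v) zero    c = c ∷ v
  setB (b ∷ v) (suc x) c = b ∷ setB v x c

  tab-cong : ∀ m {f g} → (∀ x → x < m → f x ≡ g x) → tab m f ≡ tab m g
  tab-cong zero    h = refl
  tab-cong (suc m) h = cong₂ _∷_ (h 0 (s≤s z≤n)) (tab-cong m (λ x l → h (suc x) (s≤s l)))

  getB-tab : ∀ m f x → x < m → getB (tab m f) x ≡ f x
  getB-tab (suc m) f zero    _       = refl
  getB-tab (suc m) f (suc x) (s≤s h) = getB-tab m (f ∘ suc) x h

  setB-tab : ∀ m f x b → setB (tab m f) x b ≡ tab m (upd f x b)
  setB-tab zero    f x       b = refl
  setB-tab (suc m) f zero    b = refl
  setB-tab (suc m) f (suc x) b = cong (f 0 ∷_) (setB-tab m (f ∘ suc) x b)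

  -- One tape cell holds an input symbol, one bit per counter (set iff the
  -- cell lies below the counter's value) and one bit per array.

  Cell : ℕ → Set
  Cell m = Maybe Sym × (Vec Bool m × Vec Bool m)

  Cell-finite : ∀ m → Finite (Cell m)
  Cell-finite m = ×-finite (Maybe-finite Sym-finite) (×-finite (Vec-finite Bool-finite m) (Vec-finite Bool-finite m))

  module _ {m : ℕ} where

    actC : ℕ → Act → Cell m → Cell m × Bool
    actC x incr      (s , cs , as) = (s , setB cs x true , as) , true
    actC x (put r b) (s , cs , as) = (s , cs , setB as r b) , true
    actC x (less y)  (s , cs , as) = (s , cs , as) , getB cs y
    actC x (get r)   (s , cs , as) = (s , cs , as) , getB as r
    actC x (sym? t)  (s , cs , as) = (s , cs , as) , isSym t s
    actC x inWord    (s , cs , as) = (s , cs , as) , defined s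

    clearC : ℕ → Cell m → Cell m
    clearC x (s , cs , as) = s , setB cs x false , as

    -- An operation `at x a` acts on the first cell whose x-bit is unset.

    passStep : Op → Maybe Bool → Cell m → Maybe Bool × Cell m
    passStep (clear x) s c = s , clearC x c
    passStep (at x a) (just b) c = just b , c
    passStep (at x a) nothing c =
      if getB (proj₁ (proj₂ c)) x then (nothing , c) else (just (proj₂ (actC x a c)) , proj₁ (actC x a c))

    blankCell : Cell m
    blankCell = nothing , tab m (λ _ → false) , tab m (λ _ → false)

    -- Behind the last cell all bits are unset, so an operation that has found no target acts on a
    -- fresh blank cell, which is appended to the tape.
    finish : Op → Maybe Bool → Bool × Maybe (Cell m)
    finish (clear x) s        = false , nothing
    finish (at x a)  (just b) = b , nothing
    finish (at x a)  nothing  = proj₂ (actC x a blankCell) , just (proj₁ (actC x a blankCell))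

    passAll : Op → Maybe Bool → List (Cell m) → Maybe Bool × List (Cell m)
    passAll o s []       = s , []
    passAll o s (c ∷ cs) = proj₁ (passAll o (proj₁ (passStep o s c)) cs) ,
                           proj₂ (passStep o s c) ∷ proj₂ (passAll o (proj₁ (passStep o s c)) cs)

    cell : List Sym → Store → ℕ → Cell m
    cell w σ j = symAt w j , tab m (λ x → j <ᵇ ctr σ x) , tab m (λ r → arr σ r j)

    cells : List Sym → Store → ℕ → ℕ → List (Cell m)
    cells w σ j zero    = []
    cells w σ j (suc k) = cell w σ j ∷ cells w σ (suc j) k

    cell-cong : ∀ w {σ σ′} j → (∀ x → x < m → (j <ᵇ ctr σ x) ≡ (j <ᵇ ctr σ′ x)) → (∀ r → r < m → arr σ r j ≡ arr σ′ r j) →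
                cell w σ j ≡ cell w σ′ j
    cell-cong w j h h′ = cong₂ (λ a b → symAt w j , a , b) (tab-cong m h) (tab-cong m h′)

    cells-cong : ∀ w {σ σ′} j k → (∀ i → j ≤ i → i < j + k → cell w σ i ≡ cell w σ′ i) → cells w σ j k ≡ cells w σ′ j k
    cells-cong w j zero    h = refl
    cells-cong w j (suc k) h = cong₂ _∷_ (h j ≤-refl (≤-trans (≤-reflexive (+-comm 1 j)) (+-monoʳ-≤ j (s≤s z≤n))))
      (cells-cong w (suc j) k (λ i a b → h i (≤-trans (n≤1+n j) a) (≤-trans b (≤-reflexive (≡sym (+-suc j k))))))

    cells-snoc : ∀ w σ j k → cells w σ j k ++ (cell w σ (j + k) ∷ []) ≡ cells w σ j (suc k)
    cells-snoc w σ j zero    = cong (λ i → cell w σ i ∷ []) (+-identityʳ j)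
    cells-snoc w σ j (suc k) = cong (cell w σ j ∷_)
      (trans (cong (λ i → cells w σ (suc j) k ++ cell w σ i ∷ []) (+-suc j k)) (cells-snoc w σ (suc j) k))

    length-cells : ∀ w σ j k → length (cells w σ j k) ≡ k
    length-cells w σ j zero    = refl
    length-cells w σ j (suc k) = cong suc (length-cells w σ (suc j) k)

    <ᵇ-suc : ∀ {i c} → i ≢ c → (i <ᵇ suc c) ≡ (i <ᵇ c)
    <ᵇ-suc {zero}  {zero}  h = ⊥-elim (h refl)
    <ᵇ-suc {zero}  {suc c} h = refl
    <ᵇ-suc {suc i} {zero}  h = refl
    <ᵇ-suc {suc i} {suc c} h = <ᵇ-suc {i} {c} (h ∘ cong suc)

    -- Counters are unary, so even `incr` changes only the cell at which the run of set bits ends.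
    act-other : ∀ w x a σ i → i ≢ ctr σ x → cell w σ i ≡ cell w (proj₁ (actS w x a σ)) i
    act-other w x incr σ i h = cell-cong w {σ} {proj₁ (actS w x incr σ)} i f (λ _ _ → refl)
      where
      f : ∀ y → y < m → (i <ᵇ ctr σ y) ≡ (i <ᵇ upd (ctr σ) x (suc (ctr σ x)) y)
      f y _ with x ≡ᵇ y in e
      ... | false = refl
      ... | true rewrite ≡ᵇ-sound x y e = ≡sym (<ᵇ-suc h)
    act-other w x (put r b) σ i h = cell-cong w {σ} {proj₁ (actS w x (put r b) σ)} i (λ _ _ → refl) f
      where
      f : ∀ q → q < m → arr σ q i ≡ upd (arr σ) r (upd (arr σ r) (ctr σ x) b) q i
      f q _ with r ≡ᵇ q in e
      ... | false = refl
      ... | true rewrite ≡ᵇ-sound r q e = ≡sym (upd-other (arr σ q) b (h ∘ ≡sym))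
    act-other w x (less y) σ i h = refl
    act-other w x (get r)  σ i h = refl
    act-other w x (sym? s) σ i h = refl
    act-other w x inWord   σ i h = refl

    act-here : ∀ w x a σ → x < m → BelowA m a →
               actC x a (cell w σ (ctr σ x)) ≡ (cell w (proj₁ (actS w x a σ)) (ctr σ x) , proj₂ (actS w x a σ))
    act-here w x incr σ x<m _ = cong (λ v → (symAt w (ctr σ x) , v , tab m (λ r → arr σ r (ctr σ x))) , true)
      (trans (setB-tab m _ x true) (tab-cong m f))
      where
      f : ∀ y → y < m → upd (λ z → ctr σ x <ᵇ ctr σ z) x true y ≡ (ctr σ x <ᵇ upd (ctr σ) x (suc (ctr σ x)) y)
      f y _ with x ≡ᵇ y
      ... | false = refl
      ... | true  = ≡sym (<ᵇ-true (n<1+n (ctr σ x)))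
    act-here w x (put r b) σ x<m _ = cong (λ v → (symAt w (ctr σ x) , tab m (λ z → ctr σ x <ᵇ ctr σ z) , v) , true)
      (trans (setB-tab m _ r b) (tab-cong m f))
      where
      f : ∀ q → q < m → upd (λ q′ → arr σ q′ (ctr σ x)) r b q ≡ upd (arr σ) r (upd (arr σ r) (ctr σ x) b) q (ctr σ x)
      f q _ with r ≡ᵇ q
      ... | false = refl
      ... | true  = ≡sym (upd-same (arr σ r) (ctr σ x) b)
    act-here w x (less y) σ x<m y<m = cong (cell w σ (ctr σ x) ,_) (getB-tab m _ y y<m)
    act-here w x (get r)  σ x<m r<m = cong (cell w σ (ctr σ x) ,_) (getB-tab m _ r r<m)
    act-here w x (sym? s) σ x<m _ = refl
    act-here w x inWord   σ x<m _ = refl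

    pass-rest : ∀ x a b (cs : List (Cell m)) → passAll (at x a) (just b) cs ≡ (just b , cs)
    pass-rest x a b []       = refl
    pass-rest x a b (c ∷ cs) = cong (λ p → proj₁ p , c ∷ proj₂ p) (pass-rest x a b cs)

    pass-skip : ∀ w x a σ j k → x < m → j + k ≤ ctr σ x → passAll (at x a) nothing (cells w σ j k) ≡ (nothing , cells w σ j k)
    pass-skip w x a σ j zero    x<m h = refl
    pass-skip w x a σ j (suc k) x<m h
      rewrite getB-tab m (λ y → j <ᵇ ctr σ y) x x<m
            | <ᵇ-true {j} {ctr σ x} (≤-trans (≤-trans (s≤s (m≤m+n j k)) (≤-reflexive (≡sym (+-suc j k)))) h)
            | pass-skip w x a σ (suc j) k x<m (≤-trans (≤-reflexive (≡sym (+-suc j k))) h) = refl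

    -- The first unset x-bit lies exactly at position `ctr σ x`. Earlier cells are skipped, later
    -- ones are copied, so the target cell is found without any arithmetic on addresses.
    pass-hit : ∀ w x a σ j k → x < m → BelowA m a → j ≤ ctr σ x → ctr σ x < j + k →
               passAll (at x a) nothing (cells w σ j k) ≡ (just (proj₂ (actS w x a σ)) , cells w (proj₁ (actS w x a σ)) j k)
    pass-hit w x a σ j zero x<m bl h h′ = ⊥-elim (<⇒≱ (≤-trans h′ (≤-reflexive (+-identityʳ j))) h)
    pass-hit w x a σ j (suc k) x<m bl h h′ with m≤n⇒m<n∨m≡n h
    ... | inj₁ j<c rewrite getB-tab m (λ y → j <ᵇ ctr σ y) x x<m | <ᵇ-true j<c
                         | pass-hit w x a σ (suc j) k x<m bl j<c (≤-trans h′ (≤-reflexive (+-suc j k)))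
                         = cong (λ z → just (proj₂ (actS w x a σ)) , z ∷ cells w (proj₁ (actS w x a σ)) (suc j) k)
                             (act-other w x a σ j (<⇒≢ j<c))
    ... | inj₂ refl rewrite getB-tab m (λ y → ctr σ x <ᵇ ctr σ y) x x<m | <ᵇ-false {ctr σ x} {ctr σ x} ≤-refl
                          | act-here w x a σ x<m bl | pass-rest x a (proj₂ (actS w x a σ)) (cells w σ (suc (ctr σ x)) k)
                          = cong (λ z → just (proj₂ (actS w x a σ)) , cell w (proj₁ (actS w x a σ)) (ctr σ x) ∷ z)
                              (cells-cong w (suc (ctr σ x)) k (λ i l _ → act-other w x a σ i (λ e → <⇒≢ l (≡sym e))))

    pass-clear : ∀ w x σ s j k → passAll (clear x) s (cells w σ j k) ≡ (s , cells w (proj₁ (opS w (clear x) σ)) j k)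
    pass-clear w x σ s j zero    = refl
    pass-clear w x σ s j (suc k) rewrite pass-clear w x σ s (suc j) k =
      cong (λ z → s , (symAt w j , z , tab m (λ r → arr σ r j)) ∷ cells w (proj₁ (opS w (clear x) σ)) (suc j) k)
        (trans (setB-tab m _ x false) (tab-cong m f))
      where
      f : ∀ y → y < m → upd (λ z → j <ᵇ ctr σ z) x false y ≡ (j <ᵇ upd (ctr σ) x 0 y)
      f y _ with x ≡ᵇ y
      ... | false = refl
      ... | true  = refl

    -- These bounds make the cell of index `len` blank, which is what the machine finds behind the
    -- end of its tape.
    record Fits (w : List Sym) (len : ℕ) (σ : Store) : Set where
      field
        word≤ : length w ≤ len
        ctr≤  : ∀ x → x < m → ctr σ x ≤ len
        arr≥  : ∀ r → r < m → ∀ i → len ≤ i → arr σ r i ≡ false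
    open Fits

    fits-weaken : ∀ {w len len′ σ} → len ≤ len′ → Fits w len σ → Fits w len′ σ
    fits-weaken h f = record { word≤ = ≤-trans (word≤ f) h ; ctr≤ = λ x l → ≤-trans (ctr≤ f x l) h
                             ; arr≥ = λ r l i l′ → arr≥ f r l i (≤-trans h l′) }

    symAt-end : ∀ w i → length w ≤ i → symAt w i ≡ nothing
    symAt-end []      i       h = refl
    symAt-end (s ∷ w) (suc i) (s≤s h) = symAt-end w i h

    cell-blank : ∀ {w len σ} → Fits w len σ → cell w σ len ≡ blankCell
    cell-blank {w} {len} {σ} f rewrite symAt-end w len (word≤ f) =
      cong₂ (λ a b → nothing , a , b) (tab-cong m (λ x l → <ᵇ-false (ctr≤ f x l))) (tab-cong m (λ r l → arr≥ f r l len ≤-refl))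

    fits-act : ∀ {w len σ} x a → x < m → BelowA m a → ctr σ x < len → Fits w len σ → Fits w len (proj₁ (actS w x a σ))
    fits-act {w} {len} {σ} x incr x<m _ h f = record { word≤ = word≤ f ; ctr≤ = g ; arr≥ = arr≥ f }
      where
      g : ∀ y → y < m → upd (ctr σ) x (suc (ctr σ x)) y ≤ len
      g y l with x ≡ᵇ y
      ... | false = ctr≤ f y l
      ... | true  = h
    fits-act {w} {len} {σ} x (put r b) x<m _ h f = record { word≤ = word≤ f ; ctr≤ = ctr≤ f ; arr≥ = g }
      where
      g : ∀ q → q < m → ∀ i → len ≤ i → upd (arr σ) r (upd (arr σ r) (ctr σ x) b) q i ≡ false
      g q l i l′ with r ≡ᵇ q in e
      ... | false = arr≥ f q l i l′
      ... | true rewrite ≡ᵇ-sound r q e =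
        trans (upd-other (arr σ q) b (<⇒≢ (≤-trans h l′))) (arr≥ f q l i l′)
    fits-act x (less y) x<m _ h f = f
    fits-act x (get r)  x<m _ h f = f
    fits-act x (sym? s) x<m _ h f = f
    fits-act x inWord   x<m _ h f = f

    optional : Maybe (Cell m) → List (Cell m)
    optional nothing  = []
    optional (just c) = c ∷ []

    op-pass : ∀ {w len σ} o → BelowO m o → Fits w len σ →
      (proj₁ (finish o (proj₁ (passAll o nothing (cells w σ 0 len)))) ≡ proj₂ (opS w o σ)) ×
      ∃ λ len′ → (proj₂ (passAll o nothing (cells w σ 0 len)) ++ optional (proj₂ (finish o (proj₁ (passAll o nothing (cells w σ 0 len)))))
                    ≡ cells w (proj₁ (opS w o σ)) 0 len′) ×
                 len ≤ len′ × len′ ≤ suc len × Fits w len′ (proj₁ (opS w o σ))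
    op-pass {w} {len} {σ} (clear x) bl f rewrite pass-clear w x σ nothing 0 len =
      refl , len , ++-identityʳ _ , ≤-refl , n≤1+n len ,
      record { word≤ = word≤ f ; ctr≤ = g ; arr≥ = arr≥ f }
      where
      g : ∀ y → y < m → upd (ctr σ) x 0 y ≤ len
      g y l with x ≡ᵇ y
      ... | false = ctr≤ f y l
      ... | true  = z≤n
    op-pass {w} {len} {σ} (at x a) (x<m , bl) f with m≤n⇒m<n∨m≡n (ctr≤ f x x<m)
    ... | inj₁ c<len rewrite pass-hit w x a σ 0 len x<m bl z≤n c<len =
      refl , len , ++-identityʳ _ , ≤-refl , n≤1+n len , fits-act x a x<m bl c<len f
    -- The counter equals `len`: no cell on the tape has its x-bit unset, the pass ends without a
    -- target, and the tape grows by one cell.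
    ... | inj₂ e rewrite pass-skip w x a σ 0 len x<m (≤-reflexive (≡sym e)) =
      cong proj₂ eq , suc len ,
      trans (cong₂ (λ u v → u ++ v ∷ []) (cells-cong w 0 len (λ i _ l → act-other w x a σ i (λ e′ → <⇒≢ l (trans e′ e))))
                   (cong proj₁ eq))
            (cells-snoc w (proj₁ (actS w x a σ)) 0 len) ,
      n≤1+n len , ≤-refl ,
      fits-act x a x<m bl (≤-reflexive (cong suc e)) (fits-weaken (n≤1+n len) f)
      where
      eq : actC x a blankCell ≡ (cell w (proj₁ (actS w x a σ)) len , proj₂ (actS w x a σ))
      eq = subst (λ i → actC x a blankCell ≡ (cell w (proj₁ (actS w x a σ)) i , proj₂ (actS w x a σ))) e
             (trans (cong (actC x a) (≡sym (trans (cong (cell w σ) e) (cell-blank f)))) (act-here w x a σ x<m bl))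

-- Turing machines that execute programs.

module Machines where

  open import Data.List using (map; _ʳ++_)
  open import Data.List.Properties using (ʳ++-ʳ++; ++-assoc; length-ʳ++)
  open Programs
  open Tapes
  open import Data.List.Relation.Unary.All as All using (All; []; _∷_)
  open import Data.List.Relation.Binary.Pointwise as PW using (Pointwise; []; _∷_)
  open import Data.Vec using ([]; _∷_)

  stepTM-move : ∀ (M : TM) q l x r → q ≢ TM.accept M → q ≢ TM.reject M →
    stepTM {M} ⟨ q , l , x , r ⟩ ≡ move {M} (proj₁ (TM.δ M q x)) l (proj₁ (proj₂ (TM.δ M q x))) r (proj₂ (proj₂ (TM.δ M q x)))
  stepTM-move M q l x r a b with q FP.≟ TM.accept M | q FP.≟ TM.reject M
  ... | yes e | _     = ⊥-elim (a e)
  ... | no _  | yes e = ⊥-elim (b e)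
  ... | no _  | no _  = refl

  run-+ : ∀ {M} a b (c : Config M) → run (a + b) c ≡ run b (run a c)
  run-+ zero    b c = refl
  run-+ (suc a) b c = run-+ a b (stepTM c)

  -- `fwd` sweeps right and carries the answer found so far; `back` rewinds to the blank on the left
  -- before its node is executed.
  data St (p : Prog) : Set where
    halt : Bool → St p
    back : Node p → St p
    fwd  : Node p → Maybe Bool → St p

  St-finite′ : ∀ p → Finite (St p)
  St-finite′ p = retract (⊎-finite Bool-finite (⊎-finite (Node-finite p) (×-finite (Node-finite p) (Maybe-finite Bool-finite))))
    (λ { (halt b) → inj₁ b ; (back x) → inj₂ (inj₁ x) ; (fwd x s) → inj₂ (inj₂ (x , s)) })
    (λ { (inj₁ b) → halt b ; (inj₂ (inj₁ x)) → back x ; (inj₂ (inj₂ (x , s))) → fwd x s })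
    (λ { (halt b) → refl ; (back x) → refl ; (fwd x s) → refl })

  module Simulation (p : Prog) (m : ℕ) (bl : Below m p) (St-finite : Finite (St p)) (C-finite : Finite (Cell m)) where

    G : Set
    G = Γ (size C-finite)

    -- An input symbol not swept yet reads as a cell with all counter and array bits unset, which
    -- agrees with the all-zero initial store; no initialising pass has to be made.
    decode : G → Maybe (Cell m)
    decode blank   = nothing
    decode (inp s) = just (just s , tab m (λ _ → false) , tab m (λ _ → false))
    decode (ext i) = just (dec C-finite i)

    encode′ : Cell m → G
    encode′ c = ext (enc C-finite c)

    decode-encode : ∀ c → decode (encode′ c) ≡ just c
    decode-encode c = cong just (dec-enc C-finite c)

    exitTo : Node p ⊎ Bool → St p
    exitTo (inj₁ x) = back x
    exitTo (inj₂ b) = halt b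

    fromCell : Maybe (Cell m) → G
    fromCell nothing  = blank
    fromCell (just c) = encode′ c

    trans-fwd : Node p → Maybe Bool → Maybe (Cell m) → St p × G × Move
    trans-fwd x s nothing  = exitTo (next x (proj₁ (finish {m} (opOf x) s))) , fromCell (proj₂ (finish {m} (opOf x) s)) , L
    trans-fwd x s (just c) = fwd x (proj₁ (passStep (opOf x) s c)) , encode′ (proj₂ (passStep (opOf x) s c)) , R

    trans-back : Node p → G → Maybe (Cell m) → St p × G × Move
    trans-back x γ nothing  = fwd x nothing , blank , R
    trans-back x γ (just _) = back x , γ , L

    δ′ : St p → G → St p × G × Move
    δ′ (halt b)  γ = halt b , γ , S
    δ′ (back x)  γ = trans-back x γ (decode γ)
    δ′ (fwd x s) γ = trans-fwd x s (decode γ)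

    st : St p → Fin (size St-finite)
    st = enc St-finite

    st-inj : ∀ {a b} → st a ≡ st b → a ≡ b
    st-inj {a} {b} e = trans (≡sym (dec-enc St-finite a)) (trans (cong (dec St-finite) e) (dec-enc St-finite b))

    machine : TM
    machine = record
      { Q = size St-finite ; m = size C-finite
      ; δ = λ q γ → st (proj₁ (δ′ (dec St-finite q) γ)) , proj₂ (δ′ (dec St-finite q) γ)
      ; start = st (fwd (entry p) nothing) ; accept = st (halt true) ; reject = st (halt false)
      ; acc≢rej = λ e → no-halt (st-inj e) }
      where
      no-halt : halt {p} true ≢ halt false
      no-halt ()

    Cfg : Set
    Cfg = Config machine

    live : St p → Set
    live (halt _)  = ⊥
    live (back _)  = ⊤
    live (fwd _ _) = ⊤

    step-δ : ∀ s l x r → live s → stepTM {machine} ⟨ st s , l , x , r ⟩ ≡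
      move {machine} (st (proj₁ (δ′ s x))) l (proj₁ (proj₂ (δ′ s x))) r (proj₂ (proj₂ (δ′ s x)))
    step-δ s l x r lv = trans (stepTM-move machine (st s) l x r (λ e → absurd (st-inj e) lv) (λ e → absurd (st-inj e) lv))
      (cong (λ z → move {machine} (st (proj₁ (δ′ z x))) l (proj₁ (proj₂ (δ′ z x))) r (proj₂ (proj₂ (δ′ z x)))) (dec-enc St-finite s))
      where
      absurd : ∀ {s : St p} {b} → s ≡ halt b → live s → ⊥
      absurd refl ()

    onRight : St p → List G → List G → Cfg
    onRight s l []      = ⟨ st s , l , blank , [] ⟩
    onRight s l (x ∷ r) = ⟨ st s , l , x , r ⟩

    onLeft : St p → List G → List G → Cfg
    onLeft s []      r = ⟨ st s , [] , blank , r ⟩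
    onLeft s (x ∷ l) r = ⟨ st s , l , x , r ⟩

    moveR : ∀ s l x r → move {machine} (st s) l x r R ≡ onRight s (x ∷ l) r
    moveR s []      x []      = refl
    moveR s []      x (y ∷ r) = refl
    moveR s (_ ∷ l) x []      = refl
    moveR s (_ ∷ l) x (y ∷ r) = refl

    moveL : ∀ s l x r → move {machine} (st s) l x r L ≡ onLeft s l (x ∷ r)
    moveL s []      x r = refl
    moveL s (_ ∷ l) x r = refl

    Holds : G → Cell m → Set
    Holds γ c = decode γ ≡ just c

    -- Beyond the used cells the tape may be an empty list or may contain blanks left explicitly by
    -- earlier visits; both have to be treated alike.
    Blanks : List G → Set
    Blanks = All (_≡ blank)

    sweep : ∀ x s {γs cs} l bs → Pointwise Holds γs cs →
      ∃ λ outs → Pointwise Holds outs (proj₂ (passAll (opOf x) s cs)) × length outs ≡ length cs ×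
        run (length cs) (onRight (fwd x s) l (γs ++ bs)) ≡ onRight (fwd x (proj₁ (passAll (opOf x) s cs))) (outs ʳ++ l) bs
    sweep x s l bs [] = [] , [] , refl , refl
    sweep x s {γ ∷ γs} {c ∷ cs} l bs (h ∷ hs)
      with outs , pw , le , eq ← sweep x (proj₁ (passStep (opOf x) s c)) (encode′ (proj₂ (passStep (opOf x) s c)) ∷ l) bs hs =
      encode′ (proj₂ (passStep (opOf x) s c)) ∷ outs , decode-encode _ ∷ pw , cong suc le ,
      trans (cong (run (length cs))
        (trans (step-δ (fwd x s) l γ (γs ++ bs) tt)
          (trans (cong (λ z → move {machine} (st (proj₁ (trans-fwd x s z))) l (proj₁ (proj₂ (trans-fwd x s z))) (γs ++ bs) (proj₂ (proj₂ (trans-fwd x s z)))) h)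
            (moveR (fwd x (proj₁ (passStep (opOf x) s c))) l (encode′ (proj₂ (passStep (opOf x) s c))) (γs ++ bs))))) eq

    rewind : ∀ x {γs cs} lb r → Pointwise Holds γs cs →
      run (length cs) (onLeft (back x) (γs ++ lb) r) ≡ onLeft (back x) lb (γs ʳ++ r)
    rewind x lb r [] = refl
    rewind x {γ ∷ γs} {c ∷ cs} lb r (h ∷ hs) =
      trans (cong (run (length cs))
        (trans (step-δ (back x) (γs ++ lb) γ r tt)
          (trans (cong (λ z → move {machine} (st (proj₁ (trans-back x γ z))) (γs ++ lb) (proj₁ (proj₂ (trans-back x γ z))) r (proj₂ (proj₂ (trans-back x γ z)))) h)
            (moveL (back x) (γs ++ lb) γ r))))
        (rewind x lb (γ ∷ r) hs)

    turn : ∀ x lb r → Blanks lb → ∃ λ lb′ → Blanks lb′ × run 1 (onLeft (back x) lb r) ≡ onRight (fwd x nothing) lb′ r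
    turn x [] r [] = blank ∷ [] , refl ∷ [] , trans (step-δ (back x) [] blank r tt) (moveR (fwd x nothing) [] blank r)
    turn x (_ ∷ lb) r (refl ∷ bs) = blank ∷ lb , refl ∷ bs , trans (step-δ (back x) lb blank r tt) (moveR (fwd x nothing) lb blank r)

    atEnd : ∀ x s l bs → Blanks bs → ∃ λ bs′ → Blanks bs′ ×
      run 1 (onRight (fwd x s) l bs) ≡
        onLeft (exitTo (next x (proj₁ (finish {m} (opOf x) s)))) l (fromCell (proj₂ (finish {m} (opOf x) s)) ∷ bs′)
    atEnd x s l [] [] = [] , [] , trans (step-δ (fwd x s) l blank [] tt) (moveL _ l _ [])
    atEnd x s l (_ ∷ bs) (refl ∷ h) = bs , h , trans (step-δ (fwd x s) l blank bs tt) (moveL _ l _ bs)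

    state-onLeft : ∀ s l r → Config.state (onLeft s l r) ≡ st s
    state-onLeft s []      r = refl
    state-onLeft s (_ ∷ l) r = refl

    pw-rev : ∀ {xs ys us vs} → Pointwise Holds xs ys → Pointwise Holds us vs → Pointwise Holds (xs ʳ++ us) (ys ʳ++ vs)
    pw-rev []       h = h
    pw-rev (x ∷ xs) h = pw-rev xs (x ∷ h)

    rev-split : ∀ (outs lb : List G) → outs ʳ++ lb ≡ (outs ʳ++ []) ++ lb
    rev-split outs lb = gen outs []
      where
      gen : ∀ outs acc → outs ʳ++ (acc ++ lb) ≡ (outs ʳ++ acc) ++ lb
      gen []       acc = refl
      gen (o ∷ os) acc = gen os (o ∷ acc)

    finish-cell : ∀ (c : Maybe (Cell m)) bs {outs cs} → Blanks bs → Pointwise Holds outs cs →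
      ∃ λ γs → ∃ λ bs′ → Blanks bs′ × outs ++ fromCell c ∷ bs ≡ γs ++ bs′ × Pointwise Holds γs (cs ++ optional c)
    finish-cell nothing bs {outs} {cs} b h = outs , blank ∷ bs , refl ∷ b , refl , subst (Pointwise Holds outs) (≡sym (++-identityʳ cs)) h
    finish-cell (just c) bs {outs} {cs} b h = outs ++ encode′ c ∷ [] , bs , b , ≡sym (++-assoc outs (encode′ c ∷ []) bs) ,
      PW.++⁺ h (decode-encode c ∷ [])

    module _ (w : List Sym) where

      Exits : Config machine → ℕ → Node p ⊎ Bool → Set
      Exits c len z = ∃ λ b → z ≡ inj₂ b × Config.state (run (suc len) c) ≡ st (halt b)

      Continues : Config machine → ℕ → ℕ → Store → Node p ⊎ Bool → Set
      Continues c len len′ σ z = ∃ λ y → z ≡ inj₁ y × ∃ λ γs → ∃ λ lb → ∃ λ bs → Blanks lb × Blanks bs ×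
        Pointwise Holds γs (cells w σ 0 len′) × run (suc len + suc len) c ≡ onRight (fwd y nothing) lb (γs ++ bs)

      -- A pass takes `len` steps over the cells and one at the blank behind them. If the program
      -- does not exit there, rewinding costs the same again.
      one-op : ∀ x {σ len γs} lb bs → Blanks lb → Blanks bs → Pointwise Holds γs (cells w σ 0 len) → Fits {m} w len σ →
        ∃ λ len′ → len ≤ len′ × len′ ≤ suc len × Fits {m} w len′ (proj₁ (opS w (opOf x) σ)) ×
        (Exits (onRight (fwd x nothing) lb (γs ++ bs)) len (next x (proj₂ (opS w (opOf x) σ)))
        ⊎ Continues (onRight (fwd x nothing) lb (γs ++ bs)) len len′ (proj₁ (opS w (opOf x) σ)) (next x (proj₂ (opS w (opOf x) σ))))
      one-op x {σ} {len} {γs} lb bs hl hb pw f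
        with e , len′ , ecells , l≤ , l≤′ , f′ ← op-pass {m} {w} {len} {σ} (opOf x) (below-node bl x) f
           | outs , pwo , lo , er ← sweep x nothing lb bs pw
        with bs₁ , hb₁ , e1 ← atEnd x (proj₁ (passAll (opOf x) nothing (cells w σ 0 len))) (outs ʳ++ lb) bs hb =
        len′ , l≤ , l≤′ , f′ , cont (next x (proj₂ (opS w (opOf x) σ))) refl
        where
        lenc : length (cells {m} w σ 0 len) ≡ len
        lenc = length-cells w σ 0 len
        fin : Maybe (Cell m)
        fin = proj₂ (finish (opOf x) (proj₁ (passAll (opOf x) nothing (cells w σ 0 len))))
        run1 : run (suc len) (onRight (fwd x nothing) lb (γs ++ bs)) ≡
               onLeft (exitTo (next x (proj₂ (opS w (opOf x) σ)))) (outs ʳ++ lb) (fromCell fin ∷ bs₁)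
        run1 = trans (cong (λ k → run k (onRight (fwd x nothing) lb (γs ++ bs))) (+-comm 1 len))
          (trans (run-+ len 1 (onRight (fwd x nothing) lb (γs ++ bs)))
          (trans (cong (run 1) (trans (cong (λ k → run k (onRight (fwd x nothing) lb (γs ++ bs))) (≡sym lenc)) er))
          (trans e1 (cong (λ b → onLeft (exitTo (next x b)) (outs ʳ++ lb) (fromCell fin ∷ bs₁)) e))))
        start : Config machine
        start = onRight (fwd x nothing) lb (γs ++ bs)
        cont : ∀ z → next x (proj₂ (opS w (opOf x) σ)) ≡ z → Exits start len (next x (proj₂ (opS w (opOf x) σ))) ⊎
               Continues start len len′ (proj₁ (opS w (opOf x) σ)) (next x (proj₂ (opS w (opOf x) σ)))
        cont (inj₂ b) ez = inj₁ (b , ez , trans (cong Config.state run1) (trans (state-onLeft _ (outs ʳ++ lb) _) (cong (st ∘ exitTo) ez)))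
        cont (inj₁ y) ez
          with lb′ , hl′ , e2 ← turn y lb ((outs ʳ++ []) ʳ++ (fromCell fin ∷ bs₁)) hl
             | γs′ , bs′ , hb′ , es , pw′ ← finish-cell fin bs₁ hb₁ pwo =
          inj₂ (y , ez , γs′ , lb′ , bs′ , hl′ , hb′ , subst (Pointwise Holds γs′) ecells pw′ ,
            trans (run-+ (suc len) (suc len) start)
            (trans (cong (run (suc len)) (trans run1 (cong₂ (λ u v → onLeft (exitTo u) v (fromCell fin ∷ bs₁)) ez (rev-split outs lb))))
            (trans (cong (λ k → run k (onLeft (back y) ((outs ʳ++ []) ++ lb) (fromCell fin ∷ bs₁))) (+-comm 1 len))
            (trans (run-+ len 1 (onLeft (back y) ((outs ʳ++ []) ++ lb) (fromCell fin ∷ bs₁)))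
            (trans (cong (run 1) (trans (cong (λ k → run k (onLeft (back y) ((outs ʳ++ []) ++ lb) (fromCell fin ∷ bs₁))) (≡sym lenr))
                                        (rewind y lb (fromCell fin ∷ bs₁) pwr)))
            (trans e2 (cong (onRight (fwd y nothing) lb′) (trans (ʳ++-ʳ++ outs) es))))))))
          where
          rcs : List (Cell m)
          rcs = proj₂ (passAll (opOf x) nothing (cells w σ 0 len)) ʳ++ []
          pwr : Pointwise Holds (outs ʳ++ []) rcs
          pwr = pw-rev pwo []
          lenr : length rcs ≡ len
          lenr = trans (≡sym (PW.Pointwise-length pwr)) (trans (length-ʳ++ outs) (trans (+-identityʳ _) (trans lo lenc)))

      -- Each operation lengthens the tape by at most one cell, so during the t remaining operations
      -- it never exceeds `len + t` cells, and each of them costs at most two traversals.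
      simulate : ∀ {x σ b σ′ t} → Flow w {p} (inj₁ x) σ (inj₂ b) σ′ t → ∀ {len γs} lb bs → Blanks lb → Blanks bs →
        Pointwise Holds γs (cells w σ 0 len) → Fits {m} w len σ →
        ∃ λ T → T ≤ t * (2 * suc (len + t)) × Config.state (run T (onRight (fwd x nothing) lb (γs ++ bs))) ≡ st (halt b)
      simulate {x} {σ} (go {t = t} fl) {len} lb bs hl hb pw f with one-op x lb bs hl hb pw f
      simulate {x} {σ} (go {t = t} fl) {len} lb bs hl hb pw f | len′ , _ , _ , f′ , inj₁ (b , e , h) with next x (proj₂ (opS w (opOf x) σ))
      simulate {x} {σ} (go {t = .0} stop) {len} lb bs hl hb pw f | len′ , _ , _ , f′ , inj₁ (b , refl , h) | .(inj₂ b) =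
        suc len , ≤-trans (≤-trans (s≤s (m≤m+n len 1)) (m≤m+n (suc (len + 1)) _)) (≤-reflexive (≡sym (+-identityʳ _))) , h
      simulate {x} {σ} (go {t = t} fl) {len} {γs} lb bs hl hb pw f
        | len′ , _ , l≤ , f′ , inj₂ (y , e , γs′ , lb′ , bs′ , hl′ , hb′ , pw′ , h)
        with next x (proj₂ (opS w (opOf x) σ))
      simulate {x} {σ} (go {t = t} fl) {len} {γs} lb bs hl hb pw f
        | len′ , _ , l≤ , f′ , inj₂ (y , refl , γs′ , lb′ , bs′ , hl′ , hb′ , pw′ , h) | .(inj₁ y)
        with T , T≤ , hT ← simulate fl lb′ bs′ hl′ hb′ pw′ f′ =
        (suc len + suc len) + T , bound , trans (cong Config.state (trans (run-+ (suc len + suc len) T (onRight (fwd x nothing) lb (γs ++ bs))) (cong (run T) h))) hT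
        where
        bound : suc len + suc len + T ≤ suc t * (2 * suc (len + suc t))
        bound = +-mono-≤ (≤-trans (≤-reflexive (dbl (suc len))) (*-monoʳ-≤ 2 (s≤s (m≤m+n len (suc t)))))
          (≤-trans T≤ (*-monoʳ-≤ t (*-monoʳ-≤ 2 (s≤s (≤-trans (+-monoˡ-≤ t l≤) (≤-reflexive (≡sym (+-suc len t))))))))
          where
          dbl : ∀ a → a + a ≡ 2 * a
          dbl = solve-∀

    zeroStore : Store
    zeroStore = store (λ _ → 0) (λ _ _ → false)

    initial-cells : ∀ w j u → (∀ i → symAt u (j + i) ≡ symAt w i) → Pointwise Holds (map inp w) (cells u zeroStore j (length w))
    initial-cells []      j u h = []
    initial-cells (s ∷ w) j u h =
      cong₂ (λ a b → just (a , b , tab m (λ _ → false))) (≡sym (trans (cong (symAt u) (≡sym (+-identityʳ j))) (h 0)))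
        (tab-cong m (λ _ _ → refl)) ∷
      initial-cells w (suc j) u (λ i → trans (cong (symAt u) (≡sym (+-suc j i))) (h (suc i)))

    run-halts : ∀ w → 1 ≤ length w → ∀ {b σ t} → Run w p zeroStore b σ t →
      ∃ λ T → T ≤ t * (2 * suc (length w + t)) × HaltsWith machine w T b
    run-halts w@(s ∷ w′) _ {b} {t = t} r
      with T , T≤ , h ← simulate w (flow-run r) {len = length w} [] [] [] []
                          (initial-cells w 0 w (λ _ → refl))
                          (record { word≤ = ≤-refl ; ctr≤ = λ _ _ → z≤n ; arr≥ = λ _ _ _ _ → refl }) =
      T , T≤ , trans (cong (λ z → Config.state (run T ⟨ st (fwd (entry p) nothing) , [] , inp s , z ⟩)) (≡sym (++-identityʳ (map inp w′))))
                     (trans h (out b))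
      where
      out : ∀ b → st (halt b) ≡ (if b then st (halt true) else st (halt false))
      out true  = refl
      out false = refl

-- A logic with counting and bounded iteration, and its compiler.

module Formulas where

  open import Data.List using (map)
  open Programs
  open Tapes

  -- First-order formulas with counting comparison and bounded iteration of
  -- relations.  A binder at level k binds the variables k, k+1, …; iter at
  -- relation level j binds the relation j.

  data Fm : Set where
    ⊥ᶠ   : Fm
    symb : Sym → ℕ → Fm
    lt   : ℕ → ℕ → Fm
    rel  : ℕ → List ℕ → Fm
    _∧ᶠ_ : Fm → Fm → Fm
    _⊻ᶠ_ : Fm → Fm → Fm
    ¬ᶠ   : Fm → Fm
    cnt  : ℕ → Fm → Fm → Fm
    iter : ℕ → ℕ → Fm → Fm → Fm → Fm

  infixr 6 _∧ᶠ_
  infixr 5 _⊻ᶠ_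

  b2n : Bool → ℕ
  b2n true  = 1
  b2n false = 0

  foldF : ∀ {A : Set} {m} → (Fin m → A → A) → A → A
  foldF {m = zero}  f a = a
  foldF {m = suc m} f a = foldF (f ∘ suc) (f zero a)

  -- Recursion on the accumulator makes this unfold in step with `bindAll`.
  up : ℕ → ℕ → ℕ
  up zero    k = k
  up (suc r) k = up r (suc k)

  bindAll : ∀ {A : Set} → ℕ → List A → (ℕ → A) → ℕ → A
  bindAll k []       ρ = ρ
  bindAll k (v ∷ vs) ρ = bindAll (suc k) vs (upd ρ k v)

  module _ {l : ℕ} where

    sumV : ℕ → (List (Fin l) → ℕ) → ℕ
    sumV zero    f = f []
    sumV (suc r) f = sum (λ i → sumV r (f ∘ (i ∷_)))

    loopV : ∀ {A : Set} → ℕ → (List (Fin l) → A → A) → A → A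
    loopV zero    f = f []
    loopV (suc r) f = foldF (λ i → loopV r (f ∘ (i ∷_)))

    -- Opaque, so that a loop over many variables is not unrolled by the type checker.
    abstract
      loopO : ∀ {A : Set} → ℕ → (List (Fin l) → A → A) → A → A
      loopO = loopV

      loopO-def : ∀ {A : Set} r (f : List (Fin l) → A → A) a → loopO r f a ≡ loopV r f a
      loopO-def r f a = refl

  module Semantics (w : List Sym) where

    Ix : Set
    Ix = Fin (length w)

    Env Rels : Set
    Env  = ℕ → Ix
    Rels = ℕ → List Ix → Bool

    ⟦_⟧ : Fm → ℕ → ℕ → Env → Rels → Bool
    ⟦ ⊥ᶠ ⟧ k j ρ Ξ = false
    ⟦ symb s x ⟧ k j ρ Ξ = isSym s (symAt w (toℕ (ρ x)))
    ⟦ lt x y ⟧ k j ρ Ξ = toℕ (ρ x) <ᵇ toℕ (ρ y)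
    ⟦ rel r xs ⟧ k j ρ Ξ = Ξ r (map ρ xs)
    ⟦ φ ∧ᶠ ψ ⟧ k j ρ Ξ = ⟦ φ ⟧ k j ρ Ξ ∧ ⟦ ψ ⟧ k j ρ Ξ
    ⟦ φ ⊻ᶠ ψ ⟧ k j ρ Ξ = ⟦ φ ⟧ k j ρ Ξ xor ⟦ ψ ⟧ k j ρ Ξ
    ⟦ ¬ᶠ φ ⟧ k j ρ Ξ = not (⟦ φ ⟧ k j ρ Ξ)
    ⟦ cnt r φ ψ ⟧ k j ρ Ξ =
      sumV (suc r) (λ vs → b2n (⟦ φ ⟧ (up (suc r) k) j (bindAll k vs ρ) Ξ)) <ᵇ
      sumV (suc r) (λ vs → b2n (⟦ ψ ⟧ (up (suc r) k) j (bindAll k vs ρ) Ξ))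
    ⟦ iter a r φ₀ φ ψ ⟧ k j ρ Ξ =
      ⟦ ψ ⟧ k (suc j) ρ (upd Ξ j
        (loopO r (λ us R vs → ⟦ φ ⟧ (up a (up r k)) (suc j) (bindAll (up r k) vs (bindAll k us ρ)) (upd Ξ j R))
          (λ vs → ⟦ φ₀ ⟧ (up a k) (suc j) (bindAll k vs ρ) Ξ)))

  arity : Maybe ℕ → ℕ → Bool
  arity nothing  n = false
  arity (just a) n = a ≡ᵇ n

  AllBelow : ℕ → List ℕ → Set
  AllBelow k []       = ⊤
  AllBelow k (x ∷ xs) = T (x <ᵇ k) × AllBelow k xs

  -- While `φ₀` is checked, level j is reserved but has no arity, so the initial value cannot
  -- mention the relation being defined. All conditions compute, so a closed formula is checked by
  -- evaluation.
  WF : Fm → ℕ → ℕ → (ℕ → Maybe ℕ) → Set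
  WF ⊥ᶠ k j ar = ⊤
  WF (symb s x) k j ar = T (x <ᵇ k)
  WF (lt x y) k j ar = T (x <ᵇ k) × T (y <ᵇ k)
  WF (rel r xs) k j ar = T (r <ᵇ j) × AllBelow k xs × T (arity (ar r) (length xs))
  WF (φ ∧ᶠ ψ) k j ar = WF φ k j ar × WF ψ k j ar
  WF (φ ⊻ᶠ ψ) k j ar = WF φ k j ar × WF ψ k j ar
  WF (¬ᶠ φ) k j ar = WF φ k j ar
  WF (cnt r φ ψ) k j ar = WF φ (up (suc r) k) j ar × WF ψ (up (suc r) k) j ar
  WF (iter a r φ₀ φ ψ) k j ar =
    WF φ₀ (up a k) (suc j) (upd ar j nothing) × WF φ (up a (up r k)) (suc j) (upd ar j (just a)) × WF ψ k (suc j) (upd ar j (just a))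

  -- Polynomials in the word length, kept as syntax so that a monomial bound can be extracted from
  -- the cost of a formula.
  data Pl : Set where
    K       : ℕ → Pl
    X       : Pl
    _⊕_ _⊗_ : Pl → Pl → Pl

  infixl 6 _⊕_
  infixl 7 _⊗_

  ev : Pl → ℕ → ℕ
  ev (K c)   l = c
  ev X       l = l
  ev (p ⊕ q) l = ev p l + ev q l
  ev (p ⊗ q) l = ev p l * ev q l

  pw : ℕ → Pl
  pw zero    = K 1
  pw (suc i) = pw i ⊗ X

  -- The exponents are added even for a sum: this is a crude common degree, valid since `1 ≤ l`.
  ev-monomial : ∀ p → ∃ λ c → ∃ λ d → ∀ l → 1 ≤ l → ev p l ≤ c * l ^ d
  ev-monomial (K c) = c , 0 , λ l _ → ≤-reflexive (≡sym (*-identityʳ c))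
  ev-monomial X = 1 , 1 , λ l _ → ≤-reflexive (≡sym (trans (*-identityˡ _) (*-identityʳ l)))
  ev-monomial (p ⊕ q) with c , d , h ← ev-monomial p | c′ , d′ , h′ ← ev-monomial q =
    c + c′ , d + d′ , λ l 1≤l → ≤-trans (+-mono-≤ (≤-trans (h l 1≤l) (*-monoʳ-≤ c (pow d (d + d′) 1≤l (m≤m+n d d′))))
                                                  (≤-trans (h′ l 1≤l) (*-monoʳ-≤ c′ (pow d′ (d + d′) 1≤l (m≤n+m d′ d)))))
                                        (≤-reflexive (≡sym (*-distribʳ-+ (l ^ (d + d′)) c c′)))
    where
    pow : ∀ {l} d e → 1 ≤ l → d ≤ e → l ^ d ≤ l ^ e
    pow {suc l} d e _ h = ^-monoʳ-≤ (suc l) h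
  ev-monomial (p ⊗ q) with c , d , h ← ev-monomial p | c′ , d′ , h′ ← ev-monomial q =
    c * c′ , d + d′ , λ l 1≤l → ≤-trans (*-mono-≤ (h l 1≤l) (h′ l 1≤l))
      (≤-reflexive (trans ([m*n]*[o*p]≡[m*o]*[n*p] c (l ^ d) c′ (l ^ d′)) (cong (c * c′ *_) (≡sym (^-distribˡ-+-* l d d′)))))

  -- Three counters per level: the bound variable and the two tallies of a counting comparison.
  -- Scratch counters are taken from the current level upwards.
  ctrOf : ℕ → ℕ
  ctrOf k = 3 * k

  seqP : Prog → Prog → Prog
  seqP p q = ite p q q

  loopP : ℕ → Act → Prog → Prog
  loopP u a p = seqP (op (clear u)) (while (op (at u a)) (seqP p (op (at u incr))))

  nestP : ℕ → ℕ → Prog → Prog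
  nestP zero    k p = p
  nestP (suc r) k p = loopP (ctrOf k) inWord (nestP r (suc k) p)

  falseP : ℕ → Prog
  falseP k = op (clear (ctrOf k))

  -- Computes z * |w| + x in place of z, with three scratch counters above z.
  hornerP : ℕ → ℕ → Prog
  hornerP z x =
    seqP (op (clear (3 + z)))
    (seqP (loopP (1 + z) (less z) (loopP (2 + z) inWord (op (at (3 + z) incr))))
    (seqP (loopP (1 + z) (less x) (op (at (3 + z) incr)))
    (seqP (op (clear z))
          (loopP (1 + z) (less (3 + z)) (op (at z incr))))))

  addrFrom : ℕ → List ℕ → Prog
  -- There is no empty program; clearing a scratch counter takes its place.
  addrFrom z []       = op (clear (1 + z))
  addrFrom z (x ∷ xs) = seqP (hornerP z (ctrOf x)) (addrFrom z xs)

  addrP : ℕ → List ℕ → Prog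
  addrP k xs = seqP (op (clear (ctrOf k))) (addrFrom (ctrOf k) xs)

  names : ℕ → ℕ → List ℕ
  names zero    k = []
  names (suc a) k = k ∷ names a (suc k)

  putP : ℕ → ℕ → ℕ → Bool → Prog
  putP q a k b = seqP (addrP (up a k) (names a k)) (op (at (ctrOf (up a k)) (put q b)))

  fillP : ℕ → ℕ → ℕ → Prog → Prog
  fillP q a k p = nestP a k (ite p (putP q a k true) (putP q a k false))

  readP : ℕ → ℕ → List ℕ → Prog
  readP q k xs = seqP (addrP k xs) (op (at (ctrOf k) (get q)))

  countP : ℕ → ℕ → ℕ → Prog → Prog
  countP z r k p = nestP r k (ite p (op (at z incr)) (falseP (up r k)))

  comp : Fm → ℕ → ℕ → Prog
  comp ⊥ᶠ k j = falseP k
  comp (symb s x) k j = op (at (ctrOf x) (sym? s))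
  comp (lt x y) k j = op (at (ctrOf x) (less (ctrOf y)))
  comp (rel r xs) k j = readP (2 * r) k xs
  comp (φ ∧ᶠ ψ) k j = ite (comp φ k j) (comp ψ k j) (falseP k)
  comp (φ ⊻ᶠ ψ) k j = ite (comp φ k j) (neg (comp ψ k j)) (comp ψ k j)
  comp (¬ᶠ φ) k j = neg (comp φ k j)
  comp (cnt r φ ψ) k j =
    seqP (op (clear (1 + ctrOf k)))
    (seqP (op (clear (2 + ctrOf k)))
    (seqP (countP (1 + ctrOf k) (suc r) k (comp φ (up (suc r) k) j))
    (seqP (countP (2 + ctrOf k) (suc r) k (comp ψ (up (suc r) k) j))
          (op (at (1 + ctrOf k) (less (2 + ctrOf k)))))))
  -- Relation j owns the arrays `2 * j` and `1 + 2 * j`. A round writes the new relation into the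
  -- second one while the old relation is still read from the first, and then copies it back.
  comp (iter a r φ₀ φ ψ) k j =
    seqP (fillP (2 * j) a k (comp φ₀ (up a k) (suc j)))
    (seqP (nestP r k (seqP (fillP (1 + 2 * j) a (up r k) (comp φ (up a (up r k)) (suc j)))
                           (fillP (2 * j) a (up r k) (readP (1 + 2 * j) (up a (up r k)) (names a (up r k))))))
          (comp ψ k (suc j)))

  loopCost : Pl → Pl → Pl
  loopCost m c = K 2 ⊕ m ⊗ (c ⊕ K 2)

  nestCost : ℕ → Pl → Pl
  nestCost zero    c = c
  nestCost (suc r) c = loopCost X (nestCost r c)

  -- Here i is the number of digits already absorbed, so that the accumulator is below `l ^ i`.
  hornerCost : ℕ → Pl
  hornerCost i = K 1 ⊕ (loopCost (pw i) (loopCost X (K 1)) ⊕ (loopCost X (K 1) ⊕ (K 1 ⊕ loopCost (pw (suc i)) (K 1))))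

  addrCost : ℕ → ℕ → Pl
  addrCost i zero    = K 1
  addrCost i (suc n) = hornerCost i ⊕ addrCost (suc i) n

  fillCost : ℕ → Pl → Pl
  fillCost a c = nestCost a (c ⊕ (K 1 ⊕ addrCost 0 a ⊕ K 1))

  cost : Fm → Pl
  cost ⊥ᶠ         = K 1
  cost (symb s x) = K 1
  cost (lt x y)   = K 1
  cost (rel r xs) = K 1 ⊕ addrCost 0 (length xs) ⊕ K 1
  cost (φ ∧ᶠ ψ)   = cost φ ⊕ (cost ψ ⊕ K 1)
  cost (φ ⊻ᶠ ψ)   = cost φ ⊕ cost ψ
  cost (¬ᶠ φ)     = cost φ
  cost (cnt r φ ψ) = K 1 ⊕ (K 1 ⊕ (nestCost (suc r) (cost φ ⊕ K 1) ⊕ (nestCost (suc r) (cost ψ ⊕ K 1) ⊕ K 1)))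
  cost (iter a r φ₀ φ ψ) =
    fillCost a (cost φ₀) ⊕ (nestCost r (fillCost a (cost φ) ⊕ fillCost a (K 1 ⊕ addrCost 0 a ⊕ K 1)) ⊕ cost ψ)

-- Correctness and cost of compiled formulas.

module Compilation where

  open import Data.Nat using (NonZero)
  open import Data.List using (map)
  open import Relation.Nullary using (does)
  open import Relation.Nullary.Decidable using (dec-true)
  open Programs
  open Tapes
  open Formulas
  open import Data.Nat.DivMod using (_%_; m<n⇒m%n≡m; [m+kn]%n≡m%n)

  foldF-suc : ∀ m s → foldF {m = m} (λ _ → suc) s ≡ m + s
  foldF-suc zero    s = refl
  foldF-suc (suc m) s = trans (foldF-suc m (suc s)) (+-suc m s)

  foldF-* : ∀ m l s → foldF {m = m} (λ _ → foldF {m = l} (λ _ → suc)) s ≡ m * l + s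
  foldF-* zero    l s = refl
  foldF-* (suc m) l s = trans (foldF-* m l (foldF {m = l} (λ _ → suc) s))
    (trans (cong (m * l +_) (foldF-suc l s)) (trans (≡sym (+-assoc (m * l) l s)) (cong (_+ s) (+-comm (m * l) l))))

  foldF-cong : ∀ {A : Set} {m} {f g : Fin m → A → A} → (∀ i a → f i a ≡ g i a) → ∀ a → foldF f a ≡ foldF g a
  foldF-cong {m = zero}  h a = refl
  foldF-cong {m = suc m} {f} {g} h a = trans (foldF-cong (λ i → h (suc i)) (f zero a)) (cong (foldF (g ∘ suc)) (h zero a))

  foldF-sum : ∀ {m} (g : Fin m → ℕ) n → foldF (λ i → g i +_) n ≡ sum g + n
  foldF-sum {zero}  g n = refl
  foldF-sum {suc m} g n = trans (foldF-sum (g ∘ suc) (g zero + n))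
    (trans (≡sym (+-assoc (sum (g ∘ suc)) (g zero) n)) (cong (_+ n) (+-comm (sum (g ∘ suc)) (g zero))))

  loopV-sum : ∀ {l} r (g : List (Fin l) → ℕ) n → loopV r (λ vs → g vs +_) n ≡ sumV r g + n
  loopV-sum zero    g n = refl
  loopV-sum (suc r) g n = trans (foldF-cong (λ i → loopV-sum r (g ∘ (i ∷_))) n) (foldF-sum (λ i → sumV r (g ∘ (i ∷_))) n)

  module _ {l : ℕ} where

    infix 4 _≟ᴸ_
    _≟ᴸ_ : (us vs : List (Fin l)) → _
    _≟ᴸ_ = LP.≡-dec FP._≟_

    updL : (List (Fin l) → Bool) → List (Fin l) → Bool → List (Fin l) → Bool
    updL R′ us b vs = if does (us ≟ᴸ vs) then b else R′ vs

    updL-same : ∀ R′ us b → updL R′ us b us ≡ b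
    updL-same R′ us b rewrite dec-true (us ≟ᴸ us) refl = refl

    foldF-inv : ∀ {A : Set} (P : A → Set) {m} (f : Fin m → A → A) → (∀ i a → P a → P (f i a)) → ∀ a → P a → P (foldF f a)
    foldF-inv P {zero}  f h a p = p
    foldF-inv P {suc m} f h a p = foldF-inv P (f ∘ suc) (h ∘ suc) (f zero a) (h zero a p)

    foldF-hit : ∀ {A : Set} (P : A → Set) {m} (f : Fin m → A → A) i → (∀ a → P (f i a)) → (∀ j a → P a → P (f j a)) → ∀ a → P (foldF f a)
    foldF-hit P f zero    h h′ a = foldF-inv P (f ∘ suc) (h′ ∘ suc) (f zero a) (h a)
    foldF-hit P f (suc i) h h′ a = foldF-hit P (f ∘ suc) i h (h′ ∘ suc) (f zero a)

    loopV-inv : ∀ {A : Set} (P : A → Set) r (f : List (Fin l) → A → A) → (∀ vs a → P a → P (f vs a)) → ∀ a → P a → P (loopV r f a)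
    loopV-inv P zero    f h a p = h [] a p
    loopV-inv P (suc r) f h a p = foldF-inv P _ (λ i b → loopV-inv P r (f ∘ (i ∷_)) (λ vs → h (i ∷ vs)) b) a p

    loopV-hit : ∀ {A : Set} (P : A → Set) r (f : List (Fin l) → A → A) us → length us ≡ r →
                (∀ a → P (f us a)) → (∀ vs a → P a → P (f vs a)) → ∀ a → P (loopV r f a)
    loopV-hit P zero    f []       e h h′ a = h a
    loopV-hit P (suc r) f (u ∷ us) e h h′ a = foldF-hit P _ u
      (loopV-hit P r (f ∘ (u ∷_)) us (suc-injective e) h (λ vs → h′ (u ∷ vs)))
      (λ i b → loopV-inv P r (f ∘ (i ∷_)) (λ vs → h′ (i ∷ vs)) b) a

    -- The loop visits every tuple of length r, and whatever is written afterwards at this tuple is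
    -- the same value again.
    loopV-tabulates : ∀ r (g : List (Fin l) → Bool) us → length us ≡ r → ∀ R′ → loopV r (λ vs R″ → updL R″ vs (g vs)) R′ us ≡ g us
    loopV-tabulates r g us e = loopV-hit (λ R′ → R′ us ≡ g us) r _ us e (λ R′ → updL-same R′ us (g us)) keep
      where
      keep : ∀ vs R′ → R′ us ≡ g us → updL R′ vs (g vs) us ≡ g us
      keep vs R′ h with vs ≟ᴸ us
      ... | yes e = cong g e
      ... | no  _ = h

    addrAcc : ℕ → List (Fin l) → ℕ
    addrAcc z []       = z
    addrAcc z (v ∷ vs) = addrAcc (z * l + toℕ v) vs

    addr : List (Fin l) → ℕ
    addr = addrAcc 0

    digit-injective : ∀ z z′ (v v′ : Fin l) → z * l + toℕ v ≡ z′ * l + toℕ v′ → z ≡ z′ × v ≡ v′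
    digit-injective z z′ v v′ e = *-cancelʳ-≡ z z′ l ⦃ nz ⦄ (+-cancelʳ-≡ (toℕ v) (z * l) (z′ * l) (trans e (cong (z′ * l +_) (≡sym v≡)))) ,
                                 FP.toℕ-injective v≡
      where
      nz : NonZero l
      nz = FP.nonZeroIndex v
      rem : ∀ z (v : Fin l) → _%_ (z * l + toℕ v) l ⦃ nz ⦄ ≡ toℕ v
      rem z v = trans (cong (λ n → _%_ n l ⦃ nz ⦄) (+-comm (z * l) (toℕ v)))
                  (trans ([m+kn]%n≡m%n (toℕ v) z l ⦃ nz ⦄) (m<n⇒m%n≡m ⦃ nz ⦄ (FP.toℕ<n v)))
      v≡ : toℕ v ≡ toℕ v′
      v≡ = trans (≡sym (rem z v)) (trans (cong (λ n → _%_ n l ⦃ nz ⦄) e) (rem z′ v′))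

    addrAcc-injective : ∀ z z′ us vs → length us ≡ length vs → addrAcc z us ≡ addrAcc z′ vs → z ≡ z′ × us ≡ vs
    addrAcc-injective z z′ []       []       _ e = e , refl
    addrAcc-injective z z′ (u ∷ us) (v ∷ vs) h e with e₁ , e₂ ← addrAcc-injective _ _ us vs (suc-injective h) e
                                                  with e₃ , e₄ ← digit-injective z z′ u v e₁ = e₃ , cong₂ _∷_ e₄ e₂

    horner-bound : ∀ {z i} (v : Fin l) → z < l ^ i → z * l + toℕ v < l ^ suc i
    horner-bound {z} {i} v h = ≤-trans (≤-trans (≤-reflexive (≡sym (+-suc (z * l) (toℕ v)))) (+-monoʳ-≤ (z * l) (FP.toℕ<n v)))
      (≤-trans (≤-reflexive (+-comm (z * l) l)) (≤-trans (*-monoˡ-≤ l h) (≤-reflexive (*-comm (l ^ i) l))))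

  ev-pw : ∀ i l → ev (pw i) l ≡ l ^ i
  ev-pw zero    l = refl
  ev-pw (suc i) l = trans (cong (_* l) (ev-pw i l)) (*-comm (l ^ i) l)

  suc+≢ : ∀ k z → suc k + z ≢ z
  suc+≢ k z e = <⇒≢ (≤-trans (s≤s (m≤n+m z k)) ≤-refl) (≡sym e)

  +≢< : ∀ {y z} k → y < z → k + z ≢ y
  +≢< {y} {z} k h e = <⇒≢ (≤-trans h (m≤n+m z k)) (≡sym e)

  up-≤ : ∀ r k → k ≤ up r k
  up-≤ zero    k = ≤-refl
  up-≤ (suc r) k = ≤-trans (n≤1+n k) (up-≤ r (suc k))

  ctrOf-mono : ∀ {x y} → x ≤ y → ctrOf x ≤ ctrOf y
  ctrOf-mono = *-monoʳ-≤ 3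

  ctrOf-< : ∀ {x y} → x < y → ctrOf x < ctrOf y
  ctrOf-< = *-monoʳ-< 3

  ctrOf-suc : ∀ k → ctrOf (suc k) ≡ 3 + ctrOf k
  ctrOf-suc k = *-suc 3 k

  module Correctness (w : List Sym) where

    open Semantics w

    l : ℕ
    l = length w

    setC : Store → ℕ → ℕ → Store
    setC σ x v = store (upd (ctr σ) x v) (arr σ)

    Ends : Prog → Store → Bool → ℕ → (Store → Set) → Set
    Ends p σ b c P = ∃ λ σ′ → ∃ λ t → Run w p σ b σ′ t × t ≤ c × P σ′

    Runs : Prog → Store → ℕ → (Store → Set) → Set
    Runs p σ c P = ∃ λ b → Ends p σ b c P

    weaken : ∀ {p σ b c c′ P Q} → c ≤ c′ → (∀ σ → P σ → Q σ) → Ends p σ b c P → Ends p σ b c′ Q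
    weaken h f (σ′ , t , r , t≤ , p) = σ′ , t , r , ≤-trans t≤ h , f σ′ p

    weakenR : ∀ {p σ c c′ P Q} → c ≤ c′ → (∀ σ → P σ → Q σ) → Runs p σ c P → Runs p σ c′ Q
    weakenR h f (b , e) = b , weaken h f e

    op-ends : ∀ {o σ σ′ b P} → proj₁ (opS w o σ) ≡ σ′ → proj₂ (opS w o σ) ≡ b → P σ′ → Ends (op o) σ b 1 P
    op-ends refl refl p = _ , 1 , r-op , ≤-refl , p

    ite-ends : ∀ {p q r σ c c′ P Q b} b′ → Ends p σ b′ c P → (∀ σ′ → P σ′ → Ends (if b′ then q else r) σ′ b c′ Q) → Ends (ite p q r) σ b (c + c′) Q
    ite-ends true  (σ₁ , t₁ , r₁ , h₁ , p₁) f with σ₂ , t₂ , r₂ , h₂ , p₂ ← f σ₁ p₁ = σ₂ , t₁ + t₂ , r-t r₁ r₂ , +-mono-≤ h₁ h₂ , p₂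
    ite-ends false (σ₁ , t₁ , r₁ , h₁ , p₁) f with σ₂ , t₂ , r₂ , h₂ , p₂ ← f σ₁ p₁ = σ₂ , t₁ + t₂ , r-f r₁ r₂ , +-mono-≤ h₁ h₂ , p₂

    seq-ends : ∀ {p q σ c c′ P Q b} → Runs p σ c P → (∀ σ′ → P σ′ → Ends q σ′ b c′ Q) → Ends (seqP p q) σ b (c + c′) Q
    seq-ends {q = q} {c′ = c′} {Q = Q} {b = b} (b′ , e) f = ite-ends b′ e (λ σ′ p → same b′ (f σ′ p))
      where
      same : ∀ b′ {σ′} → Ends q σ′ b c′ Q → Ends (if b′ then q else q) σ′ b c′ Q
      same true  e = e
      same false e = e

    ite-runs : ∀ {p σ c c′ P Q} (q : Bool → Prog) b → Ends p σ b c P → (∀ σ′ → P σ′ → Runs (q b) σ′ c′ Q) → Runs (ite p (q true) (q false)) σ (c + c′) Q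
    ite-runs q true  (σ′ , t , r , t≤ , h) k with b′ , σ″ , t′ , r′ , t≤′ , h′ ← k σ′ h = b′ , σ″ , t + t′ , r-t r r′ , +-mono-≤ t≤ t≤′ , h′
    ite-runs q false (σ′ , t , r , t≤ , h) k with b′ , σ″ , t′ , r′ , t≤′ , h′ ← k σ′ h = b′ , σ″ , t + t′ , r-f r r′ , +-mono-≤ t≤ t≤′ , h′

    seq-runs : ∀ {p q σ c c′ P Q} → Runs p σ c P → (∀ σ′ → P σ′ → Runs q σ′ c′ Q) → Runs (seqP p q) σ (c + c′) Q
    seq-runs {p} {q} {σ} {c} {c′} {P} {Q} (b′ , σ₁ , t₁ , r₁ , h₁ , p₁) f with b , e ← f σ₁ p₁ =
      b , seq-ends {P = _≡ σ₁} (b′ , σ₁ , t₁ , r₁ , h₁ , refl) (λ { _ refl → e })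

    module _ {A : Set} (M u : ℕ) (a : Act) (p : Prog) (I : A → Store → Set) (f : Fin M → A → A) (c : ℕ)
      (stable : ∀ x σ v → I x σ → I x (setC σ u v))
      (testOk : ∀ x σ → I x σ → proj₁ (actS w u a σ) ≡ σ × proj₂ (actS w u a σ) ≡ (ctr σ u <ᵇ M))
      (stepOk : ∀ i x σ → I x σ → ctr σ u ≡ toℕ i → Runs p σ c (λ σ′ → ctr σ′ u ≡ toℕ i × I (f i x) σ′)) where

      -- The rounds still to come are indexed by `Fin m` through `g`, a shift by the s rounds
      -- already made; this matches the recursion of `foldF`.
      while-run : ∀ m s (g : Fin m → Fin M) → (∀ i → toℕ (g i) ≡ s + toℕ i) → s + m ≡ M → ∀ x σ → I x σ → ctr σ u ≡ s →
        Ends (while (op (at u a)) (seqP p (op (at u incr)))) σ false (1 + m * (c + 2)) (I (foldF (f ∘ g) x))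
      while-run zero s g hg e x σ h cu with e₁ , e₂ ← testOk x σ h
        with σ′ , t , r , t≤ , q ← op-ends {o = at u a} {P = I x} e₁
               (trans e₂ (trans (cong (_<ᵇ M) cu) (<ᵇ-false (≤-reflexive (trans (≡sym e) (+-identityʳ s)))))) h =
        σ′ , t , w-f r , t≤ , q
      while-run (suc m) s g hg e x σ h cu with e₁ , e₂ ← testOk x σ h
        with σ₁ , t₁ , r₁ , t₁≤ , q₁ ← op-ends {o = at u a} {P = λ σ′ → I x σ′ × ctr σ′ u ≡ s} e₁
               (trans e₂ (trans (cong (_<ᵇ M) cu) (<ᵇ-true (≤-trans (s≤s (m≤m+n s m)) (≤-reflexive (trans (≡sym (+-suc s m)) e)))))) (h , cu)
        with b₂ , σ₂ , t₂ , r₂ , t₂≤ , q₂ ← seq-runs (stepOk (g zero) x σ₁ (proj₁ q₁)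
               (trans (proj₂ q₁) (≡sym (trans (hg zero) (+-identityʳ s)))))
               (λ σ′ q → true , op-ends {o = at u incr} {P = λ σ″ → ctr σ″ u ≡ suc s × I (f (g zero) x) σ″} refl refl
                  (trans (upd-same (ctr σ′) u _) (cong suc (trans (proj₁ q) (trans (hg zero) (+-identityʳ s)))) , stable _ σ′ _ (proj₂ q)))
        with σ₃ , t₃ , r₃ , t₃≤ , q₃ ← while-run m (suc s) (g ∘ suc) (λ i → trans (hg (suc i)) (+-suc s (toℕ i)))
               (trans (≡sym (+-suc s m)) e) (f (g zero) x) σ₂ (proj₂ q₂) (proj₁ q₂) =
        σ₃ , t₁ + (t₂ + t₃) , w-t r₁ r₂ r₃ , bound , q₃
        where
        bound : t₁ + (t₂ + t₃) ≤ 1 + (c + 2 + m * (c + 2))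
        bound = ≤-trans (+-mono-≤ t₁≤ (+-mono-≤ t₂≤ t₃≤)) (s≤s (≤-reflexive
          (trans (≡sym (+-assoc (c + 1) 1 (m * (c + 2)))) (cong (_+ m * (c + 2)) (+-assoc c 1 1)))))

      loop-run : ∀ x σ → I x σ → Ends (loopP u a p) σ false (2 + M * (c + 2)) (I (foldF f x))
      loop-run x σ h = seq-ends {c = 1} {P = λ σ′ → I x σ′ × ctr σ′ u ≡ 0}
        (false , op-ends {o = clear u} refl refl (stable x σ 0 h , upd-same (ctr σ) u 0))
        (λ σ′ q → while-run M 0 id (λ _ → refl) refl x σ′ (proj₁ q) (proj₂ q))

    inWord-test : ∀ u σ → proj₂ (actS w u inWord σ) ≡ (ctr σ u <ᵇ l)
    inWord-test u σ = go-in w (ctr σ u)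
      where
      go-in : ∀ w i → defined (symAt w i) ≡ (i <ᵇ length w)
      go-in []      zero    = refl
      go-in []      (suc i) = refl
      go-in (s ∷ w) zero    = refl
      go-in (s ∷ w) (suc i) = go-in w i

    Ctrs : ℕ → List Ix → Store → Set
    Ctrs k []       σ = ⊤
    Ctrs k (v ∷ vs) σ = ctr σ (ctrOf k) ≡ toℕ v × Ctrs (suc k) vs σ

    FrC : ℕ → Store → Store → Set
    FrC b σ σ′ = ∀ y → y < b → ctr σ′ y ≡ ctr σ y

    frC-setC : ∀ {b σ x v} → b ≤ x → FrC b σ (setC σ x v)
    frC-setC {σ = σ} {v = v} h y l = upd-other (ctr σ) v (λ e → <⇒≢ (≤-trans l h) (≡sym e))

    frC-trans : ∀ {b σ σ′ σ″} → FrC b σ σ′ → FrC b σ′ σ″ → FrC b σ σ″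
    frC-trans f g y l = trans (g y l) (f y l)

    frC-≤ : ∀ {b b′ σ σ′} → b ≤ b′ → FrC b′ σ σ′ → FrC b σ σ′
    frC-≤ h f y l = f y (≤-trans l h)

    ctrs-frame : ∀ k vs {a σ σ′} → length vs ≡ a → FrC (ctrOf (up a k)) σ σ′ → Ctrs k vs σ → Ctrs k vs σ′
    ctrs-frame k []       e f h = tt
    ctrs-frame k (v ∷ vs) refl f (h , hs) =
      trans (f (ctrOf k) (ctrOf-< (≤-trans (n<1+n k) (up-≤ (length vs) (suc k))))) h , ctrs-frame (suc k) vs refl f hs

    -- Inner loops have to preserve the counters of the outer ones. The recursive call therefore
    -- uses an enlarged invariant that contains the outer counter, which is why `I` is arbitrary.
    nest-run : ∀ r {A : Set} k p (I : A → Store → Set) (f : List Ix → A → A) (c : Pl) →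
      (∀ y → k ≤ y → ∀ x σ v → I x σ → I x (setC σ (ctrOf y) v)) →
      (∀ vs x σ → length vs ≡ r → Ctrs k vs σ → I x σ → Runs p σ (ev c l) (λ σ′ → Ctrs k vs σ′ × I (f vs x) σ′)) →
      ∀ x σ → I x σ → Runs (nestP r k p) σ (ev (nestCost r c) l) (I (loopV r f x))
    nest-run zero k p I f c st bd x σ h = weakenR ≤-refl (λ _ → proj₂) (bd [] x σ refl tt h)
    nest-run (suc r) k p I f c st bd x σ h = false ,
      loop-run l (ctrOf k) inWord (nestP r (suc k) p) I (λ i → loopV r (f ∘ (i ∷_))) (ev (nestCost r c) l)
        (st k ≤-refl) (λ _ σ _ → refl , inWord-test (ctrOf k) σ)
        (λ i x σ h cu → weakenR ≤-refl (λ _ q → proj₂ q , proj₁ q)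
          (nest-run r (suc k) p (λ x σ → I x σ × ctr σ (ctrOf k) ≡ toℕ i) (f ∘ (i ∷_)) c
            (λ y k<y x σ v q → st y (≤-trans (n≤1+n k) k<y) x σ v (proj₁ q) ,
                               trans (frC-setC {σ = σ} {v = v} (ctrOf-mono k<y) (ctrOf k) (ctrOf-< (n<1+n k))) (proj₂ q))
            (λ vs x σ e cs q → weakenR ≤-refl (λ _ z → proj₂ (proj₁ z) , proj₂ z , proj₁ (proj₁ z))
               (bd (i ∷ vs) x σ (cong suc e) (proj₂ q , cs) (proj₁ q)))
            x σ (h , cu)))
        x σ h

    module _ (σ₀ : Store) (z : ℕ) where

      -- The counters `1 + z` and `2 + z` are left out because they serve as loop indices; the
      -- counter `3 + z` collects the new value.
      HState : ℕ → ℕ → Store → Set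
      HState a s σ = FrC z σ₀ σ × arr σ ≡ arr σ₀ × ctr σ z ≡ a × ctr σ (3 + z) ≡ s

      hstate-set : ∀ {a s} i → i < 2 → ∀ {σ v} → HState a s σ → HState a s (setC σ (suc i + z) v)
      hstate-set i i<2 {σ} {v} (f , e , h , h′) =
        (λ y l → trans (upd-other (ctr σ) v (+≢< (suc i) l)) (f y l)) , e ,
        trans (upd-other (ctr σ) v (suc+≢ i z)) h ,
        trans (upd-other (ctr σ) v (λ e → <⇒≢ (≤-trans (s≤s (+-monoˡ-≤ z i<2)) ≤-refl) e)) h′

      incr-sum : ∀ {a s} i → i < 2 → ∀ {j} σ → HState a s σ → ctr σ (suc i + z) ≡ j →
        Runs (op (at (3 + z) incr)) σ 1 (λ σ′ → ctr σ′ (suc i + z) ≡ j × HState a (suc s) σ′)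
      incr-sum i i<2 σ (f , e , h , h′) hj = true , op-ends {o = at (3 + z) incr} refl refl
        (trans (upd-other (ctr σ) _ (λ e → <⇒≢ (≤-trans (s≤s (+-monoˡ-≤ z i<2)) ≤-refl) (≡sym e))) hj ,
         (λ y l → trans (upd-other (ctr σ) _ (+≢< 3 l)) (f y l)) , e ,
         trans (upd-other (ctr σ) _ (suc+≢ 2 z)) h , trans (upd-same (ctr σ) (3 + z) _) (cong suc h′))

      horner-run : ∀ i x (v : Ix) → x < z → ctr σ₀ x ≡ toℕ v → ctr σ₀ z < l ^ i →
        Runs (hornerP z x) σ₀ (ev (hornerCost i) l) (λ σ → FrC z σ₀ σ × arr σ ≡ arr σ₀ × ctr σ z ≡ ctr σ₀ z * l + toℕ v)
      horner-run i x v x<z hx hz =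
        seq-runs {c = 1} (false , op-ends {o = clear (3 + z)} {P = HState a 0} refl refl
          ((λ y l → upd-other (ctr σ₀) 0 (+≢< 3 l)) , refl , upd-other (ctr σ₀) 0 (suc+≢ 2 z) , upd-same (ctr σ₀) (3 + z) 0)) λ σ₁ h₁ →
        seq-runs (false , weaken {c = 2 + a * (ev (loopCost X (K 1)) l + 2)}
            (s≤s (s≤s (*-monoˡ-≤ (ev (loopCost X (K 1)) l + 2) (≤-trans (<⇒≤ hz) (≤-reflexive (≡sym (ev-pw i l)))))))
            (λ σ q → subst (λ s → HState a s σ) (trans (foldF-* a l 0) (+-identityʳ (a * l))) q)
            (loop-run a (1 + z) (less z) (loopP (2 + z) inWord (op (at (3 + z) incr))) (HState a)
              (λ _ → foldF {m = l} (λ _ → suc)) (ev (loopCost X (K 1)) l)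
              (λ s σ v q → hstate-set 0 (s≤s z≤n) q)
              (λ s σ q → refl , cong (ctr σ (1 + z) <ᵇ_) (proj₁ (proj₂ (proj₂ q))))
              (λ j s σ q e → false , weaken ≤-refl (λ _ r → proj₂ r , proj₁ r)
                (loop-run l (2 + z) inWord (op (at (3 + z) incr)) (λ s σ → HState a s σ × ctr σ (1 + z) ≡ toℕ j)
                  (λ _ → suc) 1
                  (λ s σ v r → hstate-set 1 ≤-refl (proj₁ r) , trans (upd-other (ctr σ) v (λ e → suc+≢ 0 (1 + z) e)) (proj₂ r))
                  (λ s σ r → refl , inWord-test (2 + z) σ)
                  (λ j′ s σ r e′ → weakenR ≤-refl
                     (λ σ′ t → proj₁ (proj₂ t) , proj₂ (proj₂ t) , proj₁ t)
                     (both σ (proj₁ r) e′ (proj₂ r)))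
                  s σ (q , e)))
              0 σ₁ h₁)) λ σ₂ h₂ →
        seq-runs (false , weaken {c = 2 + toℕ v * (1 + 2)} (s≤s (s≤s (*-monoˡ-≤ 3 (<⇒≤ (FP.toℕ<n v)))))
            (λ σ q → subst (λ s → HState a s σ) (trans (foldF-suc (toℕ v) (a * l)) (+-comm (toℕ v) (a * l))) q)
            (loop-run (toℕ v) (1 + z) (less x) (op (at (3 + z) incr)) (HState a) (λ _ → suc) 1
              (λ s σ v q → hstate-set 0 (s≤s z≤n) q)
              (λ s σ q → refl , cong (ctr σ (1 + z) <ᵇ_) (trans (proj₁ q x x<z) hx))
              (λ j s σ q e → incr-sum 0 (s≤s z≤n) σ q e)
              (a * l) σ₂ h₂)) λ σ₃ h₃ →
        seq-runs {c = 1} (false , op-ends {o = clear z} {P = HState 0 s₃} refl refl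
          ((λ y l → trans (upd-other (ctr σ₃) 0 (+≢< 0 l)) (proj₁ h₃ y l)) , proj₁ (proj₂ h₃) , upd-same (ctr σ₃) z 0 ,
           trans (upd-other (ctr σ₃) 0 (λ e → suc+≢ 2 z (≡sym e))) (proj₂ (proj₂ (proj₂ h₃))))) λ σ₄ h₄ →
        false , weaken {c = 2 + s₃ * (1 + 2)}
            (s≤s (s≤s (*-monoˡ-≤ 3 (≤-trans (<⇒≤ (horner-bound {i = i} v hz)) (≤-reflexive (≡sym (ev-pw (suc i) l)))))))
            (λ σ q → proj₁ q , proj₁ (proj₂ q) , trans (proj₁ (proj₂ (proj₂ q))) (trans (foldF-suc s₃ 0) (+-identityʳ s₃)))
            (loop-run s₃ (1 + z) (less (3 + z)) (op (at z incr)) (λ s → HState s s₃) (λ _ → suc) 1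
              (λ s σ v q → hstate-set 0 (s≤s z≤n) q)
              (λ s σ q → refl , cong (ctr σ (1 + z) <ᵇ_) (proj₂ (proj₂ (proj₂ q))))
              (λ j s σ q e → true , op-ends {o = at z incr} refl refl
                (trans (upd-other (ctr σ) _ (λ e → suc+≢ 0 z (≡sym e))) e ,
                 (λ y l → trans (upd-other (ctr σ) _ (+≢< 0 l)) (proj₁ q y l)) , proj₁ (proj₂ q) ,
                 trans (upd-same (ctr σ) z _) (cong suc (proj₁ (proj₂ (proj₂ q)))) ,
                 trans (upd-other (ctr σ) _ (λ e → suc+≢ 2 z (≡sym e))) (proj₂ (proj₂ (proj₂ q)))))
              0 σ₄ h₄)
        where
        a s₃ : ℕ
        a  = ctr σ₀ z
        s₃ = a * l + toℕ v
        both : ∀ {a s j j′} σ → HState a s σ → ctr σ (2 + z) ≡ j′ → ctr σ (1 + z) ≡ j →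
          Runs (op (at (3 + z) incr)) σ 1 (λ σ′ → ctr σ′ (1 + z) ≡ j × ctr σ′ (2 + z) ≡ j′ × HState a (suc s) σ′)
        both σ q e₂ e₁ with b , σ′ , t , r , t≤ , e , q′ ← incr-sum 1 ≤-refl σ q e₂ with r
        ... | r-op = true , σ′ , t , r , t≤ , trans (upd-other (ctr σ) _ (λ e → suc+≢ 1 (1 + z) e)) e₁ , e , q′

    Values : ℕ → List ℕ → List Ix → Store → Set
    Values z []       []       σ = ⊤
    Values z (x ∷ xs) (v ∷ vs) σ = ctrOf x < z × ctr σ (ctrOf x) ≡ toℕ v × Values z xs vs σ
    Values z _        _        σ = ⊥

    values-frame : ∀ {z} xs vs {σ σ′} → FrC z σ σ′ → Values z xs vs σ → Values z xs vs σ′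
    values-frame []       []       f h = tt
    values-frame (x ∷ xs) (v ∷ vs) f (h , e , hs) = h , trans (f (ctrOf x) h) e , values-frame xs vs f hs

    addrFrom-run : ∀ z i xs vs σ → Values z xs vs σ → ctr σ z < l ^ i →
      Runs (addrFrom z xs) σ (ev (addrCost i (length xs)) l) (λ σ′ → FrC z σ σ′ × arr σ′ ≡ arr σ × ctr σ′ z ≡ addrAcc (ctr σ z) vs)
    addrFrom-run z i [] [] σ h b = false , op-ends {o = clear (1 + z)} refl refl
      (frC-setC {σ = σ} (n≤1+n z) , refl , upd-other (ctr σ) 0 (suc+≢ 0 z))
    addrFrom-run z i (x ∷ xs) (v ∷ vs) σ (x<z , e , h) b =
      seq-runs (horner-run σ z i (ctrOf x) v x<z e b) λ σ′ q →
      weakenR ≤-refl (λ σ″ r → (λ y y< → trans (proj₁ r y y<) (proj₁ q y y<)) , trans (proj₁ (proj₂ r)) (proj₁ (proj₂ q)) ,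
                                trans (proj₂ (proj₂ r)) (cong (λ n → addrAcc n vs) (proj₂ (proj₂ q))))
        (addrFrom-run z (suc i) xs vs σ′ (values-frame xs vs (proj₁ q) h)
           (≤-trans (≤-reflexive (cong suc (proj₂ (proj₂ q)))) (horner-bound {i = i} v b)))

    addrP-run : ∀ k xs vs σ → Values (ctrOf k) xs vs σ →
      Runs (addrP k xs) σ (1 + ev (addrCost 0 (length xs)) l) (λ σ′ → FrC (ctrOf k) σ σ′ × arr σ′ ≡ arr σ × ctr σ′ (ctrOf k) ≡ addr vs)
    addrP-run k xs vs σ h =
      seq-runs {c = 1} (false , op-ends {o = clear (ctrOf k)} {P = λ σ′ → FrC (ctrOf k) σ σ′ × arr σ′ ≡ arr σ × ctr σ′ (ctrOf k) ≡ 0} refl refl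
        (frC-setC {σ = σ} ≤-refl , refl , upd-same (ctr σ) (ctrOf k) 0)) λ σ₁ q →
      weakenR ≤-refl (λ σ₂ r → (λ y y< → trans (proj₁ r y y<) (proj₁ q y y<)) , trans (proj₁ (proj₂ r)) (proj₁ (proj₂ q)) ,
                                trans (proj₂ (proj₂ r)) (cong (λ n → addrAcc n vs) (proj₂ (proj₂ q))))
        (addrFrom-run (ctrOf k) 0 xs vs σ₁ (values-frame xs vs (proj₁ q) h) (≤-reflexive (cong suc (proj₂ (proj₂ q)))))

    readP-run : ∀ q k xs vs σ → Values (ctrOf k) xs vs σ →
      Ends (readP q k xs) σ (arr σ q (addr vs)) (1 + ev (addrCost 0 (length xs)) l + 1) (λ σ′ → FrC (ctrOf k) σ σ′ × arr σ′ ≡ arr σ)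
    readP-run q k xs vs σ h = seq-ends (addrP-run k xs vs σ h) λ σ′ r →
      op-ends refl (cong₂ (λ f i → f q i) (proj₁ (proj₂ r)) (proj₂ (proj₂ r))) (proj₁ r , proj₁ (proj₂ r))

    ctrs-values : ∀ a k {z} vs σ → length vs ≡ a → ctrOf (up a k) ≤ z → Ctrs k vs σ → Values z (names a k) vs σ
    ctrs-values zero    k []       σ e h c = tt
    ctrs-values (suc a) k (v ∷ vs) σ e h (c , cs) =
      ≤-trans (ctrOf-< (≤-trans (n<1+n k) (up-≤ a (suc k)))) h , c , ctrs-values a (suc k) vs σ (suc-injective e) h cs

    length-names : ∀ a k → length (names a k) ≡ a
    length-names zero    k = refl
    length-names (suc a) k = cong suc (length-names a (suc k))

    -- Only tuples of length a are compared: a leading zero digit does not change an address, so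
    -- tuples of different lengths may share one.
    Content : ℕ → ℕ → (List Ix → Bool) → Store → Set
    Content q a R′ σ = ∀ vs → length vs ≡ a → arr σ q (addr vs) ≡ R′ vs

    FrA : (ℕ → Set) → Store → Store → Set
    FrA P σ σ′ = ∀ r → P r → ∀ i → arr σ′ r i ≡ arr σ r i

    module _ (q a k : ℕ) (p : Prog) (c : Pl) (g : List Ix → Bool) (B : Store → Set)
      (closed : ∀ {σ σ′} → FrC (ctrOf k) σ σ′ → FrA (_≢ q) σ σ′ → B σ → B σ′)
      (p-run : ∀ vs σ → length vs ≡ a → Ctrs k vs σ → B σ →
               Ends p σ (g vs) (ev c l) (λ σ′ → FrC (ctrOf (up a k)) σ σ′ × FrA (_≡ q) σ σ′ × B σ′)) where

      put-run : ∀ b vs R′ σ → length vs ≡ a → Ctrs k vs σ → B σ → Content q a R′ σ →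
        Runs (putP q a k b) σ (1 + ev (addrCost 0 a) l + 1) (λ σ′ → Ctrs k vs σ′ × B σ′ × Content q a (updL R′ vs b) σ′)
      put-run b vs R′ σ e cs hB hR = weakenR (≤-reflexive (cong (λ n → 1 + ev (addrCost 0 n) l + 1) (length-names a k))) (λ _ x → x)
        (seq-runs (addrP-run (up a k) (names a k) vs σ (ctrs-values a k vs σ e ≤-refl cs)) λ σ′ (f , ea , ec) →
          true , op-ends {o = at (ctrOf (up a k)) (put q b)} refl refl
            (ctrs-frame k vs e (λ y y< → f y y<) cs ,
             closed {σ} {proj₁ (opS w (at (ctrOf (up a k)) (put q b)) σ′)} (frC-≤ {σ = σ} {σ′} (ctrOf-mono (up-≤ a k)) f)
               (λ r r≢ i → trans (cong (λ h → h i) (upd-other (arr σ′) _ (r≢ ∘ ≡sym))) (cong (λ h → h r i) ea)) hB ,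
             λ us eu → trans (cong (λ h → h (addr us)) (upd-same (arr σ′) q _)) (content us eu σ′ ea ec)))
        where
        content : ∀ us → length us ≡ a → ∀ σ′ → arr σ′ ≡ arr σ → ctr σ′ (ctrOf (up a k)) ≡ addr vs →
          upd (arr σ′ q) (ctr σ′ (ctrOf (up a k))) b (addr us) ≡ updL R′ vs b us
        content us eu σ′ ea ec rewrite ea | ec with vs ≟ᴸ us
        ... | yes refl = upd-same (arr σ q) (addr vs) b
        ... | no  h    = trans (upd-other (arr σ q) b (λ e′ → h (proj₂ (addrAcc-injective 0 0 vs us (trans e (≡sym eu)) e′)))) (hR us eu)

      -- The tabulation starts from whatever the array contains, since every relevant entry is
      -- overwritten.
      fill-run : ∀ σ → B σ → Runs (fillP q a k p) σ (ev (fillCost a c) l) (λ σ′ → B σ′ × Content q a g σ′)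
      fill-run σ hB = weakenR ≤-refl (λ σ′ (h , h′) → h , λ vs e → trans (h′ vs e) (loopV-tabulates a g vs e R₀))
        (nest-run a k (ite p (putP q a k true) (putP q a k false)) (λ R′ σ → B σ × Content q a R′ σ) (λ vs R′ → updL R′ vs (g vs))
          (c ⊕ (K 1 ⊕ addrCost 0 a ⊕ K 1))
          (λ y k≤y R′ σ v (h , h′) → closed {σ} (frC-setC {σ = σ} (ctrOf-mono k≤y)) (λ _ _ _ → refl) h , h′)
          (λ vs R′ σ e cs (h , h′) → body-run vs R′ σ e cs h h′)
          R₀ σ (hB , λ _ _ → refl))
        where
        R₀ : List Ix → Bool
        R₀ vs = arr σ q (addr vs)
        body-run : ∀ vs R′ σ → length vs ≡ a → Ctrs k vs σ → B σ → Content q a R′ σ →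
          Runs (ite p (putP q a k true) (putP q a k false)) σ (ev c l + (1 + ev (addrCost 0 a) l + 1))
            (λ σ′ → Ctrs k vs σ′ × B σ′ × Content q a (updL R′ vs (g vs)) σ′)
        body-run vs R′ σ e cs h h′ = ite-runs (putP q a k) (g vs) (p-run vs σ e cs h) λ σ₁ (fr , fa , h₁) →
          put-run (g vs) vs R′ σ₁ e (ctrs-frame k vs e fr cs) h₁ (λ us eu → trans (fa q refl _) (h′ us eu))

    Frame : ℕ → ℕ → Store → Store → Set
    Frame k j σ σ′ = FrC (ctrOf k) σ σ′ × FrA (_< 2 * j) σ σ′

    frame-refl : ∀ {k j σ} → Frame k j σ σ
    frame-refl = (λ _ _ → refl) , λ _ _ _ → refl

    frame-trans : ∀ {k j σ σ′ σ″} → Frame k j σ σ′ → Frame k j σ′ σ″ → Frame k j σ σ″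
    frame-trans (f , g) (f′ , g′) = (λ y l → trans (f′ y l) (f y l)) , λ r l i → trans (g′ r l i) (g r l i)

    frame-≤ : ∀ {k k′ j j′ σ σ′} → k ≤ k′ → j ≤ j′ → Frame k′ j′ σ σ′ → Frame k j σ σ′
    frame-≤ {σ = σ} {σ′} h h′ (f , g) = frC-≤ {σ = σ} {σ′} (ctrOf-mono h) f , λ r l → g r (≤-trans l (*-monoʳ-≤ 2 h′))

    MatchC : ℕ → Env → Store → Set
    MatchC k ρ σ = ∀ x → x < k → ctr σ (ctrOf x) ≡ toℕ (ρ x)

    MatchR : (ℕ → Maybe ℕ) → ℕ → Rels → Store → Set
    MatchR ar j Ξ σ = ∀ r a → r < j → ar r ≡ just a → Content (2 * r) a (Ξ r) σ

    matchC-frame : ∀ {k j ρ σ σ′} → Frame k j σ σ′ → MatchC k ρ σ → MatchC k ρ σ′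
    matchC-frame (f , _) h x l = trans (f (ctrOf x) (ctrOf-< l)) (h x l)

    matchR-frame : ∀ {k j ar Ξ σ σ′} → Frame k j σ σ′ → MatchR ar j Ξ σ → MatchR ar j Ξ σ′
    matchR-frame (_ , g) h r a l e vs ev′ = trans (g (2 * r) (*-monoʳ-< 2 l) _) (h r a l e vs ev′)

    matchC-bind : ∀ {ρ σ} a k vs → length vs ≡ a → MatchC k ρ σ → Ctrs k vs σ → MatchC (up a k) (bindAll k vs ρ) σ
    matchC-bind zero k [] e h cs = h
    matchC-bind {ρ} {σ} (suc a) k (v ∷ vs) e h (c , cs) = matchC-bind a (suc k) vs (suc-injective e) step′ cs
      where
      step′ : MatchC (suc k) (upd ρ k v) σ
      step′ x (s≤s l) with m≤n⇒m<n∨m≡n l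
      ... | inj₁ x<k = trans (h x x<k) (cong toℕ (≡sym (upd-other ρ v (λ e → <⇒≢ x<k (≡sym e)))))
      ... | inj₂ refl = trans c (cong toℕ (≡sym (upd-same ρ k v)))

    matchR-extend : ∀ {ar j Ξ σ a R′} → MatchR ar j Ξ σ → Content (2 * j) a R′ σ → MatchR (upd ar j (just a)) (suc j) (upd Ξ j R′) σ
    matchR-extend {ar} {j} {Ξ} {σ} {a} {R′} h hR r a′ (s≤s l) e with m≤n⇒m<n∨m≡n l
    ... | inj₁ r<j = subst (λ X′ → Content (2 * r) a′ X′ σ) (≡sym (upd-other Ξ R′ (λ e → <⇒≢ r<j (≡sym e))))
          (h r a′ r<j (trans (≡sym (upd-other ar (just a) (λ e → <⇒≢ r<j (≡sym e)))) e))
    ... | inj₂ refl with refl ← trans (≡sym (upd-same ar r (just a))) e = subst (λ X′ → Content (2 * r) a X′ σ) (≡sym (upd-same Ξ r R′)) hR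

    matchR-hide : ∀ {ar j Ξ σ} → MatchR ar j Ξ σ → MatchR (upd ar j nothing) (suc j) Ξ σ
    matchR-hide {ar} {j} h r a (s≤s l) e with m≤n⇒m<n∨m≡n l
    ... | inj₁ r<j = h r a r<j (trans (≡sym (upd-other ar nothing (λ e → <⇒≢ r<j (≡sym e)))) e)
    ... | inj₂ refl with () ← trans (≡sym (upd-same ar r nothing)) e

    below-values : ∀ k ρ σ xs → AllBelow k xs → MatchC k ρ σ → Values (ctrOf k) xs (map ρ xs) σ
    below-values k ρ σ []       _        h = tt
    below-values k ρ σ (x ∷ xs) (l , ls) h = ctrOf-< (<ᵇ⇒< x k l) , h x (<ᵇ⇒< x k l) , below-values k ρ σ xs ls h

    arity-just : ∀ {m n} → T (arity m n) → m ≡ just n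
    arity-just {just a} {n} t = cong just (≡ᵇ⇒≡ a n t)

    -- Here z is the tally being computed and o the other tally, whose value has to survive. Both
    -- lie strictly between the variables of levels k and `suc k`, out of reach of the body and of
    -- the loops.
    count-run : ∀ k j σ z o n₀ r p (c : Pl) (g : List Ix → Bool) →
      ctrOf k < z → z < ctrOf (suc k) → ctrOf k < o → o < ctrOf (suc k) → z ≢ o →
      (∀ vs σ′ → length vs ≡ suc r → Ctrs k vs σ′ → Frame k j σ σ′ → Ends p σ′ (g vs) (ev c l) (Frame (up (suc r) k) j σ′)) →
      ∀ σ₁ → Frame k j σ σ₁ → ctr σ₁ z ≡ 0 → ctr σ₁ o ≡ n₀ →
      Runs (countP z (suc r) k p) σ₁ (ev (nestCost (suc r) (c ⊕ K 1)) l)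
        (λ σ′ → Frame k j σ σ′ × ctr σ′ z ≡ sumV (suc r) (b2n ∘ g) × ctr σ′ o ≡ n₀)
    count-run k j σ z o n₀ r p c g k<z z< k<o o< z≢o pr σ₁ fr ez eo =
      weakenR ≤-refl (λ σ′ (h , e , e′) → h , trans e (trans (loopV-sum (suc r) (b2n ∘ g) 0) (+-identityʳ _)) , e′)
        (nest-run (suc r) k _ I (λ vs → b2n (g vs) +_) (c ⊕ K 1) stable
          (λ vs x σ′ e cs (f , a , b) → inner vs x σ′ e cs f a b)
          0 σ₁ (fr , ez , eo))
      where
      I : ℕ → Store → Set
      I n σ′ = Frame k j σ σ′ × ctr σ′ z ≡ n × ctr σ′ o ≡ n₀
      off : ∀ {y u} → k ≤ y → ctrOf k < u → u < ctrOf (suc k) → ctrOf y ≢ u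
      off {y} k≤y l l′ e with m≤n⇒m<n∨m≡n k≤y
      ... | inj₁ k<y = <⇒≢ (≤-trans l′ (ctrOf-mono k<y)) (≡sym e)
      ... | inj₂ refl = <⇒≢ l e
      stable : ∀ y → k ≤ y → ∀ n σ′ v → I n σ′ → I n (setC σ′ (ctrOf y) v)
      stable y k≤y n σ′ v (f , a , b) =
        (frC-trans {σ = σ} {σ′} {setC σ′ (ctrOf y) v} (proj₁ f) (frC-setC {σ = σ′} (ctrOf-mono k≤y)) , proj₂ f) ,
        trans (upd-other (ctr σ′) v (off k≤y k<z z<)) a , trans (upd-other (ctr σ′) v (off k≤y k<o o<)) b
      k′ : ℕ
      k′ = up (suc r) k
      suck≤ : ctrOf (suc k) ≤ ctrOf k′
      suck≤ = ctrOf-mono (up-≤ r (suc k))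
      inner : ∀ vs x σ′ → length vs ≡ suc r → Ctrs k vs σ′ → Frame k j σ σ′ → ctr σ′ z ≡ x → ctr σ′ o ≡ n₀ →
        Runs (ite p (op (at z incr)) (falseP k′)) σ′ (ev c l + 1) (λ σ″ → Ctrs k vs σ″ × I (b2n (g vs) + x) σ″)
      inner vs x σ′ e cs f a b with pr vs σ′ e cs f
      ... | σ₂ , t₂ , r₂ , t≤ , f₂ with g vs
      ... | true = true , _ , _ , r-t r₂ r-op , +-monoˡ-≤ 1 t≤ ,
            ctrs-upd k vs e cs₂ , ((λ y l → trans (upd-other (ctr σ₂) _ (λ e → <⇒≢ (≤-trans l (<⇒≤ k<z)) (≡sym e))) (proj₁ f′ y l)) , proj₂ f′) ,
            trans (upd-same (ctr σ₂) z _) (cong suc (trans (proj₁ f₂ z (≤-trans z< suck≤)) a)) ,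
            trans (upd-other (ctr σ₂) _ z≢o) (trans (proj₁ f₂ o (≤-trans o< suck≤)) b)
        where
        f′ : Frame k j σ σ₂
        f′ = frame-trans {k} {j} {σ} {σ′} {σ₂} f (frame-≤ {k} {k′} {j} {j} {σ′} {σ₂} (up-≤ (suc r) k) ≤-refl f₂)
        cs₂ : Ctrs k vs σ₂
        cs₂ = ctrs-frame k vs {σ = σ′} {σ₂} e (proj₁ f₂) cs
        ctrs-upd′ : ∀ y us → k ≤ y → Ctrs y us σ₂ → Ctrs y us (setC σ₂ z (suc (ctr σ₂ z)))
        ctrs-upd′ y []       h cs = tt
        ctrs-upd′ y (u ∷ us) h (d , ds) = trans (upd-other (ctr σ₂) _ (λ e → off h k<z z< (≡sym e))) d , ctrs-upd′ (suc y) us (≤-trans h (n≤1+n y)) ds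
        ctrs-upd : ∀ k₁ us → length us ≡ suc r → Ctrs k us σ₂ → Ctrs k us (setC σ₂ z (suc (ctr σ₂ z)))
        ctrs-upd _ us _ = ctrs-upd′ k us ≤-refl
      ... | false = false , _ , _ , r-f r₂ r-op , +-monoˡ-≤ 1 t≤ ,
            ctrs-frame k vs {σ = σ₂} {setC σ₂ (ctrOf k′) 0} e (frC-setC {σ = σ₂} ≤-refl) (ctrs-frame k vs {σ = σ′} {σ₂} e (proj₁ f₂) cs) ,
            (frC-trans {σ = σ} {σ₂} {setC σ₂ (ctrOf k′) 0} (proj₁ f′) (frC-setC {σ = σ₂} (ctrOf-mono (up-≤ (suc r) k))) , proj₂ f′) ,
            trans (frC-setC {σ = σ₂} suck≤ z z<) (trans (proj₁ f₂ z (≤-trans z< suck≤)) a) ,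
            trans (frC-setC {σ = σ₂} suck≤ o o<) (trans (proj₁ f₂ o (≤-trans o< suck≤)) b)
        where
        f′ : Frame k j σ σ₂
        f′ = frame-trans {k} {j} {σ} {σ′} {σ₂} f (frame-≤ {k} {k′} {j} {j} {σ′} {σ₂} (up-≤ (suc r) k) ≤-refl f₂)

    comp-run : ∀ φ k j ar ρ Ξ σ → WF φ k j ar → MatchC k ρ σ → MatchR ar j Ξ σ →
      Ends (comp φ k j) σ (⟦ φ ⟧ k j ρ Ξ) (ev (cost φ) l) (Frame k j σ)
    comp-run ⊥ᶠ k j ar ρ Ξ σ wf mc mr =
      op-ends {P = Frame k j σ} refl refl (frC-setC {σ = σ} ≤-refl , λ _ _ _ → refl)
    comp-run (symb s x) k j ar ρ Ξ σ wf mc mr =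
      op-ends refl (cong (λ i → isSym s (symAt w i)) (mc x (<ᵇ⇒< x k wf))) (frame-refl {k} {j} {σ})
    comp-run (lt x y) k j ar ρ Ξ σ (wf , wf′) mc mr =
      op-ends refl (cong₂ _<ᵇ_ (mc x (<ᵇ⇒< x k wf)) (mc y (<ᵇ⇒< y k wf′))) (frame-refl {k} {j} {σ})
    comp-run (rel r xs) k j ar ρ Ξ σ (wr , wb , wa) mc mr
      with σ′ , t , run′ , t≤ , f , e ← readP-run (2 * r) k xs (map ρ xs) σ (below-values k ρ σ xs wb mc) =
      σ′ , t , subst (λ b → Run w (comp (rel r xs) k j) σ b σ′ t) (mr r _ (<ᵇ⇒< r j wr) (arity-just wa) (map ρ xs) (LP.length-map ρ xs)) run′ ,
      t≤ , f , λ r _ i → cong (λ h → h r i) e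
    comp-run (φ ∧ᶠ ψ) k j ar ρ Ξ σ (wf , wf′) mc mr with ⟦ φ ⟧ k j ρ Ξ | comp-run φ k j ar ρ Ξ σ wf mc mr
    ... | true | e = ite-ends {c′ = ev (cost ψ) l + 1} true e (λ σ′ f → weaken (m≤m+n _ 1) (λ σ″ f′ → frame-trans {k} {j} {σ} {σ′} {σ″} f f′)
            (comp-run ψ k j ar ρ Ξ σ′ wf′ (matchC-frame {j = j} {ρ} {σ} {σ′} f mc) (matchR-frame {k} {ar = ar} {Ξ} {σ} {σ′} f mr)))
    ... | false | e = ite-ends {c′ = ev (cost ψ) l + 1} false e (λ σ′ f → weaken (m≤n+m 1 _) (λ _ h → h)
            (op-ends {P = Frame k j σ} refl refl (frC-trans {σ = σ} {σ′} {setC σ′ (ctrOf k) 0} (proj₁ f) (frC-setC {σ = σ′} ≤-refl) , proj₂ f)))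
    comp-run (φ ⊻ᶠ ψ) k j ar ρ Ξ σ (wf , wf′) mc mr with ⟦ φ ⟧ k j ρ Ξ | comp-run φ k j ar ρ Ξ σ wf mc mr
    ... | true | e = ite-ends true e (λ σ′ f → negate (weaken ≤-refl (λ σ″ f′ → frame-trans {k} {j} {σ} {σ′} {σ″} f f′)
            (comp-run ψ k j ar ρ Ξ σ′ wf′ (matchC-frame {j = j} {ρ} {σ} {σ′} f mc) (matchR-frame {k} {ar = ar} {Ξ} {σ} {σ′} f mr))))
      where
      negate : ∀ {p σ b c P} → Ends p σ b c P → Ends (neg p) σ (not b) c P
      negate (σ′ , t , r , t≤ , h) = σ′ , t , r-neg r , t≤ , h
    ... | false | e = ite-ends false e (λ σ′ f → weaken ≤-refl (λ σ″ f′ → frame-trans {k} {j} {σ} {σ′} {σ″} f f′)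
            (comp-run ψ k j ar ρ Ξ σ′ wf′ (matchC-frame {j = j} {ρ} {σ} {σ′} f mc) (matchR-frame {k} {ar = ar} {Ξ} {σ} {σ′} f mr)))
    comp-run (¬ᶠ φ) k j ar ρ Ξ σ wf mc mr with σ′ , t , r , t≤ , f ← comp-run φ k j ar ρ Ξ σ wf mc mr = σ′ , t , r-neg r , t≤ , f
    comp-run (cnt r φ ψ) k j ar ρ Ξ σ (wf , wf′) mc mr =
      seq-ends {c = 1} (false , op-ends {o = clear z₁} {P = λ σ′ → Frame k j σ σ′ × ctr σ′ z₁ ≡ 0} refl refl
        ((frC-setC {σ = σ} (n≤1+n _) , λ _ _ _ → refl) , upd-same (ctr σ) z₁ 0)) λ σ₁ (f₁ , e₁) →
      seq-ends {c = 1} (false , op-ends {o = clear z₂} {P = λ σ′ → Frame k j σ σ′ × ctr σ′ z₁ ≡ 0 × ctr σ′ z₂ ≡ 0} refl refl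
        ((frC-trans {σ = σ} {σ₁} {setC σ₁ z₂ 0} (proj₁ f₁) (frC-setC {σ = σ₁} (m≤n+m _ 2)) , proj₂ f₁) ,
         trans (upd-other (ctr σ₁) 0 (λ e → suc+≢ 0 z₁ e)) e₁ , upd-same (ctr σ₁) z₂ 0)) λ σ₂ (f₂ , e₂ , e₂′) →
      seq-ends (count-run k j σ z₁ z₂ 0 r _ (cost φ) _ (n<1+n _) (lt′ (s≤s (s≤s z≤n))) (n≤1+n _) (lt′ (s≤s (s≤s (s≤s z≤n)))) (λ e → suc+≢ 0 z₁ (≡sym e))
        (λ vs σ′ e cs f → comp-run φ k′ j ar (bindAll k vs ρ) Ξ σ′ wf
           (matchC-bind (suc r) k vs e (matchC-frame {j = j} {ρ} {σ} {σ′} f mc) cs) (matchR-frame {k} {ar = ar} {Ξ} {σ} {σ′} f mr))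
        σ₂ f₂ e₂ e₂′) λ σ₃ (f₃ , e₃ , e₃′) →
      seq-ends (count-run k j σ z₂ z₁ _ r _ (cost ψ) _ (n≤1+n _) (lt′ (s≤s (s≤s (s≤s z≤n)))) (n<1+n _) (lt′ (s≤s (s≤s z≤n))) (λ e → suc+≢ 0 z₁ e)
        (λ vs σ′ e cs f → comp-run ψ k′ j ar (bindAll k vs ρ) Ξ σ′ wf′
           (matchC-bind (suc r) k vs e (matchC-frame {j = j} {ρ} {σ} {σ′} f mc) cs) (matchR-frame {k} {ar = ar} {Ξ} {σ} {σ′} f mr))
        σ₃ f₃ e₃′ e₃) λ σ₄ (f₄ , e₄ , e₄′) →
      op-ends refl (cong₂ _<ᵇ_ e₄′ e₄) f₄
      where
      z₁ z₂ k′ : ℕ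
      z₁ = 1 + ctrOf k
      z₂ = 2 + ctrOf k
      k′ = up (suc r) k
      lt′ : ∀ {i} → i < 3 → i + ctrOf k < ctrOf (suc k)
      lt′ h = ≤-trans (+-monoˡ-≤ (ctrOf k) h) (≤-reflexive (≡sym (ctrOf-suc k)))
    comp-run (iter a r φ₀ φ ψ) k j ar ρ Ξ σ (wf₀ , wf , wf′) mc mr =
      seq-ends (fill-run (2 * j) a k (comp φ₀ (up a k) (suc j)) (cost φ₀) R₀ (Frame k j σ)
        (λ {σ₁} {σ₂} fc fa f → frC-trans {σ = σ} {σ₁} {σ₂} (proj₁ f) fc , λ r l i → trans (fa r (<⇒≢ l) i) (proj₂ f r l i))
        (λ vs σ₁ e cs f → weaken ≤-refl (λ σ₂ f′ → proj₁ f′ ,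
            (λ { r refl i → proj₂ f′ r (*-monoʳ-< 2 (n<1+n j)) i }) ,
            frame-trans {k} {j} {σ} {σ₁} {σ₂} f (frame-≤ {k} {up a k} {j} {suc j} {σ₁} {σ₂} (up-≤ a k) (n≤1+n j) f′))
          (comp-run φ₀ (up a k) (suc j) (upd ar j nothing) (bindAll k vs ρ) Ξ σ₁ wf₀
            (matchC-bind a k vs e (matchC-frame {j = j} {ρ} {σ} {σ₁} f mc) cs) (matchR-hide {ar} {j} {Ξ} {σ₁} (matchR-frame {k} {ar = ar} {Ξ} {σ} {σ₁} f mr))))
        σ (frame-refl {k} {j} {σ})) λ σ₁ (f₁ , c₁) →
      seq-ends (nest-run r k _ I F (fillCost a (cost φ) ⊕ fillCost a (K 1 ⊕ addrCost 0 a ⊕ K 1))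
        (λ y k≤y R′ σ₂ v (f , c) → (frC-trans {σ = σ} {σ₂} {setC σ₂ (ctrOf y) v} (proj₁ f) (frC-setC {σ = σ₂} (ctrOf-mono k≤y)) , proj₂ f) , c)
        (λ us R′ σ₂ e cs (f , c) → round us R′ σ₂ e cs f c)
        R₀ σ₁ (f₁ , c₁)) λ σ₂ (f₂ , c₂) →
      weaken ≤-refl (λ σ₃ f → frame-trans {k} {j} {σ} {σ₂} {σ₃} f₂ (frame-≤ {k} {k} {j} {suc j} {σ₂} {σ₃} ≤-refl (n≤1+n j) f))
        (comp-run ψ k (suc j) (upd ar j (just a)) ρ (upd Ξ j (loopO r F R₀)) σ₂ wf′ (matchC-frame {j = j} {ρ} {σ} {σ₂} f₂ mc)
          (matchR-extend {ar} {j} {Ξ} {σ₂} (matchR-frame {k} {ar = ar} {Ξ} {σ} {σ₂} f₂ mr)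
            (subst (λ R′ → Content (2 * j) a R′ σ₂) (≡sym (loopO-def r F R₀)) c₂)))
      where
      k₁ : ℕ
      k₁ = up r k
      R₀ : List Ix → Bool
      R₀ vs = ⟦ φ₀ ⟧ (up a k) (suc j) (bindAll k vs ρ) Ξ
      F : List Ix → (List Ix → Bool) → List Ix → Bool
      F us R′ vs = ⟦ φ ⟧ (up a k₁) (suc j) (bindAll k₁ vs (bindAll k us ρ)) (upd Ξ j R′)
      I : (List Ix → Bool) → Store → Set
      I R′ σ′ = Frame k j σ σ′ × Content (2 * j) a R′ σ′
      odd≢ : 1 + 2 * j ≢ 2 * j
      odd≢ = suc+≢ 0 (2 * j)
      2j+1< : 1 + 2 * j < 2 * suc j
      2j+1< = ≤-reflexive (≡sym (*-suc 2 j))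
      -- The variables `us` of the surrounding round belong to the invariant because both fills of a
      -- round have to leave them intact.
      J : List Ix → (Store → Set) → Store → Set
      J us C σ′ = Frame k j σ σ′ × Ctrs k us σ′ × C σ′
      round : ∀ us R′ σ₂ → length us ≡ r → Ctrs k us σ₂ → Frame k j σ σ₂ → Content (2 * j) a R′ σ₂ →
        Runs (seqP (fillP (1 + 2 * j) a k₁ (comp φ (up a k₁) (suc j)))
                   (fillP (2 * j) a k₁ (readP (1 + 2 * j) (up a k₁) (names a k₁)))) σ₂
             (ev (fillCost a (cost φ) ⊕ fillCost a (K 1 ⊕ addrCost 0 a ⊕ K 1)) l) (λ σ′ → Ctrs k us σ′ × I (F us R′) σ′)
      round us R′ σ₂ e cs f c =
        seq-runs (fill-run (1 + 2 * j) a k₁ (comp φ (up a k₁) (suc j)) (cost φ) (F us R′) (J us (Content (2 * j) a R′))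
          (λ {σ₁} {σ₂} fc fa (h , h′ , h″) →
            (frC-trans {σ = σ} {σ₁} {σ₂} (proj₁ h) (frC-≤ {σ = σ₁} {σ₂} (ctrOf-mono (up-≤ r k)) fc) ,
             (λ q l i → trans (fa q (<⇒≢ (≤-trans l (n≤1+n _))) i) (proj₂ h q l i))) ,
            ctrs-frame k us {σ = σ₁} {σ₂} e fc h′ ,
            (λ vs ev′ → trans (fa (2 * j) (odd≢ ∘ ≡sym) _) (h″ vs ev′)))
          (λ vs σ₁ ev′ cv (h , h′ , h″) → weaken ≤-refl (λ σ₃ f′ → proj₁ f′ , (λ { q refl i → proj₂ f′ q 2j+1< i }) ,
              frame-trans {k} {j} {σ} {σ₁} {σ₃} h (frame-≤ {k} {up a k₁} {j} {suc j} {σ₁} {σ₃} (≤-trans (up-≤ r k) (up-≤ a k₁)) (n≤1+n j) f′) ,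
              ctrs-frame k us {σ = σ₁} {σ₃} e (frC-≤ {σ = σ₁} {σ₃} (ctrOf-mono (up-≤ a k₁)) (proj₁ f′)) h′ ,
              (λ us′ eu → trans (proj₂ f′ (2 * j) (*-monoʳ-< 2 (n<1+n j)) _) (h″ us′ eu)))
            (comp-run φ (up a k₁) (suc j) (upd ar j (just a)) (bindAll k₁ vs (bindAll k us ρ)) (upd Ξ j R′) σ₁ wf
              (matchC-bind a k₁ vs ev′ (matchC-bind r k us e (matchC-frame {j = j} {ρ} {σ} {σ₁} h mc) h′) cv)
              (matchR-extend {ar} {j} {Ξ} {σ₁} (matchR-frame {k} {ar = ar} {Ξ} {σ} {σ₁} h mr) h″)))
          σ₂ (f , cs , c)) λ σ₃ ((f₃ , cs₃ , _) , c₃) →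
        weakenR ≤-refl (λ σ′ ((h , h′ , _) , h‴) → h′ , h , h‴)
          (fill-run (2 * j) a k₁ (readP (1 + 2 * j) (up a k₁) (names a k₁)) (K 1 ⊕ addrCost 0 a ⊕ K 1) (F us R′) (J us (Content (1 + 2 * j) a (F us R′)))
            (λ {σ₁} {σ₂} fc fa (h , h′ , h″) →
              (frC-trans {σ = σ} {σ₁} {σ₂} (proj₁ h) (frC-≤ {σ = σ₁} {σ₂} (ctrOf-mono (up-≤ r k)) fc) ,
               (λ q l i → trans (fa q (<⇒≢ l) i) (proj₂ h q l i))) ,
              ctrs-frame k us {σ = σ₁} {σ₂} e fc h′ ,
              (λ vs ev′ → trans (fa (1 + 2 * j) odd≢ _) (h″ vs ev′)))
            (λ vs σ₁ ev′ cv (h , h′ , h″) → copy vs σ₁ ev′ cv h h′ h″)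
            σ₃ (f₃ , cs₃ , c₃))
        where
        copy : ∀ vs σ₁ → length vs ≡ a → Ctrs k₁ vs σ₁ → Frame k j σ σ₁ → Ctrs k us σ₁ → Content (1 + 2 * j) a (F us R′) σ₁ →
          Ends (readP (1 + 2 * j) (up a k₁) (names a k₁)) σ₁ (F us R′ vs) (1 + ev (addrCost 0 a) l + 1)
            (λ σ′ → FrC (ctrOf (up a k₁)) σ₁ σ′ × FrA (_≡ 2 * j) σ₁ σ′ × J us (Content (1 + 2 * j) a (F us R′)) σ′)
        copy vs σ₁ ev′ cv h h′ h″
          with σ₄ , t , run′ , t≤ , f₄ , e₄ ← readP-run (1 + 2 * j) (up a k₁) (names a k₁) vs σ₁ (ctrs-values a k₁ vs σ₁ ev′ ≤-refl cv) =
          σ₄ , t , subst (λ b → Run w (readP (1 + 2 * j) (up a k₁) (names a k₁)) σ₁ b σ₄ t) (h″ vs ev′) run′ ,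
          ≤-trans t≤ (≤-reflexive (cong (λ n → 1 + ev (addrCost 0 n) l + 1) (length-names a k₁))) ,
          f₄ , (λ q _ i → cong (λ g → g q i) e₄) ,
          (frC-trans {σ = σ} {σ₁} {σ₄} (proj₁ h) (frC-≤ {σ = σ₁} {σ₄} (ctrOf-mono (≤-trans (up-≤ r k) (up-≤ a k₁))) f₄) ,
           (λ q l i → trans (cong (λ g → g q i) e₄) (proj₂ h q l i))) ,
          ctrs-frame k us {σ = σ₁} {σ₄} e (frC-≤ {σ = σ₁} {σ₄} (ctrOf-mono (up-≤ a k₁)) f₄) h′ ,
          (λ us′ eu → trans (cong (λ g → g (1 + 2 * j) (addr us′)) e₄) (h″ us′ eu))

-- Polynomial running time of formulas.

module PolynomialTime where

  open Programs
  open Tapes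
  open Machines
  open Formulas
  open Compilation

  noRels : ℕ → Maybe ℕ
  noRels _ = nothing

  formula-polytime : ∀ φ → WF φ 0 0 noRels → ∃ λ M → ∃ λ c → ∃ λ d → ∀ w → 1 ≤ length w →
    (ρ : Semantics.Env w) (Ξ : Semantics.Rels w) →
    ∃ λ t → t ≤ c * length w ^ d + c × HaltsWith M w t (Semantics.⟦_⟧ w φ 0 0 ρ Ξ)
  -- A program that makes t operations takes at most t * 2 * (1 + length w + t) machine steps; the
  -- polynomial is this bound with `cost φ` in place of t.
  formula-polytime φ wf with c , d , h ← ev-monomial (cost φ ⊗ (K 2 ⊗ (K 1 ⊕ (X ⊕ cost φ)))) =
    Sim.machine , c , d , run-it
    where
    p : Prog
    p = comp φ 0 0
    module Sim = Simulation p (width p) (below-width p ≤-refl) (St-finite′ p) (Cell-finite (width p))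
    run-it : ∀ w → 1 ≤ length w → ∀ ρ Ξ → ∃ λ t → t ≤ c * length w ^ d + c × HaltsWith Sim.machine w t (Semantics.⟦_⟧ w φ 0 0 ρ Ξ)
    run-it w 1≤ ρ Ξ
      with σ , t , r , t≤ , _ ← Correctness.comp-run w φ 0 0 noRels ρ Ξ Sim.zeroStore wf (λ _ ()) (λ _ _ ())
      with T , T≤ , halts ← Sim.run-halts w 1≤ r =
      T , ≤-trans T≤ (≤-trans (*-mono-≤ t≤ (*-monoʳ-≤ 2 (s≤s (+-monoʳ-≤ (length w) t≤)))) (≤-trans (h (length w) 1≤) (m≤m+n _ c))) , halts

-- Parity sums, and weak duality between joins and cuts.

module Cuts where

  open import Data.Bool.Properties using (xor-∧-commutativeRing; not-distribˡ-xor; ∧-distribˡ-xor)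
  open Formulas using (b2n)
  open import Algebra.Bundles using (CommutativeRing)
  import Algebra.Properties.CommutativeMonoid.Sum as CMS

  module XS = CMS (CommutativeRing.+-commutativeMonoid xor-∧-commutativeRing)

  xsum : ∀ {n} → (Fin n → Bool) → Bool
  xsum = XS.sum

  xsum-cong : ∀ {n} {f g : Fin n → Bool} → (∀ i → f i ≡ g i) → xsum f ≡ xsum g
  xsum-cong = XS.sum-cong-≗

  sum-mono : ∀ {n} {f g : Fin n → ℕ} → (∀ i → f i ≤ g i) → sum f ≤ sum g
  sum-mono {zero}  h = z≤n
  sum-mono {suc n} h = +-mono-≤ (h zero) (sum-mono (h ∘ suc))

  sum-zero : ∀ {n} {f : Fin n → ℕ} → (∀ i → f i ≡ 0) → sum f ≡ 0
  sum-zero {zero}  h = refl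
  sum-zero {suc n} h = cong₂ _+_ (h zero) (sum-zero (h ∘ suc))

  xsum-zero : ∀ {n} {f : Fin n → Bool} → (∀ i → f i ≡ false) → xsum f ≡ false
  xsum-zero {zero}  h = refl
  xsum-zero {suc n} h = cong₂ _xor_ (h zero) (xsum-zero (h ∘ suc))

  sum-* : ∀ {n} c (f : Fin n → ℕ) → sum (λ i → c * f i) ≡ c * sum f
  sum-* {zero}  c f = ≡sym (*-zeroʳ c)
  sum-* {suc n} c f = trans (cong (c * f zero +_) (sum-* c (f ∘ suc))) (≡sym (*-distribˡ-+ c (f zero) _))

  xsum-∧ : ∀ {n} b (f : Fin n → Bool) → xsum (λ i → b ∧ f i) ≡ b ∧ xsum f
  xsum-∧ {zero}  false f = refl
  xsum-∧ {zero}  true  f = refl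
  xsum-∧ {suc n} b f = trans (cong ((b ∧ f zero) xor_) (xsum-∧ b (f ∘ suc))) (≡sym (∧-distribˡ-xor b (f zero) _))

  term≤sum : ∀ {n} (f : Fin n → ℕ) i → f i ≤ sum f
  term≤sum f zero    = m≤m+n (f zero) _
  term≤sum f (suc i) = ≤-trans (term≤sum (f ∘ suc) i) (m≤n+m _ (f zero))

  sum-unique : ∀ {n} (f : Fin n → Bool) i → f i ≡ true → (∀ j → f j ≡ true → j ≡ i) → sum (b2n ∘ f) ≡ 1
  sum-unique {suc n} f zero e h rewrite e = cong suc (sum-zero rest)
    where
    rest : ∀ j → b2n (f (suc j)) ≡ 0
    rest j with f (suc j) in e′
    ... | false = refl
    ... | true with () ← h (suc j) e′
  sum-unique {suc n} f (suc i) e h with f zero in e′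
  ... | true with () ← h zero e′
  ... | false = sum-unique (f ∘ suc) i e (λ j ej → FP.suc-injective (h (suc j) ej))

  sum-positive : ∀ {n} (f : Fin n → ℕ) → 0 < sum f → ∃ λ i → 0 < f i
  sum-positive {suc n} f h with f zero in e
  ... | suc _ = zero , ≤-trans (s≤s z≤n) (≤-reflexive (≡sym e))
  ... | zero  = let i , p = sum-positive (f ∘ suc) h in suc i , p

  positive-true : ∀ {b} → 0 < b2n b → b ≡ true
  positive-true {true} _ = refl

  odd : ℕ → Bool
  odd zero    = false
  odd (suc n) = not (odd n)

  odd-+ : ∀ m n → odd (m + n) ≡ odd m xor odd n
  odd-+ zero    n = refl
  odd-+ (suc m) n = trans (cong not (odd-+ m n)) (not-distribˡ-xor (odd m) (odd n))

  odd-b2n : ∀ b → odd (b2n b) ≡ b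
  odd-b2n true  = refl
  odd-b2n false = refl

  odd-sum : ∀ {n} (f : Fin n → ℕ) → odd (sum f) ≡ xsum (odd ∘ f)
  odd-sum {zero}  f = refl
  odd-sum {suc n} f = trans (odd-+ (f zero) _) (cong (odd (f zero) xor_) (odd-sum (f ∘ suc)))

  sum² : ∀ {n} → (Fin n → Fin n → ℕ) → ℕ
  sum² f = sum (λ u → sum (f u))

  xsum² : ∀ {n} → (Fin n → Fin n → Bool) → Bool
  xsum² f = xsum (λ u → xsum (f u))

  odd-sum² : ∀ {n} (f : Fin n → Fin n → Bool) → odd (sum² (λ u v → b2n (f u v))) ≡ xsum² f
  odd-sum² f = trans (odd-sum (λ u → sum (λ v → b2n (f u v)))) (xsum-cong (λ u → trans (odd-sum (λ v → b2n (f u v))) (xsum-cong (λ v → odd-b2n (f u v)))))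

  sum²-cong : ∀ {n} {f g : Fin n → Fin n → ℕ} → (∀ u v → f u v ≡ g u v) → sum² f ≡ sum² g
  sum²-cong h = sum-cong-≗ (λ u → sum-cong-≗ (h u))

  sum²-mono : ∀ {n} {f g : Fin n → Fin n → ℕ} → (∀ u v → f u v ≤ g u v) → sum² f ≤ sum² g
  sum²-mono h = sum-mono (λ u → sum-mono (h u))

  sum²-+ : ∀ {n} (f g : Fin n → Fin n → ℕ) → sum² (λ u v → f u v + g u v) ≡ sum² f + sum² g
  sum²-+ f g = trans (sum-cong-≗ (λ u → ∑-distrib-+ (f u) (g u))) (∑-distrib-+ (λ u → sum (f u)) (λ u → sum (g u)))

  sum²-* : ∀ {n} c (f : Fin n → Fin n → ℕ) → sum² (λ u v → c * f u v) ≡ c * sum² f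
  sum²-* c f = trans (sum-cong-≗ (λ u → sum-* c (f u))) (sum-* c (λ u → sum (f u)))

  -- The handshake argument: entries off the diagonal cancel against their mirror images.
  xsum²-symmetric : ∀ {n} (f : Fin n → Fin n → Bool) → (∀ u v → f u v ≡ f v u) → (∀ u → f u u ≡ false) → xsum² f ≡ false
  xsum²-symmetric {zero}  f s i = refl
  xsum²-symmetric {suc n} f s i = begin
    (f zero zero xor a) xor xsum (λ u → f (suc u) zero xor xsum (λ v → f (suc u) (suc v)))
      ≡⟨ cong₂ _xor_ (cong (_xor a) (i zero)) (XS.∑-distrib-+ (λ u → f (suc u) zero) (λ u → xsum (λ v → f (suc u) (suc v)))) ⟩
    a xor (xsum (λ u → f (suc u) zero) xor xsum² (λ u v → f (suc u) (suc v)))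
      ≡⟨ cong₂ (λ x y → a xor (x xor y)) (xsum-cong (λ u → s (suc u) zero)) (xsum²-symmetric _ (λ u v → s (suc u) (suc v)) (i ∘ suc)) ⟩
    a xor (a xor false) ≡⟨ cong (a xor_) (xor-identityʳ a) ⟩
    a xor a ≡⟨ xor-same a ⟩
    false ∎
    where
    open ≡-Reasoning
    a : Bool
    a = xsum (λ v → f zero (suc v))

  ∧-true : ∀ {a b} → a ∧ b ≡ true → a ≡ true × b ≡ true
  ∧-true {true} {true} _ = refl , refl

  ∧-intro : ∀ {a b} → a ≡ true → b ≡ true → a ∧ b ≡ true
  ∧-intro refl refl = refl

  bool-ext : ∀ {a b} → (a ≡ true → b ≡ true) → (b ≡ true → a ≡ true) → a ≡ b
  bool-ext {true}  {b}     f g = ≡sym (f refl)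
  bool-ext {false} {false} f g = refl
  bool-ext {false} {true}  f g = g refl

  not-true : ∀ {a} → a ≢ true → a ≡ false
  not-true {true}  h = ⊥-elim (h refl)
  not-true {false} h = refl

  false≢true : ∀ {A : Set} {b} → b ≡ true → b ≡ false → A
  false≢true refl ()

  b2n-∧ : ∀ a b → b2n (a ∧ b) ≡ b2n a * b2n b
  b2n-∧ true  b = ≡sym (*-identityˡ (b2n b))
  b2n-∧ false b = refl

  ≤ᵇ-true : ∀ {m n} → m ≤ n → (m ≤ᵇ n) ≡ true
  ≤ᵇ-true {m} {n} h with m ≤ᵇ n | ≤⇒≤ᵇ h
  ... | true | _ = refl

  true-≤ᵇ : ∀ m n → (m ≤ᵇ n) ≡ true → m ≤ n
  true-≤ᵇ m n e = ≤ᵇ⇒≤ m n (subst T (≡sym e) _)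

  true-<ᵇ : ∀ m n → (m <ᵇ n) ≡ true → m < n
  true-<ᵇ m n e = <ᵇ⇒< m n (subst T (≡sym e) _)

  <ᵇ-intro : ∀ {m n} → m < n → (m <ᵇ n) ≡ true
  <ᵇ-intro {m} {n} h with m <ᵇ n | <⇒<ᵇ h
  ... | true | _ = refl

  -- Written as the comparison of counts to which an existential formula evaluates.
  anyB : ∀ {n} → (Fin n → Bool) → Bool
  anyB {n} f = sum {n} (λ _ → 0) <ᵇ sum (λ i → b2n (f i))

  anyB-elim : ∀ {n} (f : Fin n → Bool) → anyB f ≡ true → ∃ λ i → f i ≡ true
  anyB-elim {n} f e with i , p ← sum-positive (λ i → b2n (f i)) (≤-trans (s≤s z≤n) (true-<ᵇ (sum {n} (λ _ → 0)) _ e)) = i , positive-true p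

  anyB-intro : ∀ {n} (f : Fin n → Bool) i → f i ≡ true → anyB f ≡ true
  anyB-intro {n} f i e = <ᵇ-intro (≤-trans (s≤s (≤-reflexive (sum-zero {n} (λ _ → refl))))
    (≤-trans (≤-reflexive (cong b2n (≡sym e))) (term≤sum (b2n ∘ f) i)))

  anyB-none : ∀ {n} (f : Fin n → Bool) → anyB f ≡ false → ∀ i → f i ≡ false
  anyB-none f e i = not-true (λ h → false≢true (anyB-intro f i h) e)

  least : ∀ {n} (P : Fin n → Bool) i → P i ≡ true → ∃ λ r → P r ≡ true × ∀ s → (toℕ s <ᵇ toℕ r) ≡ true → P s ≡ false
  least {suc n} P i e with P zero in e₀
  least {suc n} P i       e | true  = zero , e₀ , λ _ ()
  least {suc n} P zero    e | false = false≢true e e₀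
  least {suc n} P (suc i) e | false with r , h , m ← least (P ∘ suc) i e = suc r , h , λ { zero _ → e₀ ; (suc s) l → m s l }

  range-count : ∀ M lo hi → hi ≤ M → sum {M} (λ Θ → b2n ((lo ≤ᵇ toℕ Θ) ∧ (toℕ Θ <ᵇ hi))) ≡ hi ∸ lo
  range-count zero    lo       .0 z≤n = ≡sym (0∸n≡0 lo)
  range-count (suc M) lo zero h = trans (sum-zero {suc M} (λ Θ → cong b2n (∧-zeroʳ (lo ≤ᵇ toℕ Θ)))) (≡sym (0∸n≡0 lo))
  range-count (suc M) zero (suc hi) (s≤s h) = cong suc (range-count M zero hi h)
  range-count (suc M) (suc lo) (suc hi) (s≤s h) = trans (sum-cong-≗ {M} (λ Θ → cong (λ b → b2n (b ∧ (toℕ Θ <ᵇ hi))) (shift lo (toℕ Θ)))) (range-count M lo hi h)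
    where
    shift : ∀ lo t → (suc lo ≤ᵇ suc t) ≡ (lo ≤ᵇ t)
    shift zero    t = refl
    shift (suc l) t = refl

  -- Weak duality.  The darts leaving the classes of the relations ∼ form
  -- cuts that cover every edge with total weight four; J meets each cut at
  -- most once, and any K with the same boundary meets it equally often
  -- modulo two.

  module Duality {N : ℕ} (adj : Fin N → Fin N → Bool) (a : Fin N → ℕ)
    (a-step : ∀ u v → adj u v ≡ true → a u ≤ a v + 2)
    (rel : ℕ → Fin N → Fin N → Bool)
    (rel-sym : ∀ Θ u v → rel Θ u v ≡ true → rel Θ v u ≡ true)
    (rel-trans : ∀ Θ u v w → rel Θ u v ≡ true → rel Θ v w ≡ true → rel Θ u w ≡ true)
    (rel-diag : ∀ Θ u → rel Θ u u ≡ (2 * a u ≤ᵇ Θ))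
    (rel-adj : ∀ Θ u v → adj u v ≡ true → a u + a v + 2 ≤ Θ → rel Θ u v ≡ true)
    where

    record IsJoin (K : Fin N → Fin N → Bool) : Set where
      field
        j-sym : ∀ u v → K u v ≡ K v u
        j-adj : ∀ u v → K u v ≡ true → adj u v ≡ true
        j-irr : ∀ u → K u u ≡ false
    open IsJoin

    darts : (Fin N → Fin N → Bool) → ℕ
    darts K = sum² (λ u v → b2n (K u v))

    -- The complement of the bound in `rel-adj`: an edge that fails it joins related vertices, so
    -- only edges that satisfy it can leave a class.
    out : ℕ → Fin N → Fin N → Bool
    out Θ u v = Θ <ᵇ a u + a v + 2

    rep : ℕ → Fin N → Bool
    rep Θ r = rel Θ r r ∧ not (anyB (λ s → (toℕ s <ᵇ toℕ r) ∧ rel Θ s r))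

    hits : (Fin N → Fin N → Bool) → ℕ → Fin N → ℕ
    hits K Θ r = sum² (λ u v → b2n ((rep Θ r ∧ rel Θ r u) ∧ (K u v ∧ out Θ u v)))

    -- Larger than every `a u + a v + 2`, so that no threshold at which a dart is counted is lost.
    M : ℕ
    M = suc (sum a + sum a + 2)

    rel-refl : ∀ Θ u v → rel Θ u v ≡ true → rel Θ u u ≡ true
    rel-refl Θ u v h = rel-trans Θ u v u h (rel-sym Θ u v h)

    -- `rel Θ` is a partial equivalence. A vertex not related to itself lies in no class; any other
    -- lies in exactly one, which is named by its least member.
    rep-count : ∀ Θ u → sum (λ r → b2n (rep Θ r ∧ rel Θ r u)) ≡ b2n (rel Θ u u)
    rep-count Θ u with rel Θ u u in e
    ... | false = sum-zero (λ r → cong b2n (not-true (λ h → false≢true (rel-refl Θ u r (rel-sym Θ r u (proj₂ (∧-true {rep Θ r} h)))) e)))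
    ... | true with r , hr , m ← least (λ s → rel Θ s u) u e =
      sum-unique (λ s → rep Θ s ∧ rel Θ s u) r (∧-intro (∧-intro (rel-refl Θ r u hr) (cong not (not-true none))) hr) uniq
      where
      none : anyB (λ s → (toℕ s <ᵇ toℕ r) ∧ rel Θ s r) ≢ true
      none h with s , hs ← anyB-elim (λ s → (toℕ s <ᵇ toℕ r) ∧ rel Θ s r) h with l , hs′ ← ∧-true {toℕ s <ᵇ toℕ r} hs =
        false≢true (rel-trans Θ s r u hs′ hr) (m s l)
      uniq : ∀ s → rep Θ s ∧ rel Θ s u ≡ true → s ≡ r
      uniq s h with hrep , hs ← ∧-true {rep Θ s} h with _ , hmin ← ∧-true {rel Θ s s} hrep with <-cmp (toℕ s) (toℕ r)
      ... | tri< l _ _ = false≢true hs (m s (<ᵇ-intro l))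
      ... | tri≈ _ e _ = FP.toℕ-injective e
      ... | tri> _ _ l = false≢true (∧-intro (<ᵇ-intro l) (rel-trans Θ r u s hr (rel-sym Θ s u hs)))
                                    (anyB-none (λ t → (toℕ t <ᵇ toℕ s) ∧ rel Θ t s) (flip-not hmin) r)
        where
        flip-not : ∀ {b} → not b ≡ true → b ≡ false
        flip-not {false} _ = refl

    total : (Fin N → Fin N → Bool) → ℕ
    total K = sum {M} (λ Θ → sum (hits K (toℕ Θ)))

    weight : Fin N → Fin N → ℕ
    weight u v = (a v + 2) ∸ a u

    a+a : ∀ u v → a u + a v + 2 ≤ M
    a+a u v = ≤-trans (+-monoˡ-≤ 2 (+-mono-≤ (term≤sum a u) (term≤sum a v))) (n≤1+n _)

    -- A dart from u to v is counted at the thresholds from `2 * a u` up to `a u + a v + 1`: below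
    -- this range u lies in no class, and above it the edge lies inside one. These are
    -- `a v + 2 - a u` thresholds.
    total-weight : ∀ K → total K ≡ sum² (λ u v → b2n (K u v) * weight u v)
    total-weight K = begin
      total K ≡⟨ sum-cong-≗ {M} (λ Θ → trans (∑-comm (λ r u → sum (λ v → H (toℕ Θ) r u v)))
                         (sum-cong-≗ (λ u → trans (∑-comm (λ r v → H (toℕ Θ) r u v)) (sum-cong-≗ (λ v → per-dart (toℕ Θ) u v))))) ⟩
      sum {M} (λ Θ → sum² (λ u v → b2n (K u v) * inRange (toℕ Θ) u v)) ≡⟨ ∑-comm {M} (λ Θ u → sum (λ v → b2n (K u v) * inRange (toℕ Θ) u v)) ⟩
      sum (λ u → sum {M} (λ Θ → sum (λ v → b2n (K u v) * inRange (toℕ Θ) u v))) ≡⟨ sum-cong-≗ (λ u → ∑-comm {M} (λ Θ v → b2n (K u v) * inRange (toℕ Θ) u v)) ⟩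
      sum² (λ u v → sum {M} (λ Θ → b2n (K u v) * inRange (toℕ Θ) u v)) ≡⟨ sum²-cong (λ u v → trans (sum-* {M} (b2n (K u v)) (λ Θ → inRange (toℕ Θ) u v)) (cong (b2n (K u v) *_) (per-weight u v))) ⟩
      sum² (λ u v → b2n (K u v) * weight u v) ∎
      where
      open ≡-Reasoning
      inRange : ℕ → Fin N → Fin N → ℕ
      inRange Θ u v = b2n ((2 * a u ≤ᵇ Θ) ∧ out Θ u v)
      H : ℕ → Fin N → Fin N → Fin N → ℕ
      H Θ r u v = b2n ((rep Θ r ∧ rel Θ r u) ∧ (K u v ∧ out Θ u v))
      per-dart : ∀ Θ u v → sum (λ r → b2n ((rep Θ r ∧ rel Θ r u) ∧ (K u v ∧ out Θ u v))) ≡ b2n (K u v) * inRange Θ u v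
      per-dart Θ u v = begin
        sum (λ r → b2n ((rep Θ r ∧ rel Θ r u) ∧ (K u v ∧ out Θ u v))) ≡⟨ sum-cong-≗ (λ r → trans (b2n-∧ (rep Θ r ∧ rel Θ r u) _) (*-comm _ (b2n (K u v ∧ out Θ u v)))) ⟩
        sum (λ r → b2n (K u v ∧ out Θ u v) * b2n (rep Θ r ∧ rel Θ r u)) ≡⟨ sum-* (b2n (K u v ∧ out Θ u v)) (λ r → b2n (rep Θ r ∧ rel Θ r u)) ⟩
        b2n (K u v ∧ out Θ u v) * sum (λ r → b2n (rep Θ r ∧ rel Θ r u)) ≡⟨ cong₂ _*_ (b2n-∧ (K u v) _) (trans (rep-count Θ u) (cong b2n (rel-diag Θ u))) ⟩
        b2n (K u v) * b2n (out Θ u v) * b2n (2 * a u ≤ᵇ Θ) ≡⟨ *-assoc (b2n (K u v)) _ _ ⟩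
        b2n (K u v) * (b2n (out Θ u v) * b2n (2 * a u ≤ᵇ Θ)) ≡⟨ cong (b2n (K u v) *_) (trans (*-comm (b2n (out Θ u v)) _) (≡sym (b2n-∧ (2 * a u ≤ᵇ Θ) _))) ⟩
        b2n (K u v) * inRange Θ u v ∎
      per-weight : ∀ u v → sum {M} (λ Θ → inRange (toℕ Θ) u v) ≡ weight u v
      per-weight u v = trans (range-count M (2 * a u) (a u + a v + 2) (a+a u v))
        (trans (cong₂ _∸_ (+-assoc (a u) (a v) 2) (cong (a u +_) (+-identityʳ (a u)))) ([m+n]∸[m+o]≡n∸o (a u) (a v + 2) (a u)))

    -- The potentials cancel; `a-step` in both directions makes the truncated subtractions exact.
    weight-sum : ∀ u v → adj u v ≡ true → adj v u ≡ true → weight u v + weight v u ≡ 4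
    weight-sum u v h h′ = +-cancelʳ-≡ (a u + a v) _ 4 (begin
      (weight u v + weight v u) + (a u + a v) ≡⟨ arrange (weight u v) (weight v u) (a u) (a v) ⟩
      (weight u v + a u) + (weight v u + a v) ≡⟨ cong₂ _+_ (m∸n+n≡m (a-step u v h)) (m∸n+n≡m (a-step v u h′)) ⟩
      (a v + 2) + (a u + 2) ≡⟨ arrange′ (a u) (a v) ⟩
      4 + (a u + a v) ∎)
      where
      open ≡-Reasoning
      arrange : ∀ p q x y → (p + q) + (x + y) ≡ (p + x) + (q + y)
      arrange = solve-∀
      arrange′ : ∀ x y → (y + 2) + (x + 2) ≡ 4 + (x + y)
      arrange′ = solve-∀

    double-total : ∀ {K} → IsJoin K → total K + total K ≡ 4 * darts K
    double-total {K} j = begin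
      total K + total K ≡⟨ cong₂ _+_ (total-weight K) (trans (total-weight K) (trans (∑-comm (λ u v → b2n (K u v) * weight u v)) (sum²-cong (λ u v → cong (λ b → b2n b * weight v u) (j-sym j v u))))) ⟩
      sum² (λ u v → b2n (K u v) * weight u v) + sum² (λ u v → b2n (K u v) * weight v u) ≡⟨ ≡sym (sum²-+ (λ u v → b2n (K u v) * weight u v) (λ u v → b2n (K u v) * weight v u)) ⟩
      sum² (λ u v → b2n (K u v) * weight u v + b2n (K u v) * weight v u) ≡⟨ sum²-cong each ⟩
      sum² (λ u v → 4 * b2n (K u v)) ≡⟨ sum²-* 4 (λ u v → b2n (K u v)) ⟩
      4 * darts K ∎
      where
      open ≡-Reasoning
      each : ∀ u v → b2n (K u v) * weight u v + b2n (K u v) * weight v u ≡ 4 * b2n (K u v)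
      each u v with K u v in e
      ... | false = refl
      ... | true  = trans (cong₂ _+_ (*-identityˡ (weight u v)) (*-identityˡ (weight v u)))
                          (weight-sum u v (j-adj j u v e) (j-adj j v u (trans (j-sym j v u) e)))

    -- Summing degrees over a class counts the darts that start in it. Those that fail `out` have
    -- both ends in the class and cancel against their reverses, so the boundary of K alone
    -- determines the parity.
    hits-parity : ∀ {K} → IsJoin K → ∀ Θ r → odd (hits K Θ r) ≡ xsum (λ u → (rep Θ r ∧ rel Θ r u) ∧ xsum (K u))
    hits-parity {K} j Θ r = begin
      odd (hits K Θ r) ≡⟨ odd-sum² A ⟩
      xsum² A ≡⟨ ≡sym (trans (cong (xsum² A xor_) inner) (xor-identityʳ _)) ⟩
      xsum² A xor xsum² B ≡⟨ ≡sym (trans (xsum-cong (λ u → XS.∑-distrib-+ (A u) (B u))) (XS.∑-distrib-+ (λ u → xsum (A u)) (λ u → xsum (B u)))) ⟩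
      xsum² (λ u v → A u v xor B u v) ≡⟨ xsum-cong (λ u → trans (xsum-cong (λ v → split (rep Θ r ∧ rel Θ r u) (K u v) (out Θ u v))) (xsum-∧ (rep Θ r ∧ rel Θ r u) (K u))) ⟩
      xsum (λ u → (rep Θ r ∧ rel Θ r u) ∧ xsum (K u)) ∎
      where
      open ≡-Reasoning
      A B : Fin N → Fin N → Bool
      A u v = (rep Θ r ∧ rel Θ r u) ∧ (K u v ∧ out Θ u v)
      B u v = (rep Θ r ∧ rel Θ r u) ∧ (K u v ∧ not (out Θ u v))
      split : ∀ p k o → (p ∧ (k ∧ o)) xor (p ∧ (k ∧ not o)) ≡ p ∧ k
      split true  true  true  = refl
      split true  true  false = refl
      split true  false o     = refl
      split false k     o     = refl
      B-swap : ∀ u v → B u v ≡ true → B v u ≡ true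
      B-swap u v h with p , h′ ← ∧-true {rep Θ r ∧ rel Θ r u} h
                   with hr , hu ← ∧-true {rep Θ r} p | hk , ho ← ∧-true {K u v} h′ =
        ∧-intro (∧-intro hr (rel-trans Θ r u v hu (rel-adj Θ u v (j-adj j u v hk) (≮⇒≥ (not-lt ho)))))
          (∧-intro (trans (j-sym j v u) hk) (trans (cong (λ n → not (Θ <ᵇ n + 2)) (+-comm (a v) (a u))) ho))
        where
        not-lt : ∀ {m n} → not (m <ᵇ n) ≡ true → ¬ m < n
        not-lt {m} {n} h l rewrite <ᵇ-intro l with () ← h
      inner : xsum² B ≡ false
      inner = xsum²-symmetric B (λ u v → bool-ext (B-swap u v) (B-swap v u))
        (λ u → trans (cong (λ k → (rep Θ r ∧ rel Θ r u) ∧ (k ∧ not (out Θ u u))) (j-irr j u)) (∧-zeroʳ _))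

    module _ {J : Fin N → Fin N → Bool} (jJ : IsJoin J)
      (unique : ∀ Θ u v u′ v′ → J u v ≡ true → J u′ v′ ≡ true → rel Θ u u′ ≡ true → out Θ u v ≡ true → out Θ u′ v′ ≡ true → u ≡ u′ × v ≡ v′)
      where

      hits≤1 : ∀ Θ r → hits J Θ r ≤ 1
      hits≤1 Θ r with hits J Θ r in e
      ... | zero  = z≤n
      ... | suc n with u , hu ← sum-positive (λ u → sum (λ v → b2n ((rep Θ r ∧ rel Θ r u) ∧ (J u v ∧ out Θ u v)))) (≤-trans (s≤s z≤n) (≤-reflexive (≡sym e)))
                  with v , hv ← sum-positive (λ v → b2n ((rep Θ r ∧ rel Θ r u) ∧ (J u v ∧ out Θ u v))) hu = ≤-reflexive (trans (≡sym e) (trans (sum-cong-≗ row) (sum-unique (λ u′ → eq u′ u) u (eq-refl u) (λ j → eq-true))))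
        where
        A : Fin N → Fin N → Bool
        A u v = (rep Θ r ∧ rel Θ r u) ∧ (J u v ∧ out Θ u v)
        eq : Fin N → Fin N → Bool
        eq x y with x FP.≟ y
        ... | yes _ = true
        ... | no  _ = false
        eq-refl : ∀ x → eq x x ≡ true
        eq-refl x with x FP.≟ x
        ... | yes _ = refl
        ... | no h  = ⊥-elim (h refl)
        eq-true : ∀ {x y} → eq x y ≡ true → x ≡ y
        eq-true {x} {y} h with x FP.≟ y
        ... | yes e = e
        A-uv : A u v ≡ true
        A-uv = positive-true hv
        A-unique : ∀ u′ v′ → A u′ v′ ≡ true → u′ ≡ u × v′ ≡ v
        A-unique u′ v′ h with p , q ← ∧-true {rep Θ r ∧ rel Θ r u} A-uv | p′ , q′ ← ∧-true {rep Θ r ∧ rel Θ r u′} h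
          with _ , ru ← ∧-true {rep Θ r} p | _ , ru′ ← ∧-true {rep Θ r} p′ | k , o ← ∧-true {J u v} q | k′ , o′ ← ∧-true {J u′ v′} q′ =
          unique Θ u′ v′ u v k′ k (rel-trans Θ u′ r u (rel-sym Θ r u′ ru′) ru) o′ o
        row : ∀ u′ → sum (λ v′ → b2n (A u′ v′)) ≡ b2n (eq u′ u)
        row u′ with u′ FP.≟ u
        ... | yes refl = sum-unique (A u′) v A-uv (λ v′ h → proj₂ (A-unique u′ v′ h))
        ... | no  h    = sum-zero (λ v′ → cong b2n (not-true (λ h′ → h (proj₁ (A-unique u′ v′ h′)))))

      minimal : ∀ {K} → IsJoin K → (∀ v → xsum (J v) ≡ xsum (K v)) → darts J ≤ darts K
      minimal {K} jK same = *-cancelˡ-≤ 4 (≤-trans (≤-reflexive (≡sym (double-total jJ)))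
        (≤-trans (+-mono-≤ le le) (≤-reflexive (double-total jK))))
        where
        parity : ∀ Θ r → odd (hits J Θ r) ≡ odd (hits K Θ r)
        parity Θ r = trans (hits-parity jJ Θ r) (trans (xsum-cong (λ u → cong ((rep Θ r ∧ rel Θ r u) ∧_) (same u))) (≡sym (hits-parity jK Θ r)))
        small : ∀ m n → m ≤ 1 → odd m ≡ odd n → m ≤ n
        small zero          n       h e = z≤n
        small (suc zero)    (suc n) h e = s≤s z≤n
        small (suc (suc m)) n (s≤s ()) e
        le : total J ≤ total K
        le = sum-mono {M} (λ Θ → sum-mono (λ r → small (hits J (toℕ Θ) r) (hits K (toℕ Θ) r) (hits≤1 (toℕ Θ) r) (parity (toℕ Θ) r)))

-- Exchange inequalities, the equivalence of vertices, and cuts met once.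

module Exchanges where

  open Cuts

  BoolFun : ℕ → Set
  BoolFun zero    = Bool
  BoolFun (suc n) = Bool → BoolFun n

  agree : ∀ n → BoolFun n → BoolFun n → Bool
  agree zero    a b = not (a xor b)
  agree (suc n) f g = agree n (f true) (g true) ∧ agree n (f false) (g false)

  Agree : ∀ n → BoolFun n → BoolFun n → Set
  Agree zero    a b = a ≡ b
  Agree (suc n) f g = ∀ x → Agree n (f x) (g x)

  -- Identities between parities are proved by evaluating both sides at all arguments, which leaves
  -- `refl` as the premise.
  truthTable : ∀ n (f g : BoolFun n) → agree n f g ≡ true → Agree n f g
  truthTable zero    true  true  _ = refl
  truthTable zero    false false _ = refl
  truthTable (suc n) f g h true  = truthTable n (f true) (g true) (proj₁ (∧-true h))
  truthTable (suc n) f g h false = truthTable n (f false) (g false) (proj₂ (∧-true {agree n (f true) (g true)} h))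

  -- Equality through two strict comparisons, as the formula `eqF` evaluates.
  eqB : ∀ {n} → Fin n → Fin n → Bool
  eqB i j = not (toℕ i <ᵇ toℕ j) ∧ not (toℕ j <ᵇ toℕ i)

  <ᵇ-irrefl : ∀ m → (m <ᵇ m) ≡ false
  <ᵇ-irrefl zero    = refl
  <ᵇ-irrefl (suc m) = <ᵇ-irrefl m

  eqB-refl : ∀ {n} (i : Fin n) → eqB i i ≡ true
  eqB-refl i rewrite <ᵇ-irrefl (toℕ i) = refl

  eqB-true : ∀ {n} (i j : Fin n) → eqB i j ≡ true → i ≡ j
  eqB-true i j h with h₁ , h₂ ← ∧-true {not (toℕ i <ᵇ toℕ j)} h =
    FP.toℕ-injective (≤-antisym (≮⇒≥ (geq h₂)) (≮⇒≥ (geq h₁)))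
    where
    geq : ∀ {m n} → not (m <ᵇ n) ≡ true → ¬ m < n
    geq h l rewrite <ᵇ-intro l with () ← h

  eqB-false : ∀ {n} {i j : Fin n} → i ≢ j → eqB i j ≡ false
  eqB-false {i = i} {j} h = not-true (h ∘ eqB-true i j)

  eqB-sym : ∀ {n} (i j : Fin n) → eqB i j ≡ eqB j i
  eqB-sym i j = ∧-comm (not (toℕ i <ᵇ toℕ j)) _

  cancel : ∀ c {x y a b} → x ≤ y → x ≡ c + a → y ≡ c + b → a ≤ b
  cancel c h refl refl = +-cancelˡ-≤ c _ _ h

  Slot : ℕ → Set
  Slot N = Fin N × Fin N × Fin N × Fin N

  -- The four vertices are added modulo two, so a repeated vertex cancels; four times `x₀` encodes
  -- the empty set, and smaller even sets are padded with `x₀`.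
  par : ∀ {N} → Slot N → Fin N → Bool
  par (p , q , r , s) v = eqB p v xor (eqB q v xor (eqB r v xor eqB s v))

  -- Apart from J only the costs of the table enter, through the five inequalities that a table
  -- without improvement satisfies. Costs count darts, so an edge of the graph costs 2.
  module Exchange {N : ℕ} (adj : Fin N → Fin N → Bool) (x₀ : Fin N) (F : Slot N → ℕ) (J : Fin N → Fin N → Bool)
    (adj-sym : ∀ u v → adj u v ≡ true → adj v u ≡ true)
    (J-adj : ∀ u v → J u v ≡ true → adj u v ≡ true)
    (same≤ : ∀ A B → (∀ v → par A v ≡ par B v) → F A ≤ F B)
    (edge≤ : ∀ A B u v → adj u v ≡ true → (∀ w → par A w ≡ par B w xor (eqB u w xor eqB v w)) → F A ≤ F B + 2)
    (J-one : ∀ a b → J a b ≡ true → F (a , b , x₀ , x₀) + 2 ≤ F (x₀ , x₀ , x₀ , x₀))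
    (J-two : ∀ a b c d → J a b ≡ true → J c d ≡ true → ¬ (a ≡ c × b ≡ d) → ¬ (a ≡ d × b ≡ c) →
             F (a , b , c , d) + 4 ≤ F (x₀ , x₀ , x₀ , x₀))
    (exchange : ∀ A B z → ∃ λ w → (eqB z w xor (par A w xor par B w)) ≡ true ×
       (∀ A′ B′ → (∀ v → par A′ v ≡ par A v xor (eqB z v xor eqB w v)) → (∀ v → par B′ v ≡ par B v xor (eqB z v xor eqB w v)) →
          F A′ + F B′ ≤ F A + F B))
    where

    same : ∀ A B → (∀ v → par A v ≡ par B v) → F A ≡ F B
    same A B h = ≤-antisym (same≤ A B h) (same≤ B A (λ v → ≡sym (h v)))

    odd₁ : ∀ x p q r s → (p xor (q xor r)) ≡ (s xor ((x xor (p xor (q xor r))) xor (x xor (s xor (x xor x)))))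
    odd₁ = truthTable 5 (λ x p q r s → (p xor (q xor r))) (λ x p q r s → (s xor ((x xor (p xor (q xor r))) xor (x xor (s xor (x xor x)))))) refl

    odd₂ : ∀ x p q r s → (q xor (r xor s)) ≡ (x xor ((p xor (q xor (r xor s))) xor (x xor (p xor (x xor x)))))
    odd₂ = truthTable 5 (λ x p q r s → (q xor (r xor s))) (λ x p q r s → (x xor ((p xor (q xor (r xor s))) xor (x xor (p xor (x xor x)))))) refl

    one-of-three : ∀ (p q r w : Fin N) → (eqB p w xor (eqB q w xor eqB r w)) ≡ true → w ≡ p ⊎ w ≡ q ⊎ w ≡ r
    one-of-three p q r w h with p FP.≟ w | q FP.≟ w | r FP.≟ w
    ... | yes e | _ | _ = inj₁ (≡sym e)
    ... | no _ | yes e | _ = inj₂ (inj₁ (≡sym e))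
    ... | no _ | no _ | yes e = inj₂ (inj₂ (≡sym e))
    ... | no a | no b | no c rewrite eqB-false a | eqB-false b | eqB-false c with () ← h

    -- The odd number of entries `x₀` leaves the boundary T + x₀ + v. The cost of this join acts as
    -- a potential, in the role of a distance from `x₀`; at `x₀` itself it is `f₀`.
    a : Fin N → ℕ
    a v = F (x₀ , v , x₀ , x₀)

    f : Fin N → Fin N → Fin N → ℕ
    f u v t = F (x₀ , u , v , t)

    f₀ : ℕ
    f₀ = F (x₀ , x₀ , x₀ , x₀)

    -- Superpose the entries for x₀, u, v, t and for x₀, z and follow a trail from z. It ends at an
    -- odd vertex, which must be u, v or t; interchanging z with this end yields two entries of no
    -- larger total cost.
    triple : ∀ u v t z → (f z v t + a u ≤ f u v t + a z) ⊎ (f u z t + a v ≤ f u v t + a z) ⊎ (f u v z + a t ≤ f u v t + a z)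
    triple u v t z with exchange (x₀ , u , v , t) (x₀ , z , x₀ , x₀) z
    ... | w , o , le with one-of-three u v t w (trans (odd₁ (eqB x₀ w) (eqB u w) (eqB v w) (eqB t w) (eqB z w)) o)
    ... | inj₁ refl = inj₁ (le (x₀ , z , v , t) (x₀ , u , x₀ , x₀)
            (λ y → truthTable 5 (λ x p q r s → (x xor (s xor (q xor r)))) (λ x p q r s → ((x xor (p xor (q xor r))) xor (s xor p))) refl (eqB x₀ y) (eqB u y) (eqB v y) (eqB t y) (eqB z y))
            (λ y → truthTable 5 (λ x p q r s → (x xor (p xor (x xor x)))) (λ x p q r s → ((x xor (s xor (x xor x))) xor (s xor p))) refl (eqB x₀ y) (eqB u y) (eqB v y) (eqB t y) (eqB z y)))
    ... | inj₂ (inj₁ refl) = inj₂ (inj₁ (le (x₀ , u , z , t) (x₀ , v , x₀ , x₀)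
            (λ y → truthTable 5 (λ x p q r s → (x xor (p xor (s xor r)))) (λ x p q r s → ((x xor (p xor (q xor r))) xor (s xor q))) refl (eqB x₀ y) (eqB u y) (eqB v y) (eqB t y) (eqB z y))
            (λ y → truthTable 5 (λ x p q r s → (x xor (q xor (x xor x)))) (λ x p q r s → ((x xor (s xor (x xor x))) xor (s xor q))) refl (eqB x₀ y) (eqB u y) (eqB v y) (eqB t y) (eqB z y))))
    ... | inj₂ (inj₂ refl) = inj₂ (inj₂ (le (x₀ , u , v , z) (x₀ , t , x₀ , x₀)
            (λ y → truthTable 5 (λ x p q r s → (x xor (p xor (q xor s)))) (λ x p q r s → ((x xor (p xor (q xor r))) xor (s xor r))) refl (eqB x₀ y) (eqB u y) (eqB v y) (eqB t y) (eqB z y))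
            (λ y → truthTable 5 (λ x p q r s → (x xor (r xor (x xor x)))) (λ x p q r s → ((x xor (s xor (x xor x))) xor (s xor r))) refl (eqB x₀ y) (eqB u y) (eqB v y) (eqB t y) (eqB z y))))

    swap₂₃ : ∀ u v t → f u v t ≡ f v u t
    swap₂₃ u v t = same _ _ (λ y → truthTable 4 (λ x p q r → (x xor (p xor (q xor r)))) (λ x p q r → (x xor (q xor (p xor r)))) refl (eqB x₀ y) (eqB u y) (eqB v y) (eqB t y))

    swap₃₄ : ∀ u v t → f u v t ≡ f u t v
    swap₃₄ u v t = same _ _ (λ y → truthTable 4 (λ x p q r → (x xor (p xor (q xor r)))) (λ x p q r → (x xor (p xor (r xor q)))) refl (eqB x₀ y) (eqB u y) (eqB v y) (eqB t y))

    diag : ∀ u t → f u u t ≡ a t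
    diag u t = same _ _ (λ y → truthTable 3 (λ x p r → (x xor (p xor (p xor r)))) (λ x p r → (x xor (r xor (x xor x)))) refl (eqB x₀ y) (eqB u y) (eqB t y))

    pair : ∀ u v → F (u , v , x₀ , x₀) ≡ f u v x₀
    pair u v = same _ _ (λ y → truthTable 3 (λ x p q → (p xor (q xor (x xor x)))) (λ x p q → (x xor (p xor (q xor x)))) refl (eqB x₀ y) (eqB u y) (eqB v y))

    edge-f : ∀ u v t → adj u v ≡ true → a t ≤ f u v t + 2
    edge-f u v t h = edge≤ _ _ u v h (λ y → truthTable 4 (λ x p q r → (x xor (r xor (x xor x)))) (λ x p q r → ((x xor (p xor (q xor r))) xor (p xor q))) refl (eqB x₀ y) (eqB u y) (eqB v y) (eqB t y))

    a-step : ∀ u v → adj u v ≡ true → a u ≤ a v + 2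
    a-step u v h = edge≤ _ _ u v h (λ y → truthTable 3 (λ x p q → (x xor (p xor (x xor x)))) (λ x p q → ((x xor (q xor (x xor x))) xor (p xor q))) refl (eqB x₀ y) (eqB u y) (eqB v y))

    -- The least Θ relating u and v obeys the strong triangle inequality, which makes every
    -- threshold a partial equivalence. The classes stand in for the components of the level sets of
    -- `a`: the domain is the level set `2 * a u ≤ Θ`, and edges with `a u + a v + 2 ≤ Θ` stay
    -- inside a class.
    rel : ℕ → Fin N → Fin N → Bool
    rel Θ u v = not (anyB (λ t → f u v t + Θ <ᵇ a u + a v + a t))

    rel-elim : ∀ Θ u v → rel Θ u v ≡ true → ∀ t → a u + a v + a t ≤ f u v t + Θ
    rel-elim Θ u v h t = ≮⇒≥ (λ l → lemma h (anyB-intro _ t (<ᵇ-intro l)))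
      where
      lemma : ∀ {b} → not b ≡ true → b ≡ true → ⊥
      lemma {true} () _

    rel-intro : ∀ Θ u v → (∀ t → a u + a v + a t ≤ f u v t + Θ) → rel Θ u v ≡ true
    rel-intro Θ u v h = cong not (not-true (λ e → let t , l = anyB-elim _ e in <⇒≱ (true-<ᵇ _ _ l) (h t)))

    rel-sym : ∀ Θ u v → rel Θ u v ≡ true → rel Θ v u ≡ true
    rel-sym Θ u v h = rel-intro Θ v u (λ t → subst₂ _≤_ (cong (_+ a t) (+-comm (a u) (a v))) (cong (_+ Θ) (swap₂₃ u v t)) (rel-elim Θ u v h t))

    -- Each outcome of `triple` replaces one of u, v, t by z. If u is replaced, the relation of z
    -- and v at t closes the case; if v, that of u and z at t; if t, that of u and z at v.
    rel-trans : ∀ Θ u z v → rel Θ u z ≡ true → rel Θ z v ≡ true → rel Θ u v ≡ true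
    rel-trans Θ u z v h h′ = rel-intro Θ u v go
      where
      combine : ∀ {g g′ p q s z′} → g′ + p ≤ g + z′ → z′ + q + s ≤ g′ + Θ → p + q + s ≤ g + Θ
      combine {g} {g′} {p} {q} {s} {z′} h₁ h₂ = cancel (g′ + z′) (+-mono-≤ h₁ h₂) (e₁ g′ p q s z′) (e₂ g g′ z′ Θ)
        where
        e₁ : ∀ g′ p q s z′ → g′ + p + (z′ + q + s) ≡ g′ + z′ + (p + q + s)
        e₁ = solve-∀
        e₂ : ∀ g g′ z′ Θ → g + z′ + (g′ + Θ) ≡ g′ + z′ + (g + Θ)
        e₂ = solve-∀
      rot : ∀ x y t → x + y + t ≡ y + x + t
      rot = solve-∀
      rot′ : ∀ x y t → x + y + t ≡ t + x + y
      rot′ = solve-∀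
      go : ∀ t → a u + a v + a t ≤ f u v t + Θ
      go t with triple u v t z
      ... | inj₁ e = combine e (rel-elim Θ z v h′ t)
      ... | inj₂ (inj₁ e) = ≤-trans (≤-reflexive (rot (a u) (a v) (a t)))
              (combine e (≤-trans (≤-reflexive (rot (a z) (a u) (a t))) (rel-elim Θ u z h t)))
      ... | inj₂ (inj₂ e) = ≤-trans (≤-reflexive (rot′ (a u) (a v) (a t)))
              (combine e (≤-trans (≤-reflexive (rot (a z) (a u) (a v))) (≤-trans (rel-elim Θ u z h v) (≤-reflexive (cong (_+ Θ) (swap₃₄ u z v))))))

    rel-diag : ∀ Θ u → rel Θ u u ≡ (2 * a u ≤ᵇ Θ)
    rel-diag Θ u = bool-ext
      -- The instance t = `x₀` suffices: `a x₀` and `f u u x₀` are both the cost `f₀` and cancel.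
      (λ h → ≤ᵇ-true (cancel f₀ (rel-elim Θ u u h x₀) (e₁ (a u) f₀) (cong (_+ Θ) (diag u x₀))))
      (λ h → rel-intro Θ u u (λ t → ≤-trans (≤-reflexive (e₁ (a u) (a t)))
         (≤-trans (+-monoʳ-≤ (a t) (true-≤ᵇ (2 * a u) Θ h)) (≤-reflexive (cong (_+ Θ) (≡sym (diag u t)))))))
      where
      e₁ : ∀ x y → x + x + y ≡ y + 2 * x
      e₁ = solve-∀

    rel-adj : ∀ Θ u v → adj u v ≡ true → a u + a v + 2 ≤ Θ → rel Θ u v ≡ true
    rel-adj Θ u v h l = rel-intro Θ u v (λ t → cancel 2 (+-mono-≤ l (edge-f u v t h)) (e₁ (a u) (a v) (a t)) (e₂ Θ (f u v t)))
      where
      e₁ : ∀ x y z → x + y + 2 + z ≡ 2 + (x + y + z)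
      e₁ = solve-∀
      e₂ : ∀ x y → x + (y + 2) ≡ 2 + (y + x)
      e₂ = solve-∀

    -- Removing two edges of J saves 4, whereas the threshold estimates lose at most 3. The summand
    -- e absorbs a potential that occurs on both sides of such an estimate.
    contra : ∀ {p q G A e} → p + q ≤ G + A → A + f₀ + e ≤ p + q + e + 3 → G + 4 ≤ f₀ → ⊥
    contra {p} {q} {G} {A} {e} h₁ h₂ h₃ = 1+n≰n (cancel (p + q + G + A + f₀ + e + 3) (+-mono-≤ (+-mono-≤ h₁ h₂) h₃)
      (e₁ p q G A f₀ e) (e₂ p q G A f₀ e))
      where
      e₁ : ∀ p q G A f₀ e → p + q + (A + f₀ + e) + (G + 4) ≡ p + q + G + A + f₀ + e + 3 + 1
      e₁ = solve-∀
      e₂ : ∀ p q G A f₀ e → G + A + (p + q + e + 3) + f₀ ≡ p + q + G + A + f₀ + e + 3 + 0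
      e₂ = solve-∀

    -- Exchange the entry for u, v, c, d with the one for x₀, u along a trail from `x₀`; it ends at
    -- v, c or d. In each case the thresholds bound the two new entries from below by a u + f₀ - 3
    -- in total, while J without uv and cd bounds the same total from above by a u + f₀ - 4.
    crossing : ∀ Θ u v c d → J u v ≡ true → J c d ≡ true → rel Θ u c ≡ true →
      (Θ <ᵇ a u + a v + 2) ≡ true → (Θ <ᵇ a c + a d + 2) ≡ true → ¬ (u ≡ c × v ≡ d) → ¬ (u ≡ d × v ≡ c) → ⊥
    crossing Θ u v c d juv jcd uc o o′ ne ne′ with exchange (u , v , c , d) (x₀ , u , x₀ , x₀) x₀
    ... | w , odd , le with one-of-three v c d w (trans (odd₂ (eqB x₀ w) (eqB u w) (eqB v w) (eqB c w) (eqB d w)) odd)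
    ... | inj₁ refl = contra {f u c d} {F (u , v , x₀ , x₀)} {e = 0} (le (x₀ , u , c , d) (u , v , x₀ , x₀)
            (λ y → truthTable 5 (λ x p q r s → (x xor (p xor (r xor s)))) (λ x p q r s → ((p xor (q xor (r xor s))) xor (x xor q))) refl (eqB x₀ y) (eqB u y) (eqB v y) (eqB c y) (eqB d y))
            (λ y → truthTable 5 (λ x p q r s → (p xor (q xor (x xor x)))) (λ x p q r s → ((x xor (p xor (x xor x))) xor (x xor q))) refl (eqB x₀ y) (eqB u y) (eqB v y) (eqB c y) (eqB d y)))
          (≤-trans (≤-reflexive (+-identityʳ _)) (≤-trans (+-mono-≤ near (≤-trans (edge-f u v x₀ (J-adj u v juv)) (≤-reflexive (cong (_+ 2) (≡sym (pair u v))))))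
            (≤-reflexive (e₁ (f u c d) (F (u , v , x₀ , x₀))))))
          (J-two u v c d juv jcd ne ne′)
      where
      near : a u ≤ f u c d + 1
      near = cancel (a c + a d + Θ + 1) (+-mono-≤ (rel-elim Θ u c uc d) (true-<ᵇ Θ _ o′)) (e₂ (a u) (a c) (a d) Θ) (e₃ (f u c d) (a c) (a d) Θ)
        where
        e₂ : ∀ x y z t → x + y + z + suc t ≡ y + z + t + 1 + x
        e₂ = solve-∀
        e₃ : ∀ g y z t → g + t + (y + z + 2) ≡ y + z + t + 1 + (g + 1)
        e₃ = solve-∀
      e₁ : ∀ x y → x + 1 + (y + 2) ≡ x + y + 0 + 3
      e₁ = solve-∀
    ... | inj₂ (inj₁ refl) = contra {f u v d} {F (u , c , x₀ , x₀)} {e = a d} (le (x₀ , u , v , d) (u , c , x₀ , x₀)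
            (λ y → truthTable 5 (λ x p q r s → (x xor (p xor (q xor s)))) (λ x p q r s → ((p xor (q xor (r xor s))) xor (x xor r))) refl (eqB x₀ y) (eqB u y) (eqB v y) (eqB c y) (eqB d y))
            (λ y → truthTable 5 (λ x p q r s → (p xor (r xor (x xor x)))) (λ x p q r s → ((x xor (p xor (x xor x))) xor (x xor r))) refl (eqB x₀ y) (eqB u y) (eqB v y) (eqB c y) (eqB d y)))
          (cancel (Θ + 1 + a c) (+-mono-≤ (+-mono-≤ (edge-f u v d (J-adj u v juv)) (rel-elim Θ u c uc x₀)) (true-<ᵇ Θ _ o′))
            (e₁ (a d) (a u) (a c) f₀ Θ) (trans (cong (λ z → f u v d + 2 + (z + Θ) + (a c + a d + 2)) (≡sym (pair u c))) (e₂ (f u v d) (F (u , c , x₀ , x₀)) (a c) (a d) Θ)))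
          (J-two u v c d juv jcd ne ne′)
      where
      e₁ : ∀ ad au ac f₀ Θ → ad + (au + ac + f₀) + suc Θ ≡ Θ + 1 + ac + (au + f₀ + ad)
      e₁ = solve-∀
      e₂ : ∀ p q ac ad Θ → p + 2 + (q + Θ) + (ac + ad + 2) ≡ Θ + 1 + ac + (p + q + ad + 3)
      e₂ = solve-∀
    ... | inj₂ (inj₂ refl) = contra {f u v c} {F (u , d , x₀ , x₀)} {e = a c} (le (x₀ , u , v , c) (u , d , x₀ , x₀)
            (λ y → truthTable 5 (λ x p q r s → (x xor (p xor (q xor r)))) (λ x p q r s → ((p xor (q xor (r xor s))) xor (x xor s))) refl (eqB x₀ y) (eqB u y) (eqB v y) (eqB c y) (eqB d y))
            (λ y → truthTable 5 (λ x p q r s → (p xor (s xor (x xor x)))) (λ x p q r s → ((x xor (p xor (x xor x))) xor (x xor s))) refl (eqB x₀ y) (eqB u y) (eqB v y) (eqB c y) (eqB d y)))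
          (≤-trans (+-mono-≤ far near) (≤-reflexive (trans (cong (λ z → z + a c + 2 + (f u v c + 1)) (≡sym (pair u d))) (e₁ (F (u , d , x₀ , x₀)) (f u v c) (a c)))))
          (J-two u v c d juv jcd ne ne′)
      where
      near : a c ≤ f u v c + 1
      near = cancel (a u + a v + Θ + 1) (+-mono-≤ (≤-trans (rel-elim Θ u c uc v) (≤-reflexive (cong (_+ Θ) (swap₃₄ u c v)))) (true-<ᵇ Θ _ o))
        (e₂ (a u) (a c) (a v) Θ) (e₃ (f u v c) (a u) (a v) Θ)
        where
        e₂ : ∀ x y z t → x + y + z + suc t ≡ x + z + t + 1 + y
        e₂ = solve-∀
        e₃ : ∀ g x z t → g + t + (x + z + 2) ≡ x + z + t + 1 + (g + 1)
        e₃ = solve-∀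
      -- For the end d a further exchange is needed, of u, d, x₀ at c. Its outcomes are closed by
      -- the edge cd, or by the relation of u and c together with the threshold of cd.
      far : a u + f₀ ≤ f u d x₀ + a c + 2
      far with triple u d x₀ c
      ... | inj₁ e = cancel (f c d x₀) (+-mono-≤ e (edge-f c d x₀ (J-adj c d jcd))) (e₂ (f c d x₀) (a u) f₀) (e₃ (f u d x₀) (a c) (f c d x₀))
        where
        e₂ : ∀ g x h → g + x + h ≡ g + (x + h)
        e₂ = solve-∀
        e₃ : ∀ p q g → p + q + (g + 2) ≡ g + (p + q + 2)
        e₃ = solve-∀
      ... | inj₂ (inj₁ e) = ≤-trans (n≤1+n _) (cancel (f u c x₀ + a d + a c + Θ) (+-mono-≤ (+-mono-≤ e (rel-elim Θ u c uc x₀)) (true-<ᵇ Θ _ o′))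
            (e₂ (f u c x₀) (a d) (a u) (a c) f₀ Θ) (e₃ (f u d x₀) (f u c x₀) (a c) (a d) Θ))
        where
        e₂ : ∀ g ad au ac h t → g + ad + (au + ac + h) + suc t ≡ g + ad + ac + t + suc (au + h)
        e₂ = solve-∀
        e₃ : ∀ p g ac ad t → p + ac + (g + t) + (ac + ad + 2) ≡ g + ad + ac + t + (p + ac + 2)
        e₃ = solve-∀
      ... | inj₂ (inj₂ e) = ≤-trans (n≤1+n _) (cancel (f u d c + a c + a d + Θ) (+-mono-≤ (+-mono-≤ e (≤-trans (rel-elim Θ u c uc d) (≤-reflexive (cong (_+ Θ) (swap₃₄ u c d))))) (true-<ᵇ Θ _ o′))
            (e₂ (f u d c) f₀ (a u) (a c) (a d) Θ) (e₃ (f u d x₀) (f u d c) (a c) (a d) Θ))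
        where
        e₂ : ∀ g h au ac ad t → g + h + (au + ac + ad) + suc t ≡ g + ac + ad + t + suc (au + h)
        e₂ = solve-∀
        e₃ : ∀ p g ac ad t → p + ac + (g + t) + (ac + ad + 2) ≡ g + ac + ad + t + (p + ac + 2)
        e₃ = solve-∀
      e₁ : ∀ p q ac → p + ac + 2 + (q + 1) ≡ q + p + ac + 3
      e₁ = solve-∀

    unique : ∀ Θ u v u′ v′ → J u v ≡ true → J u′ v′ ≡ true → rel Θ u u′ ≡ true →
      (Θ <ᵇ a u + a v + 2) ≡ true → (Θ <ᵇ a u′ + a v′ + 2) ≡ true → u ≡ u′ × v ≡ v′
    unique Θ u v c d juv jcd uc o o′ with u FP.≟ c | v FP.≟ d | u FP.≟ d | v FP.≟ c
    ... | yes e | yes e′ | _ | _ = e , e′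
    -- The two darts of one edge: its ends would be related although the edge is `out`, and removing
    -- this single edge from J gives the contradiction.
    ... | _ | _ | yes refl | yes refl = ⊥-elim (1+n≰n (cancel (a u + a v + f₀ + f u v x₀ + Θ + 2)
        (+-mono-≤ (+-mono-≤ (J-one u v juv) (rel-elim Θ u v uc x₀)) (true-<ᵇ Θ _ o))
        (trans (cong (λ z → z + 2 + (a u + a v + f₀) + suc Θ) (pair u v)) (e₁ (f u v x₀) (a u) (a v) f₀ Θ)) (e₂ (f u v x₀) (a u) (a v) f₀ Θ)))
      where
      e₁ : ∀ g x y h t → g + 2 + (x + y + h) + suc t ≡ x + y + h + g + t + 2 + 1
      e₁ = solve-∀
      e₂ : ∀ g x y h t → h + (g + t) + (x + y + 2) ≡ x + y + h + g + t + 2 + 0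
      e₂ = solve-∀
    ... | no n | _ | no m | _ = ⊥-elim (crossing Θ u v c d juv jcd uc o o′ (n ∘ proj₁) (m ∘ proj₁))
    ... | no n | _ | _ | no m = ⊥-elim (crossing Θ u v c d juv jcd uc o o′ (n ∘ proj₁) (m ∘ proj₂))
    ... | _ | no n | no m | _ = ⊥-elim (crossing Θ u v c d juv jcd uc o o′ (n ∘ proj₂) (m ∘ proj₁))
    ... | _ | no n | _ | no m = ⊥-elim (crossing Θ u v c d juv jcd uc o o′ (n ∘ proj₂) (m ∘ proj₂))

    module D = Duality adj a a-step rel rel-sym rel-trans rel-diag rel-adj

    minimal : ∀ {K} → D.IsJoin J → D.IsJoin K → (∀ v → xsum (J v) ≡ xsum (K v)) → D.darts J ≤ D.darts K
    minimal jJ jK same-boundary = D.minimal jJ unique jK same-boundary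

-- Greedy trails.

module Trails where

  open import Data.Bool.Properties using (∧-identityʳ)
  open Formulas using (b2n; foldF; loopV)
  open Cuts
  open Exchanges

  infixr 5 _orB_

  _orB_ : Bool → Bool → Bool
  x orB y  = not (not x ∧ not y)

  orB-elim : ∀ {x y} → (x orB y) ≡ true → x ≡ true ⊎ y ≡ true
  orB-elim {true}         _ = inj₁ refl
  orB-elim {false} {true} _ = inj₂ refl

  orB-left : ∀ {x y} → x ≡ true → (x orB y) ≡ true
  orB-left refl = refl

  orB-right : ∀ {x y} → y ≡ true → (x orB y) ≡ true
  orB-right {true}  refl = refl
  orB-right {false} refl = refl

  orB-comm : ∀ x y → (x orB y) ≡ (y orB x)
  orB-comm x y = cong not (∧-comm (not x) (not y))

  sum-strict : ∀ {n} {f g : Fin n → ℕ} i → (∀ j → f j ≤ g j) → f i < g i → sum f < sum g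
  sum-strict zero    h l = +-mono-≤ l (sum-mono (h ∘ suc))
  sum-strict {f = f} {g} (suc i) h l = ≤-trans (≤-reflexive (≡sym (+-suc (f zero) _))) (+-mono-≤ (h zero) (sum-strict i (h ∘ suc) l))

  sum-zero-elim : ∀ {n} (f : Fin n → ℕ) → sum f ≡ 0 → ∀ i → f i ≡ 0
  sum-zero-elim f e i = n≤0⇒n≡0 (≤-trans (term≤sum f i) (≤-reflexive e))

  xsum-point : ∀ {n} (b : Fin n) → xsum (λ w → eqB b w) ≡ true
  xsum-point b = trans (≡sym (trans (odd-sum (λ w → b2n (eqB b w))) (xsum-cong (λ w → odd-b2n (eqB b w)))))
    (cong odd (sum-unique (eqB b) b (eqB-refl b) (λ j h → ≡sym (eqB-true b j h))))

  module _ {N : ℕ} where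

    Graph² : Set
    Graph² = Fin N → Fin N → Bool

    infix 4 _≗²_
    _≗²_ : Graph² → Graph² → Set
    A ≗² B = ∀ u w → A u w ≡ B u w

    edgeB : Fin N → Fin N → Graph²
    edgeB a b u w = (eqB a u ∧ eqB b w) orB (eqB a w ∧ eqB b u)

    edgeB-sym : ∀ a b u w → edgeB a b u w ≡ edgeB a b w u
    edgeB-sym a b u w = orB-comm (eqB a u ∧ eqB b w) (eqB a w ∧ eqB b u)

    edgeB-elim : ∀ a b u w → edgeB a b u w ≡ true → (a ≡ u × b ≡ w) ⊎ (a ≡ w × b ≡ u)
    edgeB-elim a b u w h with orB-elim {eqB a u ∧ eqB b w} h
    ... | inj₁ e with e₁ , e₂ ← ∧-true {eqB a u} e = inj₁ (eqB-true a u e₁ , eqB-true b w e₂)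
    ... | inj₂ e with e₁ , e₂ ← ∧-true {eqB a w} e = inj₂ (eqB-true a w e₁ , eqB-true b u e₂)

    edgeB-here : ∀ a b → edgeB a b a b ≡ true
    edgeB-here a b = orB-left (∧-intro (eqB-refl a) (eqB-refl b))

    edgeB-irr : ∀ {a b} → a ≢ b → ∀ u → edgeB a b u u ≡ false
    edgeB-irr {a} {b} h u = not-true (λ e → clash (edgeB-elim a b u u e))
      where
      clash : (a ≡ u × b ≡ u) ⊎ (a ≡ u × b ≡ u) → ⊥
      clash (inj₁ (refl , refl)) = h refl
      clash (inj₂ (refl , refl)) = h refl

    edgeB-xor : ∀ {a b} → a ≢ b → ∀ u w → edgeB a b u w ≡ (eqB a u ∧ eqB b w) xor (eqB b u ∧ eqB a w)
    edgeB-xor {a} {b} h u w = trans (lemma (eqB a u) (eqB b w) (eqB a w) (eqB b u) excl) refl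
      where
      excl : ¬ (eqB a u ≡ true × eqB b u ≡ true)
      excl (p , q) = h (trans (eqB-true a u p) (≡sym (eqB-true b u q)))
      lemma : ∀ p q r s → ¬ (p ≡ true × s ≡ true) → ((p ∧ q) orB (r ∧ s)) ≡ (p ∧ q) xor (s ∧ r)
      lemma true  q     r     true  n = ⊥-elim (n (refl , refl))
      lemma true  true  true  false n = refl
      lemma true  true  false false n = refl
      lemma true  false true  false n = refl
      lemma true  false false false n = refl
      lemma false q     true  true  n = refl
      lemma false q     true  false n = refl
      lemma false q     false true  n = refl
      lemma false q     false false n = refl

    edgeB-boundary : ∀ {a b} → a ≢ b → ∀ v → xsum (edgeB a b v) ≡ eqB a v xor eqB b v
    edgeB-boundary {a} {b} h v = begin
      xsum (edgeB a b v) ≡⟨ xsum-cong (edgeB-xor h v) ⟩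
      xsum (λ w → (eqB a v ∧ eqB b w) xor (eqB b v ∧ eqB a w)) ≡⟨ XS.∑-distrib-+ (λ w → eqB a v ∧ eqB b w) (λ w → eqB b v ∧ eqB a w) ⟩
      xsum (λ w → eqB a v ∧ eqB b w) xor xsum (λ w → eqB b v ∧ eqB a w) ≡⟨ cong₂ _xor_ (single a b) (single b a) ⟩
      eqB a v xor eqB b v ∎
      where
      open ≡-Reasoning
      single : ∀ a b → xsum (λ w → eqB a v ∧ eqB b w) ≡ eqB a v
      single a b = trans (xsum-∧ (eqB a v) (eqB b)) (trans (cong (eqB a v ∧_) (xsum-point b)) (∧-identityʳ _))

    -- A trail state stores the unused edges off the diagonal and the
    -- current end of the trail on the diagonal.

    nextOf : Graph² → Fin N → Bool
    nextOf R′ w = anyB (λ v → not (eqB v w) ∧ (R′ v v ∧ (R′ v w ∧ not (anyB (λ x → (toℕ x <ᵇ toℕ w) ∧ (not (eqB v x) ∧ R′ v x))))))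

    trailStep : Graph² → Graph²
    trailStep R′ u w =
      (eqB u w ∧ (nextOf R′ u orB (not (anyB (λ x → nextOf R′ x)) ∧ R′ u u)))
      orB (not (eqB u w) ∧ (R′ u w ∧ (not (R′ u u ∧ nextOf R′ w) ∧ not (R′ w w ∧ nextOf R′ u))))

    trailStart : Fin N → Graph² → Graph²
    trailStart z S₀ u w = (eqB u w ∧ eqB u z) orB (not (eqB u w) ∧ S₀ u w)

    -- There are at most `N ^ 2` darts and each round uses one up unless the trail is stuck, so two
    -- loop variables are enough.
    trail : Fin N → Graph² → Graph²
    trail z S₀ = loopV {N} 2 (λ _ → trailStep) (trailStart z S₀)

    anyB-cong : ∀ {f g : Fin N → Bool} → (∀ i → f i ≡ g i) → anyB f ≡ anyB g
    anyB-cong h = cong (sum {N} (λ _ → 0) <ᵇ_) (sum-cong-≗ (λ i → cong b2n (h i)))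

    nextOf-cong : ∀ {A B} → A ≗² B → ∀ w → nextOf A w ≡ nextOf B w
    nextOf-cong h w = anyB-cong (λ v → cong (not (eqB v w) ∧_) (cong₂ _∧_ (h v v) (cong₂ _∧_ (h v w)
      (cong not (anyB-cong (λ x → cong (λ b → (toℕ x <ᵇ toℕ w) ∧ (not (eqB v x) ∧ b)) (h v x)))))))

    trailStep-cong : ∀ {A B} → A ≗² B → trailStep A ≗² trailStep B
    trailStep-cong {A} {B} h u w = cong₂ _orB_
      (cong (eqB u w ∧_) (cong₂ _orB_ (nextOf-cong h u) (cong₂ _∧_ (cong not (anyB-cong (nextOf-cong h))) (h u u))))
      (cong (not (eqB u w) ∧_) (cong₂ _∧_ (h u w) (cong₂ _∧_
        (cong not (cong₂ _∧_ (h u u) (nextOf-cong h w))) (cong not (cong₂ _∧_ (h w w) (nextOf-cong h u))))))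

  foldF-rel : ∀ {A B : Set} (P : A → B → Set) {m} {f : Fin m → A → A} {g : Fin m → B → B} →
    (∀ i a b → P a b → P (f i a) (g i b)) → ∀ a b → P a b → P (foldF f a) (foldF g b)
  foldF-rel P {zero}  h a b p = p
  foldF-rel P {suc m} h a b p = foldF-rel P (h ∘ suc) _ _ (h zero a b p)

  loopV-rel : ∀ {A B : Set} (P : A → B → Set) {l} r {f : List (Fin l) → A → A} {g : List (Fin l) → B → B} →
    (∀ us a b → length us ≡ r → P a b → P (f us a) (g us b)) → ∀ a b → P a b → P (loopV r f a) (loopV r g b)
  loopV-rel P zero    h a b p = h [] a b refl p
  loopV-rel P (suc r) h a b p = foldF-rel P (λ i a b → loopV-rel P r (λ us a b e → h (i ∷ us) a b (cong suc e)) a b) a b p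

  foldF-count : ∀ {A : Set} (Q : ℕ → A → Set) m c {g : A → A} → (∀ n a → Q n a → Q (c + n) (g a)) →
    ∀ n a → Q n a → Q (m * c + n) (foldF {m = m} (λ _ → g) a)
  foldF-count Q zero    c h n a q = q
  foldF-count Q (suc m) c {g} h n a q = subst (λ k → Q k (foldF {m = m} (λ _ → g) (g a)))
    (trans (≡sym (+-assoc (m * c) c n)) (cong (_+ n) (+-comm (m * c) c)))
    (foldF-count Q m c h (c + n) (g a) (h n a q))

  loopV-count : ∀ {A : Set} (Q : ℕ → A → Set) {l} r {g : A → A} → (∀ n a → Q n a → Q (suc n) (g a)) →
    ∀ n a → Q n a → Q (l ^ r + n) (loopV {l} r (λ _ → g) a)
  loopV-count Q zero    h n a q = h n a q
  loopV-count Q {l} (suc r) h n a q = foldF-count Q l (l ^ r) (loopV-count Q r h) n a q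

  trail-cong : ∀ {N} (z : Fin N) {A B} → A ≗² B → trail z A ≗² trail z B
  trail-cong {N} z {A} {B} h = loopV-rel _≗²_ {N} 2 {λ _ → trailStep} {λ _ → trailStep} (λ _ a b _ → trailStep-cong) _ _
    (λ u w → cong (λ b → (eqB u w ∧ eqB u z) orB (not (eqB u w) ∧ b)) (h u w))

  module Trail {N : ℕ} (z : Fin N) (S₀ : Graph² {N}) (S₀-sym : ∀ u w → S₀ u w ≡ S₀ w u) (S₀-irr : ∀ u → S₀ u u ≡ false) where

    -- `rest` and `cur` are the contents decoded from the matrix. `boundary` expresses that the used
    -- edges form a trail from z to `cur` modulo two, and `progress` that the trail is stuck or has
    -- lost at least one dart in each of n rounds.
    record State (n : ℕ) (R′ : Graph² {N}) : Set where
      field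
        rest      : Graph² {N}
        cur       : Fin N
        r-sym     : ∀ u w → rest u w ≡ rest w u
        r-irr     : ∀ u → rest u u ≡ false
        r-sub     : ∀ u w → rest u w ≡ true → S₀ u w ≡ true
        r-diag    : ∀ u → R′ u u ≡ eqB u cur
        r-off     : ∀ u w → u ≢ w → R′ u w ≡ rest u w
        boundary  : ∀ v → xsum (λ w → S₀ v w xor rest v w) ≡ eqB z v xor eqB cur v
        progress  : (∀ w → rest cur w ≡ false) ⊎ (sum² (λ u w → b2n (rest u w)) + n ≤ sum² (λ u w → b2n (S₀ u w)))
    open State

    start-diag : ∀ u → trailStart z S₀ u u ≡ eqB u z
    start-diag u rewrite eqB-refl u = lemma (eqB u z)
      where
      lemma : ∀ b → (b orB false) ≡ b
      lemma true  = refl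
      lemma false = refl

    start-off : ∀ u w → u ≢ w → trailStart z S₀ u w ≡ S₀ u w
    start-off u w h rewrite eqB-false h = lemma (S₀ u w)
      where
      lemma : ∀ b → (false orB b) ≡ b
      lemma true  = refl
      lemma false = refl

    start : State 0 (trailStart z S₀)
    start = record
      { rest = S₀ ; cur = z ; r-sym = S₀-sym ; r-irr = S₀-irr ; r-sub = λ _ _ h → h
      ; r-diag = start-diag ; r-off = start-off
      ; boundary = λ v → trans (xsum-zero (λ w → xor-same (S₀ v w))) (≡sym (xor-same (eqB z v)))
      ; progress = inj₂ (≤-reflexive (+-identityʳ _)) }

    module _ {n R′} (s : State n R′) where

      next-true : ∀ w → nextOf R′ w ≡ true → rest s (cur s) w ≡ true × (∀ x → (toℕ x <ᵇ toℕ w) ≡ true → rest s (cur s) x ≡ false)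
      next-true w h with v , e ← anyB-elim (λ v → not (eqB v w) ∧ (R′ v v ∧ (R′ v w ∧ not (anyB (λ x → (toℕ x <ᵇ toℕ w) ∧ (not (eqB v x) ∧ R′ v x)))))) h
        with e₁ , e₂ ← ∧-true {not (eqB v w)} e
        with e₃ , e₄ ← ∧-true {R′ v v} e₂
        with e₅ , e₆ ← ∧-true {R′ v w} e₄
        with refl ← eqB-true v (cur s) (trans (≡sym (r-diag s v)) e₃) =
        trans (≡sym (r-off s v w v≢w)) e₅ , λ x l → not-true (λ r → clash e₆ (anyB-intro (λ x → (toℕ x <ᵇ toℕ w) ∧ (not (eqB v x) ∧ R′ v x)) x
          (∧-intro l (∧-intro (cong not (eqB-false (v≢ x r))) (trans (r-off s v x (v≢ x r)) r)))))
        where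
        clash : ∀ {b} → not b ≡ true → b ≡ true → ⊥
        clash {true} () _
        v≢w : v ≢ w
        v≢w refl = clash e₁ (eqB-refl v)
        v≢ : ∀ x → rest s v x ≡ true → v ≢ x
        v≢ x r refl = false≢true r (r-irr s v)

      next-intro : ∀ w → rest s (cur s) w ≡ true → (∀ x → (toℕ x <ᵇ toℕ w) ≡ true → rest s (cur s) x ≡ false) → nextOf R′ w ≡ true
      next-intro w h m = anyB-intro _ (cur s) (∧-intro (cong not (eqB-false c≢w)) (∧-intro (trans (r-diag s (cur s)) (eqB-refl (cur s)))
        (∧-intro (trans (r-off s (cur s) w c≢w) h) (cong not (not-true none)))))
        where
        c≢w : cur s ≢ w
        c≢w e = false≢true (subst (λ x → rest s (cur s) x ≡ true) (≡sym e) h) (r-irr s (cur s))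
        none : anyB (λ x → (toℕ x <ᵇ toℕ w) ∧ (not (eqB (cur s) x) ∧ R′ (cur s) x)) ≢ true
        none e with x , e′ ← anyB-elim (λ x → (toℕ x <ᵇ toℕ w) ∧ (not (eqB (cur s) x) ∧ R′ (cur s) x)) e
          with l , e″ ← ∧-true {toℕ x <ᵇ toℕ w} e′
          with ne , r ← ∧-true {not (eqB (cur s) x)} e″ = false≢true (trans (≡sym (r-off s (cur s) x c≢x)) r) (m x l)
          where
          c≢x : cur s ≢ x
          c≢x refl with () ← trans (≡sym ne) (cong not (eqB-refl (cur s)))

      diag-value : ∀ u → trailStep R′ u u ≡ (nextOf R′ u orB (not (anyB (λ x → nextOf R′ x)) ∧ R′ u u))
      diag-value u rewrite eqB-refl u = lemma (nextOf R′ u orB (not (anyB (λ x → nextOf R′ x)) ∧ R′ u u))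
        where
        lemma : ∀ b → (b orB false) ≡ b
        lemma true  = refl
        lemma false = refl

      off-value : ∀ u w → u ≢ w → trailStep R′ u w ≡ (R′ u w ∧ (not (R′ u u ∧ nextOf R′ w) ∧ not (R′ w w ∧ nextOf R′ u)))
      off-value u w h rewrite eqB-false h = lemma (R′ u w ∧ (not (R′ u u ∧ nextOf R′ w) ∧ not (R′ w w ∧ nextOf R′ u)))
        where
        lemma : ∀ b → (false orB b) ≡ b
        lemma true  = refl
        lemma false = refl

      advance : State (suc n) (trailStep R′)
      advance with anyB (rest s (cur s)) in e
      ... | false = record
        { rest = rest s ; cur = cur s ; r-sym = r-sym s ; r-irr = r-irr s ; r-sub = r-sub s
        ; r-diag = λ u → trans (diag-value u) (trans (cong₂ (λ b c → b orB (not c ∧ R′ u u)) (no-next u) no-any) (trans (lemma (R′ u u)) (r-diag s u)))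
        ; r-off = λ u w h → trans (off-value u w h) (trans (cong₂ (λ b c → R′ u w ∧ (not (R′ u u ∧ b) ∧ not (R′ w w ∧ c))) (no-next w) (no-next u))
                     (trans (lemma′ (R′ u w) (R′ u u) (R′ w w)) (r-off s u w h)))
        ; boundary = boundary s ; progress = inj₁ (anyB-none (rest s (cur s)) e) }
        where
        no-next : ∀ w → nextOf R′ w ≡ false
        no-next w = not-true (λ h → false≢true (proj₁ (next-true w h)) (anyB-none (rest s (cur s)) e w))
        no-any : anyB (λ x → nextOf R′ x) ≡ false
        no-any = not-true (λ h → let x , h′ = anyB-elim (λ x → nextOf R′ x) h in false≢true h′ (no-next x))
        lemma : ∀ b → (false orB (true ∧ b)) ≡ b
        lemma true  = refl
        lemma false = refl
        lemma′ : ∀ a b c → a ∧ (not (b ∧ false) ∧ not (c ∧ false)) ≡ a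
        lemma′ a b c rewrite ∧-zeroʳ b | ∧-zeroʳ c with a
        ... | true  = refl
        ... | false = refl
      ... | true with i , hi ← anyB-elim (rest s (cur s)) e
                 with w* , hw , hm ← least (rest s (cur s)) i hi = record
        { rest = rest′ ; cur = w*
        ; r-sym = λ u w → cong₂ (λ a b → a ∧ not b) (r-sym s u w) (edgeB-sym (cur s) w* u w)
        ; r-irr = λ u → cong (_∧ not (edgeB (cur s) w* u u)) (r-irr s u)
        ; r-sub = λ u w h → r-sub s u w (proj₁ (∧-true {rest s u w} h))
        ; r-diag = λ u → trans (diag-value u) (trans (cong₂ (λ b c → b orB (not c ∧ R′ u u)) (next-is u) some) (lemma (eqB u w*) {R′ u u}))
        ; r-off = λ u w h → trans (off-value u w h) (trans (cong₂ _∧_ (r-off s u w h)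
                    (trans (cong₂ (λ b c → not b ∧ not c) (cong₂ _∧_ (trans (r-diag s u) (eqB-sym u (cur s))) (trans (next-is w) (eqB-sym w w*)))
                                                          (cong₂ _∧_ (trans (r-diag s w) (eqB-sym w (cur s))) (trans (next-is u) (eqB-sym u w*))))
                           (≡sym (not-not _)))) refl)
        ; boundary = bd
        ; progress = prog (progress s) }
        where
        rest′ : Graph²
        rest′ u w = rest s u w ∧ not (edgeB (cur s) w* u w)
        c≢w* : cur s ≢ w*
        c≢w* e = false≢true (subst (λ x → rest s (cur s) x ≡ true) (≡sym e) hw) (r-irr s (cur s))
        not-not : ∀ b → not (not b) ≡ b
        not-not true  = refl
        not-not false = refl
        lemma : ∀ b {c} → (b orB (false ∧ c)) ≡ b
        lemma true  = refl
        lemma false = refl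
        next-is : ∀ w → nextOf R′ w ≡ eqB w w*
        next-is w = bool-ext fwd′ (λ h → subst (λ x → nextOf R′ x ≡ true) (≡sym (eqB-true w w* h)) (next-intro w* hw hm))
          where
          fwd′ : nextOf R′ w ≡ true → eqB w w* ≡ true
          fwd′ h with hr , hn ← next-true w h with <-cmp (toℕ w) (toℕ w*)
          ... | tri< l _ _ = false≢true hr (hm w (<ᵇ-intro l))
          ... | tri≈ _ q _ = trans (cong (eqB w) (≡sym (FP.toℕ-injective q))) (eqB-refl w)
          ... | tri> _ _ l = false≢true hw (hn w* (<ᵇ-intro l))
        some : anyB (λ x → nextOf R′ x) ≡ true
        some = anyB-intro _ w* (next-intro w* hw hm)
        on : ∀ v w → (cur s ≡ v × w* ≡ w) ⊎ (cur s ≡ w × w* ≡ v) → rest s v w ≡ true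
        on v w (inj₁ (refl , refl)) = hw
        on v w (inj₂ (refl , refl)) = trans (r-sym s v w) hw
        split : ∀ v w → S₀ v w xor rest′ v w ≡ (S₀ v w xor rest s v w) xor edgeB (cur s) w* v w
        split v w with edgeB (cur s) w* v w in ee
        ... | false = trans (cong (S₀ v w xor_) (∧-identityʳ (rest s v w))) (≡sym (xor-identityʳ _))
        ... | true rewrite on v w (edgeB-elim (cur s) w* v w ee) = lemma₂ (S₀ v w)
          where
          lemma₂ : ∀ b → b xor false ≡ (b xor true) xor true
          lemma₂ true  = refl
          lemma₂ false = refl
        bd : ∀ v → xsum (λ w → S₀ v w xor rest′ v w) ≡ eqB z v xor eqB w* v
        bd v = trans (xsum-cong (split v)) (trans (XS.∑-distrib-+ (λ w → S₀ v w xor rest s v w) (edgeB (cur s) w* v))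
          (trans (cong₂ _xor_ (boundary s v) (edgeB-boundary c≢w* v)) (lemma₃ (eqB z v) (eqB (cur s) v) (eqB w* v))))
          where
          lemma₃ : ∀ x y t → (x xor y) xor (y xor t) ≡ x xor t
          lemma₃ = truthTable 3 (λ x y t → (x xor y) xor (y xor t)) (λ x y t → x xor t) refl
        fewer : suc (sum² (λ u w → b2n (rest′ u w))) ≤ sum² (λ u w → b2n (rest s u w))
        fewer = sum-strict (cur s) (λ u → sum-mono (λ w → drop (rest s u w) (edgeB (cur s) w* u w)))
          (sum-strict w* (λ w → drop (rest s (cur s) w) (edgeB (cur s) w* (cur s) w))
            (subst₂ (λ a b → b2n (a ∧ not b) < b2n a) (≡sym hw) (≡sym (edgeB-here (cur s) w*)) ≤-refl))
          where
          drop : ∀ a b → b2n (a ∧ not b) ≤ b2n a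
          drop true  true  = z≤n
          drop true  false = ≤-refl
          drop false b     = z≤n
        prog : _ → (∀ w → rest′ w* w ≡ false) ⊎ (sum² (λ u w → b2n (rest′ u w)) + suc n ≤ sum² (λ u w → b2n (S₀ u w)))
        prog (inj₁ stuck) = false≢true hw (stuck w*)
        prog (inj₂ le)    = inj₂ (≤-trans (≤-reflexive (+-suc _ n)) (≤-trans (+-monoˡ-≤ n fewer) le))

    abstract
     finished : State (N ^ 2 + 0) (trail z S₀)
     finished = loopV-count State {N} 2 (λ n R′ s → advance s) 0 (trailStart z S₀) start

    bound : sum² (λ u w → b2n (S₀ u w)) ≤ N ^ 2
    bound = ≤-trans (sum²-mono (λ u w → b2n≤1 (S₀ u w))) (≤-reflexive (trans (sum-cong-≗ {N} (λ _ → ones N)) (trans (consts N N) (cong (N *_) (≡sym (*-identityʳ N))))))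
      where
      b2n≤1 : ∀ b → b2n b ≤ 1
      b2n≤1 true  = ≤-refl
      b2n≤1 false = z≤n
      consts : ∀ m c → sum {m} (λ _ → c) ≡ m * c
      consts zero    c = refl
      consts (suc m) c = cong (c +_) (consts m c)
      ones : ∀ m → sum {m} (λ _ → 1) ≡ m
      ones m = trans (consts m 1) (*-identityʳ m)

    -- If the trail has advanced in each of `N ^ 2` rounds, no dart remains, and it is stuck for
    -- this reason.
    stuck : ∀ w → rest finished (cur finished) w ≡ false
    stuck w with progress finished
    ... | inj₁ h = h w
    ... | inj₂ le = empty (rest finished (cur finished) w) (sum-zero-elim _ (sum-zero-elim _ none (cur finished)) w)
      where
      none : sum² (λ u w → b2n (rest finished u w)) ≡ 0
      none = n≤0⇒n≡0 (+-cancelʳ-≤ (N ^ 2 + 0) _ 0 (≤-trans le (≤-trans bound (≤-reflexive (≡sym (+-identityʳ (N ^ 2)))))))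
      empty : ∀ b → b2n b ≡ 0 → b ≡ false
      empty false _ = refl

-- Local search on a table of joins.

module LocalSearch where

  open import Data.Bool.Properties using (xor-assoc)
  open import Data.List using (drop)
  open Formulas using (b2n; loopV)
  open Compilation using (foldF-cong)
  open Cuts
  open Exchanges
  open Trails

  sum-bound : ∀ {n} (f : Fin n → ℕ) c → (∀ i → f i ≤ c) → sum f ≤ n * c
  sum-bound {zero}  f c h = z≤n
  sum-bound {suc n} f c h = +-mono-≤ (h zero) (sum-bound (f ∘ suc) c (h ∘ suc))

  sum-const : ∀ m c → sum {m} (λ _ → c) ≡ m * c
  sum-const zero    c = refl
  sum-const (suc m) c = cong (c +_) (sum-const m c)

  sum-point : ∀ {n} (a : Fin n) (h : Fin n → ℕ) → sum (λ u → b2n (eqB a u) * h u) ≡ h a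
  sum-point a h = trans (sum-cong-≗ only) (trans (sum-* (h a) (λ u → b2n (eqB a u)))
    (trans (cong (h a *_) (sum-unique (eqB a) a (eqB-refl a) (λ j e → ≡sym (eqB-true a j e)))) (*-identityʳ (h a))))
    where
    only : ∀ u → b2n (eqB a u) * h u ≡ h a * b2n (eqB a u)
    only u with eqB a u in e
    ... | true rewrite eqB-true a u e = *-comm 1 (h u)
    ... | false = ≡sym (*-zeroʳ (h a))

  sum²-point : ∀ {n} (a b : Fin n) (g : Fin n → Fin n → ℕ) → sum² (λ u w → b2n (eqB a u ∧ eqB b w) * g u w) ≡ g a b
  sum²-point a b g = trans (sum-cong-≗ (λ u → trans (sum-cong-≗ (λ w → trans (cong (_* g u w) (b2n-∧ (eqB a u) (eqB b w))) (*-assoc (b2n (eqB a u)) _ _)))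
    (trans (sum-* (b2n (eqB a u)) (λ w → b2n (eqB b w) * g u w)) (cong (b2n (eqB a u) *_) (sum-point b (g u)))))) (sum-point a (λ u → g u b))

  loopV-drop : ∀ {A : Set} {l} r s (f : List (Fin l) → A → A) a → loopV (r + s) (λ us → f (drop r us)) a ≡ loopV {l} r (λ _ → loopV s f) a
  loopV-drop zero    s f a = refl
  loopV-drop {l = l} (suc r) s f a = foldF-cong {m = l} {f = λ i → loopV (r + s) (λ us → f (drop r us))} {g = λ i → loopV {l} r (λ _ → loopV s f)} (λ i b → loopV-drop r s f b) a

  b2n-xor-sub : ∀ a q → (q ≡ true → a ≡ true) → b2n (a xor q) + b2n q ≡ b2n a
  b2n-xor-sub true  true  h = refl
  b2n-xor-sub true  false h = refl
  b2n-xor-sub false false h = refl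
  b2n-xor-sub false true  h with () ← h refl

  b2n-xor-≤ : ∀ a q → b2n (a xor q) ≤ b2n a + b2n q
  b2n-xor-≤ true  true  = z≤n
  b2n-xor-≤ true  false = ≤-refl
  b2n-xor-≤ false q     = ≤-refl

  -- Adding P to both sets moves the elements of P, each of which lies in exactly one of them, to
  -- the other set; the total is kept.
  b2n-xor-exchange : ∀ a b p → (p ≡ true → a xor b ≡ true) → b2n (a xor p) + b2n (b xor p) ≡ b2n a + b2n b
  b2n-xor-exchange true  true  true  h with () ← h refl
  b2n-xor-exchange false false true  h with () ← h refl
  b2n-xor-exchange true  false true  h = refl
  b2n-xor-exchange false true  true  h = refl
  b2n-xor-exchange true  true  false h = refl
  b2n-xor-exchange true  false false h = refl
  b2n-xor-exchange false true  false h = refl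
  b2n-xor-exchange false false false h = refl

  slotEq : ∀ {N} → Slot N → Slot N → Bool
  slotEq (p , q , r , s) (p′ , q′ , r′ , s′) = eqB p p′ ∧ (eqB q q′ ∧ (eqB r r′ ∧ eqB s s′))

  slotEq-true : ∀ {N} (A B : Slot N) → slotEq A B ≡ true → A ≡ B
  slotEq-true (p , q , r , s) (p′ , q′ , r′ , s′) h with h₁ , h′ ← ∧-true {eqB p p′} h with h₂ , h″ ← ∧-true {eqB q q′} h′ with h₃ , h₄ ← ∧-true {eqB r r′} h″
    with refl ← eqB-true p p′ h₁ | refl ← eqB-true q q′ h₂ | refl ← eqB-true r r′ h₃ | refl ← eqB-true s s′ h₄ = refl

  slotEq-refl : ∀ {N} (A : Slot N) → slotEq A A ≡ true
  slotEq-refl (p , q , r , s) = ∧-intro (eqB-refl p) (∧-intro (eqB-refl q) (∧-intro (eqB-refl r) (eqB-refl s)))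

  -- One kind of move serves all purposes: `base` is changed by the trail from z in the sum of
  -- `left` and `right` and by two toggled edges, and the result competes with the entry at
  -- `target`. The 16 + 1 + 4 vertices are the 21 variables of a sweep.
  record Choice (N : ℕ) : Set where
    constructor choice
    field
      target left right base : Slot N
      z y₁ y₂ y₃ y₄          : Fin N

  module Algorithm {N : ℕ} (adj : Graph² {N}) (x₀ : Fin N) where

    Table : Set
    Table = Slot N → Graph² {N}

    apex : Fin N → Graph²
    apex p u w = not (eqB p x₀) ∧ edgeB p x₀ u w

    -- The edge set itself has boundary T, and each slot vertex other than `x₀` is added to the
    -- boundary by its apex edge.
    table₀ : Table
    table₀ (p , q , r , s) u w = adj u w xor (apex p u w xor (apex q u w xor (apex r u w xor apex s u w)))

    -- All N values of c count at an apex dart and only c = `x₀` at any other dart. A weight thereby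
    -- becomes a number of triples, which the logic can compare.
    wt : Fin N → Fin N → Fin N → Bool
    wt u w c = eqB c x₀ orB eqB u x₀ orB eqB w x₀

    cost : Graph² {N} → ℕ
    cost A = sum (λ u → sum (λ w → sum (λ c → b2n (A u w ∧ wt u w c))))

    toggle : Fin N → Fin N → Graph²
    toggle y y′ u w = adj u w ∧ edgeB y y′ u w

    -- A pair of equal vertices toggles nothing and serves as the idle move.
    ok : Fin N → Fin N → Bool
    ok y y′ = adj y y′ orB eqB y y′

    module _ (c : Choice N) (τ : Table) where
      open Choice c

      diff : Graph²
      diff u w = τ left u w xor τ right u w

      route : Graph²
      route = trail z diff

    module _ (c : Choice N) (τ : Table) (path : Graph² {N}) where
      open Choice c

      -- Off the diagonal the trail is what `path` no longer contains of the difference. The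
      -- diagonal of `path` holds the end of the trail and has to be masked.
      candWith : Graph²
      candWith u w = τ base u w xor ((not (eqB u w) ∧ (diff c τ u w ∧ not (path u w))) xor (toggle y₁ y₂ u w xor toggle y₃ y₄ u w))

      checkWith : Bool
      checkWith = not (anyB (λ v → par target v xor (par base v xor (eqB z v xor (path v v xor (eqB y₁ v xor (eqB y₂ v xor (eqB y₃ v xor eqB y₄ v))))))))
                  ∧ (ok y₁ y₂ ∧ ok y₃ y₄)

      improvesWith : Bool
      improvesWith = checkWith ∧ (cost candWith <ᵇ cost (τ target))

      stepWith : Table
      stepWith A u w = ((slotEq target A ∧ improvesWith) ∧ candWith u w) orB (not (slotEq target A ∧ improvesWith) ∧ τ A u w)

    module _ (c : Choice N) (τ : Table) where

      cand : Graph²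
      cand = candWith c τ (route c τ)

      check improves : Bool
      check    = checkWith c τ (route c τ)
      improves = improvesWith c τ (route c τ)

      stepT : Table
      stepT = stepWith c τ (route c τ)

    choiceOf : List (Fin N) → Choice N
    choiceOf (a₁ ∷ a₂ ∷ a₃ ∷ a₄ ∷ b₁ ∷ b₂ ∷ b₃ ∷ b₄ ∷ c₁ ∷ c₂ ∷ c₃ ∷ c₄ ∷ d₁ ∷ d₂ ∷ d₃ ∷ d₄ ∷ z ∷ y₁ ∷ y₂ ∷ y₃ ∷ y₄ ∷ []) =
      choice (a₁ , a₂ , a₃ , a₄) (b₁ , b₂ , b₃ , b₄) (c₁ , c₂ , c₃ , c₄) (d₁ , d₂ , d₃ , d₄) z y₁ y₂ y₃ y₄
    -- A default for lists that do not have 21 entries.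
    choiceOf _ = choice o o o o x₀ x₀ x₀ x₀ x₀
      where
      o : Slot N
      o = x₀ , x₀ , x₀ , x₀

    -- The first r variables only repeat the sweep over the s variables that describe a choice.
    search : ℕ → ℕ → Table
    search r s = loopV (r + s) (λ us → stepT (choiceOf (drop r us))) table₀

    infix 4 _≗ᵀ_
    _≗ᵀ_ : Table → Table → Set
    τ ≗ᵀ τ′ = ∀ A → τ A ≗² τ′ A

    cost-cong : ∀ {A B} → A ≗² B → cost A ≡ cost B
    cost-cong h = sum-cong-≗ (λ u → sum-cong-≗ (λ w → sum-cong-≗ (λ c → cong (λ b → b2n (b ∧ wt u w c)) (h u w))))

    module _ (c : Choice N) {τ τ′ : Table} (h : τ ≗ᵀ τ′) where
      open Choice c

      diff-cong : diff c τ ≗² diff c τ′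
      diff-cong u w = cong₂ _xor_ (h left u w) (h right u w)

      route-cong : route c τ ≗² route c τ′
      route-cong = trail-cong z diff-cong

      module _ {path path′ : Graph² {N}} (p : path ≗² path′) where

        cand-cong : candWith c τ path ≗² candWith c τ′ path′
        cand-cong u w = cong₂ (λ a b → a xor (b xor (toggle y₁ y₂ u w xor toggle y₃ y₄ u w))) (h base u w)
          (cong₂ (λ a b → not (eqB u w) ∧ (a ∧ not b)) (diff-cong u w) (p u w))

        check-cong : checkWith c τ path ≡ checkWith c τ′ path′
        check-cong = cong (λ b → not b ∧ (ok y₁ y₂ ∧ ok y₃ y₄)) (anyB-cong (λ v →
          cong (λ b → par target v xor (par base v xor (eqB z v xor (b xor (eqB y₁ v xor (eqB y₂ v xor (eqB y₃ v xor eqB y₄ v))))))) (p v v)))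

        improvesWith-cong : improvesWith c τ path ≡ improvesWith c τ′ path′
        improvesWith-cong = cong₂ _∧_ check-cong (cong₂ _<ᵇ_ (cost-cong cand-cong) (cost-cong (h target)))

        stepWith-cong : stepWith c τ path ≗ᵀ stepWith c τ′ path′
        stepWith-cong A u w = cong₂ _orB_ (cong₂ (λ a b → (slotEq target A ∧ a) ∧ b) improvesWith-cong (cand-cong u w))
                                          (cong₂ (λ a b → not (slotEq target A ∧ a) ∧ b) improvesWith-cong (h A u w))

      stepT-cong : stepT c τ ≗ᵀ stepT c τ′
      stepT-cong = stepWith-cong route-cong

      improves-cong : improves c τ ≡ improves c τ′
      improves-cong = improvesWith-cong route-cong

    module Correct (adj-sym : ∀ u v → adj u v ≡ adj v u) (adj-irr : ∀ u → adj u u ≡ false) (x₀-isolated : ∀ v → adj x₀ v ≡ false)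
      (few : sum² (λ u v → b2n (adj u v)) < N) (2≤N : 2 ≤ N) where

      W : Fin N → Fin N → ℕ
      W u w = sum (λ c → b2n (wt u w c))

      cost-W : ∀ A → cost A ≡ sum² (λ u w → b2n (A u w) * W u w)
      cost-W A = sum²-cong (λ u w → trans (sum-cong-≗ (λ c → b2n-∧ (A u w) (wt u w c))) (sum-* (b2n (A u w)) (λ c → b2n (wt u w c))))

      adj-x₀ : ∀ {u v} → adj u v ≡ true → u ≢ x₀ × v ≢ x₀
      adj-x₀ {u} {v} h = (λ { refl → false≢true h (x₀-isolated v) }) , (λ { refl → false≢true (trans (adj-sym x₀ u) h) (x₀-isolated u) })

      W-adj : ∀ {u v} → adj u v ≡ true → W u v ≡ 1
      W-adj {u} {v} h = trans (sum-cong-≗ (λ c → cong b2n (plain c))) (sum-unique (λ c → eqB c x₀) x₀ (eqB-refl x₀) (λ j → eqB-true j x₀))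
        where
        plain : ∀ c → wt u v c ≡ eqB c x₀
        plain c rewrite eqB-false (proj₁ (adj-x₀ h)) | eqB-false (proj₂ (adj-x₀ h)) with eqB c x₀
        ... | true  = refl
        ... | false = refl

      W-apex : ∀ {u v} → u ≡ x₀ ⊎ v ≡ x₀ → W u v ≡ N
      W-apex {u} {v} h = trans (sum-cong-≗ (λ c → cong b2n (all c h))) (trans (sum-const N 1) (*-identityʳ N))
        where
        all : ∀ c → u ≡ x₀ ⊎ v ≡ x₀ → wt u v c ≡ true
        all c (inj₁ refl) = orB-right {eqB c x₀} (orB-left (eqB-refl x₀))
        all c (inj₂ refl) = orB-right {eqB c x₀} (orB-right {eqB u x₀} (eqB-refl x₀))

      cost-sub : ∀ (A Q : Graph²) → (∀ u w → Q u w ≡ true → A u w ≡ true) → cost (λ u w → A u w xor Q u w) + cost Q ≡ cost A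
      cost-sub A Q h = trans (cong₂ _+_ (cost-W (λ u w → A u w xor Q u w)) (cost-W Q)) (trans (≡sym (sum²-+ (λ u w → b2n (A u w xor Q u w) * W u w) (λ u w → b2n (Q u w) * W u w)))
        (trans (sum²-cong (λ u w → trans (≡sym (*-distribʳ-+ (W u w) (b2n (A u w xor Q u w)) (b2n (Q u w)))) (cong (_* W u w) (b2n-xor-sub (A u w) (Q u w) (h u w))))) (≡sym (cost-W A))))

      cost-xor : ∀ (A Q : Graph²) → cost (λ u w → A u w xor Q u w) ≤ cost A + cost Q
      cost-xor A Q = ≤-trans (≤-reflexive (cost-W (λ u w → A u w xor Q u w))) (≤-trans (sum²-mono {f = λ u w → b2n (A u w xor Q u w) * W u w} {g = λ u w → b2n (A u w) * W u w + b2n (Q u w) * W u w} (λ u w → ≤-trans (*-monoˡ-≤ (W u w) (b2n-xor-≤ (A u w) (Q u w)))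
        (≤-reflexive (*-distribʳ-+ (W u w) (b2n (A u w)) (b2n (Q u w)))))) (≤-reflexive (trans (sum²-+ (λ u w → b2n (A u w) * W u w) (λ u w → b2n (Q u w) * W u w)) (≡sym (cong₂ _+_ (cost-W A) (cost-W Q))))))

      cost-exchange : ∀ (A B P : Graph²) → (∀ u w → P u w ≡ true → A u w xor B u w ≡ true) →
        cost (λ u w → A u w xor P u w) + cost (λ u w → B u w xor P u w) ≡ cost A + cost B
      cost-exchange A B P h = trans (cong₂ _+_ (cost-W (λ u w → A u w xor P u w)) (cost-W (λ u w → B u w xor P u w)))
        (trans (≡sym (sum²-+ (λ u w → b2n (A u w xor P u w) * W u w) (λ u w → b2n (B u w xor P u w) * W u w)))
        (trans (sum²-cong (λ u w → trans (≡sym (*-distribʳ-+ (W u w) (b2n (A u w xor P u w)) (b2n (B u w xor P u w)))) (trans (cong (_* W u w) (b2n-xor-exchange (A u w) (B u w) (P u w) (h u w))) (*-distribʳ-+ (W u w) (b2n (A u w)) (b2n (B u w))))))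
        (trans (sum²-+ (λ u w → b2n (A u w) * W u w) (λ u w → b2n (B u w) * W u w)) (≡sym (cong₂ _+_ (cost-W A) (cost-W B))))))

      cost-edge : ∀ {a b} → adj a b ≡ true → cost (edgeB a b) ≡ 2
      cost-edge {a} {b} h = trans (cost-W (edgeB a b)) (trans (sum²-cong split) (trans (sum²-+ (λ u w → b2n (eqB a u ∧ eqB b w) * W u w) (λ u w → b2n (eqB b u ∧ eqB a w) * W u w))
        (cong₂ _+_ (trans (sum²-point a b W) (W-adj h)) (trans (sum²-point b a W) (W-adj (trans (adj-sym b a) h))))))
        where
        a≢b : a ≢ b
        a≢b refl = false≢true h (adj-irr a)
        xor-+ : ∀ p q → ¬ (p ≡ true × q ≡ true) → b2n (p xor q) ≡ b2n p + b2n q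
        xor-+ true  true  n = ⊥-elim (n (refl , refl))
        xor-+ true  false n = refl
        xor-+ false q     n = refl
        split : ∀ u w → b2n (edgeB a b u w) * W u w ≡ b2n (eqB a u ∧ eqB b w) * W u w + b2n (eqB b u ∧ eqB a w) * W u w
        split u w = trans (cong (_* W u w) (trans (cong b2n (edgeB-xor a≢b u w)) (xor-+ _ _ (λ (p , q) →
          a≢b (trans (eqB-true a u (proj₁ (∧-true {eqB a u} p))) (≡sym (eqB-true b u (proj₁ (∧-true {eqB b u} q)))))))))
          (*-distribʳ-+ (W u w) (b2n (eqB a u ∧ eqB b w)) _)

      record Valid (X : Slot N) (A : Graph²) : Set where
        field
          v-sym  : ∀ u w → A u w ≡ A w u
          v-irr  : ∀ u → A u u ≡ false
          v-supp : ∀ u w → A u w ≡ true → adj u w ≡ true ⊎ (u ≡ x₀ ⊎ w ≡ x₀)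
          v-bd   : ∀ v → xsum (A v) ≡ xsum (adj v) xor par X v
      open Valid

      valid-cong : ∀ {X A B} → A ≗² B → Valid X A → Valid X B
      valid-cong h V = record
        { v-sym = λ u w → trans (≡sym (h u w)) (trans (v-sym V u w) (h w u)) ; v-irr = λ u → trans (≡sym (h u u)) (v-irr V u)
        ; v-supp = λ u w e → v-supp V u w (trans (h u w) e) ; v-bd = λ v → trans (xsum-cong (λ w → ≡sym (h v w))) (v-bd V v) }

      toggle-adj : ∀ {y y′} → adj y y′ ≡ true → toggle y y′ ≗² edgeB y y′
      toggle-adj {y} {y′} h u w = bool-ext (λ e → proj₂ (∧-true {adj u w} e)) (λ e → ∧-intro (on (edgeB-elim y y′ u w e)) e)
        where
        on : (y ≡ u × y′ ≡ w) ⊎ (y ≡ w × y′ ≡ u) → adj u w ≡ true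
        on (inj₁ (refl , refl)) = h
        on (inj₂ (refl , refl)) = trans (adj-sym u w) h

      toggle-loop : ∀ y u w → toggle y y u w ≡ false
      toggle-loop y u w = not-true (λ e → let p , q = ∧-true {adj u w} e in bad p (edgeB-elim y y u w q))
        where
        bad : adj u w ≡ true → (y ≡ u × y ≡ w) ⊎ (y ≡ w × y ≡ u) → ⊥
        bad p (inj₁ (refl , refl)) = false≢true p (adj-irr y)
        bad p (inj₂ (refl , refl)) = false≢true p (adj-irr y)

      toggle-sym : ∀ y y′ u w → toggle y y′ u w ≡ toggle y y′ w u
      toggle-sym y y′ u w = cong₂ _∧_ (adj-sym u w) (edgeB-sym y y′ u w)

      toggle-boundary : ∀ y y′ → ok y y′ ≡ true → ∀ v → xsum (toggle y y′ v) ≡ eqB y v xor eqB y′ v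
      toggle-boundary y y′ h v with orB-elim {adj y y′} h
      ... | inj₁ a = trans (xsum-cong (toggle-adj a v)) (edgeB-boundary (λ { refl → false≢true a (adj-irr y) }) v)
      ... | inj₂ e rewrite eqB-true y y′ e = trans (xsum-zero (toggle-loop y′ v)) (≡sym (xor-same (eqB y′ v)))

      module Route (left right : Slot N) (z : Fin N) (τ : Table) (V : ∀ X → Valid X (τ X)) where

        delta : Graph²
        delta u w = τ left u w xor τ right u w

        diff-sym : ∀ u w → delta u w ≡ delta w u
        diff-sym u w = cong₂ _xor_ (v-sym (V left) u w) (v-sym (V right) u w)

        diff-irr : ∀ u → delta u u ≡ false
        diff-irr u = cong₂ _xor_ (v-irr (V left) u) (v-irr (V right) u)

        module Tr = Trail z delta diff-sym diff-irr
        open Tr.State Tr.finished public using (rest; cur; r-sym; r-irr; r-sub; r-diag; r-off; boundary)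

        used : Graph²
        used u w = delta u w xor rest u w

        used-eq : ∀ u w → (not (eqB u w) ∧ (delta u w ∧ not (trail z delta u w))) ≡ used u w
        used-eq u w with u FP.≟ w
        ... | yes refl rewrite eqB-refl u | diff-irr u | r-irr u = refl
        ... | no h rewrite eqB-false h | r-off u w h = lemma (delta u w) (rest u w) (r-sub u w)
          where
          lemma : ∀ d r → (r ≡ true → d ≡ true) → d ∧ not r ≡ d xor r
          lemma true  r     h = refl
          lemma false true  h with () ← h refl
          lemma false false h = refl

        used-true : ∀ u w → used u w ≡ true → delta u w ≡ true
        used-true u w h with delta u w | rest u w | r-sub u w
        ... | true  | _    | _ = refl
        ... | false | true | s = s refl

      module Cand (c : Choice N) (τ : Table) (V : ∀ X → Valid X (τ X)) where
        open Choice c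
        open Route left right z τ V

        cand-xor : ∀ u w → cand c τ u w ≡ τ base u w xor (used u w xor (toggle y₁ y₂ u w xor toggle y₃ y₄ u w))
        cand-xor u w = cong (λ b → τ base u w xor (b xor (toggle y₁ y₂ u w xor toggle y₃ y₄ u w))) (used-eq u w)

        terms : Fin N → Bool
        terms v = par target v xor (par base v xor (eqB z v xor (eqB cur v xor (eqB y₁ v xor (eqB y₂ v xor (eqB y₃ v xor eqB y₄ v))))))

        termsB : Fin N → Bool
        termsB v = par target v xor (par base v xor (eqB z v xor (route c τ v v xor (eqB y₁ v xor (eqB y₂ v xor (eqB y₃ v xor eqB y₄ v))))))

        terms-eq : ∀ v → termsB v ≡ terms v
        terms-eq v = cong (λ b → par target v xor (par base v xor (eqB z v xor (b xor (eqB y₁ v xor (eqB y₂ v xor (eqB y₃ v xor eqB y₄ v)))))))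
          (trans (r-diag v) (eqB-sym v cur))

        -- Boundaries add modulo two, and the test made by `checkWith` is that the sum of those of
        -- `base`, trail and toggles is the one required at `target`.
        cand-valid : check c τ ≡ true → Valid target (cand c τ)
        cand-valid h with h₁ , h₂ ← ∧-true {not (anyB termsB)} h with o₁ , o₂ ← ∧-true {ok y₁ y₂} h₂ =
          valid-cong (λ u w → ≡sym (cand-xor u w)) (record
          { v-sym = λ u w → cong₂ _xor_ (v-sym (V base) u w) (cong₂ _xor_ (cong₂ _xor_ (diff-sym u w) (r-sym u w)) (cong₂ _xor_ (toggle-sym y₁ y₂ u w) (toggle-sym y₃ y₄ u w)))
          ; v-irr = λ u → cong₂ _xor_ (v-irr (V base) u) (cong₂ _xor_ (cong₂ _xor_ (diff-irr u) (r-irr u))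
                      (cong₂ _xor_ (cong (_∧ edgeB y₁ y₂ u u) (adj-irr u)) (cong (_∧ edgeB y₃ y₄ u u) (adj-irr u))))
          ; v-supp = supp
          ; v-bd = λ v → trans (XS.∑-distrib-+ (τ base v) _) (trans (cong₂ _xor_ (v-bd (V base) v) (trans (XS.∑-distrib-+ (used v) _)
                     (cong₂ _xor_ (boundary v) (trans (XS.∑-distrib-+ (toggle y₁ y₂ v) (toggle y₃ y₄ v)) (cong₂ _xor_ (toggle-boundary y₁ y₂ o₁ v) (toggle-boundary y₃ y₄ o₂ v))))))
                     (trans (rearrange (xsum (adj v)) (par target v) (par base v) (eqB z v) (eqB cur v) (eqB y₁ v) (eqB y₂ v) (eqB y₃ v) (eqB y₄ v))
                       (trans (cong ((xsum (adj v) xor par target v) xor_) (trans (≡sym (terms-eq v)) (anyB-none termsB (flip-not h₁) v))) (xor-identityʳ _)))) })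
          where
          flip-not : ∀ {b} → not b ≡ true → b ≡ false
          flip-not {false} _ = refl
          rearrange : ∀ a t b z r y₁ y₂ y₃ y₄ → (a xor b) xor ((z xor r) xor ((y₁ xor y₂) xor (y₃ xor y₄))) ≡
            (a xor t) xor (t xor (b xor (z xor (r xor (y₁ xor (y₂ xor (y₃ xor y₄)))))))
          rearrange = truthTable 9 (λ a t b z r y₁ y₂ y₃ y₄ → (a xor b) xor ((z xor r) xor ((y₁ xor y₂) xor (y₃ xor y₄)))) (λ a t b z r y₁ y₂ y₃ y₄ → (a xor t) xor (t xor (b xor (z xor (r xor (y₁ xor (y₂ xor (y₃ xor y₄)))))))) refl
          one-true : ∀ a b c d → a xor (b xor (c xor d)) ≡ true → a ≡ true ⊎ (b ≡ true ⊎ (c ≡ true ⊎ d ≡ true))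
          one-true true  b     c     d    h = inj₁ refl
          one-true false true  c     d    h = inj₂ (inj₁ refl)
          one-true false false true  d    h = inj₂ (inj₂ (inj₁ refl))
          one-true false false false true h = inj₂ (inj₂ (inj₂ refl))
          xor-true : ∀ a b → a xor b ≡ true → a ≡ true ⊎ b ≡ true
          xor-true true  b    h = inj₁ refl
          xor-true false true h = inj₂ refl
          supp : ∀ u w → τ base u w xor (used u w xor (toggle y₁ y₂ u w xor toggle y₃ y₄ u w)) ≡ true → adj u w ≡ true ⊎ (u ≡ x₀ ⊎ w ≡ x₀)
          supp u w e with one-true (τ base u w) (used u w) (toggle y₁ y₂ u w) _ e
          ... | inj₁ p = v-supp (V base) u w p
          ... | inj₂ (inj₂ (inj₁ p)) = inj₁ (proj₁ (∧-true {adj u w} p))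
          ... | inj₂ (inj₂ (inj₂ p)) = inj₁ (proj₁ (∧-true {adj u w} p))
          ... | inj₂ (inj₁ p) with xor-true (τ left u w) (τ right u w) (used-true u w p)
          ... | inj₁ q = v-supp (V left) u w q
          ... | inj₂ q = v-supp (V right) u w q

        check-intro : (∀ v → terms v ≡ false) → ok y₁ y₂ ≡ true → ok y₃ y₄ ≡ true → check c τ ≡ true
        check-intro h o₁ o₂ = ∧-intro (cong not (not-true none)) (∧-intro o₁ o₂)
          where
          none : anyB termsB ≢ true
          none e with v , e′ ← anyB-elim termsB e = false≢true e′ (trans (terms-eq v) (h v))

      ∅ : Slot N
      ∅ = x₀ , x₀ , x₀ , x₀

      m₀ : ℕ
      m₀ = sum² (λ u v → b2n (adj u v))

      cost-darts : ∀ A → (∀ u w → A u w ≡ true → adj u w ≡ true) → cost A ≡ sum² (λ u w → b2n (A u w))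
      cost-darts A h = trans (cost-W A) (sum²-cong each)
        where
        each : ∀ u w → b2n (A u w) * W u w ≡ b2n (A u w)
        each u w with A u w in e
        ... | false = refl
        ... | true  = trans (*-identityˡ (W u w)) (W-adj (h u w e))

      -- A single apex dart costs N, which exceeds the number of all darts of the graph.
      no-apex : ∀ {X A} → Valid X A → cost A ≤ m₀ → ∀ u w → A u w ≡ true → adj u w ≡ true
      no-apex {X} {A} V le u w e with v-supp V u w e
      ... | inj₁ h = h
      ... | inj₂ h = ⊥-elim (<⇒≱ few (≤-trans (≤-trans (≤-reflexive (≡sym (trans (cong (λ b → b2n b * W u w) e) (trans (*-identityˡ _) (W-apex h)))))
              (≤-trans (term≤sum (λ w → b2n (A u w) * W u w) w) (term≤sum (λ u → sum (λ w → b2n (A u w) * W u w)) u))) (≤-trans (≤-reflexive (≡sym (cost-W A))) le)))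

      record Inv (τ : Table) : Set where
        field
          valid : ∀ X → Valid X (τ X)
          small : cost (τ ∅) ≤ m₀
      open Inv

      Stable : Table → Set
      Stable τ = ∀ c → improves c τ ≡ false

      join : Graph² → Set
      join K = (∀ u v → K u v ≡ K v u) × (∀ u v → K u v ≡ true → adj u v ≡ true) × (∀ v → xsum (K v) ≡ xsum (adj v))

      module _ {τ : Table} (I : Inv τ) (stable : Stable τ) where

        bestOf : ∀ c → check c τ ≡ true → cost (τ (Choice.target c)) ≤ cost (cand c τ)
        bestOf c h = ≮⇒≥ (λ l → false≢true (∧-intro h (<ᵇ-intro l)) (stable c))

        -- With left = right the trail is empty and only the toggles act.
        module Still (A B : Slot N) (y₁ y₂ y₃ y₄ : Fin N) where
          c : Choice N
          c = choice A B B B x₀ y₁ y₂ y₃ y₄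
          module C = Route B B x₀ τ (valid I)
          module C′ = Cand c τ (valid I)
          rest-none : ∀ u w → C.rest u w ≡ false
          rest-none u w = not-true (λ e → false≢true (C.r-sub u w e) (xor-same (τ B u w)))
          used-none : ∀ u w → C.used u w ≡ false
          used-none u w rewrite rest-none u w = trans (xor-identityʳ _) (xor-same (τ B u w))
          cur-x₀ : C.cur ≡ x₀
          cur-x₀ with x₀ FP.≟ C.cur
          ... | yes e = ≡sym e
          ... | no h with () ← trans (≡sym (trans (xsum-zero (used-none x₀)) refl)) (trans (C.boundary x₀) (cong₂ _xor_ (eqB-refl x₀) (eqB-false (h ∘ ≡sym))))
          cand-eq : ∀ u w → cand c τ u w ≡ τ B u w xor (toggle y₁ y₂ u w xor toggle y₃ y₄ u w)
          cand-eq u w = trans (C′.cand-xor u w) (cong (λ b → τ B u w xor (b xor (toggle y₁ y₂ u w xor toggle y₃ y₄ u w))) (used-none u w))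
          gain : (∀ v → par A v ≡ par B v xor ((eqB y₁ v xor eqB y₂ v) xor (eqB y₃ v xor eqB y₄ v))) → ok y₁ y₂ ≡ true → ok y₃ y₄ ≡ true →
            cost (τ A) ≤ cost (λ u w → τ B u w xor (toggle y₁ y₂ u w xor toggle y₃ y₄ u w))
          gain h o₁ o₂ = ≤-trans (bestOf c (C′.check-intro (λ v → trans (cong₂ (λ a b → a xor (par B v xor (eqB x₀ v xor (eqB b v xor (eqB y₁ v xor (eqB y₂ v xor (eqB y₃ v xor eqB y₄ v))))))) (h v) cur-x₀)
            (vanish (par B v) (eqB x₀ v) (eqB y₁ v) (eqB y₂ v) (eqB y₃ v) (eqB y₄ v))) o₁ o₂)) (≤-reflexive (cost-cong cand-eq))
            where
            vanish : ∀ b x y₁ y₂ y₃ y₄ → (b xor ((y₁ xor y₂) xor (y₃ xor y₄))) xor (b xor (x xor (x xor (y₁ xor (y₂ xor (y₃ xor y₄)))))) ≡ false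
            vanish = truthTable 6 (λ b x y₁ y₂ y₃ y₄ → (b xor ((y₁ xor y₂) xor (y₃ xor y₄))) xor (b xor (x xor (x xor (y₁ xor (y₂ xor (y₃ xor y₄))))))) (λ b x y₁ y₂ y₃ y₄ → false) refl

        ok-loop : ∀ y → ok y y ≡ true
        ok-loop y = orB-right {adj y y} (eqB-refl y)

        ok-adj : ∀ {y y′} → adj y y′ ≡ true → ok y y′ ≡ true
        ok-adj h = orB-left h

        F : Slot N → ℕ
        F A = cost (τ A)

        J : Graph²
        J = τ ∅

        J-adj : ∀ u v → J u v ≡ true → adj u v ≡ true
        J-adj = no-apex (valid I ∅) (small I)

        same≤ : ∀ A B → (∀ v → par A v ≡ par B v) → F A ≤ F B
        same≤ A B h = ≤-trans (Still.gain A B x₀ x₀ x₀ x₀ (λ v → trans (h v) (lemma (par B v) (eqB x₀ v))) (ok-loop x₀) (ok-loop x₀))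
          (≤-reflexive (cost-cong (λ u w → trans (cong (λ b → τ B u w xor (b xor b)) (toggle-loop x₀ u w)) (xor-identityʳ _))))
          where
          lemma : ∀ b x → b ≡ b xor ((x xor x) xor (x xor x))
          lemma b x rewrite xor-same x = ≡sym (xor-identityʳ b)

        one-toggle : ∀ A B u v → adj u v ≡ true → (∀ w → par A w ≡ par B w xor (eqB u w xor eqB v w)) →
          F A ≤ cost (λ p q → τ B p q xor edgeB u v p q)
        one-toggle A B u v a h = ≤-trans (Still.gain A B u v x₀ x₀ (λ w → trans (h w) (cong (par B w xor_) (lemma (eqB u w xor eqB v w) (eqB x₀ w)))) (ok-adj a) (ok-loop x₀))
          (≤-reflexive (cost-cong (λ p q → cong (τ B p q xor_) (trans (cong₂ _xor_ (toggle-adj a p q) (toggle-loop x₀ p q)) (xor-identityʳ _)))))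
          where
          lemma : ∀ b x → b ≡ b xor (x xor x)
          lemma b x rewrite xor-same x = ≡sym (xor-identityʳ b)

        edge≤ : ∀ A B u v → adj u v ≡ true → (∀ w → par A w ≡ par B w xor (eqB u w xor eqB v w)) → F A ≤ F B + 2
        edge≤ A B u v a h = ≤-trans (one-toggle A B u v a h) (≤-trans (cost-xor (τ B) (edgeB u v)) (≤-reflexive (cong (F B +_) (cost-edge a))))

        in-J : ∀ {a b} → J a b ≡ true → ∀ u w → edgeB a b u w ≡ true → J u w ≡ true
        in-J {a} {b} h u w e with edgeB-elim a b u w e
        ... | inj₁ (refl , refl) = h
        ... | inj₂ (refl , refl) = trans (v-sym (valid I ∅) u w) h

        J-one : ∀ a b → J a b ≡ true → F (a , b , x₀ , x₀) + 2 ≤ F ∅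
        J-one a b h = ≤-trans (+-mono-≤ (one-toggle (a , b , x₀ , x₀) ∅ a b (J-adj a b h) (λ y →
            truthTable 3 (λ x p q → (p xor (q xor (x xor x)))) (λ x p q → ((x xor (x xor (x xor x))) xor (p xor q))) refl (eqB x₀ y) (eqB a y) (eqB b y)))
            (≤-reflexive (≡sym (cost-edge (J-adj a b h)))))
          (≤-reflexive (cost-sub J (edgeB a b) (in-J h)))

        J-two : ∀ a b c d → J a b ≡ true → J c d ≡ true → ¬ (a ≡ c × b ≡ d) → ¬ (a ≡ d × b ≡ c) → F (a , b , c , d) + 4 ≤ F ∅
        J-two a b c d h h′ n n′ = ≤-trans (+-mono-≤ (≤-trans
            (Still.gain (a , b , c , d) ∅ a b c d (λ y → truthTable 5 (λ x p q r s → (p xor (q xor (r xor s)))) (λ x p q r s → ((x xor (x xor (x xor x))) xor ((p xor q) xor (r xor s)))) refl (eqB x₀ y) (eqB a y) (eqB b y) (eqB c y) (eqB d y))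
               (ok-adj (J-adj a b h)) (ok-adj (J-adj c d h′)))
            (≤-reflexive (cost-cong (λ u w → trans (cong (J u w xor_) (cong₂ _xor_ (toggle-adj (J-adj a b h) u w) (toggle-adj (J-adj c d h′) u w))) (≡sym (xor-assoc (J u w) _ _))))))
            (≤-reflexive (≡sym (cong₂ _+_ (cost-edge (J-adj c d h′)) (cost-edge (J-adj a b h))))))
          (≤-reflexive (trans (≡sym (+-assoc (cost (λ u w → (J u w xor edgeB a b u w) xor edgeB c d u w)) _ _))
            (trans (cong (_+ cost (edgeB a b)) (cost-sub (λ u w → J u w xor edgeB a b u w) (edgeB c d) second)) (cost-sub J (edgeB a b) (in-J h)))))
          where
          disjoint : ∀ u w → (a ≡ u × b ≡ w) ⊎ (a ≡ w × b ≡ u) → (c ≡ u × d ≡ w) ⊎ (c ≡ w × d ≡ u) → ⊥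
          disjoint u w (inj₁ (refl , refl)) (inj₁ (refl , refl)) = n (refl , refl)
          disjoint u w (inj₁ (refl , refl)) (inj₂ (refl , refl)) = n′ (refl , refl)
          disjoint u w (inj₂ (refl , refl)) (inj₁ (refl , refl)) = n′ (refl , refl)
          disjoint u w (inj₂ (refl , refl)) (inj₂ (refl , refl)) = n (refl , refl)
          second : ∀ u w → edgeB c d u w ≡ true → J u w xor edgeB a b u w ≡ true
          second u w e rewrite in-J h′ u w e | not-true (λ e′ → disjoint u w (edgeB-elim a b u w e′) (edgeB-elim c d u w e)) = refl

        -- With `base` equal to A and then to B, the same trail moves its edges from one entry to
        -- the other and keeps the total cost. All edges of the sum at the end of the trail are
        -- used, so the parity of that vertex is known.
        exchange : ∀ A B z → ∃ λ w → (eqB z w xor (par A w xor par B w)) ≡ true ×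
          (∀ A′ B′ → (∀ v → par A′ v ≡ par A v xor (eqB z v xor eqB w v)) → (∀ v → par B′ v ≡ par B v xor (eqB z v xor eqB w v)) → F A′ + F B′ ≤ F A + F B)
        exchange A B z = C.cur , odd-end , swap
          where
          c : Slot N → Slot N → Choice N
          c X Y = choice X A B Y z x₀ x₀ x₀ x₀
          module C = Route A B z τ (valid I)
          odd-end : (eqB z C.cur xor (par A C.cur xor par B C.cur)) ≡ true
          odd-end = trans (cong (eqB z C.cur xor_) (trans (≡sym deg) (trans (C.boundary C.cur) (cong (eqB z C.cur xor_) (eqB-refl C.cur)))))
            (lemma (eqB z C.cur))
            where
            lemma : ∀ b → b xor (b xor true) ≡ true
            lemma true  = refl
            lemma false = refl
            deg : xsum (λ w → C.delta C.cur w xor C.rest C.cur w) ≡ par A C.cur xor par B C.cur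
            deg = trans (xsum-cong (λ w → trans (cong (C.delta C.cur w xor_) (C.Tr.stuck w)) (xor-identityʳ _)))
              (trans (XS.∑-distrib-+ (τ A C.cur) (τ B C.cur)) (trans (cong₂ _xor_ (v-bd (valid I A) C.cur) (v-bd (valid I B) C.cur))
                (lemma₂ (xsum (adj C.cur)) (par A C.cur) (par B C.cur))))
              where
              lemma₂ : ∀ a p q → (a xor p) xor (a xor q) ≡ p xor q
              lemma₂ = truthTable 3 (λ a p q → (a xor p) xor (a xor q)) (λ a p q → p xor q) refl
          via : ∀ X Y → (∀ v → par X v ≡ par Y v xor (eqB z v xor eqB C.cur v)) → F X ≤ cost (λ u w → τ Y u w xor C.used u w)
          via X Y h = ≤-trans (bestOf (c X Y) (C′.check-intro (λ v → trans (cong (_xor (par Y v xor (eqB z v xor (eqB C.cur v xor (eqB x₀ v xor (eqB x₀ v xor (eqB x₀ v xor eqB x₀ v))))))) (h v))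
                (lemma (par Y v) (eqB z v) (eqB C.cur v) (eqB x₀ v))) (ok-loop x₀) (ok-loop x₀)))
              (≤-reflexive (cost-cong (λ u w → trans (C′.cand-xor u w) (cong (τ Y u w xor_) (trans (cong (λ b → C.used u w xor (b xor b)) (toggle-loop x₀ u w)) (xor-identityʳ _))))))
            where
            module C′ = Cand (c X Y) τ (valid I)
            lemma : ∀ b z w x → (b xor (z xor w)) xor (b xor (z xor (w xor (x xor (x xor (x xor x)))))) ≡ false
            lemma = truthTable 4 (λ b z w x → (b xor (z xor w)) xor (b xor (z xor (w xor (x xor (x xor (x xor x))))))) (λ b z w x → false) refl
          swap : ∀ A′ B′ → (∀ v → par A′ v ≡ par A v xor (eqB z v xor eqB C.cur v)) → (∀ v → par B′ v ≡ par B v xor (eqB z v xor eqB C.cur v)) → F A′ + F B′ ≤ F A + F B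
          swap A′ B′ h h′ = ≤-trans (+-mono-≤ (via A′ A h) (via B′ B h′))
            (≤-reflexive (cost-exchange (τ A) (τ B) C.used C.used-true))

        module E = Exchange adj x₀ F J (λ u v h → trans (adj-sym v u) h) J-adj same≤ edge≤ J-one J-two exchange

        stable-minimal : ∀ K → join K → cost J ≤ sum² (λ u v → b2n (K u v))
        stable-minimal K (ks , ka , kb) = ≤-trans (≤-reflexive (cost-darts J J-adj))
          (E.minimal (record { j-sym = v-sym (valid I ∅) ; j-adj = J-adj ; j-irr = v-irr (valid I ∅) })
            (record { j-sym = ks ; j-adj = ka ; j-irr = λ u → not-true (λ e → false≢true (ka u u e) (adj-irr u)) })
            (λ v → trans (v-bd (valid I ∅) v) (trans (trans (cong (xsum (adj v) xor_) (zero-par v)) (xor-identityʳ _)) (≡sym (kb v)))))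
          where
          zero-par : ∀ v → par ∅ v ≡ false
          zero-par v with eqB x₀ v
          ... | true  = refl
          ... | false = refl

-- Termination of the search.

module SearchRuns where

  open Formulas using (b2n; foldF; loopV)
  open Cuts
  open Exchanges
  open Trails
  open LocalSearch

  module Search {N : ℕ} (adj : Graph² {N}) (x₀ : Fin N)
    (adj-sym : ∀ u v → adj u v ≡ adj v u) (adj-irr : ∀ u → adj u u ≡ false) (x₀-isolated : ∀ v → adj x₀ v ≡ false)
    (few : sum² (λ u v → b2n (adj u v)) < N) (2≤N : 2 ≤ N) where

    open Algorithm adj x₀
    open Correct adj-sym adj-irr x₀-isolated few 2≤N
    open Valid
    open Inv

    apex-self : ∀ u w → apex x₀ u w ≡ false
    apex-self u w rewrite eqB-refl x₀ = refl

    apex-other : ∀ {p} → p ≢ x₀ → apex p ≗² edgeB p x₀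
    apex-other h u w rewrite eqB-false h = refl

    apex-sym : ∀ p u w → apex p u w ≡ apex p w u
    apex-sym p u w = cong (not (eqB p x₀) ∧_) (edgeB-sym p x₀ u w)

    apex-irr : ∀ p u → apex p u u ≡ false
    apex-irr p u with p FP.≟ x₀
    ... | yes refl = apex-self u u
    ... | no h = trans (apex-other h u u) (edgeB-irr h u)

    apex-supp : ∀ p u w → apex p u w ≡ true → u ≡ x₀ ⊎ w ≡ x₀
    apex-supp p u w h with edgeB-elim p x₀ u w (proj₂ (∧-true {not (eqB p x₀)} h))
    ... | inj₁ (_ , e) = inj₂ (≡sym e)
    ... | inj₂ (_ , e) = inj₁ (≡sym e)

    apex-boundary : ∀ p v → xsum (apex p v) ≡ eqB p v xor eqB x₀ v
    apex-boundary p v with p FP.≟ x₀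
    ... | yes refl = trans (xsum-zero (apex-self v)) (≡sym (xor-same (eqB x₀ v)))
    ... | no h = trans (xsum-cong (apex-other h v)) (edgeB-boundary h v)

    table₀-valid : ∀ X → Valid X (table₀ X)
    table₀-valid (p , q , r , s) = (record
      { v-sym = λ u w → cong₂ _xor_ (adj-sym u w) (cong₂ _xor_ (apex-sym p u w) (cong₂ _xor_ (apex-sym q u w) (cong₂ _xor_ (apex-sym r u w) (apex-sym s u w))))
      ; v-irr = λ u → cong₂ _xor_ (adj-irr u) (cong₂ _xor_ (apex-irr p u) (cong₂ _xor_ (apex-irr q u) (cong₂ _xor_ (apex-irr r u) (apex-irr s u))))
      ; v-supp = supp
      ; v-bd = λ v → trans (XS.∑-distrib-+ (adj v) _) (trans (cong (xsum (adj v) xor_)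
          (trans (XS.∑-distrib-+ (apex p v) _) (trans (cong₂ _xor_ (apex-boundary p v) (trans (XS.∑-distrib-+ (apex q v) _) (cong₂ _xor_ (apex-boundary q v)
            (trans (XS.∑-distrib-+ (apex r v) (apex s v)) (cong₂ _xor_ (apex-boundary r v) (apex-boundary s v)))))) (four (eqB x₀ v) (eqB p v) (eqB q v) (eqB r v) (eqB s v))))) refl) })
      where
      four : ∀ x p q r s → (p xor x) xor ((q xor x) xor ((r xor x) xor (s xor x))) ≡ p xor (q xor (r xor s))
      four = truthTable 5 (λ x p q r s → (p xor x) xor ((q xor x) xor ((r xor x) xor (s xor x)))) (λ x p q r s → p xor (q xor (r xor s))) refl
      or-true : ∀ {a b} → a xor b ≡ true → a ≡ true ⊎ b ≡ true
      or-true {true}  h = inj₁ refl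
      or-true {false} h = inj₂ h
      supp : ∀ u w → adj u w xor (apex p u w xor (apex q u w xor (apex r u w xor apex s u w))) ≡ true → adj u w ≡ true ⊎ (u ≡ x₀ ⊎ w ≡ x₀)
      supp u w e with or-true {adj u w} e
      ... | inj₁ h = inj₁ h
      ... | inj₂ e with or-true {apex p u w} e
      ... | inj₁ h = inj₂ (apex-supp p u w h)
      ... | inj₂ e with or-true {apex q u w} e
      ... | inj₁ h = inj₂ (apex-supp q u w h)
      ... | inj₂ e with or-true {apex r u w} e
      ... | inj₁ h = inj₂ (apex-supp r u w h)
      ... | inj₂ h = inj₂ (apex-supp s u w h)

    table₀-inv : Inv table₀
    table₀-inv = record { valid = table₀-valid ; small = ≤-reflexive (trans (cost-cong plain) (cost-darts adj (λ _ _ h → h))) }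
      where
      plain : table₀ ∅ ≗² adj
      plain u w = trans (cong (λ b → adj u w xor (b xor (b xor (b xor b)))) (apex-self u w)) (xor-identityʳ _)

    module _ (c : Choice N) (τ : Table) where

      step-other : ∀ A → slotEq (Choice.target c) A ∧ improves c τ ≡ false → stepT c τ A ≗² τ A
      step-other A h u w rewrite h with τ A u w
      ... | true  = refl
      ... | false = refl

      step-target : ∀ A → slotEq (Choice.target c) A ∧ improves c τ ≡ true → stepT c τ A ≗² cand c τ
      step-target A h u w rewrite h with cand c τ u w
      ... | true  = refl
      ... | false = refl

    pot : Table → ℕ
    pot τ = sum (λ p → sum (λ q → sum (λ r → sum (λ s → cost (τ (p , q , r , s))))))

    pot-cong : ∀ {τ τ′} → τ ≗ᵀ τ′ → pot τ ≡ pot τ′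
    pot-cong h = sum-cong-≗ (λ p → sum-cong-≗ (λ q → sum-cong-≗ (λ r → sum-cong-≗ (λ s → cost-cong (h (p , q , r , s))))))

    pot-strict : ∀ {τ τ′} X → (∀ A → cost (τ A) ≤ cost (τ′ A)) → cost (τ X) < cost (τ′ X) → pot τ < pot τ′
    pot-strict {τ} {τ′} (p , q , r , s) h l = sum-strict p (λ p → sum-mono (λ q → sum-mono (λ r → sum-mono (λ s → h (p , q , r , s)))))
      (sum-strict q (λ q → sum-mono (λ r → sum-mono (λ s → h (p , q , r , s)))) (sum-strict r (λ r → sum-mono (λ s → h (p , q , r , s))) (sum-strict s (λ s → h (p , q , r , s)) l)))

    ∅-cost : Table → ℕ
    ∅-cost τ = cost (τ ∅)

    -- A phase either lowers the potential or leaves this table unchanged and certifies Z for it. In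
    -- a composition that lowers nothing, all certificates therefore speak about the same table.
    Phase : (Table → Table) → (Table → Set) → Set
    Phase g Z = ∀ τ → Inv τ → Inv (g τ) × ∅-cost (g τ) ≤ ∅-cost τ × (pot (g τ) < pot τ ⊎ (g τ ≗ᵀ τ × Z τ))

    step-phase : ∀ c → Phase (stepT c) (λ τ → improves c τ ≡ false)
    step-phase c τ I = by-outcome (improves c τ) refl
      where
      Goal : Set
      Goal = Inv (stepT c τ) × ∅-cost (stepT c τ) ≤ ∅-cost τ × (pot (stepT c τ) < pot τ ⊎ (stepT c τ ≗ᵀ τ × improves c τ ≡ false))
      by-outcome : ∀ b → improves c τ ≡ b → Goal
      by-outcome false e =
        record { valid = λ X → valid-cong (λ u w → ≡sym (still X u w)) (valid I X) ; small = ≤-trans (≤-reflexive (cost-cong (still ∅))) (small I) } ,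
        ≤-reflexive (cost-cong (still ∅)) , inj₂ (still , e)
        where
        still : stepT c τ ≗ᵀ τ
        still A = step-other c τ A (trans (cong (slotEq (Choice.target c) A ∧_) e) (∧-zeroʳ _))
      by-outcome true e = record { valid = λ X → ok-valid X (slotEq (Choice.target c) X) refl ; small = ≤-trans (down ∅) (small I) } , down ∅ ,
        inj₁ (pot-strict {stepT c τ} {τ} (Choice.target c) down
          (≤-trans (s≤s (≤-reflexive (cost-cong (step-target c τ (Choice.target c) (∧-intro (slotEq-refl (Choice.target c)) e))))) (true-<ᵇ (cost (cand c τ)) _ (proj₂ (∧-true {check c τ} e)))))
        where
        ok-valid : ∀ X b → slotEq (Choice.target c) X ≡ b → Valid X (stepT c τ X)
        ok-valid X false s = valid-cong (λ u w → ≡sym (step-other c τ X (cong (_∧ improves c τ) s) u w)) (valid I X)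
        ok-valid X true  s with refl ← slotEq-true (Choice.target c) X s =
          valid-cong (λ u w → ≡sym (step-target c τ X (∧-intro s e) u w)) (Cand.cand-valid c τ (valid I) (proj₁ (∧-true {check c τ} e)))
        down′ : ∀ A b → slotEq (Choice.target c) A ≡ b → cost (stepT c τ A) ≤ cost (τ A)
        down′ A false s = ≤-reflexive (cost-cong (step-other c τ A (cong (_∧ improves c τ) s)))
        down′ A true  s with refl ← slotEq-true (Choice.target c) A s =
          ≤-trans (≤-reflexive (cost-cong (step-target c τ A (∧-intro s e)))) (<⇒≤ (true-<ᵇ (cost (cand c τ)) _ (proj₂ (∧-true {check c τ} e))))
        down : ∀ A → cost (stepT c τ A) ≤ cost (τ A)
        down A = down′ A (slotEq (Choice.target c) A) refl

    Drop : (Table → Table) → (Table → Set) → Table → Set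
    Drop g Z τ = pot (g τ) < pot τ ⊎ (g τ ≗ᵀ τ × Z τ)

    drop-map : ∀ {g Z Z′ τ} → (Z τ → Z′ τ) → Drop g Z τ → Drop g Z′ τ
    drop-map f (inj₁ l)       = inj₁ l
    drop-map f (inj₂ (e , z)) = inj₂ (e , f z)

    phase-map : ∀ {g Z Z′} → (∀ {τ} → Z τ → Z′ τ) → Phase g Z → Phase g Z′
    phase-map {g} {Z} {Z′} f ph τ I = let I₁ , c₁ , d₁ = ph τ I in I₁ , c₁ , drop-map {g} {Z} {Z′} {τ} f d₁

    -- The later certificates are issued for `g zero τ`; since this table agrees pointwise with τ
    -- when nothing was lowered, `resp` carries them back to τ.
    fold-phase : ∀ {m} (g : Fin m → Table → Table) (Z : Fin m → Table → Set) → (∀ i {τ τ′} → τ′ ≗ᵀ τ → Z i τ′ → Z i τ) →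
      (∀ i → Phase (g i) (Z i)) → Phase (foldF g) (λ τ → ∀ i → Z i τ)
    fold-phase {zero} g Z resp ph τ I = I , ≤-refl , inj₂ ((λ _ _ _ → refl) , λ ())
    fold-phase {suc m} g Z resp ph τ I with ph zero τ I
    ... | I₁ , c₁ , d₁ with fold-phase (g ∘ suc) (Z ∘ suc) (λ i → resp (suc i)) (ph ∘ suc) (g zero τ) I₁
    ... | I₂ , c₂ , d₂ = I₂ , ≤-trans c₂ c₁ , both d₁ d₂
      where
      both : Drop (g zero) (Z zero) τ → Drop (foldF (g ∘ suc)) (λ τ → ∀ i → Z (suc i) τ) (g zero τ) → Drop (foldF g) (λ τ → ∀ i → Z i τ) τ
      both (inj₁ l) (inj₁ l′) = inj₁ (<-trans l′ l)
      both (inj₁ l) (inj₂ (e , _)) = inj₁ (≤-trans (s≤s (≤-reflexive (pot-cong e))) l)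
      both (inj₂ (e , z)) (inj₁ l) = inj₁ (≤-trans l (≤-reflexive (pot-cong e)))
      both (inj₂ (e , z)) (inj₂ (e′ , zs)) = inj₂ ((λ A u w → trans (e′ A u w) (e A u w)) , λ { zero → z ; (suc i) → resp (suc i) e (zs i) })

    loop-phase : ∀ r (g : List (Fin N) → Table → Table) (Z : List (Fin N) → Table → Set) → (∀ us {τ τ′} → τ′ ≗ᵀ τ → Z us τ′ → Z us τ) →
      (∀ us → Phase (g us) (Z us)) → Phase (loopV r g) (λ τ → ∀ us → length us ≡ r → Z us τ)
    loop-phase zero g Z resp ph τ I with ph [] τ I
    ... | I₁ , c₁ , d₁ = I₁ , c₁ , drop-map {g []} {Z []} {λ τ → ∀ us → length us ≡ 0 → Z us τ} (λ { z [] _ → z }) d₁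
    loop-phase (suc r) g Z resp ph τ I
      with fold-phase (λ i → loopV r (g ∘ (i ∷_))) (λ i τ → ∀ us → length us ≡ r → Z (i ∷ us) τ)
             (λ i e z us l → resp (i ∷ us) e (z us l)) (λ i → loop-phase r (g ∘ (i ∷_)) (Z ∘ (i ∷_)) (λ us → resp (i ∷ us)) (λ us → ph (i ∷ us))) τ I
    ... | I₁ , c₁ , d₁ = I₁ , c₁ , drop-map {loopV (suc r) g} {λ τ → ∀ i us → length us ≡ r → Z (i ∷ us) τ} {λ τ → ∀ us → length us ≡ suc r → Z us τ}
        (λ { z (i ∷ us) l → z i us (suc-injective l) }) d₁

    sweep : ℕ → Table → Table
    sweep s = loopV s (λ us → stepT (choiceOf us))

    sweep-phase : ∀ s → s ≡ 21 → Phase (sweep s) Stable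
    sweep-phase s e = phase-map {sweep s} {λ τ → ∀ us → length us ≡ s → improves (choiceOf us) τ ≡ false} {Stable}
      (λ { z (choice (a₁ , a₂ , a₃ , a₄) (b₁ , b₂ , b₃ , b₄) (c₁ , c₂ , c₃ , c₄) (d₁ , d₂ , d₃ , d₄) z₁ y₁ y₂ y₃ y₄) →
        z (a₁ ∷ a₂ ∷ a₃ ∷ a₄ ∷ b₁ ∷ b₂ ∷ b₃ ∷ b₄ ∷ c₁ ∷ c₂ ∷ c₃ ∷ c₄ ∷ d₁ ∷ d₂ ∷ d₃ ∷ d₄ ∷ z₁ ∷ y₁ ∷ y₂ ∷ y₃ ∷ y₄ ∷ []) (≡sym e) })
      (loop-phase s (λ us → stepT (choiceOf us)) (λ us τ → improves (choiceOf us) τ ≡ false)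
        (λ us e z → trans (≡sym (improves-cong (choiceOf us) e)) z) (λ us → step-phase (choiceOf us)))

    -- A stable table met on the way is remembered, and afterwards the cost of the entry for the
    -- empty boundary can only fall. If none was met, n sweeps have consumed n units of potential.
    Progress : ℕ → Table → Set
    Progress n τ = Inv τ × ((∃ λ τ′ → Inv τ′ × Stable τ′ × ∅-cost τ ≤ ∅-cost τ′) ⊎ pot τ + n ≤ pot table₀)

    phase-progress : ∀ {g} → Phase g Stable → ∀ n τ → Progress n τ → Progress (suc n) (g τ)
    phase-progress {g} ph n τ (I , d) with I′ , c , d′ ← ph τ I = I′ , onward d d′
      where
      Done : Table → Set
      Done τ = ∃ λ τ′ → Inv τ′ × Stable τ′ × ∅-cost τ ≤ ∅-cost τ′
      onward : Done τ ⊎ pot τ + n ≤ pot table₀ → Drop g Stable τ → Done (g τ) ⊎ pot (g τ) + suc n ≤ pot table₀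
      onward (inj₁ (τ′ , J , st , le)) _ = inj₁ (τ′ , J , st , ≤-trans c le)
      onward (inj₂ b) (inj₁ l) = inj₂ (≤-trans (≤-reflexive (+-suc (pot (g τ)) n)) (≤-trans (+-monoˡ-≤ n l) b))
      onward (inj₂ b) (inj₂ (_ , st)) = inj₁ (τ , I , st , c)

    search-progress : ∀ r s → s ≡ 21 → Progress (N ^ r + 0) (search r s)
    search-progress r s e = subst (Progress (N ^ r + 0)) (≡sym (loopV-drop r s (λ us → stepT (choiceOf us)) table₀))
      (loopV-count Progress {N} r (phase-progress {sweep s} (sweep-phase s e)) 0 table₀ (table₀-inv , inj₂ (≤-reflexive (+-identityʳ _))))

    -- Seven nested sums of bits: four slot vertices, the two ends of a dart and the third argument
    -- of `wt`.
    pot-bound : pot table₀ ≤ N ^ 7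
    pot-bound = ≤-trans (sum-bound {N} _ (N ^ 6) λ p → sum-bound {N} _ (N ^ 5) λ q → sum-bound {N} _ (N ^ 4) λ r → sum-bound {N} _ (N ^ 3) λ s →
        sum-bound {N} _ (N ^ 2) λ u → sum-bound {N} _ (N ^ 1) λ w → sum-bound {N} _ 1 λ c → b2n≤1 _) ≤-refl
      where
      b2n≤1 : ∀ b → b2n b ≤ 1
      b2n≤1 true  = ≤-refl
      b2n≤1 false = z≤n

    -- The origin of the eight repetition variables: `N ^ 8` sweeps cannot all lower a potential
    -- that starts at no more than `N ^ 7`.
    pow-grows : N ^ 7 < N ^ 8
    pow-grows = ^-monoʳ-< N 2≤N {7} {8} ≤-refl

    -- The loop counts stay variables here so that the nested loops are not unrolled.
    module Result (r s : ℕ) (r≡8 : r ≡ 8) (s≡21 : s ≡ 21) where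

      J* : Graph²
      J* = search r s ∅

      progress* : Progress (N ^ r + 0) (search r s)
      progress* = search-progress r s s≡21

      J*-join : join J*
      J*-join = v-sym V , no-apex V (small (proj₁ progress*)) , λ v → trans (v-bd V v) (trans (cong (xsum (adj v) xor_) (zero-par v)) (xor-identityʳ _))
        where
        V : Valid ∅ J*
        V = valid (proj₁ progress*) ∅
        zero-par : ∀ v → par ∅ v ≡ false
        zero-par v with eqB x₀ v
        ... | true  = refl
        ... | false = refl

      J*-minimal : ∀ K → join K → sum² (λ u v → b2n (J* u v)) ≤ sum² (λ u v → b2n (K u v))
      J*-minimal K jK = compare (proj₂ progress*)
        where
        compare : (∃ λ τ′ → Inv τ′ × Stable τ′ × ∅-cost (search r s) ≤ ∅-cost τ′) ⊎ pot (search r s) + (N ^ r + 0) ≤ pot table₀ →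
          sum² (λ u v → b2n (J* u v)) ≤ sum² (λ u v → b2n (K u v))
        compare (inj₁ (τ′ , I′ , st , le)) = ≤-trans (≤-reflexive (≡sym (cost-darts J* (proj₁ (proj₂ J*-join))))) (≤-trans le (stable-minimal I′ st K jK))
        compare (inj₂ b) = ⊥-elim (<⇒≱ pow-grows (≤-trans (≤-reflexive (cong (N ^_) (≡sym r≡8)))
              (≤-trans (≤-trans (m≤m+n (N ^ r) 0) (m≤n+m (N ^ r + 0) (pot (search r s)))) (≤-trans b pot-bound))))

-- The decision formula and its evaluation.

module DecisionFormula where

  open import Data.List using (drop)
  open Programs using (upd; symAt; isSym)
  open Formulas
  open PolynomialTime using (noRels)
  open Cuts
  open Exchanges
  open Trails
  open LocalSearch

  ex : Fm → Fm
  ex = cnt 0 ⊥ᶠ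

  eqF : ℕ → ℕ → Fm
  eqF x y = ¬ᶠ (lt x y) ∧ᶠ ¬ᶠ (lt y x)

  infixr 5 _orF_
  _orF_ : Fm → Fm → Fm
  φ orF ψ = ¬ᶠ (¬ᶠ φ ∧ᶠ ¬ᶠ ψ)

  sameCountF : Fm → Fm → Fm
  sameCountF φ ψ = ¬ᶠ (cnt 0 φ ψ) ∧ᶠ ¬ᶠ (cnt 0 ψ φ)

  -- Variables 0 and 1 denote the last and the first position.

  adjF vertF kvF : Fm
  adjF = ex (symb 𝟏 4 ∧ᶠ (sameCountF (lt 5 4 ∧ᶠ symb ♯ 5) (¬ᶠ (lt 2 5))
                        ∧ᶠ sameCountF (lt 5 4 ∧ᶠ ¬ᶠ (ex (¬ᶠ (lt 6 5) ∧ᶠ (lt 6 4 ∧ᶠ symb ♯ 6)))) (lt 5 3)))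
  vertF = cnt 0 (¬ᶠ (lt 2 3)) (symb ♯ 3)
  kvF = (symb 𝟏 3 ∧ᶠ ¬ᶠ (cnt 1 dbl (eqF 6 1 ∧ᶠ lt 5 4))) orF (symb 𝟎 3 ∧ᶠ ¬ᶠ (cnt 1 dbl (eqF 6 1 ∧ᶠ (lt 1 5 ∧ᶠ lt 5 4))))
    where
    dbl : Fm
    dbl = (eqF 6 0 orF eqF 6 1) ∧ᶠ ex ((lt 3 7 ∧ᶠ ¬ᶠ (ex (lt 3 8 ∧ᶠ lt 8 7))) ∧ᶠ rel 2 (7 ∷ 5 ∷ []))

  edgeF : ℕ → ℕ → ℕ → ℕ → Fm
  edgeF a b u w = (eqF a u ∧ᶠ eqF b w) orF (eqF a w ∧ᶠ eqF b u)

  -- Variables 2–30 of the search are eight repetition counters, four slots,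
  -- the start of the trail and two toggled edges; 31–36 are the arguments.

  apexF : ℕ → ℕ → ℕ → Fm
  apexF p u w = ¬ᶠ (eqF p 0) ∧ᶠ edgeF p 0 u w

  initF : Fm
  initF = rel 0 (6 ∷ 7 ∷ []) ⊻ᶠ (apexF 2 6 7 ⊻ᶠ (apexF 3 6 7 ⊻ᶠ (apexF 4 6 7 ⊻ᶠ apexF 5 6 7)))

  diffF : ℕ → ℕ → Fm
  diffF u w = rel 3 (14 ∷ 15 ∷ 16 ∷ 17 ∷ u ∷ w ∷ []) ⊻ᶠ rel 3 (18 ∷ 19 ∷ 20 ∷ 21 ∷ u ∷ w ∷ [])

  trailStartF : Fm
  trailStartF = (eqF 37 38 ∧ᶠ eqF 37 26) orF (¬ᶠ (eqF 37 38) ∧ᶠ diffF 37 38)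

  nextF : ℕ → ℕ → Fm
  nextF k x = ex (¬ᶠ (eqF k x) ∧ᶠ (rel 4 (k ∷ k ∷ []) ∧ᶠ (rel 4 (k ∷ x ∷ []) ∧ᶠ
              ¬ᶠ (ex (lt (suc k) x ∧ᶠ (¬ᶠ (eqF k (suc k)) ∧ᶠ rel 4 (k ∷ suc k ∷ [])))))))

  trailStepF : Fm
  trailStepF =
    (eqF 39 40 ∧ᶠ (nextF 41 39 orF (¬ᶠ (ex (nextF 42 41)) ∧ᶠ rel 4 (39 ∷ 39 ∷ []))))
    orF (¬ᶠ (eqF 39 40) ∧ᶠ (rel 4 (39 ∷ 40 ∷ []) ∧ᶠ
          (¬ᶠ (rel 4 (39 ∷ 39 ∷ []) ∧ᶠ nextF 41 40) ∧ᶠ ¬ᶠ (rel 4 (40 ∷ 40 ∷ []) ∧ᶠ nextF 41 39))))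

  toggleF : ℕ → ℕ → ℕ → ℕ → Fm
  toggleF y y′ u w = rel 0 (u ∷ w ∷ []) ∧ᶠ edgeF y y′ u w

  okF : ℕ → ℕ → Fm
  okF y y′ = rel 0 (y ∷ y′ ∷ []) orF eqF y y′

  parF : ℕ → ℕ → ℕ → ℕ → ℕ → Fm
  parF p q r s v = eqF p v ⊻ᶠ (eqF q v ⊻ᶠ (eqF r v ⊻ᶠ eqF s v))

  candF : ℕ → ℕ → Fm
  candF u w = rel 3 (22 ∷ 23 ∷ 24 ∷ 25 ∷ u ∷ w ∷ []) ⊻ᶠ
    ((¬ᶠ (eqF u w) ∧ᶠ (diffF u w ∧ᶠ ¬ᶠ (rel 4 (u ∷ w ∷ [])))) ⊻ᶠ (toggleF 27 28 u w ⊻ᶠ toggleF 29 30 u w))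

  checkF : Fm
  checkF = ¬ᶠ (ex (parF 10 11 12 13 37 ⊻ᶠ (parF 22 23 24 25 37 ⊻ᶠ (eqF 26 37 ⊻ᶠ (rel 4 (37 ∷ 37 ∷ []) ⊻ᶠ
    (eqF 27 37 ⊻ᶠ (eqF 28 37 ⊻ᶠ (eqF 29 37 ⊻ᶠ eqF 30 37)))))))) ∧ᶠ (okF 27 28 ∧ᶠ okF 29 30)

  wtF : Fm
  wtF = eqF 39 0 orF (eqF 37 0 orF eqF 38 0)

  improvesF : Fm
  improvesF = checkF ∧ᶠ cnt 2 (candF 37 38 ∧ᶠ wtF) (rel 3 (10 ∷ 11 ∷ 12 ∷ 13 ∷ 37 ∷ 38 ∷ []) ∧ᶠ wtF)

  slotF : Fm
  slotF = eqF 10 31 ∧ᶠ (eqF 11 32 ∧ᶠ (eqF 12 33 ∧ᶠ eqF 13 34))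

  stepF : Fm
  stepF = ((slotF ∧ᶠ improvesF) ∧ᶠ candF 35 36) orF (¬ᶠ (slotF ∧ᶠ improvesF) ∧ᶠ rel 3 (31 ∷ 32 ∷ 33 ∷ 34 ∷ 35 ∷ 36 ∷ []))

  searchStepF : Fm
  searchStepF = iter 2 2 trailStartF trailStepF stepF

  k2F : Fm
  k2F = rel 0 (4 ∷ 5 ∷ []) ∧ᶠ (¬ᶠ (ex (rel 0 (4 ∷ 6 ∷ []) ∧ᶠ ¬ᶠ (eqF 6 5))) ∧ᶠ ¬ᶠ (ex (rel 0 (5 ∷ 6 ∷ []) ∧ᶠ ¬ᶠ (eqF 6 4))))

  leftF rightF finalF : Fm
  leftF = (eqF 2 0 ∧ᶠ ((eqF 3 0 ∧ᶠ rel 0 (4 ∷ 5 ∷ [])) orF (eqF 3 1 ∧ᶠ rel 3 (0 ∷ 0 ∷ 0 ∷ 0 ∷ 4 ∷ 5 ∷ []))))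
          orF (eqF 2 1 ∧ᶠ ((eqF 3 0 ∧ᶠ k2F) orF (eqF 3 1 ∧ᶠ k2F)))
  rightF = (eqF 2 0 ∧ᶠ ((eqF 3 0 ∧ᶠ vF) orF (eqF 3 1 ∧ᶠ vF))) orF (eqF 2 1 ∧ᶠ ((eqF 3 0 ∧ᶠ wF) orF (eqF 3 1 ∧ᶠ wF)))
    where
    vF wF : Fm
    vF = eqF 5 0 ∧ᶠ rel 1 (4 ∷ [])
    wF = eqF 5 0 ∧ᶠ rel 2 (1 ∷ 4 ∷ [])
  finalF = ¬ᶠ (ex (rel 1 (2 ∷ []) ∧ᶠ ¬ᶠ (ex (rel 0 (2 ∷ 3 ∷ []))))) ∧ᶠ ¬ᶠ (cnt 3 rightF leftF)

  mainF decideF : Fm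
  mainF = iter 2 0 ⊥ᶠ adjF (iter 1 0 ⊥ᶠ vertF (iter 2 1 ⊥ᶠ kvF (iter 6 29 initF searchStepF finalF)))
  decideF = ex (¬ᶠ (ex (lt 0 1)) ∧ᶠ ex (¬ᶠ (ex (lt 2 1)) ∧ᶠ mainF))

  -- Every condition computes to the unit type, so the proof term is inferred.
  decide-wf : WF decideF 0 0 noRels
  decide-wf = _

  count : ∀ {n} → (Fin n → Bool) → ℕ
  count f = sum (λ x → b2n (f x))

  sameCount : ∀ {n} → (Fin n → Bool) → (Fin n → Bool) → Bool
  sameCount f g = not (count f <ᵇ count g) ∧ not (count g <ᵇ count f)

  ltB : ∀ {n} → Fin n → Fin n → Bool
  ltB i j = toℕ i <ᵇ toℕ j

  module Meaning (w : List Sym) where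

    open Semantics w public

    G² : Set
    G² = Graph² {length w}

    sy : Sym → Ix → Bool
    sy s p = isSym s (symAt w (toℕ p))

    -- Row i lies behind i + 1 marks, since the first ♯ ends the number, and i + 1 is the number of
    -- positions up to i. The column is the number of positions since the last ♯.
    adjB : Ix → Ix → Bool
    adjB i j = anyB (λ p → sy 𝟏 p ∧ (sameCount (λ q → ltB q p ∧ sy ♯ q) (λ q → not (ltB i q))
      ∧ sameCount (λ q → ltB q p ∧ not (anyB (λ h → not (ltB h q) ∧ (ltB h p ∧ sy ♯ h)))) (λ q → ltB q j)))

    -- A word contains one ♯ more than the graph has vertices, so the test i + 1 < number of marks
    -- singles out the vertices.
    vertB : Ix → Bool
    vertB i = count (λ q → not (ltB i q)) <ᵇ count (λ q → sy ♯ q)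

    module _ (last first : Ix) where

      double : G² → Ix → ℕ
      double V p = sum (λ x → sum (λ b → b2n ((eqB b last orB eqB b first) ∧
        anyB (λ q → (ltB p q ∧ not (anyB (λ y → ltB p y ∧ ltB y q))) ∧ V q x))))

      -- `V p c` is meant to say that c lies below the value of the digits from p on. With v the
      -- value behind p, the digit 𝟏 gives 1 + 2v and 𝟎 gives 2 + 2v, so the test is that 2v is not
      -- below c, or not below c - 1. In `double` the two tags produce the factor 2.
      kvStep : G² → G²
      kvStep V p c =
        (sy 𝟏 p ∧ not (double V p <ᵇ sum (λ x → sum (λ b → b2n (eqB b first ∧ ltB x c)))))
        orB (sy 𝟎 p ∧ not (double V p <ᵇ sum (λ x → sum (λ b → b2n (eqB b first ∧ (ltB first x ∧ ltB x c))))))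

      kvB : G²
      kvB = loopV {length w} 1 (λ _ → kvStep) (λ _ _ → false)

    k2B : G² → G²
    k2B A u v = A u v ∧ (not (anyB (λ x → A u x ∧ not (eqB x v))) ∧ not (anyB (λ x → A v x ∧ not (eqB x u))))

    -- On the side of V and W the equation `eqB v l` pins the last variable, so that vertices are
    -- counted by quadruples. V and W occur twice because the other side counts darts.
    finalB : Ix → Ix → G² → (Ix → Bool) → (Ix → Bool) → G² → Bool
    finalB l f A V W J =
      not (anyB (λ v → V v ∧ not (anyB (λ u → A v u)))) ∧
      not (sum (λ b → sum (λ b′ → sum (λ u → sum (λ v → b2n (
             (eqB b l ∧ ((eqB b′ l ∧ (eqB v l ∧ V u)) orB (eqB b′ f ∧ (eqB v l ∧ V u)))) orB
             (eqB b f ∧ ((eqB b′ l ∧ (eqB v l ∧ W u)) orB (eqB b′ f ∧ (eqB v l ∧ W u)))))))))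
          <ᵇ sum (λ b → sum (λ b′ → sum (λ u → sum (λ v → b2n (
             (eqB b l ∧ ((eqB b′ l ∧ A u v) orB (eqB b′ f ∧ J u v))) orB
             (eqB b f ∧ ((eqB b′ l ∧ k2B A u v) orB (eqB b′ f ∧ k2B A u v)))))))))

    module _ (ρ₀ : Env) (Ξ : Rels) where

      ends : Ix → Ix → Env
      ends l f = upd (upd ρ₀ 0 l) 1 f

      abstract
        -- Opaque names for the two evaluations, so that later conversions do not unfold the whole
        -- formula.
        decideB : Bool
        decideB = ⟦ decideF ⟧ 0 0 ρ₀ Ξ

        mainB : Ix → Ix → Bool
        mainB l f = ⟦ mainF ⟧ 2 0 (ends l f) Ξ

        decideB-def : decideB ≡ ⟦ decideF ⟧ 0 0 ρ₀ Ξ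
        decideB-def = refl

        decide-eq : decideB ≡ anyB (λ l → not (anyB (λ y → ltB l y)) ∧ anyB (λ f → not (anyB (λ y → ltB y f)) ∧ mainB l f))
        decide-eq = refl

      module _ (l f : Ix) where

        ρ : Env
        ρ = ends l f

        adjR vertR kvR tabR : List Ix → Bool
        adjR = loopO 0 (λ us R′ vs → ⟦ adjF ⟧ 4 1 (bindAll 2 vs (bindAll 2 us ρ)) (upd Ξ 0 R′)) (λ vs → ⟦ ⊥ᶠ ⟧ 4 1 (bindAll 2 vs ρ) Ξ)
        Ξ₁ Ξ₂ Ξ₃ : Rels
        Ξ₁ = upd Ξ 0 adjR
        vertR = loopO 0 (λ us R′ vs → ⟦ vertF ⟧ 3 2 (bindAll 2 vs (bindAll 2 us ρ)) (upd Ξ₁ 1 R′)) (λ vs → ⟦ ⊥ᶠ ⟧ 3 2 (bindAll 2 vs ρ) Ξ₁)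
        Ξ₂ = upd Ξ₁ 1 vertR
        kvR = loopO 1 (λ us R′ vs → ⟦ kvF ⟧ 5 3 (bindAll 3 vs (bindAll 2 us ρ)) (upd Ξ₂ 2 R′)) (λ vs → ⟦ ⊥ᶠ ⟧ 4 3 (bindAll 2 vs ρ) Ξ₂)
        Ξ₃ = upd Ξ₂ 2 kvR

        tabF : List Ix → (List Ix → Bool) → List Ix → Bool
        tabF us R′ vs = ⟦ searchStepF ⟧ 37 4 (bindAll 31 vs (bindAll 2 us ρ)) (upd Ξ₃ 3 R′)
        tab₀ : List Ix → Bool
        tab₀ vs = ⟦ initF ⟧ 8 4 (bindAll 2 vs ρ) Ξ₃

        tabR = loopO 29 tabF tab₀

        abstract
          main-eq : mainB l f ≡ finalB l f (λ u v → adjR (u ∷ v ∷ [])) (λ u → vertR (u ∷ [])) (λ u → kvR (f ∷ u ∷ []))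
                                         (λ u v → tabR (l ∷ l ∷ l ∷ l ∷ u ∷ v ∷ []))
          main-eq = refl

        adjR-eq : ∀ i j → adjR (i ∷ j ∷ []) ≡ adjB i j
        adjR-eq i j = cong (λ R′ → R′ (i ∷ j ∷ [])) (loopO-def 0 (λ us R′ vs → ⟦ adjF ⟧ 4 1 (bindAll 2 vs (bindAll 2 us ρ)) (upd Ξ 0 R′)) (λ _ → false))

        vertR-eq : ∀ i → vertR (i ∷ []) ≡ vertB i
        vertR-eq i = cong (λ R′ → R′ (i ∷ [])) (loopO-def 0 (λ us R′ vs → ⟦ vertF ⟧ 3 2 (bindAll 2 vs (bindAll 2 us ρ)) (upd Ξ₁ 1 R′)) (λ _ → false))

        Matches² : G² → (List Ix → Bool) → Set
        Matches² A R′ = ∀ u v → A u v ≡ R′ (u ∷ v ∷ [])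

        kvF-step : List Ix → (List Ix → Bool) → List Ix → Bool
        kvF-step us R′ vs = ⟦ kvF ⟧ 5 3 (bindAll 3 vs (bindAll 2 us ρ)) (upd Ξ₂ 2 R′)

        kvR-eq : Matches² (kvB l f) kvR
        kvR-eq = subst (Matches² (kvB l f)) (≡sym (loopO-def 1 kvF-step (λ _ → false)))
          (loopV-rel Matches² 1 {λ _ → kvStep l f} {kvF-step} kv-step (λ _ _ → false) (λ _ → false) (λ _ _ → refl))
          where
          kv-step : ∀ us V R′ → length us ≡ 1 → Matches² V R′ →
            Matches² (kvStep l f V) (kvF-step us R′)
          kv-step (_ ∷ []) V R′ refl h p c = kvStep-cong p c
            where
            double-cong : ∀ p → double l f V p ≡ double l f (λ u v → R′ (u ∷ v ∷ [])) p
            double-cong p = sum-cong-≗ (λ x → sum-cong-≗ (λ b → cong (λ z → b2n ((eqB b l orB eqB b f) ∧ z))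
              (anyB-cong (λ q → cong ((ltB p q ∧ not (anyB (λ y → ltB p y ∧ ltB y q))) ∧_) (h q x)))))
            kvStep-cong : ∀ p c → kvStep l f V p c ≡ kvStep l f (λ u v → R′ (u ∷ v ∷ [])) p c
            kvStep-cong p c = cong (λ d → (sy 𝟏 p ∧ not (d <ᵇ sum (λ x → sum (λ b → b2n (eqB b f ∧ ltB x c)))))
              orB (sy 𝟎 p ∧ not (d <ᵇ sum (λ x → sum (λ b → b2n (eqB b f ∧ (ltB f x ∧ ltB x c))))))) (double-cong p)

        open Algorithm (λ u v → adjR (u ∷ v ∷ [])) l

        MatchesT : Table → (List Ix → Bool) → Set
        MatchesT τ R′ = ∀ p q r s u v → τ (p , q , r , s) u v ≡ R′ (p ∷ q ∷ r ∷ s ∷ u ∷ v ∷ [])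

        tableOf : (List Ix → Bool) → Table
        tableOf R′ (p , q , r , s) u v = R′ (p ∷ q ∷ r ∷ s ∷ u ∷ v ∷ [])

        tab₀-eq : MatchesT table₀ tab₀
        tab₀-eq p q r s u v = refl

        module _ (a₁ a₂ a₃ a₄ a₅ a₆ a₇ a₈ x₁ x₂ x₃ x₄ b₁ b₂ b₃ b₄ c₁ c₂ c₃ c₄ d₁ d₂ d₃ d₄ z y₁ y₂ y₃ y₄ : Ix) (R′ : List Ix → Bool) where

          ch : Choice (length w)
          ch = choice (x₁ , x₂ , x₃ , x₄) (b₁ , b₂ , b₃ , b₄) (c₁ , c₂ , c₃ , c₄) (d₁ , d₂ , d₃ , d₄) z y₁ y₂ y₃ y₄

          us : List Ix
          us = a₁ ∷ a₂ ∷ a₃ ∷ a₄ ∷ a₅ ∷ a₆ ∷ a₇ ∷ a₈ ∷ x₁ ∷ x₂ ∷ x₃ ∷ x₄ ∷ b₁ ∷ b₂ ∷ b₃ ∷ b₄ ∷ c₁ ∷ c₂ ∷ c₃ ∷ c₄ ∷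
               d₁ ∷ d₂ ∷ d₃ ∷ d₄ ∷ z ∷ y₁ ∷ y₂ ∷ y₃ ∷ y₄ ∷ []

          module _ (p q r s u v : Ix) where

            ρ₇ : Env
            ρ₇ = bindAll 31 (p ∷ q ∷ r ∷ s ∷ u ∷ v ∷ []) (bindAll 2 us ρ)

            start advance : List Ix → (List Ix → Bool) → List Ix → Bool
            start ts Q vs = ⟦ trailStartF ⟧ 39 5 (bindAll 37 vs ρ₇) (upd Ξ₃ 3 R′)
            advance ts Q vs = ⟦ trailStepF ⟧ 41 5 (bindAll 39 vs (bindAll 37 ts ρ₇)) (upd (upd Ξ₃ 3 R′) 4 Q)

            pathR : List Ix → Bool
            pathR = loopO 2 advance (λ vs → ⟦ trailStartF ⟧ 39 5 (bindAll 37 vs ρ₇) (upd Ξ₃ 3 R′))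

            path-eq : Matches² (route ch (tableOf R′)) pathR
            path-eq = subst (Matches² (route ch (tableOf R′))) (≡sym (loopO-def 2 advance (start [] R′)))
              (loopV-rel Matches² 2 {λ _ → trailStep} {advance} one (trailStart z (diff ch (tableOf R′))) (start [] R′) (λ _ _ → refl))
              where
              one : ∀ ts A Q → length ts ≡ 2 → Matches² A Q → Matches² (trailStep A) (advance ts Q)
              one (_ ∷ _ ∷ []) A Q refl h i j = trans (trailStep-cong h i j) refl

            step-eq : stepT ch (tableOf R′) (p , q , r , s) u v ≡ tabF us R′ (p ∷ q ∷ r ∷ s ∷ u ∷ v ∷ [])
            step-eq = trans (stepWith-cong ch {tableOf R′} {tableOf R′} (λ _ _ _ → refl) path-eq (p , q , r , s) u v) refl

        table-step : ∀ r s → r ≡ 8 → s ≡ 21 → ∀ us τ R′ → length us ≡ r + s → MatchesT τ R′ →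
          MatchesT (stepT (choiceOf (drop r us)) τ) (tabF us R′)
        table-step .8 .21 refl refl
          (a₁ ∷ a₂ ∷ a₃ ∷ a₄ ∷ a₅ ∷ a₆ ∷ a₇ ∷ a₈ ∷ x₁ ∷ x₂ ∷ x₃ ∷ x₄ ∷ b₁ ∷ b₂ ∷ b₃ ∷ b₄ ∷ c₁ ∷ c₂ ∷ c₃ ∷ c₄ ∷
           d₁ ∷ d₂ ∷ d₃ ∷ d₄ ∷ z ∷ y₁ ∷ y₂ ∷ y₃ ∷ y₄ ∷ []) τ R′ refl h p q r s u v =
          trans (stepT-cong c {τ} {tableOf R′} (λ { (p , q , r , s) u v → h p q r s u v }) (p , q , r , s) u v)
            (step-eq a₁ a₂ a₃ a₄ a₅ a₆ a₇ a₈ x₁ x₂ x₃ x₄ b₁ b₂ b₃ b₄ c₁ c₂ c₃ c₄ d₁ d₂ d₃ d₄ z y₁ y₂ y₃ y₄ R′ p q r s u v)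
          where
          c : Choice (length w)
          c = choice (x₁ , x₂ , x₃ , x₄) (b₁ , b₂ , b₃ , b₄) (c₁ , c₂ , c₃ , c₄) (d₁ , d₂ , d₃ , d₄) z y₁ y₂ y₃ y₄

        tabR-eq : ∀ r s → r ≡ 8 → s ≡ 21 → MatchesT (search r s) tabR
        tabR-eq r s e e′ = subst (λ n → MatchesT (search r s) (loopO n tabF tab₀)) (cong₂ _+_ e e′)
          (subst (MatchesT (search r s)) (≡sym (loopO-def (r + s) tabF tab₀))
            (loopV-rel MatchesT (r + s) {λ us → stepT (choiceOf (drop r us))} {tabF} (table-step r s e e′) table₀ tab₀ tab₀-eq))

-- What the decision formula tests.

module Outcomes where

  open import Data.Fin using (fromℕ)
  open Formulas
  open Cuts
  open Exchanges
  open Trails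
  open LocalSearch
  open SearchRuns
  open DecisionFormula

  flip-not : ∀ {b} → not b ≡ true → b ≡ false
  flip-not {false} _ = refl

  anyB-unique : ∀ {n} (P Q : Fin n → Bool) x → P x ≡ true → (∀ y → P y ≡ true → y ≡ x) → anyB (λ y → P y ∧ Q y) ≡ Q x
  anyB-unique P Q x p u = bool-ext
    (λ h → let y , e = anyB-elim (λ y → P y ∧ Q y) h ; e₁ , e₂ = ∧-true {P y} e in subst (λ z → Q z ≡ true) (u y e₁) e₂)
    (λ q → anyB-intro (λ y → P y ∧ Q y) x (∧-intro p q))

  sum-two : ∀ {n} {l f : Fin n} (h : Fin n → ℕ) → l ≢ f → (∀ b → eqB b l ≡ false → eqB b f ≡ false → h b ≡ 0) → sum h ≡ h l + h f
  sum-two {n} {l} {f} h l≢f z = trans (sum-cong-≗ split) (trans (∑-distrib-+ (λ b → b2n (eqB l b) * h b) (λ b → b2n (eqB f b) * h b)) (cong₂ _+_ (sum-point l h) (sum-point f h)))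
    where
    split : ∀ b → h b ≡ b2n (eqB l b) * h b + b2n (eqB f b) * h b
    split b with eqB l b in e | eqB f b in e′
    ... | true  | true  = ⊥-elim (l≢f (trans (eqB-true l b e) (≡sym (eqB-true f b e′))))
    ... | true  | false = ≡sym (trans (+-identityʳ _) (+-identityʳ (h b)))
    ... | false | true  = ≡sym (+-identityʳ (h b))
    ... | false | false = z b (trans (eqB-sym b l) e) (trans (eqB-sym b f) e′)

  module _ {N : ℕ} where

    -- Two positions l ≠ f serve as tags selecting one of four predicates.
    tagged : (l f : Fin N) (P₁ P₂ P₃ P₄ : Graph² {N}) → ℕ
    tagged l f P₁ P₂ P₃ P₄ = sum (λ b → sum (λ b′ → sum² (λ u v → b2n (
      (eqB b l ∧ ((eqB b′ l ∧ P₁ u v) orB (eqB b′ f ∧ P₂ u v))) orB (eqB b f ∧ ((eqB b′ l ∧ P₃ u v) orB (eqB b′ f ∧ P₄ u v)))))))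

    dartCount : Graph² {N} → ℕ
    dartCount A = sum² (λ u v → b2n (A u v))

    sum²-zero : (f : Fin N → Fin N → ℕ) → (∀ u v → f u v ≡ 0) → sum² f ≡ 0
    sum²-zero f h = sum-zero (λ u → sum-zero (h u))

    tagged-count : ∀ {l f} → l ≢ f → ∀ P₁ P₂ P₃ P₄ → tagged l f P₁ P₂ P₃ P₄ ≡ (dartCount P₁ + dartCount P₂) + (dartCount P₃ + dartCount P₄)
    tagged-count {l} {f} l≢f P₁ P₂ P₃ P₄ =
      trans (sum-two (λ b → sum (λ b′ → sum² (cell b b′))) l≢f (λ b e e′ → sum-zero (λ b′ → sum²-zero _ (λ u v → dead b b′ u v e e′))))
        (cong₂ _+_ (half l (λ b′ u v → first-half b′ u v)) (half f (λ b′ u v → second-half b′ u v)))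
      where
      cell : Fin N → Fin N → Fin N → Fin N → ℕ
      cell b b′ u v = b2n ((eqB b l ∧ ((eqB b′ l ∧ P₁ u v) orB (eqB b′ f ∧ P₂ u v))) orB (eqB b f ∧ ((eqB b′ l ∧ P₃ u v) orB (eqB b′ f ∧ P₄ u v))))
      dead : ∀ b b′ u v → eqB b l ≡ false → eqB b f ≡ false → cell b b′ u v ≡ 0
      dead b b′ u v e e′ rewrite e | e′ = refl
      two : Fin N → Fin N → Fin N → Bool → Bool → ℕ
      two b′ u v p q = b2n ((eqB b′ l ∧ p) orB (eqB b′ f ∧ q))
      orB-false : ∀ b → (b orB false) ≡ b
      orB-false true  = refl
      orB-false false = refl
      false-orB : ∀ b → (false orB b) ≡ b
      false-orB true  = refl
      false-orB false = refl
      first-half : ∀ b′ u v → cell l b′ u v ≡ two b′ u v (P₁ u v) (P₂ u v)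
      first-half b′ u v rewrite eqB-refl l | eqB-false l≢f = cong b2n (orB-false ((eqB b′ l ∧ P₁ u v) orB (eqB b′ f ∧ P₂ u v)))
      second-half : ∀ b′ u v → cell f b′ u v ≡ two b′ u v (P₃ u v) (P₄ u v)
      second-half b′ u v rewrite eqB-refl f | eqB-false (l≢f ∘ ≡sym) = cong b2n (false-orB ((eqB b′ l ∧ P₃ u v) orB (eqB b′ f ∧ P₄ u v)))
      half : ∀ b {p q : Graph² {N}} → (∀ b′ u v → cell b b′ u v ≡ two b′ u v (p u v) (q u v)) → sum (λ b′ → sum² (cell b b′)) ≡ dartCount p + dartCount q
      half b {p} {q} h = trans (sum-cong-≗ (λ b′ → sum²-cong (h b′)))
        (trans (sum-two (λ b′ → sum² (λ u v → two b′ u v (p u v) (q u v))) l≢f (λ b′ e e′ → sum²-zero _ (λ u v → none b′ u v e e′)))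
          (cong₂ _+_ (sum²-cong at-l) (sum²-cong at-f)))
        where
        none : ∀ b′ u v → eqB b′ l ≡ false → eqB b′ f ≡ false → two b′ u v (p u v) (q u v) ≡ 0
        none b′ u v e e′ rewrite e | e′ = refl
        at-l : ∀ u v → two l u v (p u v) (q u v) ≡ b2n (p u v)
        at-l u v rewrite eqB-refl l | eqB-false l≢f = cong b2n (orB-false (p u v))
        at-f : ∀ u v → two f u v (p u v) (q u v) ≡ b2n (q u v)
        at-f u v rewrite eqB-refl f | eqB-false (l≢f ∘ ≡sym) = cong b2n (false-orB (q u v))

    column-count : ∀ (l : Fin N) (V : Fin N → Bool) → dartCount (λ u v → eqB v l ∧ V u) ≡ count V
    column-count l V = sum-cong-≗ (λ u → trans (sum-cong-≗ (λ v → trans (b2n-∧ (eqB v l) (V u)) (cong (λ b → b2n b * b2n (V u)) (eqB-sym v l)))) (sum-point l (λ _ → b2n (V u))))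

  module Decision (s : Sym) (w′ : List Sym) (2≤ : 1 ≤ length w′) where

    open Meaning (s ∷ w′)

    -- The last position has two roles: it is a tag in the final count and the apex of the search.
    l f : Ix
    l = fromℕ (length w′)
    f = zero

    l≢f : l ≢ f
    l≢f e = <⇒≢ 2≤ (≡sym (trans (≡sym (FP.toℕ-fromℕ (length w′))) (cong toℕ e)))

    record Join (A K : G²) : Set where
      field
        k-sym : ∀ u v → K u v ≡ K v u
        k-adj : ∀ u v → K u v ≡ true → A u v ≡ true
        k-bd  : ∀ v → xsum (K v) ≡ xsum (A v)

    k2-cong : ∀ {A A′} → (∀ u v → A u v ≡ A′ u v) → ∀ u v → k2B A u v ≡ k2B A′ u v
    k2-cong h u v = cong₂ _∧_ (h u v) (cong₂ _∧_ (cong not (anyB-cong (λ x → cong (_∧ not (eqB x v)) (h u x)))) (cong not (anyB-cong (λ x → cong (_∧ not (eqB x u)) (h v x)))))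

    tagged-cong : ∀ {P₁ P₂ P₃ P₄ Q₁ Q₂ Q₃ Q₄ : G²} → P₁ ≗² Q₁ → P₂ ≗² Q₂ → P₃ ≗² Q₃ → P₄ ≗² Q₄ → tagged l f P₁ P₂ P₃ P₄ ≡ tagged l f Q₁ Q₂ Q₃ Q₄
    tagged-cong h₁ h₂ h₃ h₄ = sum-cong-≗ (λ b → sum-cong-≗ (λ b′ → sum²-cong (λ u v → cong b2n
      (cong₂ (λ x y → (eqB b l ∧ x) orB (eqB b f ∧ y)) (cong₂ (λ x y → (eqB b′ l ∧ x) orB (eqB b′ f ∧ y)) (h₁ u v) (h₂ u v))
                                                       (cong₂ (λ x y → (eqB b′ l ∧ x) orB (eqB b′ f ∧ y)) (h₃ u v) (h₄ u v))))))

    finalB-cong : ∀ {A A′ V V′ W W′ J J′} → A ≗² A′ → (∀ u → V u ≡ V′ u) → (∀ u → W u ≡ W′ u) → J ≗² J′ → finalB l f A V W J ≡ finalB l f A′ V′ W′ J′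
    finalB-cong {A} {A′} hA hV hW hJ = cong₂ _∧_ (cong not (anyB-cong (λ v → cong₂ _∧_ (hV v) (cong not (anyB-cong (hA v))))))
      (cong not (cong₂ _<ᵇ_ (tagged-cong vv vv ww ww) (tagged-cong hA hJ (k2-cong hA) (k2-cong hA))))
      where
      vv : ∀ u v → (eqB v l ∧ _) ≡ (eqB v l ∧ _)
      vv u v = cong (eqB v l ∧_) (hV u)
      ww : ∀ u v → (eqB v l ∧ _) ≡ (eqB v l ∧ _)
      ww u v = cong (eqB v l ∧_) (hW u)

    Fits : G² → (Ix → Bool) → (Ix → Bool) → G² → Set
    Fits A V W J = (∀ v → V v ≡ true → ∃ λ u → A v u ≡ true) ×
      ((dartCount A + dartCount J) + (dartCount (k2B A) + dartCount (k2B A)) ≤ (count V + count V) + (count W + count W))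

    left-count : ∀ A J → tagged l f A J (k2B A) (k2B A) ≡ (dartCount A + dartCount J) + (dartCount (k2B A) + dartCount (k2B A))
    left-count A J = tagged-count l≢f A J (k2B A) (k2B A)

    right-count : ∀ V W → tagged l f (λ u v → eqB v l ∧ V u) (λ u v → eqB v l ∧ V u) (λ u v → eqB v l ∧ W u) (λ u v → eqB v l ∧ W u) ≡ (count V + count V) + (count W + count W)
    right-count V W = trans (tagged-count l≢f (λ u v → eqB v l ∧ V u) (λ u v → eqB v l ∧ V u) (λ u v → eqB v l ∧ W u) (λ u v → eqB v l ∧ W u)) (cong₂ (λ a b → (a + a) + (b + b)) (column-count l V) (column-count l W))

    finalB-sound : ∀ A V W J → finalB l f A V W J ≡ true → Fits A V W J
    finalB-sound A V W J h with h₁ , h₂ ← ∧-true {not (anyB (λ v → V v ∧ not (anyB (λ u → A v u))))} h =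
      (λ v e → anyB-elim (A v) (true-or (anyB-none (λ v → V v ∧ not (anyB (λ u → A v u))) (flip-not h₁) v) e)) ,
      subst₂ _≤_ (left-count A J) (right-count V W) (≮⇒≥ (λ x<y → false≢true (<ᵇ-intro x<y) (flip-not h₂)))
      where
      true-or : ∀ {a b} → a ∧ not b ≡ false → a ≡ true → b ≡ true
      true-or {true} {true} _ _ = refl

    finalB-complete : ∀ A V W J → Fits A V W J → finalB l f A V W J ≡ true
    finalB-complete A V W J (h₁ , h₂) = ∧-intro
      (cong not (not-true (λ e → let v , e′ = anyB-elim (λ v → V v ∧ not (anyB (λ u → A v u))) e ; p , q = ∧-true {V v} e′ ; u , r = h₁ v p
                                 in false≢true (anyB-intro (A v) u r) (flip-not q))))
      (cong not (not-true (λ e → <⇒≱ (true-<ᵇ _ _ e) (subst₂ _≤_ (≡sym (left-count A J)) (≡sym (right-count V W)) h₂))))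

    last-only : ∀ x → not (anyB (λ y → ltB x y)) ≡ true → x ≡ l
    last-only x h with <-cmp (toℕ x) (toℕ l)
    ... | tri≈ _ e _ = FP.toℕ-injective e
    ... | tri< x<y _ _ = false≢true (<ᵇ-intro x<y) (anyB-none (λ y → ltB x y) (flip-not h) l)
    ... | tri> _ _ gt = ⊥-elim (<⇒≱ gt (≤-trans (≤-pred (FP.toℕ<n x)) (≤-reflexive (≡sym (FP.toℕ-fromℕ (length w′))))))

    last-is : not (anyB (λ y → ltB l y)) ≡ true
    last-is = cong not (not-true (λ e → let y , x<y = anyB-elim (λ y → ltB l y) e in
      <⇒≱ (true-<ᵇ (toℕ l) (toℕ y) x<y) (≤-trans (≤-pred (FP.toℕ<n y)) (≤-reflexive (≡sym (FP.toℕ-fromℕ (length w′)))))))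

    first-only : ∀ x → not (anyB (λ y → ltB y x)) ≡ true → x ≡ f
    first-only zero    h = refl
    first-only (suc x) h = false≢true refl (anyB-none (λ y → ltB y (suc x)) (flip-not h) zero)

    first-is : not (anyB (λ y → ltB y f)) ≡ true
    first-is = cong not (not-true (λ e → let y , x<y = anyB-elim (λ y → ltB y f) e in false≢true x<y refl))

    at-ends : ∀ (m : Ix → Ix → Bool) → anyB (λ x → not (anyB (λ y → ltB x y)) ∧ anyB (λ y → not (anyB (λ z → ltB z y)) ∧ m x y)) ≡ m l f
    at-ends m = trans (anyB-unique (λ x → not (anyB (λ y → ltB x y))) (λ x → anyB (λ y → not (anyB (λ z → ltB z y)) ∧ m x y)) l last-is last-only)
      (anyB-unique (λ x → not (anyB (λ y → ltB y x))) (m l) f first-is first-only)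

    module _ (A : G²) (V W : Ix → Bool)
      (A-eq : ∀ u v → adjB u v ≡ A u v) (V-eq : ∀ u → vertB u ≡ V u) (W-eq : ∀ u → kvB l f f u ≡ W u)
      (A-sym : ∀ u v → A u v ≡ A v u) (A-irr : ∀ u → A u u ≡ false) (A-l : ∀ v → A l v ≡ false)
      (few : sum² (λ u v → b2n (A u v)) < suc (length w′)) (ρ : Env) (Ξ : Rels) where

      raw : G²
      raw u v = adjR ρ Ξ l f (u ∷ v ∷ [])

      raw-eq : raw ≗² A
      raw-eq u v = trans (adjR-eq ρ Ξ l f u v) (A-eq u v)

      module Sr = Search raw l (λ u v → trans (raw-eq u v) (trans (A-sym u v) (≡sym (raw-eq v u)))) (λ u → trans (raw-eq u u) (A-irr u))
        (λ v → trans (raw-eq l v) (A-l v)) (≤-trans (s≤s (≤-reflexive (sum²-cong (λ u v → cong b2n (raw-eq u v))))) few) (s≤s 2≤)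

      decide-main : decideB ρ Ξ ≡ mainB ρ Ξ l f
      decide-main = trans (decide-eq ρ Ξ) (at-ends (mainB ρ Ξ))

      module _ (r s : ℕ) (r≡8 : r ≡ 8) (s≡21 : s ≡ 21) where

        open Sr.Result r s r≡8 s≡21

        main-final : mainB ρ Ξ l f ≡ finalB l f A V W J*
        main-final = trans (main-eq ρ Ξ l f) (finalB-cong {raw} {A} {λ u → vertR ρ Ξ l f (u ∷ [])} {V} {λ u → kvR ρ Ξ l f (f ∷ u ∷ [])} {W} {λ u v → tabR ρ Ξ l f (l ∷ l ∷ l ∷ l ∷ u ∷ v ∷ [])} {J*}
          raw-eq (λ u → trans (vertR-eq ρ Ξ l f u) (V-eq u)) (λ u → trans (≡sym (kvR-eq ρ Ξ l f f u)) (W-eq u))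
          (λ u v → ≡sym (tabR-eq ρ Ξ l f r s r≡8 s≡21 l l l l u v)))

        J*-Join : Join A J*
        J*-Join = record { k-sym = proj₁ J*-join ; k-adj = λ u v e → trans (≡sym (raw-eq u v)) (proj₁ (proj₂ J*-join) u v e)
                         ; k-bd = λ v → trans (proj₂ (proj₂ J*-join) v) (xsum-cong (raw-eq v)) }

        J*-least : ∀ K → Join A K → dartCount J* ≤ dartCount K
        J*-least K′ j = J*-minimal K′ (Join.k-sym j , (λ u v e → trans (raw-eq u v) (Join.k-adj j u v e)) , λ v → trans (Join.k-bd j v) (≡sym (xsum-cong (raw-eq v))))

        outcome : ∃ λ J → Join A J × (∀ K → Join A K → dartCount J ≤ dartCount K) × decideB ρ Ξ ≡ finalB l f A V W J
        outcome = J* , J*-Join , J*-least , trans decide-main main-final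

-- Inclusive splits as surjective homomorphisms.

module Coverings where

  open Cuts
  open Exchanges
  open Trails

  -- The graphs obtainable from G by inclusive splits are those with a
  -- homomorphism to G that is surjective on vertices and on edges.

  record Covers (G H : Graph) (f : Fin (n H) → Fin (n G)) : Set where
    field
      onto  : ∀ u → ∃ λ a → f a ≡ u
      hom   : ∀ a b → adj H a b ≡ true → adj G (f a) (f b) ≡ true
      edge⁺ : ∀ u w → adj G u w ≡ true → ∃ λ a → ∃ λ b → f a ≡ u × f b ≡ w × adj H a b ≡ true
  open Covers

  covers-∘ : ∀ {G H K f g} → Covers G H f → Covers H K g → Covers G K (f ∘ g)
  covers-∘ {f = f} {g} c d = record
    { onto = λ u → let a , e = onto c u ; b , e′ = onto d a in b , trans (cong f e′) e
    ; hom = λ a b h → hom c (g a) (g b) (hom d a b h)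
    ; edge⁺ = λ u w h → let a , b , ea , eb , h′ = edge⁺ c u w h ; a′ , b′ , ea′ , eb′ , h″ = edge⁺ d a b h′
                        in a′ , b′ , trans (cong f ea′) ea , trans (cong f eb′) eb , h″ }

  module _ {G H : Graph} (s : InclusiveSplit G H) where
    open InclusiveSplit s

    split-covers : Covers G H f
    split-covers = record { onto = surj ; hom = hom′ ; edge⁺ = edge′ }
      where
      hom′ : ∀ a b → adj H a b ≡ true → adj G (f a) (f b) ≡ true
      hom′ a b h with f a FP.≟ v | f b FP.≟ v
      ... | yes e | _ = subst (λ x → adj G x (f b) ≡ true) (≡sym e) (adj-new a b e h)
      ... | no _ | yes e = trans (Graph.sym G (f a) (f b)) (subst (λ x → adj G x (f a) ≡ true) (≡sym e) (adj-new b a e (trans (Graph.sym H b a) h)))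
      ... | no x | no y = trans (≡sym (adj-off a b x y)) h
      from-v : ∀ b → adj G v (f b) ≡ true → ∃ λ a → f a ≡ v × adj H a b ≡ true
      from-v b h with cover b h
      ... | inj₁ e = v₁ , fv₁ , e
      ... | inj₂ e = v₂ , fv₂ , e
      edge′ : ∀ u w → adj G u w ≡ true → ∃ λ a → ∃ λ b → f a ≡ u × f b ≡ w × adj H a b ≡ true
      edge′ u w h with surj u | surj w | u FP.≟ v | w FP.≟ v
      ... | _ | b , refl | yes refl | _ = let a , e , h′ = from-v b h in a , b , e , refl , h′
      ... | a , refl | _ | no _ | yes refl = let b , e , h′ = from-v a (trans (Graph.sym G v (f a)) h) in a , b , refl , e , trans (Graph.sym H a b) h′
      ... | a , refl | b , refl | no x | no y = a , b , refl , refl , trans (adj-off a b x y) h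

    -- Sending `v₁` to a new point turns the split map into an injection.
    split-size : n H ≤ suc (n G)
    split-size = FP.injective⇒≤ {f = g} inj
      where
      g : Fin (n H) → Fin (suc (n G))
      g a with a FP.≟ v₁
      ... | yes _ = zero
      ... | no _  = suc (f a)
      other : ∀ {a} → f a ≡ v → a ≢ v₁ → a ≡ v₂
      other {a} e n with fiber-v a e
      ... | inj₁ x = ⊥-elim (n x)
      ... | inj₂ x = x
      inj : ∀ {a b} → g a ≡ g b → a ≡ b
      inj {a} {b} e with a FP.≟ v₁ | b FP.≟ v₁
      ... | yes x | yes y = trans x (≡sym y)
      ... | no x | no y with FP.suc-injective e | f a FP.≟ v
      ... | e′ | yes z = trans (other z x) (≡sym (other (trans (≡sym e′) z) y))
      ... | e′ | no z = inj-off a b z e′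

  splits-cover : ∀ {k G H} → SplitsAtMost k G H → ∃ λ f → Covers G H f × n H ≤ n G + k
  splits-cover {k} {G} done = id , record { onto = λ u → u , refl ; hom = λ _ _ h → h ; edge⁺ = λ u w h → u , w , refl , refl , h } , m≤m+n (n G) k
  splits-cover {suc k} {G} (step s r) with f , c , le ← splits-cover r =
    InclusiveSplit.f s ∘ f , covers-∘ (split-covers s) c , ≤-trans le (≤-trans (+-monoˡ-≤ k (split-size s)) (≤-reflexive (≡sym (+-suc (n G) k))))

  splits-mono : ∀ {k k′ G H} → k ≤ k′ → SplitsAtMost k G H → SplitsAtMost k′ G H
  splits-mono h       done       = done
  splits-mono (s≤s h) (step s r) = step s (splits-mono h r)

  -- Two vertices of H over one vertex of G allow a split in between: i receives a copy of its own,
  -- the rest of its fibre keeps the old vertex, and the edges are the images of the edges of H. The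
  -- result is still covered by H.
  module SplitOff {G H : Graph} {f : Fin (n H) → Fin (n G)} (c : Covers G H f) {i j : Fin (n H)} (i≢j : i ≢ j) (fij : f i ≡ f j) where

    g : Fin (n H) → Fin (suc (n G))
    g a with a FP.≟ i
    ... | yes _ = zero
    ... | no _  = suc (f a)

    back : Fin (suc (n G)) → Fin (n G)
    back zero    = f i
    back (suc u) = u

    back-g : ∀ a → back (g a) ≡ f a
    back-g a with a FP.≟ i
    ... | yes e = cong f (≡sym e)
    ... | no _  = refl

    g-i : g i ≡ zero
    g-i with i FP.≟ i
    ... | yes _ = refl
    ... | no n = ⊥-elim (n refl)

    g-other : ∀ {a} → a ≢ i → g a ≡ suc (f a)
    g-other {a} h with a FP.≟ i
    ... | yes e = ⊥-elim (h e)
    ... | no _  = refl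

    abstract
      link : Fin (suc (n G)) → Fin (suc (n G)) → Bool
      link x y = anyB (λ a → anyB (λ b → eqB (g a) x ∧ (eqB (g b) y ∧ adj H a b)))

      link-elim : ∀ x y → link x y ≡ true → ∃ λ a → ∃ λ b → g a ≡ x × g b ≡ y × adj H a b ≡ true
      link-elim x y h =
        let a , h₁ = anyB-elim (λ a → anyB (λ b → eqB (g a) x ∧ (eqB (g b) y ∧ adj H a b))) h
            b , h₂ = anyB-elim (λ b → eqB (g a) x ∧ (eqB (g b) y ∧ adj H a b)) h₁
            e₁ , h₃ = ∧-true {eqB (g a) x} h₂
            e₂ , h₄ = ∧-true {eqB (g b) y} h₃
        in a , b , eqB-true (g a) x e₁ , eqB-true (g b) y e₂ , h₄

      link-intro : ∀ a b → adj H a b ≡ true → link (g a) (g b) ≡ true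
      link-intro a b h = anyB-intro (λ a′ → anyB (λ b′ → eqB (g a′) (g a) ∧ (eqB (g b′) (g b) ∧ adj H a′ b′))) a
        (anyB-intro (λ b′ → eqB (g a) (g a) ∧ (eqB (g b′) (g b) ∧ adj H a b′)) b (∧-intro (eqB-refl (g a)) (∧-intro (eqB-refl (g b)) h)))

    link-sym : ∀ x y → link x y ≡ true → link y x ≡ true
    link-sym x y h with a , b , refl , refl , e ← link-elim x y h = link-intro b a (trans (Graph.sym H b a) e)

    G′ : Graph
    G′ = record { n = suc (n G) ; adj = link ; sym = λ x y → bool-ext (link-sym x y) (link-sym y x) ; irrefl = λ x → not-true (no-loop x) }
      where
      no-loop : ∀ x → link x x ≢ true
      no-loop x h with a , b , ea , eb , e ← link-elim x x h =
        false≢true (subst (λ z → adj G z (f b) ≡ true) (trans (≡sym (back-g a)) (trans (cong back (trans ea (≡sym eb))) (back-g b))) (hom c a b e)) (irrefl G (f b))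

    g-covers : Covers G′ H g
    g-covers = record { onto = onto′ ; hom = link-intro ; edge⁺ = link-elim }
      where
      onto′ : ∀ x → ∃ λ a → g a ≡ x
      onto′ zero = i , g-i
      onto′ (suc u) with onto c u
      ... | a , e with a FP.≟ i
      ... | no h     = a , trans (g-other h) (cong suc e)
      ... | yes refl = j , trans (g-other (i≢j ∘ ≡sym)) (cong suc (trans (≡sym fij) e))

    is-split : InclusiveSplit G G′
    is-split = record
      { f = back ; v = f i ; v₁ = zero ; v₂ = suc (f i) ; v₁≢v₂ = λ () ; fv₁ = refl ; fv₂ = refl
      ; fiber-v = λ { zero _ → inj₁ refl ; (suc u) e → inj₂ (cong suc e) }
      ; surj = λ u → suc u , refl ; inj-off = inj ; adj-off = off ; adj-new = new ; cover = cov }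
      where
      inj : ∀ a b → back a ≢ f i → back a ≡ back b → a ≡ b
      inj zero    b       h e = ⊥-elim (h refl)
      inj (suc u) zero    h e = ⊥-elim (h e)
      inj (suc u) (suc w) h e = cong suc e
      keep : ∀ {a u} → f a ≡ u → u ≢ f i → g a ≡ suc u
      keep {a} e h = trans (g-other (λ x → h (trans (≡sym e) (cong f x)))) (cong suc e)
      down : ∀ x y → link x y ≡ true → adj G (back x) (back y) ≡ true
      down x y h with a , b , refl , refl , e ← link-elim x y h =
        subst₂ (λ p q → adj G p q ≡ true) (≡sym (back-g a)) (≡sym (back-g b)) (hom c a b e)
      off : ∀ a b → back a ≢ f i → back b ≢ f i → link a b ≡ adj G (back a) (back b)
      off zero    b       h h′ = ⊥-elim (h refl)
      off (suc u) zero    h h′ = ⊥-elim (h′ refl)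
      off (suc u) (suc w) h h′ = bool-ext (down (suc u) (suc w)) up′
        where
        up′ : adj G u w ≡ true → link (suc u) (suc w) ≡ true
        up′ e with a , b , ea , eb , e′ ← edge⁺ c u w e = subst₂ (λ x y → link x y ≡ true) (keep ea h) (keep eb h′) (link-intro a b e′)
      new : ∀ a b → back a ≡ f i → link a b ≡ true → adj G (f i) (back b) ≡ true
      new a b e h = subst (λ x → adj G x (back b) ≡ true) e (down a b h)
      cov : ∀ b → adj G (f i) (back b) ≡ true → link zero b ≡ true ⊎ link (suc (f i)) b ≡ true
      cov zero h = false≢true h (irrefl G (f i))
      cov (suc w) h with a , b , ea , eb , e ← edge⁺ c (f i) w h
        with gb ← keep eb (λ x → false≢true (subst (λ z → adj G (f i) z ≡ true) x h) (irrefl G (f i))) with a FP.≟ i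
      ... | yes refl = inj₁ (subst₂ (λ x y → link x y ≡ true) g-i gb (link-intro i b e))
      ... | no ne = inj₂ (subst₂ (λ x y → link x y ≡ true) (trans (g-other ne) (cong suc ea)) gb (link-intro a b e))

  module Transport {G H : Graph} {f : Fin (n H) → Fin (n G)} (c : Covers G H f) (size : n H ≡ n G) (cyc : IsCycleGraph H) where
    open IsCycleGraph cyc

    h : Fin (n G) → Fin (n H)
    h u = proj₁ (onto c u)

    fh : ∀ u → f (h u) ≡ u
    fh u = proj₂ (onto c u)

    -- A vertex of H missed by the section h would, together with the image of h, give more vertices
    -- than H has.
    hf : ∀ a → h (f a) ≡ a
    hf a with h (f a) FP.≟ a
    ... | yes e = e
    ... | no ne = ⊥-elim (1+n≰n (≤-trans (FP.injective⇒≤ {f = k} k-inj) (≤-reflexive size)))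
      where
      k : Fin (suc (n G)) → Fin (n H)
      k zero    = a
      k (suc u) = h u
      k-inj : ∀ {x y} → k x ≡ k y → x ≡ y
      k-inj {zero}  {zero}  e = refl
      k-inj {zero}  {suc u} e = ⊥-elim (ne (trans (cong (h ∘ f) e) (trans (cong h (fh u)) (≡sym e))))
      k-inj {suc u} {zero}  e = ⊥-elim (ne (trans (cong (h ∘ f) (≡sym e)) (trans (cong h (fh u)) e)))
      k-inj {suc u} {suc w} e = cong suc (trans (≡sym (fh u)) (trans (cong f e) (fh w)))

    transported : IsCycleGraph G
    transported = record
      { σ = f ∘ σ ∘ h ; σ⁻¹ = f ∘ σ⁻¹ ∘ h
      ; inv₁ = λ a → trans (cong (f ∘ σ⁻¹) (hf _)) (trans (cong f (inv₁ (h a))) (fh a))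
      ; inv₂ = λ a → trans (cong (f ∘ σ) (hf _)) (trans (cong f (inv₂ (h a))) (fh a))
      ; len≥3₁ = λ a e → len≥3₁ (h a) (trans (≡sym (hf _)) (cong h e))
      ; len≥3₂ = λ a e → len≥3₂ (h a) (trans (cong σ (≡sym (hf _))) (trans (≡sym (hf _)) (cong h e)))
      ; edges = edges-G
      ; edges′ = λ a → subst (λ x → adj G x (f (σ (h a))) ≡ true) (fh a) (hom c (h a) (σ (h a)) (edges′ (h a))) }
      where
      edges-G : ∀ u w → adj G u w ≡ true → w ≡ f (σ (h u)) ⊎ u ≡ f (σ (h w))
      edges-G u w e with a , b , refl , refl , e′ ← edge⁺ c u w e with edges a b e′
      ... | inj₁ x = inj₁ (trans (cong f x) (cong (f ∘ σ) (≡sym (hf a))))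
      ... | inj₂ x = inj₂ (trans (cong f x) (cong (f ∘ σ) (≡sym (hf b))))

  -- As long as H is larger than its base, two of its vertices have the same image and can be
  -- separated by a split; at equal size the covering is an isomorphism.
  cover-splits : ∀ m {G H f} → Covers G H f → n H ≡ n G + m → IsCycleGraph H → ∃ λ H′ → SplitsAtMost m G H′ × IsCycleGraph H′
  cover-splits zero {G} c e cyc = G , done , Transport.transported c (trans e (+-identityʳ _)) cyc
  cover-splits (suc m) {G} {H} {f} c e cyc
    with i , j , i<j , fij ← FP.pigeonhole {m = n G} {n = n H} (≤-trans (≤-trans (m≤m+n (suc (n G)) m) (≤-reflexive (≡sym (+-suc (n G) m)))) (≤-reflexive (≡sym e))) f
    with H′ , s , cyc′ ← cover-splits m (SplitOff.g-covers c (FP.<⇒≢ i<j) fij) (trans e (+-suc (n G) m)) cyc =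
    H′ , step (SplitOff.is-split c (FP.<⇒≢ i<j) fij) s , cyc′

-- Necessity: the inequality for graphs covered by cycles.

module Necessity where

  open Formulas using (b2n)
  open Cuts
  open Exchanges
  open Trails
  open LocalSearch using (sum-const)
  open Coverings
  open import Data.Fin.Permutation using (permutation)

  record TJoin {N : ℕ} (A K : Graph² {N}) : Set where
    field
      t-sym : ∀ u v → K u v ≡ K v u
      t-adj : ∀ u v → K u v ≡ true → A u v ≡ true
      t-bd  : ∀ v → xsum (K v) ≡ xsum (A v)

  module _ {N : ℕ} where

    dartsOf : Graph² {N} → ℕ
    dartsOf A = sum² (λ u v → b2n (A u v))

    abstract
      -- The darts of the K₂ components: neither end has another neighbour.
      single : Graph² {N} → Graph² {N}
      single A u v = A u v ∧ (not (anyB (λ x → A u x ∧ not (eqB x v))) ∧ not (anyB (λ x → A v x ∧ not (eqB x u))))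

      single-def : ∀ A u v → single A u v ≡ A u v ∧ (not (anyB (λ x → A u x ∧ not (eqB x v))) ∧ not (anyB (λ x → A v x ∧ not (eqB x u))))
      single-def A u v = refl

      private
        only : (A : Graph² {N}) → ∀ u v → not (anyB (λ x → A u x ∧ not (eqB x v))) ≡ true → ∀ x → A u x ≡ true → x ≡ v
        only A u v h x e with x FP.≟ v
        ... | yes p = p
        ... | no n = ⊥-elim (clash h (anyB-intro (λ x → A u x ∧ not (eqB x v)) x (∧-intro e (cong not (eqB-false n)))))
          where
          clash : ∀ {b} → not b ≡ true → b ≡ true → ⊥
          clash {true} () _

        other : (A : Graph² {N}) → ∀ u v → anyB (λ x → A u x ∧ not (eqB x v)) ≡ true → ∃ λ x → A u x ≡ true × x ≢ v
        other A u v h = let x , e = anyB-elim (λ x → A u x ∧ not (eqB x v)) h ; e₁ , e₂ = ∧-true {A u x} e in x , e₁ , λ p → clash p e₂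
          where
          clash : ∀ {x} → x ≡ v → not (eqB x v) ≡ true → ⊥
          clash refl e with () ← trans (≡sym e) (cong not (eqB-refl v))

      single-elim : ∀ A u v → single A u v ≡ true → A u v ≡ true × (∀ x → A u x ≡ true → x ≡ v) × (∀ x → A v x ≡ true → x ≡ u)
      single-elim A u v h = let e₁ , e₂ = ∧-true {A u v} h ; e₃ , e₄ = ∧-true {not (anyB (λ x → A u x ∧ not (eqB x v)))} e₂
                            in e₁ , only A u v e₃ , only A v u e₄

      single-cases : ∀ A u v → A u v ≡ true → single A u v ≡ true ⊎ ((∃ λ x → A u x ≡ true × x ≢ v) ⊎ (∃ λ x → A v x ≡ true × x ≢ u))
      single-cases A u v h = decide (anyB (λ x → A u x ∧ not (eqB x v))) (anyB (λ x → A v x ∧ not (eqB x u))) refl refl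
        where
        decide : ∀ b c → anyB (λ x → A u x ∧ not (eqB x v)) ≡ b → anyB (λ x → A v x ∧ not (eqB x u)) ≡ c →
          single A u v ≡ true ⊎ ((∃ λ x → A u x ≡ true × x ≢ v) ⊎ (∃ λ x → A v x ≡ true × x ≢ u))
        decide true  c     p q = inj₂ (inj₁ (other A u v p))
        decide false true  p q = inj₂ (inj₂ (other A v u q))
        decide false false p q = inj₁ (∧-intro h (∧-intro (cong not p) (cong not q)))

  sum-one : ∀ {n} (i : Fin n) → sum (λ k → b2n (eqB i k)) ≡ 1
  sum-one i = sum-unique (eqB i) i (eqB-refl i) (λ j e → ≡sym (eqB-true i j e))

  two≤sum : ∀ {n} (f : Fin n → Bool) i j → f i ≡ true → f j ≡ true → i ≢ j → 2 ≤ sum (λ k → b2n (f k))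
  two≤sum f i j fi fj i≢j = ≤-trans (≤-reflexive (≡sym (trans (∑-distrib-+ (λ k → b2n (eqB i k)) (λ k → b2n (eqB j k))) (cong₂ _+_ (sum-one i) (sum-one j)))))
    (sum-mono each)
    where
    each : ∀ k → b2n (eqB i k) + b2n (eqB j k) ≤ b2n (f k)
    each k with eqB i k in e | eqB j k in e′
    ... | false | false = z≤n
    ... | true  | false rewrite ≡sym (eqB-true i k e) | fi = ≤-refl
    ... | false | true  rewrite ≡sym (eqB-true j k e′) | fj = ≤-refl
    ... | true  | true  = ⊥-elim (i≢j (trans (eqB-true i k e) (≡sym (eqB-true j k e′))))

  one≤sum : ∀ {n} (f : Fin n → Bool) i → f i ≡ true → 1 ≤ sum (λ k → b2n (f k))
  one≤sum f i e = ≤-trans (≤-reflexive (cong b2n (≡sym e))) (term≤sum (λ k → b2n (f k)) i)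

  odd-double : ∀ m → odd (m + m) ≡ false
  odd-double m = trans (odd-+ m m) (xor-same (odd m))

  -- Counting darts of closed walks: t lists the vertices visited, σ is the
  -- successor, and μ u w is the number of traversals of the edge uw.

  module Walks {N h : ℕ} (t : Fin h → Fin N) (σ σ⁻¹ : Fin h → Fin h) (inv₁ : ∀ a → σ⁻¹ (σ a) ≡ a) (inv₂ : ∀ a → σ (σ⁻¹ a) ≡ a) where

    m : Fin N → Fin N → ℕ
    m u w = sum (λ a → b2n (eqB (t a) u ∧ eqB (t (σ a)) w))

    μ : Fin N → Fin N → ℕ
    μ u w = m u w + m w u

    visits : Fin N → ℕ
    visits u = sum (λ a → b2n (eqB (t a) u))

    row : ∀ u → sum (λ w → m u w) ≡ visits u
    row u = trans (∑-comm (λ w a → b2n (eqB (t a) u ∧ eqB (t (σ a)) w))) (sum-cong-≗ (λ a →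
      trans (sum-cong-≗ (λ w → b2n-∧ (eqB (t a) u) (eqB (t (σ a)) w))) (trans (sum-* (b2n (eqB (t a) u)) (λ w → b2n (eqB (t (σ a)) w)))
        (trans (cong (b2n (eqB (t a) u) *_) (sum-one (t (σ a)))) (*-identityʳ _)))))

    column : ∀ w → sum (λ u → m u w) ≡ visits w
    column w = trans (∑-comm (λ u a → b2n (eqB (t a) u ∧ eqB (t (σ a)) w))) (trans (sum-cong-≗ (λ a →
        trans (sum-cong-≗ (λ u → trans (b2n-∧ (eqB (t a) u) (eqB (t (σ a)) w)) (*-comm (b2n (eqB (t a) u)) _))) (trans (sum-* (b2n (eqB (t (σ a)) w)) (λ u → b2n (eqB (t a) u)))
          (trans (cong (b2n (eqB (t (σ a)) w) *_) (sum-one (t a))) (*-identityʳ _)))))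
      (≡sym (∑-permute (λ a → b2n (eqB (t a) w)) (permutation σ σ⁻¹ inv₂ inv₁))))

    degree : ∀ u → sum (λ w → μ u w) ≡ visits u + visits u
    degree u = trans (∑-distrib-+ (m u) (λ w → m w u)) (cong₂ _+_ (row u) (column u))

    total : sum² m ≡ h
    total = trans (sum-cong-≗ row) (trans (∑-comm (λ u a → b2n (eqB (t a) u))) (trans (sum-cong-≗ (λ a → sum-one (t a))) (trans (sum-const h 1) (*-identityʳ h))))

    total-μ : sum² μ ≡ h + h
    total-μ = trans (sum²-+ m (λ u w → m w u)) (cong₂ _+_ total (trans (∑-comm (λ u w → m w u)) total))

  module Forward (G : Graph) {H : Graph} {f : Fin (n H) → Fin (n G)} (c : Covers G H f) (cyc : IsCycleGraph H) where
    open IsCycleGraph cyc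
    open Walks f σ σ⁻¹ inv₁ inv₂
    open Covers c

    A : Graph² {n G}
    A = adj G

    m-positive : ∀ u w → 0 < m u w → A u w ≡ true
    m-positive u w p = let a , q = sum-positive (λ a → b2n (eqB (f a) u ∧ eqB (f (σ a)) w)) p
                           e₁ , e₂ = ∧-true {eqB (f a) u} (positive-true q)
                       in subst₂ (λ x y → A x y ≡ true) (eqB-true (f a) u e₁) (eqB-true (f (σ a)) w e₂) (hom a (σ a) (edges′ a))

    μ-positive : ∀ u w → A u w ≡ true → 1 ≤ μ u w
    μ-positive u w h with edge⁺ u w h
    ... | a , b , refl , refl , e with edges a b e
    ... | inj₁ refl = ≤-trans (one≤sum (λ k → eqB (f k) (f a) ∧ eqB (f (σ k)) (f (σ a))) a (∧-intro (eqB-refl (f a)) (eqB-refl (f (σ a))))) (m≤m+n _ _)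
    ... | inj₂ refl = ≤-trans (one≤sum (λ k → eqB (f k) (f b) ∧ eqB (f (σ k)) (f (σ b))) b (∧-intro (eqB-refl (f b)) (eqB-refl (f (σ b))))) (m≤n+m _ (m (f (σ b)) (f b)))

    μ-zero : ∀ u w → A u w ≡ false → μ u w ≡ 0
    μ-zero u w h = cong₂ _+_ (none u w h) (none w u (trans (Graph.sym G w u) h))
      where
      none : ∀ u w → A u w ≡ false → m u w ≡ 0
      none u w h with m u w in e
      ... | zero  = refl
      ... | suc _ = false≢true (m-positive u w (≤-trans (s≤s z≤n) (≤-reflexive (≡sym e)))) h

    μ-sym : ∀ u w → μ u w ≡ μ w u
    μ-sym u w = +-comm (m u w) (m w u)

    J : Graph² {n G}
    J u w = A u w xor odd (μ u w)

    σ-inj : ∀ {a b} → σ a ≡ σ b → a ≡ b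
    σ-inj {a} {b} e = trans (≡sym (inv₁ a)) (trans (cong σ⁻¹ e) (inv₁ b))

    -- Over such an edge the walk can only alternate between the two ends. Since σ (σ a) differs
    -- from a, each of the two darts is traversed at two different times.
    μ-single : ∀ u w → single A u w ≡ true → 4 ≤ μ u w
    μ-single u w h with single-elim A u w h
    ... | auw , ou , ow with onto u
    ... | a , refl = +-mono-≤
          (two≤sum (λ k → eqB (f k) (f a) ∧ eqB (f (σ k)) w) a (σ (σ a)) (at a refl s₁) (at (σ (σ a)) s₂ s₃) (λ e → len≥3₂ a (≡sym e)))
          (two≤sum (λ k → eqB (f k) w ∧ eqB (f (σ k)) (f a)) (σ a) (σ (σ (σ a))) (at′ (σ a) s₁ s₂) (at′ (σ (σ (σ a))) s₃ s₄) (λ e → len≥3₂ a (≡sym (σ-inj e))))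
      where
      next : ∀ b → A (f b) (f (σ b)) ≡ true
      next b = hom b (σ b) (edges′ b)
      s₁ : f (σ a) ≡ w
      s₁ = ou _ (next a)
      s₂ : f (σ (σ a)) ≡ f a
      s₂ = ow _ (subst (λ x → A x (f (σ (σ a))) ≡ true) s₁ (next (σ a)))
      s₃ : f (σ (σ (σ a))) ≡ w
      s₃ = ou _ (subst (λ x → A x (f (σ (σ (σ a)))) ≡ true) s₂ (next (σ (σ a))))
      s₄ : f (σ (σ (σ (σ a)))) ≡ f a
      s₄ = ow _ (subst (λ x → A x (f (σ (σ (σ (σ a))))) ≡ true) s₃ (next (σ (σ (σ a)))))
      at : ∀ k → f k ≡ f a → f (σ k) ≡ w → eqB (f k) (f a) ∧ eqB (f (σ k)) w ≡ true
      at k e e′ rewrite e | e′ = ∧-intro (eqB-refl (f a)) (eqB-refl w)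
      at′ : ∀ k → f k ≡ w → f (σ k) ≡ f a → eqB (f k) w ∧ eqB (f (σ k)) (f a) ≡ true
      at′ k e e′ rewrite e | e′ = ∧-intro (eqB-refl w) (eqB-refl (f a))

    -- An edge traversed μ times contributes 1 to A + J if μ is odd and 2 if μ is even, hence at
    -- most μ. For a K₂ component the left side is at most 2 + 2, which four traversals cover.
    dart-cost : ∀ u w → (b2n (A u w) + b2n (J u w)) + (b2n (single A u w) + b2n (single A u w)) ≤ μ u w
    dart-cost u w = cases (A u w) (single A u w) refl refl
      where
      small : ∀ a o → b2n a + b2n (a xor o) ≤ 2
      small true  true  = s≤s z≤n
      small true  false = ≤-refl
      small false true  = s≤s z≤n
      small false false = z≤n
      parity : ∀ x → 1 ≤ x → 1 + b2n (true xor odd x) ≤ x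
      parity (suc zero)    h = s≤s z≤n
      parity (suc (suc x)) h = ≤-trans (small true (odd (suc (suc x)))) (s≤s (s≤s z≤n))
      cases : ∀ a s → A u w ≡ a → single A u w ≡ s → (b2n (A u w) + b2n (J u w)) + (b2n (single A u w) + b2n (single A u w)) ≤ μ u w
      cases a true ea es = ≤-trans (+-mono-≤ (small (A u w) (odd (μ u w))) (+-mono-≤ (b2n≤1 (single A u w)) (b2n≤1 (single A u w)))) (μ-single u w es)
        where
        b2n≤1 : ∀ b → b2n b ≤ 1
        b2n≤1 true  = ≤-refl
        b2n≤1 false = z≤n
      cases true false ea es rewrite es | ea = ≤-trans (≤-reflexive (+-identityʳ _)) (parity (μ u w) (μ-positive u w ea))
      cases false false ea es rewrite es | ea | μ-zero u w ea = z≤n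

    J-join : TJoin A J
    J-join = record
      { t-sym = λ u w → cong₂ _xor_ (Graph.sym G u w) (cong odd (μ-sym u w))
      ; t-adj = λ u w h → in-A (A u w) refl h
      ; t-bd = λ v → trans (XS.∑-distrib-+ (A v) (λ w → odd (μ v w))) (trans (cong (xsum (A v) xor_)
          (trans (≡sym (odd-sum (μ v))) (trans (cong odd (degree v)) (odd-double (visits v))))) (xor-identityʳ _)) }
      where
      in-A : ∀ {u w} a → A u w ≡ a → J u w ≡ true → A u w ≡ true
      in-A true  e h = e
      in-A {u} {w} false e h = false≢true h (trans (cong₂ (λ a x → a xor odd x) e (μ-zero u w e)) refl)

    inequality : (dartsOf A + dartsOf J) + (dartsOf (single A) + dartsOf (single A)) ≤ n H + n H
    inequality = ≤-trans (≤-reflexive (≡sym (trans (sum²-+ (λ u w → b2n (A u w) + b2n (J u w)) (λ u w → b2n (single A u w) + b2n (single A u w)))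
        (cong₂ _+_ (sum²-+ (λ u w → b2n (A u w)) (λ u w → b2n (J u w))) (sum²-+ (λ u w → b2n (single A u w)) (λ u w → b2n (single A u w)))))))
      (≤-trans (sum²-mono dart-cost) (≤-reflexive total-μ))

    no-isolated : ∀ u → ∃ λ w → A u w ≡ true
    no-isolated u with onto u
    ... | a , refl = f (σ a) , hom a (σ a) (edges′ a)

  -- Counting darts doubles every term of the inequality. As `single` has two darts for each of the
  -- κ components, it occurs twice to give 4 κ.
  Feasible : (G : Graph) → ℕ → Set
  Feasible G k = (∀ u → ∃ λ w → adj G u w ≡ true) ×
    ∃ λ J → TJoin (adj G) J × (dartsOf (adj G) + dartsOf J) + (dartsOf (single (adj G)) + dartsOf (single (adj G))) ≤ (n G + n G) + (k + k)

  forward : ∀ G k → CGIVS G k → Feasible G k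
  forward G k (H , s , cyc) with splits-cover s
  ... | f , c , le = no-isolated , J , J-join , ≤-trans inequality (≤-trans (+-mono-≤ le le) (≤-reflexive (arrange (n G) k)))
    where
    open Forward G c cyc
    arrange : ∀ n k → (n + k) + (n + k) ≡ (n + n) + (k + k)
    arrange = solve-∀

-- Sufficiency: closed walks from an even multigraph.

module Sufficiency where

  open import Data.Fin using (cast)
  open import Data.List using (map; lookup; replicate)
  open import Function using (Inverse)
  open import Relation.Nullary.Decidable using (_×-dec_; ¬?)
  open Formulas using (b2n)
  open Cuts
  open Exchanges
  open Trails
  open LocalSearch using (sum-point)
  open Coverings
  open Necessity
  open import Data.Fin.Permutation using (Permutation; permutation)
  open import Data.List.Membership.Propositional using (_∈_)
  open import Data.List.Membership.Propositional.Properties using (∈-++⁺ˡ; ∈-++⁺ʳ; ∈-++⁻)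
  open import Data.List.Relation.Unary.Any using (here; there; index)
  open import Data.List.Relation.Unary.Any.Properties using (lookup-index)
  open import Data.List.Relation.Binary.Pointwise as PW using (Pointwise; []; _∷_)
  open import Data.List.Relation.Binary.Permutation.Propositional using (_↭_; prep; swap; ↭-sym; ↭⇒↭ₛ) renaming (refl to ↭refl; trans to ↭trans)
  open import Data.List.Relation.Binary.Permutation.Propositional.Properties using (map⁺; ↭-length)
  import Data.List.Relation.Binary.Permutation.Setoid as PS
  import Data.List.Relation.Binary.Permutation.Setoid.Properties as PSP

  module Orientation {N : ℕ} where

    E : Set
    E = Fin N × Fin N

    data Flip : E → E → Set where
      same    : ∀ {e} → Flip e e
      flipped : ∀ {u w} → Flip (u , w) (w , u)

    parity : Fin N → List E → Bool
    parity v []             = false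
    parity v ((u , w) ∷ es) = (eqB u v xor eqB w v) xor parity v es

    parity-↭ : ∀ v {es fs} → es ↭ fs → parity v es ≡ parity v fs
    parity-↭ v ↭refl = refl
    parity-↭ v (prep (u , w) p) = cong ((eqB u v xor eqB w v) xor_) (parity-↭ v p)
    parity-↭ v (swap (u , w) (x , y) p) = trans (truthTable 3 (λ a b c → a xor (b xor c)) (λ a b c → b xor (a xor c)) refl (eqB u v xor eqB w v) (eqB x v xor eqB y v) _)
      (cong (λ z → (eqB x v xor eqB y v) xor ((eqB u v xor eqB w v) xor z)) (parity-↭ v p))
    parity-↭ v (↭trans p q) = trans (parity-↭ v p) (parity-↭ v q)

    incident : ∀ v es → parity v es ≡ true → ∃ λ e → ∃ λ fs → es ↭ e ∷ fs × (proj₁ e ≡ v ⊎ proj₂ e ≡ v)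
    incident v ((u , w) ∷ es) h with u FP.≟ v | w FP.≟ v
    ... | yes e | _     = (u , w) , es , ↭refl , inj₁ e
    ... | no _  | yes e = (u , w) , es , ↭refl , inj₂ e
    ... | no a  | no b with incident v es (trans (≡sym (cong₂ (λ x y → (x xor y) xor parity v es) (eqB-false a) (eqB-false b))) h)
    ... | e , fs , p , q = e , (u , w) ∷ fs , ↭trans (prep (u , w) p) (swap (u , w) e ↭refl) , q

    -- Carries an orientation of the rearranged list back to the original order of the edges.
    transfer : ∀ {es fs os} → es ↭ fs → Pointwise Flip fs os → ∃ λ qs → Pointwise Flip es qs × qs ↭ os
    transfer ↭refl p = _ , p , ↭refl
    transfer (prep x p) (r ∷ rs) = let qs , a , b = transfer p rs in _ ∷ qs , r ∷ a , prep _ b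
    transfer (swap x y p) (r ∷ r′ ∷ rs) = let qs , a , b = transfer p rs in _ , r′ ∷ r ∷ a , swap _ _ b
    transfer (↭trans p q) rs = let qs , a , b = transfer q rs ; qs′ , a′ , b′ = transfer p a in qs′ , a′ , ↭trans b′ b

    -- Equal in- and out-degrees, expressed by a permutation because this permutation is what yields
    -- the successor of each arc.
    Balanced : List E → Set
    Balanced os = map proj₁ os ↭ map proj₂ os

    -- Two edges uw, wx at a common vertex are merged into ux, oriented
    -- recursively, and the arc obtained is subdivided again.

    orient : ∀ k es → length es ≤ k → (∀ v → parity v es ≡ false) → ∃ λ os → Pointwise Flip es os × Balanced os
    orient k [] l p = [] , [] , ↭refl
    orient (suc k) ((u , w) ∷ es) (s≤s l) p with u FP.≟ w
    ... | yes refl = let os , a , b = orient k es l (λ v → trans (cong (_xor parity v es) (≡sym (xor-same (eqB u v)))) (p v)) in (u , u) ∷ os , same ∷ a , prep u b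
    ... | no u≢w with incident w es odd-rest
      where
      odd-rest : parity w es ≡ true
      odd-rest = flip-it (parity w es) (trans (cong₂ (λ x y → (x xor y) xor parity w es) (≡sym (eqB-false u≢w)) (≡sym (eqB-refl w))) (p w))
        where
        flip-it : ∀ b → not b ≡ false → b ≡ true
        flip-it true _ = refl
    ... | (y , y′) , fs , perm , touches = at-w touches
      where
      shorter : suc (length fs) ≤ k
      shorter = ≤-trans (≤-reflexive (≡sym (↭-length perm))) l
      merge : ∀ x → (∀ v → eqB y v xor eqB y′ v ≡ eqB w v xor eqB x v) → Flip (y , y′) (w , x) → Flip (y , y′) (x , w) →
        ∃ λ os → Pointwise Flip ((u , w) ∷ es) os × Balanced os
      merge x par-e f₁ f₂ with orient k ((u , x) ∷ fs) shorter (λ v → trans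
          (truthTable 4 (λ a b c d → (a xor c) xor d) (λ a b c d → (a xor b) xor ((b xor c) xor d)) refl (eqB u v) (eqB w v) (eqB x v) (parity v fs))
          (trans (cong (λ z → (eqB u v xor eqB w v) xor (z xor parity v fs)) (≡sym (par-e v))) (trans (cong ((eqB u v xor eqB w v) xor_) (≡sym (parity-↭ v perm))) (p v))))
      ... | _ ∷ os , same ∷ a , b with transfer (prep (u , w) perm) (same ∷ f₁ ∷ a)
      ... | qs , a′ , b′ = qs , a′ , ↭trans (map⁺ proj₁ b′) (↭trans (↭trans (swap u w ↭refl) (prep w b)) (↭-sym (map⁺ proj₂ b′)))
      merge x par-e f₁ f₂ | _ ∷ os , flipped ∷ a , b with transfer (prep (u , w) perm) (flipped ∷ f₂ ∷ a)
      ... | qs , a′ , b′ = qs , a′ , ↭trans (map⁺ proj₁ b′) (↭trans (↭trans (prep w b) (swap w u ↭refl)) (↭-sym (map⁺ proj₂ b′)))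
      at-w : y ≡ w ⊎ y′ ≡ w → ∃ λ os → Pointwise Flip ((u , w) ∷ es) os × Balanced os
      at-w (inj₁ refl) = merge y′ (λ v → refl) same flipped
      at-w (inj₂ refl) = merge y (λ v → truthTable 2 (λ a b → a xor b) (λ a b → b xor a) refl (eqB y v) (eqB w v)) flipped same

    sumL : (E → ℕ) → List E → ℕ
    sumL φ []       = 0
    sumL φ (e ∷ es) = φ e + sumL φ es

    sumL-++ : ∀ φ es fs → sumL φ (es ++ fs) ≡ sumL φ es + sumL φ fs
    sumL-++ φ []       fs = refl
    sumL-++ φ (e ∷ es) fs = trans (cong (φ e +_) (sumL-++ φ es fs)) (≡sym (+-assoc (φ e) _ _))

    sumL-replicate : ∀ φ k e → sumL φ (replicate k e) ≡ k * φ e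
    sumL-replicate φ zero    e = refl
    sumL-replicate φ (suc k) e = cong (φ e +_) (sumL-replicate φ k e)

    sumL-lookup : ∀ φ es → sum (λ i → φ (lookup es i)) ≡ sumL φ es
    sumL-lookup φ []       = refl
    sumL-lookup φ (e ∷ es) = cong (φ e +_) (sumL-lookup φ es)

    sumL-length : ∀ es → sumL (λ _ → 1) es ≡ length es
    sumL-length []       = refl
    sumL-length (e ∷ es) = cong suc (sumL-length es)

    touch : Fin N → E → ℕ
    touch v (u , w) = b2n (eqB u v) + b2n (eqB w v)

    parity-touch : ∀ v es → odd (sumL (touch v) es) ≡ parity v es
    parity-touch v []             = refl
    parity-touch v ((u , w) ∷ es) = trans (odd-+ (touch v (u , w)) _) (cong₂ _xor_ (trans (odd-+ (b2n (eqB u v)) _) (cong₂ _xor_ (odd-b2n (eqB u v)) (odd-b2n (eqB w v)))) (parity-touch v es))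

    touch-flip : ∀ v {es os} → Pointwise Flip es os → sumL (touch v) es ≡ sumL (touch v) os
    touch-flip v []             = refl
    touch-flip v (same ∷ p)     = cong (touch v _ +_) (touch-flip v p)
    touch-flip v (flipped {u} {w} ∷ p) = cong₂ _+_ (+-comm (b2n (eqB u v)) _) (touch-flip v p)

    ∈-replicate⁻ : ∀ k {x e : E} → e ∈ replicate k x → e ≡ x
    ∈-replicate⁻ (suc k) (here p)  = p
    ∈-replicate⁻ (suc k) (there m) = ∈-replicate⁻ k m

    concatF : ∀ {n} → (Fin n → List E) → List E
    concatF {zero}  f = []
    concatF {suc n} f = f zero ++ concatF (f ∘ suc)

    sumL-concatF : ∀ φ {n} (f : Fin n → List E) → sumL φ (concatF f) ≡ sum (λ i → sumL φ (f i))
    sumL-concatF φ {zero}  f = refl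
    sumL-concatF φ {suc n} f = trans (sumL-++ φ (f zero) _) (cong (sumL φ (f zero) +_) (sumL-concatF φ (f ∘ suc)))

    ∈-concatF⁺ : ∀ {n} (f : Fin n → List E) i {e} → e ∈ f i → e ∈ concatF f
    ∈-concatF⁺ f zero    h = ∈-++⁺ˡ h
    ∈-concatF⁺ f (suc i) h = ∈-++⁺ʳ (f zero) (∈-concatF⁺ (f ∘ suc) i h)

    ∈-concatF⁻ : ∀ {n} (f : Fin n → List E) {e} → e ∈ concatF f → ∃ λ i → e ∈ f i
    ∈-concatF⁻ {suc n} f h with ∈-++⁻ (f zero) h
    ... | inj₁ p = zero , p
    ... | inj₂ p = let i , q = ∈-concatF⁻ (f ∘ suc) p in suc i , q

    ∈-flip : ∀ {es os e} → Pointwise Flip es os → e ∈ es → e ∈ os ⊎ (proj₂ e , proj₁ e) ∈ os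
    ∈-flip (same ∷ p)    (here refl) = inj₁ (here refl)
    ∈-flip (flipped ∷ p) (here refl) = inj₂ (here refl)
    ∈-flip (_ ∷ p) (there h) with ∈-flip p h
    ... | inj₁ q = inj₁ (there q)
    ... | inj₂ q = inj₂ (there q)

    flip-∈ : ∀ {es os e} → Pointwise Flip es os → e ∈ os → e ∈ es ⊎ (proj₂ e , proj₁ e) ∈ es
    flip-∈ (same ∷ p)    (here refl) = inj₁ (here refl)
    flip-∈ (flipped ∷ p) (here refl) = inj₂ (here refl)
    flip-∈ (_ ∷ p) (there h) with flip-∈ p h
    ... | inj₁ q = inj₁ (there q)
    ... | inj₂ q = inj₂ (there q)

    lookup-map : ∀ {B : Set} (f : E → B) es (i : Fin (length es)) → lookup (map f es) (cast (≡sym (LP.length-map f es)) i) ≡ f (lookup es i)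
    lookup-map f (e ∷ es) zero    = refl
    lookup-map f (e ∷ es) (suc i) = lookup-map f es i

    -- Matching each head with an equal tail lets every arc be followed by one that starts where it
    -- ends; the orbits are closed walks.
    module Successor (os : List E) (b : Balanced os) where

      heads↭tails : PS._↭_ (setoid (Fin N)) (map proj₂ os) (map proj₁ os)
      heads↭tails = ↭⇒↭ₛ (↭-sym b)

      π : Permutation (length (map proj₂ os)) (length (map proj₁ os))
      π = PS.onIndices heads↭tails

      to₂ : Fin (length os) → Fin (length (map proj₂ os))
      to₂ = cast (≡sym (LP.length-map proj₂ os))
      from₁ : Fin (length (map proj₁ os)) → Fin (length os)
      from₁ = cast (LP.length-map proj₁ os)
      to₁ : Fin (length os) → Fin (length (map proj₁ os))
      to₁ = cast (≡sym (LP.length-map proj₁ os))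
      from₂ : Fin (length (map proj₂ os)) → Fin (length os)
      from₂ = cast (LP.length-map proj₂ os)

      σ σ⁻¹ : Fin (length os) → Fin (length os)
      σ a   = from₁ (Inverse.to π (to₂ a))
      σ⁻¹ a = from₂ (Inverse.from π (to₁ a))

      to₁-from₁ : ∀ x → to₁ (from₁ x) ≡ x
      to₁-from₁ x = FP.cast-involutive (≡sym (LP.length-map proj₁ os)) (LP.length-map proj₁ os) x
      to₂-from₂ : ∀ x → to₂ (from₂ x) ≡ x
      to₂-from₂ x = FP.cast-involutive (≡sym (LP.length-map proj₂ os)) (LP.length-map proj₂ os) x

      σ⁻¹-σ : ∀ a → σ⁻¹ (σ a) ≡ a
      σ⁻¹-σ a = trans (cong (from₂ ∘ Inverse.from π) (to₁-from₁ _)) (trans (cong from₂ (Inverse.strictlyInverseʳ π _)) (FP.cast-involutive (LP.length-map proj₂ os) (≡sym (LP.length-map proj₂ os)) a))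

      σ-σ⁻¹ : ∀ a → σ (σ⁻¹ a) ≡ a
      σ-σ⁻¹ a = trans (cong (from₁ ∘ Inverse.to π) (to₂-from₂ _)) (trans (cong from₁ (Inverse.strictlyInverseˡ π _)) (FP.cast-involutive (LP.length-map proj₁ os) (≡sym (LP.length-map proj₁ os)) a))

      tail-σ : ∀ a → proj₁ (lookup os (σ a)) ≡ proj₂ (lookup os a)
      tail-σ a = trans (≡sym (lookup-map proj₁ os (σ a))) (trans (cong (lookup (map proj₁ os)) (to₁-from₁ _))
        (trans (≡sym (PSP.onIndices-lookup (setoid (Fin N)) heads↭tails (to₂ a))) (lookup-map proj₂ os a)))

  -- Closed walks of length two are removed by exchanging the successors of
  -- two visits to the same vertex.

  module Repair {N h : ℕ} (A : Graph² {N}) (A-irr : ∀ u → A u u ≡ false) (t : Fin h → Fin N)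
    (rich : ∀ u w → single A u w ≡ true → ∀ a → t a ≡ u → ∃ λ b → b ≢ a × t b ≡ u) where

    record Tour : Set where
      field
        σ σ⁻¹ : Fin h → Fin h
        inv₁  : ∀ a → σ⁻¹ (σ a) ≡ a
        inv₂  : ∀ a → σ (σ⁻¹ a) ≡ a
        steps : ∀ a → A (t a) (t (σ a)) ≡ true
        all   : ∀ u w → A u w ≡ true → ∃ λ a → (t a ≡ u × t (σ a) ≡ w) ⊎ (t a ≡ w × t (σ a) ≡ u)

    bad : Tour → ℕ
    bad T = sum (λ a → b2n (eqB (Tour.σ T (Tour.σ T a)) a))

    module Swap (T : Tour) (a b : Fin h) (σσa : Tour.σ T (Tour.σ T a) ≡ a) (b≢a : b ≢ a) (tb : t b ≡ t a) where
      open Tour T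

      ex : Fin h → Fin h
      ex x with x FP.≟ a | x FP.≟ b
      ... | yes _ | _     = b
      ... | no _  | yes _ = a
      ... | no _  | no _  = x

      ex-a : ex a ≡ b
      ex-a with a FP.≟ a
      ... | yes _ = refl
      ... | no n  = ⊥-elim (n refl)

      ex-b : ex b ≡ a
      ex-b with b FP.≟ a | b FP.≟ b
      ... | yes e | _     = e
      ... | no _  | yes _ = refl
      ... | no _  | no n  = ⊥-elim (n refl)

      ex-other : ∀ {x} → x ≢ a → x ≢ b → ex x ≡ x
      ex-other {x} n m with x FP.≟ a | x FP.≟ b
      ... | yes e | _     = ⊥-elim (n e)
      ... | no _  | yes e = ⊥-elim (m e)
      ... | no _  | no _  = refl

      ex-ex : ∀ x → ex (ex x) ≡ x
      ex-ex x = by (x FP.≟ a) (x FP.≟ b)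
        where
        by : _ → _ → ex (ex x) ≡ x
        by (yes refl) _ = trans (cong ex ex-a) ex-b
        by (no _) (yes refl) = trans (cong ex ex-b) ex-a
        by (no n) (no m) = trans (cong ex (ex-other n m)) (ex-other n m)

      t-ex : ∀ x → t (ex x) ≡ t x
      t-ex x = by (x FP.≟ a) (x FP.≟ b)
        where
        by : _ → _ → t (ex x) ≡ t x
        by (yes refl) _ = trans (cong t ex-a) tb
        by (no _) (yes refl) = trans (cong t ex-b) (≡sym tb)
        by (no n) (no m) = cong t (ex-other n m)

      σ-inj : ∀ {x y} → σ x ≡ σ y → x ≡ y
      σ-inj {x} {y} e = trans (≡sym (inv₁ x)) (trans (cong σ⁻¹ e) (inv₁ y))

      exchanged : Tour
      exchanged = record
        { σ = σ ∘ ex ; σ⁻¹ = ex ∘ σ⁻¹ ; inv₁ = λ x → trans (cong ex (inv₁ (ex x))) (ex-ex x) ; inv₂ = λ x → trans (cong σ (ex-ex (σ⁻¹ x))) (inv₂ x)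
        ; steps = λ x → subst (λ z → A z (t (σ (ex x))) ≡ true) (t-ex x) (steps (ex x))
        ; all = λ u w e → cover (all u w e) }
        where
        cover : ∀ {u w} → (∃ λ x → (t x ≡ u × t (σ x) ≡ w) ⊎ (t x ≡ w × t (σ x) ≡ u)) → ∃ λ x → (t x ≡ u × t (σ (ex x)) ≡ w) ⊎ (t x ≡ w × t (σ (ex x)) ≡ u)
        cover (x , inj₁ (e , e′)) = ex x , inj₁ (trans (t-ex x) e , trans (cong (t ∘ σ) (ex-ex x)) e′)
        cover (x , inj₂ (e , e′)) = ex x , inj₂ (trans (t-ex x) e , trans (cong (t ∘ σ) (ex-ex x)) e′)

      t≢ : ∀ x → t (σ x) ≢ t x
      t≢ x e = false≢true (subst (λ z → A (t x) z ≡ true) e (steps x)) (A-irr (t x))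

      a′≢a : σ a ≢ a
      a′≢a e = t≢ a (cong t e)
      a′≢b : σ a ≢ b
      a′≢b e = t≢ a (trans (cong t e) tb)
      b′≢b : σ b ≢ b
      b′≢b e = t≢ b (cong t e)
      b′≢a : σ b ≢ a
      b′≢a e = a′≢b (≡sym (σ-inj (trans e (≡sym σσa))))
      b′≢a′ : σ b ≢ σ a
      b′≢a′ e = b≢a (σ-inj e)

      new-a : σ (ex (σ (ex a))) ≢ a
      new-a e = b′≢a′ (σ-inj (trans (trans (≡sym (trans (cong (σ ∘ ex ∘ σ) ex-a) (cong σ (ex-other b′≢a b′≢b)))) e) (≡sym σσa)))

      -- Exchanging the successors of a and b merges the orbit of a, which has length two, with the
      -- orbit of b. The latter is a different orbit, as b is neither a nor σ a, and it has length
      -- at least two, so the merged orbit is long enough and all others are unchanged.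
      only-old : ∀ x → σ (ex (σ (ex x))) ≡ x → σ (σ x) ≡ x
      only-old x e = by (x FP.≟ a) (x FP.≟ b) (σ x FP.≟ a) (σ x FP.≟ b)
        where
        by : _ → _ → _ → _ → σ (σ x) ≡ x
        by (yes refl) _ _ _ = ⊥-elim (new-a e)
        by (no _) (yes refl) _ _ = ⊥-elim (b≢a (trans (≡sym e) (trans (cong (σ ∘ ex ∘ σ) ex-b) (trans (cong σ (ex-other a′≢a a′≢b)) σσa))))
        by (no n) (no m) (yes p) _ = ⊥-elim (b′≢a′ (trans (≡sym (trans (cong (σ ∘ ex ∘ σ) (ex-other n m)) (cong σ (trans (cong ex p) ex-a)))) (trans e (σ-inj (trans p (≡sym σσa))))))
        by (no n) (no m) (no _) (yes p) = ⊥-elim (b≢a (trans (≡sym p) (trans (cong σ (≡sym (trans (≡sym (trans (cong (σ ∘ ex ∘ σ) (ex-other n m)) (cong σ (trans (cong ex p) ex-b)))) e))) σσa)))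
        by (no n) (no m) (no p) (no q) = trans (≡sym (trans (cong (σ ∘ ex ∘ σ) (ex-other n m)) (cong σ (ex-other p q)))) e

      fewer : bad exchanged < bad T
      fewer = sum-strict a each (≤-trans (s≤s (≤-reflexive (cong b2n (eqB-false new-a)))) (≤-reflexive (≡sym (cong b2n (trans (cong (λ z → eqB z a) σσa) (eqB-refl a))))))
        where
        each : ∀ x → b2n (eqB (σ (ex (σ (ex x)))) x) ≤ b2n (eqB (σ (σ x)) x)
        each x with eqB (σ (ex (σ (ex x)))) x in e
        ... | false = z≤n
        ... | true rewrite only-old x (eqB-true _ x e) | eqB-refl x = ≤-refl

    -- On a K₂ component `rich` supplies a second visit. Otherwise one end of the edge has a further
    -- neighbour, and the tour visits that end again when it traverses the further edge.
    partner : (T : Tour) → ∀ a → Tour.σ T (Tour.σ T a) ≡ a → ∃ λ a* → Tour.σ T (Tour.σ T a*) ≡ a* × ∃ λ b → b ≢ a* × t b ≡ t a*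
    partner T a e = by (single-cases A (t a) (t (σ a)) (steps a))
      where
      open Tour T
      Result : Set
      Result = ∃ λ a* → σ (σ a*) ≡ a* × ∃ λ b → b ≢ a* × t b ≡ t a*
      another : ∀ a → σ (σ a) ≡ a → ∀ x → A (t a) x ≡ true → x ≢ t (σ a) → ∃ λ b → b ≢ a × t b ≡ t a
      another a e x h n with all (t a) x h
      ... | c , inj₁ (p , q) = c , (λ { refl → n (≡sym q) }) , p
      ... | c , inj₂ (p , q) = σ c , (λ r → n (trans (≡sym p) (cong t (trans (≡sym (inv₁ c)) (trans (cong σ⁻¹ (trans r (≡sym e))) (inv₁ (σ a))))))) , q
      by : single A (t a) (t (σ a)) ≡ true ⊎ ((∃ λ x → A (t a) x ≡ true × x ≢ t (σ a)) ⊎ (∃ λ x → A (t (σ a)) x ≡ true × x ≢ t a)) → Result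
      by (inj₁ s) = a , e , rich (t a) (t (σ a)) s a refl
      by (inj₂ (inj₁ (x , h , n))) = a , e , another a e x h n
      by (inj₂ (inj₂ (x , h , n))) = σ a , cong σ e , another (σ a) (cong σ e) x h (λ p → n (trans p (cong t e)))

    repair : ∀ k (T : Tour) → bad T ≤ k → ∃ λ T′ → ∀ a → Tour.σ T′ (Tour.σ T′ a) ≢ a
    repair k T le with FP.any? (λ a → Tour.σ T (Tour.σ T a) FP.≟ a)
    ... | no none = T , λ a e → none (a , e)
    ... | yes (a , e) with partner T a e
    ... | a* , e* , b , b≢ , tb with Swap.fewer T a* b e* b≢ tb
    repair zero T le    | yes (a , e) | a* , e* , b , b≢ , tb | lt′ = ⊥-elim (<⇒≱ (≤-trans (s≤s z≤n) lt′) le)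
    repair (suc k) T le | yes (a , e) | a* , e* , b , b≢ , tb | lt′ = repair k (Swap.exchanged T a* b e* b≢ tb) (≤-pred (≤-trans lt′ le))

  module Backward (G : Graph) (no-isolated : ∀ u → ∃ λ w → adj G u w ≡ true) (J : Graph² {n G}) (jJ : TJoin (adj G) J) where
    open Orientation {n G}
    open TJoin jJ

    A : Graph² {n G}
    A = adj G

    -- `g` is the multiplicity as a symmetric matrix; `g′` keeps the half with u < w, so that every
    -- edge is listed once.
    g g′ : Fin (n G) → Fin (n G) → ℕ
    g u w  = (b2n (A u w) + b2n (J u w)) + (b2n (single A u w) + b2n (single A u w))
    g′ u w = b2n (toℕ u <ᵇ toℕ w) * g u w

    between : Fin (n G) → Fin (n G) → List E
    between u w = replicate (g′ u w) (u , w)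

    upward : Fin (n G) → List E
    upward u = concatF (between u)

    es : List E
    es = concatF upward

    sumL-es : ∀ φ → sumL φ es ≡ sum² (λ u w → g′ u w * φ (u , w))
    sumL-es φ = trans (sumL-concatF φ upward) (sum-cong-≗ (λ u → trans (sumL-concatF φ (between u)) (sum-cong-≗ (λ w → sumL-replicate φ (g′ u w) (u , w)))))

    single-sym : ∀ u w → single A u w ≡ single A w u
    single-sym u w = bool-ext (to u w) (to w u)
      where
      to : ∀ u w → single A u w ≡ true → single A w u ≡ true
      to u w h with single-elim A u w h
      ... | e , p , q with single-cases A w u (trans (Graph.sym G w u) e)
      ... | inj₁ s = s
      ... | inj₂ (inj₁ (x , a , ne)) = ⊥-elim (ne (q x a))
      ... | inj₂ (inj₂ (x , a , ne)) = ⊥-elim (ne (p x a))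

    g-sym : ∀ u w → g u w ≡ g w u
    g-sym u w = cong₂ _+_ (cong₂ _+_ (cong b2n (Graph.sym G u w)) (cong b2n (t-sym u w))) (cong₂ _+_ (cong b2n (single-sym u w)) (cong b2n (single-sym u w)))

    g-zero : ∀ u w → A u w ≡ false → g u w ≡ 0
    g-zero u w h rewrite h | not-true {J u w} (λ e → false≢true (t-adj u w e) h) | not-true {single A u w} (λ e → false≢true (proj₁ (single-elim A u w e)) h) = refl

    g′-split : ∀ u w → g′ u w + g′ w u ≡ g u w
    g′-split u w with <-cmp (toℕ u) (toℕ w)
    ... | tri< l _ ¬l rewrite <ᵇ-intro l | not-true {toℕ w <ᵇ toℕ u} (λ e → ¬l (true-<ᵇ (toℕ w) (toℕ u) e)) = trans (+-identityʳ _) (+-identityʳ _)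
    ... | tri> ¬l _ l rewrite <ᵇ-intro l | not-true {toℕ u <ᵇ toℕ w} (λ e → ¬l (true-<ᵇ (toℕ u) (toℕ w) e)) = trans (+-identityʳ _) (g-sym w u)
    ... | tri≈ _ e _ with refl ← FP.toℕ-injective {i = u} {j = w} e = trans (cong₂ _+_ (cong (b2n (toℕ u <ᵇ toℕ u) *_) z) (cong (b2n (toℕ u <ᵇ toℕ u) *_) z)) (trans (cong₂ _+_ (*-zeroʳ (b2n (toℕ u <ᵇ toℕ u))) (*-zeroʳ (b2n (toℕ u <ᵇ toℕ u)))) (≡sym z))
      where
      z : g u u ≡ 0
      z = g-zero u u (irrefl G u)

    length-es : length es + length es ≡ sum² g
    length-es = trans (cong₂ _+_ len (trans len (∑-comm g′))) (trans (≡sym (sum²-+ g′ (λ u w → g′ w u))) (sum²-cong g′-split))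
      where
      len : length es ≡ sum² g′
      len = trans (≡sym (sumL-length es)) (trans (sumL-es (λ _ → 1)) (sum²-cong (λ u w → *-identityʳ (g′ u w))))

    degree-es : ∀ v → sumL (touch v) es ≡ sum (g v)
    degree-es v = trans (sumL-es (touch v)) (trans (sum²-cong (λ u w → *-distribˡ-+ (g′ u w) (b2n (eqB u v)) (b2n (eqB w v))))
      (trans (sum²-+ (λ u w → g′ u w * b2n (eqB u v)) (λ u w → g′ u w * b2n (eqB w v)))
      (trans (cong₂ _+_ outgoing (trans (∑-comm (λ u w → g′ u w * b2n (eqB w v))) (incoming)))
      (trans (≡sym (∑-distrib-+ (g′ v) (λ w → g′ w v))) (sum-cong-≗ (g′-split v))))))
      where
      point : ∀ (k : Fin (n G) → Fin (n G) → ℕ) → sum² (λ u w → k u w * b2n (eqB u v)) ≡ sum (k v)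
      point k = trans (sum-cong-≗ (λ u → trans (sum-cong-≗ (λ w → trans (*-comm (k u w) _) (cong (λ b → b2n b * k u w) (eqB-sym u v)))) (sum-* (b2n (eqB v u)) (k u)))) (sum-point v (λ u → sum (k u)))
      outgoing : sum² (λ u w → g′ u w * b2n (eqB u v)) ≡ sum (g′ v)
      outgoing = point g′
      incoming : sum² (λ w u → g′ u w * b2n (eqB w v)) ≡ sum (λ w → g′ w v)
      incoming = point (λ w u → g′ u w)

    -- E and J have the same degree parities, and the extra copies of K₂ edges come in pairs.
    even-es : ∀ v → parity v es ≡ false
    even-es v = trans (≡sym (parity-touch v es)) (trans (cong odd (degree-es v)) (trans (odd-sum (g v)) (trans (xsum-cong (λ w →
        trans (odd-+ (b2n (A v w) + b2n (J v w)) _) (trans (cong₂ _xor_ (trans (odd-+ (b2n (A v w)) _) (cong₂ _xor_ (odd-b2n (A v w)) (odd-b2n (J v w)))) (odd-double (b2n (single A v w)))) (xor-identityʳ _))))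
      (trans (XS.∑-distrib-+ (A v) (J v)) (trans (cong (xsum (A v) xor_) (t-bd v)) (xor-same (xsum (A v))))))))

    abstract
      oriented : ∃ λ os → Pointwise Flip es os × Balanced os
      oriented = orient (length es) es ≤-refl even-es

    os : List E
    os = proj₁ oriented
    flips : Pointwise Flip es os
    flips = proj₁ (proj₂ oriented)
    balanced : Balanced os
    balanced = proj₂ (proj₂ oriented)

    h : ℕ
    h = length os

    open Successor os balanced

    t : Fin h → Fin (n G)
    t a = proj₁ (lookup os a)

    es-adj : ∀ {e} → e ∈ es → A (proj₁ e) (proj₂ e) ≡ true
    es-adj {e} m with u , m′ ← ∈-concatF⁻ upward m with w , m″ ← ∈-concatF⁻ (between u) m′ = by (A u w) refl
      where
      by : ∀ b → A u w ≡ b → A (proj₁ e) (proj₂ e) ≡ true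
      by true  auw = subst (λ e → A (proj₁ e) (proj₂ e) ≡ true) (≡sym (∈-replicate⁻ (g′ u w) m″)) auw
      by false auw with () ← subst (λ k → e ∈ replicate k (u , w)) (trans (cong (b2n (toℕ u <ᵇ toℕ w) *_) (g-zero u w auw)) (*-zeroʳ (b2n (toℕ u <ᵇ toℕ w)))) m″

    os-adj : ∀ a → A (t a) (t (σ a)) ≡ true
    os-adj a = subst (λ x → A (t a) x ≡ true) (≡sym (tail-σ a)) (arc (flip-∈ flips (∈-lookup′ os a)))
      where
      ∈-lookup′ : ∀ (xs : List E) i → lookup xs i ∈ xs
      ∈-lookup′ (x ∷ xs) zero    = here refl
      ∈-lookup′ (x ∷ xs) (suc i) = there (∈-lookup′ xs i)
      arc : lookup os a ∈ es ⊎ (proj₂ (lookup os a) , proj₁ (lookup os a)) ∈ es → A (t a) (proj₂ (lookup os a)) ≡ true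
      arc (inj₁ m) = es-adj m
      arc (inj₂ m) = trans (Graph.sym G _ _) (es-adj m)

    g-positive : ∀ u w → A u w ≡ true → ∃ λ k → g u w ≡ suc k
    g-positive u w e rewrite e = _ , refl

    ∈-es : ∀ u w → A u w ≡ true → toℕ u < toℕ w → (u , w) ∈ es
    ∈-es u w e l = ∈-concatF⁺ upward u (∈-concatF⁺ (between u) w (copies (g′ u w) (trans (cong (λ b → b2n b * g u w) (<ᵇ-intro l)) (trans (+-identityʳ _) (proj₂ (g-positive u w e))))))
      where
      copies : ∀ k {j} → k ≡ suc j → (u , w) ∈ replicate k (u , w)
      copies (suc k) _ = here refl

    arc-of : ∀ {u w} → (u , w) ∈ os → ∃ λ a → t a ≡ u × t (σ a) ≡ w
    arc-of m = index m , cong proj₁ (≡sym (lookup-index m)) , trans (tail-σ (index m)) (cong proj₂ (≡sym (lookup-index m)))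

    covered : ∀ u w → A u w ≡ true → ∃ λ a → (t a ≡ u × t (σ a) ≡ w) ⊎ (t a ≡ w × t (σ a) ≡ u)
    covered u w e with <-cmp (toℕ u) (toℕ w)
    ... | tri≈ _ p _ = false≢true (subst (λ x → A u x ≡ true) (≡sym (FP.toℕ-injective p)) e) (irrefl G u)
    ... | tri< l _ _ with ∈-flip flips (∈-es u w e l)
    ... | inj₁ m = let a , p = arc-of m in a , inj₁ p
    ... | inj₂ m = let a , p = arc-of m in a , inj₂ p
    covered u w e | tri> _ _ l with ∈-flip flips (∈-es w u (trans (Graph.sym G w u) e) l)
    ... | inj₁ m = let a , p = arc-of m in a , inj₂ p
    ... | inj₂ m = let a , p = arc-of m in a , inj₁ p

    visits : Fin (n G) → ℕ
    visits u = sum (λ a → b2n (eqB (t a) u))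

    degree-visits : ∀ u → sum (g u) ≡ visits u + visits u
    degree-visits u = trans (≡sym (degree-es u)) (trans (touch-flip u flips) (trans (≡sym (sumL-lookup (touch u) os))
      (trans (∑-distrib-+ (λ a → b2n (eqB (t a) u)) (λ a → b2n (eqB (proj₂ (lookup os a)) u)))
        (cong (visits u +_) (trans (sum-cong-≗ (λ a → cong (λ x → b2n (eqB x u)) (≡sym (tail-σ a)))) (≡sym (∑-permute (λ a → b2n (eqB (t a) u)) (permutation σ σ⁻¹ σ-σ⁻¹ σ⁻¹-σ))))))))

    -- A K₂ edge has multiplicity at least 3, and the degree of a vertex is twice its number of
    -- visits, so a single visit is too few.
    rich : ∀ u w → single A u w ≡ true → ∀ a → t a ≡ u → ∃ λ b → b ≢ a × t b ≡ u
    rich u w s a ta with FP.any? (λ b → not-eq b)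
      where
      not-eq : ∀ b → _
      not-eq b = ¬? (b FP.≟ a) ×-dec (t b FP.≟ u)
    ... | yes r = r
    ... | no none = ⊥-elim (<⇒≱ three (≤-trans (≤-reflexive (degree-visits u)) (+-mono-≤ (≤-reflexive one) (≤-reflexive one))))
      where
      one : visits u ≡ 1
      one = sum-unique (λ b → eqB (t b) u) a (trans (cong (λ x → eqB x u) ta) (eqB-refl u)) (λ b e → only b (eqB-true (t b) u e))
        where
        only : ∀ b → t b ≡ u → b ≡ a
        only b e with b FP.≟ a
        ... | yes p = p
        ... | no ne = ⊥-elim (none (b , ne , e))
      three : 2 < sum (g u)
      three = ≤-trans (≤-reflexive′ (proj₁ (single-elim A u w s)) s) (term≤sum (g u) w)
        where
        ≤-reflexive′ : A u w ≡ true → single A u w ≡ true → 3 ≤ g u w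
        ≤-reflexive′ e e′ rewrite e | e′ = s≤s (≤-trans (m≤n+m 2 (b2n (J u w))) ≤-refl)

    module R = Repair A (irrefl G) t rich

    tour₀ : R.Tour
    tour₀ = record { σ = σ ; σ⁻¹ = σ⁻¹ ; inv₁ = σ⁻¹-σ ; inv₂ = σ-σ⁻¹ ; steps = os-adj ; all = covered }

    abstract
      repaired : ∃ λ T → ∀ a → R.Tour.σ T (R.Tour.σ T a) ≢ a
      repaired = R.repair (R.bad tour₀) tour₀ ≤-refl

    module T = R.Tour (proj₁ repaired)

    link : Fin h → Fin h → Bool
    link a b = eqB b (T.σ a) orB eqB a (T.σ b)

    link-elim : ∀ a b → link a b ≡ true → b ≡ T.σ a ⊎ a ≡ T.σ b
    link-elim a b e with orB-elim {eqB b (T.σ a)} e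
    ... | inj₁ p = inj₁ (eqB-true b (T.σ a) p)
    ... | inj₂ p = inj₂ (eqB-true a (T.σ b) p)

    no-fix : ∀ a → T.σ a ≢ a
    no-fix a e = false≢true (subst (λ x → A (t a) (t x) ≡ true) e (T.steps a)) (irrefl G (t a))

    H : Graph
    H = record { n = h ; adj = link ; sym = λ a b → orB-comm (eqB b (T.σ a)) (eqB a (T.σ b)) ; irrefl = λ a → not-true (λ e → loop (link-elim a a e)) }
      where
      loop : ∀ {a} → a ≡ T.σ a ⊎ a ≡ T.σ a → ⊥
      loop (inj₁ e) = no-fix _ (≡sym e)
      loop (inj₂ e) = no-fix _ (≡sym e)

    H-cycles : IsCycleGraph H
    H-cycles = record { σ = T.σ ; σ⁻¹ = T.σ⁻¹ ; inv₁ = T.inv₁ ; inv₂ = T.inv₂ ; len≥3₁ = no-fix ; len≥3₂ = proj₂ repaired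
                      ; edges = link-elim ; edges′ = λ a → orB-left (eqB-refl (T.σ a)) }

    H-covers : Covers G H t
    H-covers = record { onto = onto′ ; hom = hom′ ; edge⁺ = edge′ }
      where
      onto′ : ∀ u → ∃ λ a → t a ≡ u
      onto′ u with no-isolated u
      ... | w , e with T.all u w e
      ... | a , inj₁ (p , _) = a , p
      ... | a , inj₂ (_ , p) = T.σ a , p
      hom′ : ∀ a b → link a b ≡ true → A (t a) (t b) ≡ true
      hom′ a b e with link-elim a b e
      ... | inj₁ refl = T.steps a
      ... | inj₂ refl = trans (Graph.sym G _ _) (T.steps b)
      edge′ : ∀ u w → A u w ≡ true → ∃ λ a → ∃ λ b → t a ≡ u × t b ≡ w × link a b ≡ true
      edge′ u w e with T.all u w e
      ... | a , inj₁ (p , q) = a , T.σ a , p , q , orB-left (eqB-refl (T.σ a))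
      ... | a , inj₂ (p , q) = T.σ a , a , q , p , orB-right {eqB a (T.σ (T.σ a))} (eqB-refl (T.σ a))

    h-size : h + h ≡ (dartsOf A + dartsOf J) + (dartsOf (single A) + dartsOf (single A))
    h-size = trans (cong₂ _+_ len len) (trans length-es (trans (sum²-+ (λ u w → b2n (A u w) + b2n (J u w)) (λ u w → b2n (single A u w) + b2n (single A u w)))
      (cong₂ _+_ (sum²-+ (λ u w → b2n (A u w)) (λ u w → b2n (J u w))) (sum²-+ (λ u w → b2n (single A u w)) (λ u w → b2n (single A u w))))))
      where
      len : h ≡ length es
      len = ≡sym (PW.Pointwise-length flips)

    n≤h : n G ≤ h
    n≤h = FP.injective⇒≤ {f = λ u → proj₁ (Covers.onto H-covers u)} (λ {u} {w} e → trans (≡sym (proj₂ (Covers.onto H-covers u))) (trans (cong t e) (proj₂ (Covers.onto H-covers w))))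

  backward : ∀ G k → Feasible G k → CGIVS G k
  -- The cycle graph has h vertices, so exactly h - n splits are made, and the inequality says that
  -- these are at most k.
  backward G k (iso , J , jJ , le) with cover-splits (h ∸ n G) H-covers (≡sym (m+[n∸m]≡n n≤h)) H-cycles
    where open Backward G iso J jJ
  ... | H′ , s , cyc = H′ , splits-mono (≤-trans (∸-monoˡ-≤ (n G) small) (≤-reflexive (m+n∸m≡n (n G) k))) s , cyc
    where
    open Backward G iso J jJ
    small : h ≤ n G + k
    small = *-cancelˡ-≤ 2 (≤-trans (≤-reflexive (trans (dbl h) h-size)) (≤-trans le (≤-reflexive (arrange (n G) k))))
      where
      dbl : ∀ x → 2 * x ≡ x + x
      dbl = solve-∀
      arrange : ∀ x k → (x + x) + (k + k) ≡ 2 * (x + k)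
      arrange = solve-∀

-- Rows, columns and marks of a word.

module Words where

  open Programs using (symAt; isSym)
  open Formulas
  open Cuts
  open Exchanges
  open Trails
  open DecisionFormula

  count-below : ∀ N h → count {N} (λ x → toℕ x <ᵇ h) ≡ h ⊓ N
  count-below N h = trans (sum-cong-≗ {N} (λ x → cong b2n (bool-ext
      (λ e → <ᵇ-intro (⊓-pres-m< (true-<ᵇ (toℕ x) h e) (FP.toℕ<n x)))
      (λ e → <ᵇ-intro (≤-trans (true-<ᵇ (toℕ x) (h ⊓ N) e) (m⊓n≤m h N))))))
    (range-count N 0 (h ⊓ N) (m⊓n≤n h N))

  sameCount-true : ∀ {n} (f g : Fin n → Bool) → sameCount f g ≡ true → count f ≡ count g
  sameCount-true f g h with p , q ← ∧-true {not (count f <ᵇ count g)} h = ≤-antisym (≮⇒≥ (not-< q)) (≮⇒≥ (not-< p))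
    where
    not-< : ∀ {m n} → not (m <ᵇ n) ≡ true → ¬ m < n
    not-< h l with () ← trans (≡sym h) (cong not (<ᵇ-intro l))

  true-sameCount : ∀ {n} (f g : Fin n → Bool) → count f ≡ count g → sameCount f g ≡ true
  true-sameCount f g e rewrite e = ∧-intro irr irr
    where
    irr : not (count g <ᵇ count g) ≡ true
    irr = cong not (not-true (λ h → <-irrefl refl (true-<ᵇ (count g) (count g) h)))

  count-cong : ∀ {n} {f g : Fin n → Bool} → (∀ i → f i ≡ g i) → count f ≡ count g
  count-cong h = sum-cong-≗ (λ i → cong b2n (h i))

  isHash : Sym → Bool
  isHash ♯ = true
  isHash _ = false

  hashes : List Sym → ℕ → ℕ
  hashes []      p       = 0
  hashes (s ∷ w) zero    = 0
  hashes (s ∷ w) (suc p) = b2n (isHash s) + hashes w p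

  column : ℕ → List Sym → ℕ → ℕ
  column c []      p       = c
  column c (s ∷ w) zero    = c
  column c (♯ ∷ w) (suc p) = column 0 w p
  column c (_ ∷ w) (suc p) = column (suc c) w p

  -- A ♯ between positions q (included) and p (excluded).
  split : List Sym → ℕ → ℕ → Bool
  split []      q       p       = false
  split (s ∷ w) q       zero    = false
  split (s ∷ w) zero    (suc p) = isHash s orB split w 0 p
  split (s ∷ w) (suc q) (suc p) = split w q p

  isSym-♯ : ∀ s → isSym ♯ (just s) ≡ isHash s
  isSym-♯ 𝟎 = refl
  isSym-♯ 𝟏 = refl
  isSym-♯ ♯ = refl

  anyB-suc : ∀ {n} (f : Fin (suc n) → Bool) → anyB f ≡ (f zero orB anyB (f ∘ suc))
  anyB-suc f = bool-ext
    (λ h → to (anyB-elim f h))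
    (λ h → from (orB-elim {f zero} h))
    where
    to : ∃ (λ i → f i ≡ true) → (f zero orB anyB (f ∘ suc)) ≡ true
    to (zero , e)  = orB-left e
    to (suc i , e) = orB-right {f zero} (anyB-intro (f ∘ suc) i e)
    from : f zero ≡ true ⊎ anyB (f ∘ suc) ≡ true → anyB f ≡ true
    from (inj₁ e) = anyB-intro f zero e
    from (inj₂ e) = let i , e′ = anyB-elim (f ∘ suc) e in anyB-intro f (suc i) e′

  anyB-never : ∀ {n} {f : Fin n → Bool} → (∀ i → f i ≡ false) → anyB f ≡ false
  anyB-never {f = f} h = not-true (λ e → let i , e′ = anyB-elim f e in false≢true e′ (h i))

  hashIn : ∀ w → ℕ → ℕ → Fin (length w) → Bool
  hashIn w q p h = not (toℕ h <ᵇ q) ∧ ((toℕ h <ᵇ p) ∧ isSym ♯ (symAt w (toℕ h)))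

  split-anyB : ∀ w q p → anyB (hashIn w q p) ≡ split w q p
  split-anyB []      q p = refl
  split-anyB (s ∷ w) q zero = anyB-never {suc (length w)} (λ h → ∧-zeroʳ (not (toℕ h <ᵇ q)))
  split-anyB (s ∷ w) zero (suc p) = trans (anyB-suc (hashIn (s ∷ w) zero (suc p))) (cong₂ _orB_ (isSym-♯ s) (split-anyB w zero p))
  split-anyB (s ∷ w) (suc q) (suc p) = trans (anyB-suc (hashIn (s ∷ w) (suc q) (suc p))) (trans (false-or (anyB (hashIn w q p))) (split-anyB w q p))
    where
    false-or : ∀ b → (false orB b) ≡ b
    false-or true  = refl
    false-or false = refl

  hashes-count : ∀ w p → sum {length w} (λ q → b2n ((toℕ q <ᵇ p) ∧ isSym ♯ (symAt w (toℕ q)))) ≡ hashes w p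
  hashes-count []      p       = refl
  hashes-count (s ∷ w) zero    = sum-zero {suc (length w)} (λ _ → refl)
  hashes-count (s ∷ w) (suc p) = cong₂ _+_ (cong b2n (isSym-♯ s)) (hashes-count w p)

  next-column : ∀ b {c x z} → x ≡ b2n (not b) * suc c + z → x ≡ b2n (not (false orB b)) * c + (b2n (not (false orB b)) + z)
  next-column true          e = e
  next-column false {c} {z = z} e = trans e (arrange c z)
    where
    arrange : ∀ c z → (suc c + 0) + z ≡ (c + 0) + (1 + z)
    arrange = solve-∀

  -- A position before p belongs to the current row iff no ♯ lies from there up to p; the c columns
  -- read earlier count only if there is no ♯ before p at all.
  column-split : ∀ c w p → p ≤ length w → column c w p ≡ b2n (not (split w 0 p)) * c + sum {length w} (λ q → b2n ((toℕ q <ᵇ p) ∧ not (split w (toℕ q) p)))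
  column-split c []      zero    z≤n = ≡sym (trans (+-identityʳ _) (+-identityʳ c))
  column-split c (s ∷ w) zero    h   = ≡sym (trans (cong₂ _+_ (+-identityʳ c) (sum-zero {suc (length w)} (λ _ → refl))) (+-identityʳ c))
  column-split c (𝟎 ∷ w) (suc p) (s≤s h) = next-column (split w 0 p) (column-split (suc c) w p h)
  column-split c (𝟏 ∷ w) (suc p) (s≤s h) = next-column (split w 0 p) (column-split (suc c) w p h)
  column-split c (♯ ∷ w) (suc p) (s≤s h) = trans (column-split 0 w p h) (cong₂ _+_ (*-zeroʳ (b2n (not (split w 0 p)))) (zero-first (split w 0 p)))
    where
    zero-first : ∀ b {z} → z ≡ b2n (not (true orB b)) + z
    zero-first true  = refl
    zero-first false = refl

  -- Mark r c w i j: reading w from row r and column c on, the digit 𝟏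
  -- occurs in row i and column j.

  Mark : ℕ → ℕ → List Sym → ℕ → ℕ → Set
  Mark r c []      i j = ⊥
  Mark r c (𝟎 ∷ w) i j = Mark r (suc c) w i j
  Mark r c (𝟏 ∷ w) i j = (r ≡ i × c ≡ j) ⊎ Mark r (suc c) w i j
  Mark r c (♯ ∷ w) i j = Mark (suc r) 0 w i j

  marked : ∀ w r c {i j} (p : Fin (length w)) → isSym 𝟏 (symAt w (toℕ p)) ≡ true → r + hashes w (toℕ p) ≡ i → column c w (toℕ p) ≡ j → Mark r c w i j
  marked (𝟏 ∷ w) r c zero    h e e′ = inj₁ (trans (≡sym (+-identityʳ r)) e , e′)
  marked (𝟎 ∷ w) r c (suc p) h e e′ = marked w r (suc c) p h e e′
  marked (𝟏 ∷ w) r c (suc p) h e e′ = inj₂ (marked w r (suc c) p h e e′)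
  marked (♯ ∷ w) r c (suc p) h e e′ = marked w (suc r) 0 p h (trans (≡sym (+-suc r _)) e) e′

  mark-position : ∀ w r c {i j} → Mark r c w i j → ∃ λ (p : Fin (length w)) → isSym 𝟏 (symAt w (toℕ p)) ≡ true × r + hashes w (toℕ p) ≡ i × column c w (toℕ p) ≡ j
  mark-position (𝟎 ∷ w) r c m = let p , a , b , d = mark-position w r (suc c) m in suc p , a , b , d
  mark-position (𝟏 ∷ w) r c (inj₁ (e , e′)) = zero , refl , trans (+-identityʳ r) e , e′
  mark-position (𝟏 ∷ w) r c (inj₂ m) = let p , a , b , d = mark-position w r (suc c) m in suc p , a , b , d
  mark-position (♯ ∷ w) r c m = let p , a , b , d = mark-position w (suc r) 0 m in suc p , a , trans (+-suc r _) b , d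

  all-hashes : List Sym → ℕ
  all-hashes []      = 0
  all-hashes (s ∷ w) = b2n (isHash s) + all-hashes w

  all-hashes-count : ∀ w → sum {length w} (λ q → b2n (isSym ♯ (symAt w (toℕ q)))) ≡ all-hashes w
  all-hashes-count []      = refl
  all-hashes-count (s ∷ w) = cong₂ _+_ (cong b2n (isSym-♯ s)) (all-hashes-count w)

  module Reading (w : List Sym) where
    open Meaning w

    count-upto : ∀ (i : Fin (length w)) → count (λ q → not (ltB i q)) ≡ suc (toℕ i)
    count-upto i = trans (count-cong {length w} (λ q → bool-ext
        (λ e → <ᵇ-intro {toℕ q} {suc (toℕ i)} (s≤s (≮⇒≥ (λ l → false≢true (<ᵇ-intro l) (flip-not e)))))
        (λ e → cong not (not-true (λ l → <⇒≱ (true-<ᵇ (toℕ i) (toℕ q) l) (≤-pred (true-<ᵇ (toℕ q) (suc (toℕ i)) e)))))))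
      (trans (count-below (length w) (suc (toℕ i))) (m≤n⇒m⊓n≡m (FP.toℕ<n i)))
      where
      flip-not : ∀ {b} → not b ≡ true → b ≡ false
      flip-not {false} _ = refl

    count-before : ∀ (j : Fin (length w)) → count (λ q → ltB q j) ≡ toℕ j
    count-before j = trans (count-below (length w) (toℕ j)) (m≤n⇒m⊓n≡m (<⇒≤ (FP.toℕ<n j)))

    row-of column-of : Fin (length w) → ℕ
    row-of p    = count (λ q → ltB q p ∧ sy ♯ q)
    column-of p = count (λ q → ltB q p ∧ not (anyB (λ h → not (ltB h q) ∧ (ltB h p ∧ sy ♯ h))))

    row-of≡ : ∀ p → row-of p ≡ hashes w (toℕ p)
    row-of≡ p = hashes-count w (toℕ p)

    column-of≡ : ∀ p → column-of p ≡ column 0 w (toℕ p)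
    column-of≡ p = trans (count-cong {length w} (λ q → cong (λ b → ltB q p ∧ not b) (split-anyB w (toℕ q) (toℕ p))))
      (≡sym (trans (column-split 0 w (toℕ p) (<⇒≤ (FP.toℕ<n p))) (cong (_+ sum {length w} (λ q → b2n ((toℕ q <ᵇ toℕ p) ∧ not (split w (toℕ q) (toℕ p))))) (*-zeroʳ (b2n (not (split w 0 (toℕ p))))))))

    adjB-mark : ∀ i j → adjB i j ≡ true → Mark 0 0 w (suc (toℕ i)) (toℕ j)
    adjB-mark i j h =
      let p , e = anyB-elim (λ p → sy 𝟏 p ∧ (sameCount (λ q → ltB q p ∧ sy ♯ q) (λ q → not (ltB i q))
                    ∧ sameCount (λ q → ltB q p ∧ not (anyB (λ h → not (ltB h q) ∧ (ltB h p ∧ sy ♯ h)))) (λ q → ltB q j))) h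
          e₁ , e₂ = ∧-true {sy 𝟏 p} e
          e₃ , e₄ = ∧-true {sameCount (λ q → ltB q p ∧ sy ♯ q) (λ q → not (ltB i q))} e₂
      in marked w 0 0 p e₁ (trans (≡sym (row-of≡ p)) (trans (sameCount-true (λ q → ltB q p ∧ sy ♯ q) (λ q → not (ltB i q)) e₃) (count-upto i)))
           (trans (≡sym (column-of≡ p)) (trans (sameCount-true (λ q → ltB q p ∧ not (anyB (λ h → not (ltB h q) ∧ (ltB h p ∧ sy ♯ h)))) (λ q → ltB q j) e₄) (count-before j)))

    mark-adjB : ∀ i j → Mark 0 0 w (suc (toℕ i)) (toℕ j) → adjB i j ≡ true
    mark-adjB i j m =
      let p , a , b , d = mark-position w 0 0 m
      in anyB-intro (λ p → sy 𝟏 p ∧ (sameCount (λ q → ltB q p ∧ sy ♯ q) (λ q → not (ltB i q))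
                    ∧ sameCount (λ q → ltB q p ∧ not (anyB (λ h → not (ltB h q) ∧ (ltB h p ∧ sy ♯ h)))) (λ q → ltB q j))) p
           (∧-intro a (∧-intro (true-sameCount (λ q → ltB q p ∧ sy ♯ q) (λ q → not (ltB i q)) (trans (row-of≡ p) (trans b (≡sym (count-upto i)))))
             (true-sameCount (λ q → ltB q p ∧ not (anyB (λ h → not (ltB h q) ∧ (ltB h p ∧ sy ♯ h)))) (λ q → ltB q j) (trans (column-of≡ p) (trans d (≡sym (count-before j)))))))

    vertB-hashes : ∀ i → vertB i ≡ (suc (toℕ i) <ᵇ all-hashes w)
    vertB-hashes i = cong₂ _<ᵇ_ (count-upto i) (all-hashes-count w)

-- Reading an instance off its encoding.

module Encodings where

  open import Data.List using (map; drop; concatMap; tabulate; allFin)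
  open Programs using (symAt; isSym)
  open Formulas
  open Cuts
  open Exchanges
  open Trails
  open LocalSearch using (sum-point)
  open DecisionFormula
  open Words
  open import Data.Nat.Binary.Base using (ℕᵇ; 2[1+_]; 1+[2_]) renaming (zero to zeroᵇ; toℕ to fromBin; fromℕ to toBin)
  open import Data.Nat.Binary.Properties using (toℕ-fromℕ)

  -- Bijective binary with the least significant digit in front: 𝟎 stands for the digit 2 and 𝟏 for
  -- the digit 1.
  value : List Sym → ℕ
  value []      = 0
  value (𝟎 ∷ w) = 2 + (value w + value w)
  value (𝟏 ∷ w) = 1 + (value w + value w)
  value (♯ ∷ w) = 0

  value-encBin : ∀ b r → value (encBin b ++ ♯ ∷ r) ≡ fromBin b
  value-encBin zeroᵇ    r = refl
  value-encBin 2[1+ b ] r = trans (cong (λ v → 2 + (v + v)) (value-encBin b r)) (arrange (fromBin b))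
    where
    arrange : ∀ v → 2 + (v + v) ≡ 2 * suc v
    arrange = solve-∀
  value-encBin 1+[2 b ] r = trans (cong (λ v → 1 + (v + v)) (value-encBin b r)) (arrange (fromBin b))
    where
    arrange : ∀ v → 1 + (v + v) ≡ suc (2 * v)
    arrange = solve-∀

  -- A count over N positions cuts v off at N. Since c < N, this does not affect the comparison of
  -- 2v with c or c - 1.
  digit-value : ∀ v N c → c < N →
    (not (((v ⊓ N) + (v ⊓ N)) <ᵇ c) ≡ (c <ᵇ 1 + (v + v))) × (not (((v ⊓ N) + (v ⊓ N)) <ᵇ (c ∸ 1)) ≡ (c <ᵇ 2 + (v + v)))
  digit-value v N c c<N =
      bool-ext (λ e → <ᵇ-intro {c} {1 + (v + v)} (s≤s (≤-trans (not-< e) (+-mono-≤ (m⊓n≤m v N) (m⊓n≤m v N)))))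
               (λ e → cong not (not-true (λ l → <⇒≱ (true-<ᵇ _ c l) (enough c (≤-pred (true-<ᵇ c (1 + (v + v)) e)) (<⇒≤ c<N)))))
    , bool-ext (λ e → <ᵇ-intro {c} {2 + (v + v)} (s≤s (≤-trans (pred-≤ c) (s≤s (≤-trans (not-< e) (+-mono-≤ (m⊓n≤m v N) (m⊓n≤m v N)))))))
               (λ e → cong not (not-true (λ l → <⇒≱ (true-<ᵇ _ (c ∸ 1) l) (enough (c ∸ 1) (∸-monoˡ-≤ 1 (≤-pred (true-<ᵇ c (2 + (v + v)) e))) (≤-trans (m∸n≤m c 1) (<⇒≤ c<N))))))
    where
    not-< : ∀ {m n} → not (m <ᵇ n) ≡ true → n ≤ m
    not-< {m} {n} h = ≮⇒≥ (λ l → clash h (<ᵇ-intro l))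
      where
      clash : ∀ {b} → not b ≡ true → b ≡ true → ⊥
      clash {true} () _
    pred-≤ : ∀ c → c ≤ suc (c ∸ 1)
    pred-≤ zero    = z≤n
    pred-≤ (suc c) = ≤-refl
    enough : ∀ c → c ≤ v + v → c ≤ N → c ≤ (v ⊓ N) + (v ⊓ N)
    enough c a b with ≤-total v N
    ... | inj₁ l = ≤-trans a (≤-reflexive (cong (λ x → x + x) (≡sym (m≤n⇒m⊓n≡m l))))
    ... | inj₂ l = ≤-trans (≤-trans b (m≤m+n N N)) (≤-reflexive (cong (λ x → x + x) (≡sym (m≥n⇒m⊓n≡n l))))

  private
    false-or : ∀ b → (false orB b) ≡ b
    false-or true  = refl
    false-or false = refl

    or-false : ∀ b → (b orB false) ≡ b
    or-false true  = refl
    or-false false = refl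

  -- The counters range over positions, so a value is only compared with
  -- bounds c below the length of the word.

  below-value : ∀ w p c v N → c < N → (suc p < length w → v ≡ value (drop (suc p) w) ⊓ N) → (length w ≤ suc p → v ≡ 0) → p < length w →
    ((isSym 𝟏 (symAt w p) ∧ not ((v + v) <ᵇ c)) orB (isSym 𝟎 (symAt w p) ∧ not ((v + v) <ᵇ (c ∸ 1)))) ≡ (c <ᵇ value (drop p w))
  below-value (s ∷ w) zero c v N c<N h z p< with last-or w h z
    where
    last-or : ∀ w → (1 < suc (length w) → v ≡ value w ⊓ N) → (suc (length w) ≤ 1 → v ≡ 0) → v ≡ value w ⊓ N
    last-or []      h z = z ≤-refl
    last-or (s ∷ w) h z = h (s≤s (s≤s z≤n))
  below-value (𝟎 ∷ w) zero c v N c<N h z p< | refl = trans (false-or _) (proj₂ (digit-value (value w) N c c<N))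
  below-value (𝟏 ∷ w) zero c v N c<N h z p< | refl = trans (or-false _) (proj₁ (digit-value (value w) N c c<N))
  below-value (♯ ∷ w) zero c v N c<N h z p< | refl = refl
  below-value (s ∷ w) (suc p) c v N c<N h z (s≤s p<) = below-value w p c v N c<N (λ l → h (s≤s l)) (λ l → z (s≤s l)) p<

  module ReadingNumber (w : List Sym) (l f : Fin (length w)) (l≢f : l ≢ f) (f-zero : toℕ f ≡ 0) where
    open Meaning w

    N : ℕ
    N = length w

    next : Fin N → Fin N → Bool
    next p q = ltB p q ∧ not (anyB (λ y → ltB p y ∧ ltB y q))

    next-elim : ∀ p q → next p q ≡ true → toℕ q ≡ suc (toℕ p)
    next-elim p q h with e₁ , e₂ ← ∧-true {ltB p q} h = ≤-antisym (≮⇒≥ gap) p<q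
      where
      p<q : toℕ p < toℕ q
      p<q = true-<ᵇ (toℕ p) (toℕ q) e₁
      flip-not : ∀ {b} → not b ≡ true → b ≡ false
      flip-not {false} _ = refl
      gap : ¬ suc (toℕ p) < toℕ q
      gap lt′ = false≢true (anyB-intro (λ y → ltB p y ∧ ltB y q) (fromℕ< (<-trans lt′ (FP.toℕ<n q)))
        (∧-intro (<ᵇ-intro (≤-reflexive (≡sym (FP.toℕ-fromℕ< (<-trans lt′ (FP.toℕ<n q))))))
                 (<ᵇ-intro (≤-trans (≤-reflexive (cong suc (FP.toℕ-fromℕ< (<-trans lt′ (FP.toℕ<n q))))) lt′)))) (flip-not e₂)

    next-intro : ∀ p q → toℕ q ≡ suc (toℕ p) → next p q ≡ true
    next-intro p q e = ∧-intro (<ᵇ-intro (≤-reflexive (≡sym e))) (cong not (not-true (λ h →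
      let y , h′ = anyB-elim (λ y → ltB p y ∧ ltB y q) h ; a , b = ∧-true {ltB p y} h′
      in <⇒≱ (true-<ᵇ (toℕ p) (toℕ y) a) (≤-pred (≤-trans (true-<ᵇ (toℕ y) (toℕ q) b) (≤-reflexive e))))))

    follows : (V : G²) → Fin N → Fin N → Bool
    follows V p x = anyB (λ q → next p q ∧ V q x)

    sum-tag : ∀ (P : Bool) → sum {N} (λ b → b2n ((eqB b l orB eqB b f) ∧ P)) ≡ b2n P + b2n P
    sum-tag P = trans (sum-cong-≗ each) (trans (∑-distrib-+ (λ b → b2n (eqB l b) * b2n P) (λ b → b2n (eqB f b) * b2n P)) (cong₂ _+_ (sum-point l (λ _ → b2n P)) (sum-point f (λ _ → b2n P))))
      where
      each : ∀ b → b2n ((eqB b l orB eqB b f) ∧ P) ≡ b2n (eqB l b) * b2n P + b2n (eqB f b) * b2n P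
      each b rewrite eqB-sym b l | eqB-sym b f with eqB l b in e | eqB f b in e′
      ... | true  | true  = ⊥-elim (l≢f (trans (eqB-true l b e) (≡sym (eqB-true f b e′))))
      ... | true  | false = ≡sym (trans (+-identityʳ _) (+-identityʳ _))
      ... | false | true  = ≡sym (+-identityʳ _)
      ... | false | false = refl

    double-count : ∀ V p → double l f V p ≡ count (follows V p) + count (follows V p)
    double-count V p = trans (sum-cong-≗ (λ x → sum-tag (follows V p x))) (∑-distrib-+ (λ x → b2n (follows V p x)) (λ x → b2n (follows V p x)))

    sum-first : ∀ (P : Fin N → Bool) → sum (λ x → sum (λ b → b2n (eqB b f ∧ P x))) ≡ count P
    sum-first P = sum-cong-≗ (λ x → trans (sum-cong-≗ (λ b → trans (b2n-∧ (eqB b f) (P x)) (cong (λ z → b2n z * b2n (P x)) (eqB-sym b f)))) (sum-point f (λ _ → b2n (P x))))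

    count-between : ∀ (c : Fin N) → count (λ x → ltB f x ∧ ltB x c) ≡ toℕ c ∸ 1
    count-between c = trans (count-cong {N} (λ x → cong (_∧ ltB x c) (trans (cong (_<ᵇ toℕ x) f-zero) (positive (toℕ x))))) (range-count N 1 (toℕ c) (<⇒≤ (FP.toℕ<n c)))
      where
      positive : ∀ m → (0 <ᵇ m) ≡ (1 ≤ᵇ m)
      positive zero    = refl
      positive (suc m) = refl

    kvStep-value : ∀ V p c → kvStep l f V p c ≡
      ((isSym 𝟏 (symAt w (toℕ p)) ∧ not ((count (follows V p) + count (follows V p)) <ᵇ toℕ c)) orB
       (isSym 𝟎 (symAt w (toℕ p)) ∧ not ((count (follows V p) + count (follows V p)) <ᵇ (toℕ c ∸ 1))))
    kvStep-value V p c = cong₂ _orB_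
      (cong (sy 𝟏 p ∧_) (cong not (cong₂ _<ᵇ_ (double-count V p) (trans (sum-first (λ x → ltB x c)) (Reading.count-before w c)))))
      (cong (sy 𝟎 p ∧_) (cong not (cong₂ _<ᵇ_ (double-count V p) (trans (sum-first (λ x → ltB f x ∧ ltB x c)) (count-between c)))))

    -- A position depends only on its successor, so after m rounds the last m positions are correct.
    Read : ℕ → G² → Set
    Read m V = ∀ p → N ≤ toℕ p + m → ∀ c → V p c ≡ (toℕ c <ᵇ value (drop (toℕ p) w))

    read-step : ∀ m V → Read m V → Read (suc m) (kvStep l f V)
    read-step m V r p le c = trans (kvStep-value V p c) (below-value w (toℕ p) (toℕ c) (count (follows V p)) N (FP.toℕ<n c) inside outside (FP.toℕ<n p))
      where
      inside : suc (toℕ p) < N → count (follows V p) ≡ value (drop (suc (toℕ p)) w) ⊓ N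
      inside lt′ = trans (count-cong {N} each) (count-below N (value (drop (suc (toℕ p)) w)))
        where
        q : Fin N
        q = fromℕ< lt′
        q≡ : toℕ q ≡ suc (toℕ p)
        q≡ = FP.toℕ-fromℕ< lt′
        each : ∀ x → follows V p x ≡ (toℕ x <ᵇ value (drop (suc (toℕ p)) w))
        each x = trans (bool-ext
            (λ h → let y , h′ = anyB-elim (λ q → next p q ∧ V q x) h ; a , b = ∧-true {next p y} h′
                   in subst (λ y → V y x ≡ true) (FP.toℕ-injective (trans (next-elim p y a) (≡sym q≡))) b)
            (λ h → anyB-intro (λ q → next p q ∧ V q x) q (∧-intro (next-intro p q q≡) h)))
          (trans (r q (≤-trans le (≤-reflexive (trans (+-suc (toℕ p) m) (cong (_+ m) (≡sym q≡))))) x) (cong (λ k → toℕ x <ᵇ value (drop k w)) q≡))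
      outside : N ≤ suc (toℕ p) → count (follows V p) ≡ 0
      outside le′ = sum-zero {N} (λ x → cong b2n (anyB-never {f = λ q → next p q ∧ V q x} (λ q → not-true (λ h →
        <⇒≱ (FP.toℕ<n q) (≤-trans le′ (≤-reflexive (≡sym (next-elim p q (proj₁ (∧-true {next p q} h))))))))))

    kvB-value : ∀ c → kvB l f f c ≡ (toℕ c <ᵇ value w)
    kvB-value c = trans (loopV-count Read {N} 1 {kvStep l f} read-step 0 (λ _ _ → false)
        (λ p le → ⊥-elim (<⇒≱ (FP.toℕ<n p) (≤-trans le (≤-reflexive (+-identityʳ _)))))
        f (≤-trans (≤-reflexive (≡sym (trans (+-identityʳ _) (*-identityʳ N)))) (m≤n+m _ (toℕ f))) c)
      (cong (λ k → toℕ c <ᵇ value (drop k w)) f-zero)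

  matrix : ∀ {m n} → (Fin m → Fin n → Bool) → List Sym
  matrix {zero}  B = []
  matrix {suc m} B = tabulate (bit ∘ B zero) ++ ♯ ∷ matrix (B ∘ suc)

  encode-matrix : ∀ G k → encode G k ≡ encBin (toBin k) ++ ♯ ∷ matrix (adj G)
  encode-matrix G k = cong (λ r → encBin (toBin k) ++ ♯ ∷ r) (rows id)
    where
    rows : ∀ {m} (g : Fin m → Fin (n G)) →
      concatMap (λ i → map (λ j → bit (adj G i j)) (allFin (n G)) ++ ♯ ∷ []) (tabulate g) ≡ matrix (λ a → adj G (g a))
    rows {zero}  g = refl
    rows {suc m} g = trans (LP.++-assoc (map (λ j → bit (adj G (g zero) j)) (allFin (n G))) (♯ ∷ []) _)
      (cong₂ (λ x y → x ++ ♯ ∷ y) (LP.map-tabulate id (λ j → bit (adj G (g zero) j))) (rows (g ∘ suc)))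

  row-mark : ∀ {m} (h : Fin m → Bool) r c rest {i j} → Mark r c (tabulate (bit ∘ h) ++ ♯ ∷ rest) i j →
    (r ≡ i × ∃ λ b → c + toℕ b ≡ j × h b ≡ true) ⊎ Mark (suc r) 0 rest i j
  row-mark {zero}  h r c rest x = inj₂ x
  row-mark {suc m} h r c rest x with h zero in e
  row-mark {suc m} h r c rest (inj₁ (p , q)) | true = inj₁ (p , zero , trans (+-identityʳ c) q , e)
  row-mark {suc m} h r c rest (inj₂ x) | true with row-mark (h ∘ suc) r (suc c) rest x
  ... | inj₁ (p , b , q , e′) = inj₁ (p , suc b , trans (+-suc c _) q , e′)
  ... | inj₂ y = inj₂ y
  row-mark {suc m} h r c rest x | false with row-mark (h ∘ suc) r (suc c) rest x
  ... | inj₁ (p , b , q , e′) = inj₁ (p , suc b , trans (+-suc c _) q , e′)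
  ... | inj₂ y = inj₂ y

  mark-in-row : ∀ {m} (h : Fin m → Bool) r c rest b → h b ≡ true → Mark r c (tabulate (bit ∘ h) ++ ♯ ∷ rest) r (c + toℕ b)
  mark-in-row h r c rest zero e rewrite e = inj₁ (refl , ≡sym (+-identityʳ c))
  mark-in-row h r c rest (suc b) e with h zero
  ... | true  = inj₂ (subst (Mark r (suc c) (tabulate (bit ∘ h ∘ suc) ++ ♯ ∷ rest) r) (≡sym (+-suc c (toℕ b))) (mark-in-row (h ∘ suc) r (suc c) rest b e))
  ... | false = subst (Mark r (suc c) (tabulate (bit ∘ h ∘ suc) ++ ♯ ∷ rest) r) (≡sym (+-suc c (toℕ b))) (mark-in-row (h ∘ suc) r (suc c) rest b e)

  mark-after-row : ∀ {m} (h : Fin m → Bool) r c rest {i j} → Mark (suc r) 0 rest i j → Mark r c (tabulate (bit ∘ h) ++ ♯ ∷ rest) i j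
  mark-after-row {zero}  h r c rest x = x
  mark-after-row {suc m} h r c rest x with h zero
  ... | true  = inj₂ (mark-after-row (h ∘ suc) r (suc c) rest x)
  ... | false = mark-after-row (h ∘ suc) r (suc c) rest x

  matrix-mark : ∀ {m n} (B : Fin m → Fin n → Bool) r {i j} → Mark r 0 (matrix B) i j → ∃ λ a → ∃ λ b → r + toℕ a ≡ i × toℕ b ≡ j × B a b ≡ true
  matrix-mark {suc m} B r x with row-mark (B zero) r 0 (matrix (B ∘ suc)) x
  ... | inj₁ (p , b , q , e) = zero , b , trans (+-identityʳ r) p , q , e
  ... | inj₂ y = let a , b , p , q , e = matrix-mark (B ∘ suc) (suc r) y in suc a , b , trans (+-suc r _) p , q , e

  mark-matrix : ∀ {m n} (B : Fin m → Fin n → Bool) r a b → B a b ≡ true → Mark r 0 (matrix B) (r + toℕ a) (toℕ b)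
  mark-matrix B r zero    b e = subst (λ i → Mark r 0 (matrix B) i (toℕ b)) (≡sym (+-identityʳ r)) (mark-in-row (B zero) r 0 (matrix (B ∘ suc)) b e)
  mark-matrix B r (suc a) b e = mark-after-row (B zero) r 0 (matrix (B ∘ suc))
    (subst (λ i → Mark (suc r) 0 (matrix (B ∘ suc)) i (toℕ b)) (≡sym (+-suc r (toℕ a))) (mark-matrix (B ∘ suc) (suc r) a b e))

  -- The digits of the number lie in row 0 and therefore cannot be taken for entries of the matrix,
  -- whose rows start at 1.
  number-mark : ∀ x c r {i j} → Mark 0 c (encBin x ++ ♯ ∷ r) (suc i) j → Mark 1 0 r (suc i) j
  number-mark zeroᵇ     c r m = m
  number-mark 2[1+ x ]  c r m = number-mark x (suc c) r m
  number-mark 1+[2 x ]  c r (inj₂ m) = number-mark x (suc c) r m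

  mark-number : ∀ x c r {i j} → Mark 1 0 r i j → Mark 0 c (encBin x ++ ♯ ∷ r) i j
  mark-number zeroᵇ     c r m = m
  mark-number 2[1+ x ]  c r m = mark-number x (suc c) r m
  mark-number 1+[2 x ]  c r m = inj₂ (mark-number x (suc c) r m)

  hashes-number : ∀ x r → all-hashes (encBin x ++ ♯ ∷ r) ≡ suc (all-hashes r)
  hashes-number zeroᵇ    r = refl
  hashes-number 2[1+ x ] r = hashes-number x r
  hashes-number 1+[2 x ] r = hashes-number x r

  hashes-matrix : ∀ {m n} (B : Fin m → Fin n → Bool) → all-hashes (matrix B) ≡ m
  hashes-matrix {zero}  B = refl
  hashes-matrix {suc m} B = trans (row (B zero)) (cong suc (hashes-matrix (B ∘ suc)))
    where
    row : ∀ {n} (h : Fin n → Bool) {rest} → all-hashes (tabulate (bit ∘ h) ++ ♯ ∷ rest) ≡ suc (all-hashes rest)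
    row {zero}  h = refl
    row {suc n} h with h zero
    ... | true  = row (h ∘ suc)
    ... | false = row (h ∘ suc)

  length-matrix : ∀ {m n} (B : Fin m → Fin n → Bool) → length (matrix B) ≡ m * suc n
  length-matrix {zero}  B = refl
  length-matrix {suc m} {n} B = trans (LP.length-++ (tabulate (bit ∘ B zero))) (trans (cong₂ (λ x y → x + suc y) (LP.length-tabulate (bit ∘ B zero)) (length-matrix (B ∘ suc))) (+-suc n (m * suc n)))

  length-number : ∀ x → 1 ≤ fromBin x → 1 ≤ length (encBin x)
  length-number 2[1+ x ] h = s≤s z≤n
  length-number 1+[2 x ] h = s≤s z≤n

  module Encoding (G : Graph) (k : ℕ) (1≤k : 1 ≤ k) where

    word : List Sym
    word = encode G k

    word-mark : ∀ {i j} → Mark 0 0 word (suc i) j → ∃ λ a → ∃ λ b → toℕ a ≡ i × toℕ b ≡ j × adj G a b ≡ true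
    word-mark {i} {j} m =
      let a , b , p , q = matrix-mark (adj G) 1 (number-mark (toBin k) 0 (matrix (adj G)) (subst (λ w → Mark 0 0 w (suc i) j) (encode-matrix G k) m))
      in a , b , suc-injective p , q

    mark-word : ∀ a b → adj G a b ≡ true → Mark 0 0 word (suc (toℕ a)) (toℕ b)
    mark-word a b e = subst (λ w → Mark 0 0 w (suc (toℕ a)) (toℕ b)) (≡sym (encode-matrix G k)) (mark-number (toBin k) 0 (matrix (adj G)) (mark-matrix (adj G) 1 a b e))

    word-hashes : all-hashes word ≡ suc (n G)
    word-hashes = trans (cong all-hashes (encode-matrix G k)) (trans (hashes-number (toBin k) (matrix (adj G))) (cong suc (hashes-matrix (adj G))))

    word-value : value word ≡ k
    word-value = trans (value-encBin (toBin k) _) (toℕ-fromℕ k)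

    -- The matrix has n rows of n + 1 symbols; a ♯ ends the number, and `1 ≤ k` guarantees it at
    -- least one digit.
    word-length : n G * suc (n G) + 2 ≤ length word
    word-length = ≤-trans (≤-reflexive (+-comm (n G * suc (n G)) 2)) (≤-trans (+-monoˡ-≤ (suc (n G * suc (n G))) (length-number (toBin k) (≤-trans 1≤k (≤-reflexive (≡sym (toℕ-fromℕ k))))))
      (≤-reflexive (≡sym (trans (cong length (encode-matrix G k)) (trans (LP.length-++ (encBin (toBin k))) (cong (λ x → length (encBin (toBin k)) + suc x) (length-matrix (adj G))))))))

-- Padding the graph to all positions of the word, and the reduction.

open import Data.Nat using (_<?_)
open import Data.Fin using (inject≤)
open import Data.Product using (Σ)
open Formulas using (b2n; module Semantics)
open PolynomialTime
open Cuts
open Exchanges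
open Trails
open LocalSearch using (sum-bound)
open DecisionFormula
open Outcomes
open Necessity
open Sufficiency
open Words
open Encodings

sum-inject : ∀ {m N} (le : m ≤ N) (f : Fin N → ℕ) → (∀ i → m ≤ toℕ i → f i ≡ 0) → sum f ≡ sum (λ a → f (inject≤ a le))
sum-inject z≤n      f h = sum-zero (λ i → h i z≤n)
sum-inject (s≤s le) f h = cong (f zero +_) (sum-inject le (f ∘ suc) (λ i l → h (suc i) (s≤s l)))

xsum-inject : ∀ {m N} (le : m ≤ N) (f : Fin N → Bool) → (∀ i → m ≤ toℕ i → f i ≡ false) → xsum f ≡ xsum (λ a → f (inject≤ a le))
xsum-inject z≤n      f h = xsum-zero (λ i → h i z≤n)
xsum-inject (s≤s le) f h = cong (f zero xor_) (xsum-inject le (f ∘ suc) (λ i l → h (suc i) (s≤s l)))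

sum≤1 : ∀ {n} (f : Fin n → Bool) → (∀ i j → f i ≡ true → f j ≡ true → i ≡ j) → sum (b2n ∘ f) ≤ 1
sum≤1 f h with sum (b2n ∘ f) in e
... | zero  = z≤n
... | suc m = let i , p = sum-positive (b2n ∘ f) (≤-trans (s≤s z≤n) (≤-reflexive (≡sym e))) ; t = positive-true p
              in ≤-reflexive (trans (≡sym e) (sum-unique f i t (λ j t′ → h j i t′ t)))

darts-bound : ∀ {m} (B : Graph² {m}) → dartsOf B ≤ m * m
darts-bound {m} B = sum-bound (λ u → sum (λ v → b2n (B u v))) m (λ u → ≤-trans (sum-bound (λ v → b2n (B u v)) 1 (λ v → b2n≤1 (B u v))) (≤-reflexive (*-identityʳ m)))
  where
  b2n≤1 : ∀ b → b2n b ≤ 1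
  b2n≤1 true  = ≤-refl
  b2n≤1 false = z≤n

single-bound : ∀ {m} (B : Graph² {m}) → dartsOf (single B) ≤ m
single-bound {m} B = ≤-trans (sum-bound (λ u → sum (λ v → b2n (single B u v))) 1 (λ u → sum≤1 (single B u) (λ v v′ e e′ →
  proj₁ (proj₂ (single-elim B u v′ e′)) v (proj₁ (single-elim B u v e))))) (≤-reflexive (*-identityʳ m))

-- The formula sees a graph on all positions of the word; the positions from m on are isolated in
-- it, and joins of the two graphs correspond.
module Extension {m N : ℕ} (le : m ≤ N) where

  ι : Fin m → Fin N
  ι a = inject≤ a le

  Inside : Fin N → Set
  Inside i = ∃ λ a → ι a ≡ i

  inside : ∀ i → toℕ i < m → Inside i
  inside i l = fromℕ< l , FP.toℕ-injective (trans (FP.toℕ-inject≤ (fromℕ< l) le) (FP.toℕ-fromℕ< l))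

  view : ∀ i → Inside i ⊎ m ≤ toℕ i
  view i with toℕ i <? m
  ... | yes l = inj₁ (inside i l)
  ... | no nl = inj₂ (≮⇒≥ nl)

  ι-inj : ∀ {a b} → ι a ≡ ι b → a ≡ b
  ι-inj {a} {b} e = FP.toℕ-injective (trans (≡sym (FP.toℕ-inject≤ a le)) (trans (cong toℕ e) (FP.toℕ-inject≤ b le)))

  ι-small : ∀ a → toℕ (ι a) < m
  ι-small a = ≤-trans (s≤s (≤-reflexive (FP.toℕ-inject≤ a le))) (FP.toℕ<n a)

  abstract
    pad : Graph² {m} → Graph² {N}
    pad B i j with toℕ i <? m | toℕ j <? m
    ... | yes p | yes q = B (fromℕ< p) (fromℕ< q)
    ... | yes _ | no _  = false
    ... | no _  | _     = false

    pad-ι : ∀ B a b → pad B (ι a) (ι b) ≡ B a b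
    pad-ι B a b with toℕ (ι a) <? m | toℕ (ι b) <? m
    ... | yes p | yes q = cong₂ B (ι-inj (proj₂ (inside (ι a) p))) (ι-inj (proj₂ (inside (ι b) q)))
    ... | yes _ | no n  = ⊥-elim (n (ι-small b))
    ... | no n  | _     = ⊥-elim (n (ι-small a))

    pad-left : ∀ B i j → m ≤ toℕ i → pad B i j ≡ false
    pad-left B i j h with toℕ i <? m | toℕ j <? m
    ... | yes p | _ = ⊥-elim (<⇒≱ p h)
    ... | no _  | _ = refl

    pad-right : ∀ B i j → m ≤ toℕ j → pad B i j ≡ false
    pad-right B i j h with toℕ i <? m | toℕ j <? m
    ... | yes _ | yes q = ⊥-elim (<⇒≱ q h)
    ... | yes _ | no _  = refl
    ... | no _  | _     = refl

  pad-elim : ∀ B i j → pad B i j ≡ true → ∃ λ a → ∃ λ b → ι a ≡ i × ι b ≡ j × B a b ≡ true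
  pad-elim B i j h with view i | view j
  ... | inj₁ (a , refl) | inj₁ (b , refl) = a , b , refl , refl , trans (≡sym (pad-ι B a b)) h
  ... | inj₁ _ | inj₂ l = false≢true h (pad-right B i j l)
  ... | inj₂ l | _      = false≢true h (pad-left B i j l)

  pad-sym : ∀ B → (∀ a b → B a b ≡ B b a) → ∀ i j → pad B i j ≡ pad B j i
  pad-sym B s i j = bool-ext (to i j) (to j i)
    where
    to : ∀ i j → pad B i j ≡ true → pad B j i ≡ true
    to i j h with a , b , refl , refl , e ← pad-elim B i j h = trans (pad-ι B b a) (trans (s b a) e)

  Confined : Graph² {N} → Set
  Confined C = ∀ i j → m ≤ toℕ i ⊎ m ≤ toℕ j → C i j ≡ false

  pad-confined : ∀ B → Confined (pad B)
  pad-confined B i j (inj₁ l) = pad-left B i j l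
  pad-confined B i j (inj₂ l) = pad-right B i j l

  row-inject : ∀ {C} → Confined C → ∀ i → sum (λ j → b2n (C i j)) ≡ sum (λ b → b2n (C i (ι b)))
  row-inject {C} c i = sum-inject le (λ j → b2n (C i j)) (λ j l → cong b2n (c i j (inj₂ l)))

  darts-inject : ∀ {C} → Confined C → dartsOf C ≡ dartsOf (λ a b → C (ι a) (ι b))
  darts-inject {C} c = trans (sum-inject le (λ i → sum (λ j → b2n (C i j))) (λ i l → sum-zero (λ j → cong b2n (c i j (inj₁ l)))))
    (sum-cong-≗ (λ a → row-inject c (ι a)))

  boundary-inject : ∀ {C} → Confined C → ∀ i → xsum (C i) ≡ xsum (λ b → C i (ι b))
  boundary-inject {C} c i = xsum-inject le (C i) (λ j l → c i j (inj₂ l))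

  module _ (B : Graph² {m}) where

    single-pad : ∀ a b → single (pad B) (ι a) (ι b) ≡ single B a b
    single-pad a b = bool-ext to from
      where
      to : single (pad B) (ι a) (ι b) ≡ true → single B a b ≡ true
      to h with single-elim (pad B) (ι a) (ι b) h
      ... | e , p , q with single-cases B a b (trans (≡sym (pad-ι B a b)) e)
      ... | inj₁ s = s
      ... | inj₂ (inj₁ (x , e′ , ne)) = ⊥-elim (ne (ι-inj (p (ι x) (trans (pad-ι B a x) e′))))
      ... | inj₂ (inj₂ (x , e′ , ne)) = ⊥-elim (ne (ι-inj (q (ι x) (trans (pad-ι B b x) e′))))
      from : single B a b ≡ true → single (pad B) (ι a) (ι b) ≡ true
      from h with single-elim B a b h
      ... | e , p , q with single-cases (pad B) (ι a) (ι b) (trans (pad-ι B a b) e)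
      ... | inj₁ s = s
      ... | inj₂ (inj₁ (x , e′ , ne)) = ⊥-elim (ne (other (pad-elim B (ι a) x e′)))
        where
        other : (∃ λ c → ∃ λ d → ι c ≡ ι a × ι d ≡ x × B c d ≡ true) → x ≡ ι b
        other (c , d , u , refl , t) = cong ι (p d (subst (λ z → B z d ≡ true) (ι-inj u) t))
      ... | inj₂ (inj₂ (x , e′ , ne)) = ⊥-elim (ne (other (pad-elim B (ι b) x e′)))
        where
        other : (∃ λ c → ∃ λ d → ι c ≡ ι b × ι d ≡ x × B c d ≡ true) → x ≡ ι a
        other (c , d , u , refl , t) = cong ι (q d (subst (λ z → B z d ≡ true) (ι-inj u) t))

    single-darts : dartsOf (single (pad B)) ≡ dartsOf (single B)
    single-darts = trans (darts-inject (λ i j o → not-true (λ e → false≢true (proj₁ (single-elim (pad B) i j e)) (pad-confined B i j o))))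
      (sum²-cong (λ a b → cong b2n (single-pad a b)))

    pad-darts : dartsOf (pad B) ≡ dartsOf B
    pad-darts = trans (darts-inject (pad-confined B)) (sum²-cong (λ a b → cong b2n (pad-ι B a b)))

    restrict : ∀ {K} → TJoin (pad B) K → TJoin B (λ a b → K (ι a) (ι b)) × dartsOf K ≡ dartsOf (λ a b → K (ι a) (ι b))
    restrict {K} j = record
      { t-sym = λ a b → t-sym (ι a) (ι b)
      ; t-adj = λ a b e → trans (≡sym (pad-ι B a b)) (t-adj (ι a) (ι b) e)
      ; t-bd  = λ a → trans (≡sym (boundary-inject confined (ι a))) (trans (t-bd (ι a)) (trans (boundary-inject (pad-confined B) (ι a)) (xsum-cong (pad-ι B a))))
      } , darts-inject confined
      where
      open TJoin j
      confined : Confined K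
      confined u v o = not-true (λ e → false≢true (t-adj u v e) (pad-confined B u v o))

    extend : ∀ {K} → TJoin B K → TJoin (pad B) (pad K)
    extend {K} j = record { t-sym = pad-sym K t-sym ; t-adj = adj′ ; t-bd = bd }
      where
      open TJoin j
      adj′ : ∀ u v → pad K u v ≡ true → pad B u v ≡ true
      adj′ u v h with a , b , refl , refl , e ← pad-elim K u v h = trans (pad-ι B a b) (t-adj a b e)
      bd : ∀ v → xsum (pad K v) ≡ xsum (pad B v)
      bd v with view v
      ... | inj₂ l = trans (xsum-zero (λ x → pad-left K v x l)) (≡sym (xsum-zero (λ x → pad-left B v x l)))
      ... | inj₁ (a , refl) = trans (boundary-inject (pad-confined K) (ι a)) (trans (xsum-cong (pad-ι K a)) (trans (t-bd a)
              (≡sym (trans (boundary-inject (pad-confined B) (ι a)) (xsum-cong (pad-ι B a))))))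

module Reduction (G : Graph) (k : ℕ) (1≤k : 1 ≤ k) (s : Sym) (w′ : List Sym) (e : encode G k ≡ s ∷ w′) where

  open Encoding G k 1≤k

  N : ℕ
  N = suc (length w′)

  long : n G * suc (n G) + 2 ≤ N
  long = ≤-trans word-length (≤-reflexive (cong length e))

  n≤n*sn : n G ≤ n G * suc (n G)
  n≤n*sn = ≤-trans (m≤m+n (n G) (n G * n G)) (≤-reflexive (≡sym (*-suc (n G) (n G))))

  n*n≤ : n G * n G ≤ n G * suc (n G)
  n*n≤ = *-monoʳ-≤ (n G) (n≤1+n (n G))

  2≤ : 1 ≤ length w′
  2≤ = ≤-pred (≤-trans (m≤n+m 2 (n G * suc (n G))) long)

  n≤N : n G ≤ N
  n≤N = ≤-trans n≤n*sn (≤-trans (m≤m+n _ 2) long)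

  open Decision s w′ 2≤
  open Meaning (s ∷ w′)
  open Extension n≤N

  A : G²
  A = pad (adj G)

  V W : Ix → Bool
  V u = toℕ u <ᵇ n G
  W u = toℕ u <ᵇ k

  A-eq : ∀ u v → adjB u v ≡ A u v
  A-eq u v = bool-ext to from
    where
    to : adjB u v ≡ true → A u v ≡ true
    to h = let a , b , p , q , t = word-mark (subst (λ w → Mark 0 0 w (suc (toℕ u)) (toℕ v)) (≡sym e) (Reading.adjB-mark (s ∷ w′) u v h))
           in subst₂ (λ x y → A x y ≡ true) (FP.toℕ-injective (trans (FP.toℕ-inject≤ a n≤N) p)) (FP.toℕ-injective (trans (FP.toℕ-inject≤ b n≤N) q)) (trans (pad-ι (adj G) a b) t)
    from : A u v ≡ true → adjB u v ≡ true
    from h with a , b , refl , refl , t ← pad-elim (adj G) u v h = Reading.mark-adjB (s ∷ w′) (ι a) (ι b)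
      (subst₂ (λ x y → Mark 0 0 (s ∷ w′) (suc x) y) (≡sym (FP.toℕ-inject≤ a n≤N)) (≡sym (FP.toℕ-inject≤ b n≤N))
        (subst (λ w → Mark 0 0 w (suc (toℕ a)) (toℕ b)) e (mark-word a b t)))

  V-eq : ∀ u → vertB u ≡ V u
  V-eq u = trans (Reading.vertB-hashes (s ∷ w′) u) (cong (suc (toℕ u) <ᵇ_) (trans (cong all-hashes (≡sym e)) word-hashes))

  W-eq : ∀ u → kvB l f f u ≡ W u
  W-eq u = trans (ReadingNumber.kvB-value (s ∷ w′) l f l≢f refl u) (cong (toℕ u <ᵇ_) (trans (cong value (≡sym e)) word-value))

  A-irr : ∀ u → A u u ≡ false
  A-irr u = not-true (λ h → let a , b , p , q , t = pad-elim (adj G) u u h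
    in false≢true (subst (λ x → adj G a x ≡ true) (ι-inj (trans q (≡sym p))) t) (irrefl G a))

  A-l : ∀ v → A l v ≡ false
  A-l v = pad-left (adj G) l v (≤-trans (≤-pred (≤-trans (s≤s n≤n*sn) (≤-trans (≤-trans (n≤1+n _) (≤-reflexive (+-comm 2 _))) long))) (≤-reflexive (≡sym (FP.toℕ-fromℕ (length w′)))))

  few : sum² (λ u v → b2n (A u v)) < N
  few = ≤-trans (s≤s (≤-trans (≤-reflexive (pad-darts (adj G))) (≤-trans (darts-bound (adj G)) n*n≤)))
    (≤-trans (≤-trans (n≤1+n _) (≤-reflexive (+-comm 2 _))) long)

  V-count : count V ≡ n G
  V-count = trans (count-below N (n G)) (m≤n⇒m⊓n≡m n≤N)

  W-count : count W ≡ k ⊓ N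
  W-count = count-below N k

  k2-darts : dartCount (k2B A) ≡ dartsOf (single (adj G))
  k2-darts = trans (sum²-cong (λ u v → cong b2n (≡sym (single-def A u v)))) (single-darts (adj G))

  join⇒ : ∀ {K} → Join A K → TJoin A K
  join⇒ j = record { t-sym = Join.k-sym j ; t-adj = Join.k-adj j ; t-bd = Join.k-bd j }

  join⇐ : ∀ {K} → TJoin A K → Join A K
  join⇐ j = record { k-sym = TJoin.t-sym j ; k-adj = TJoin.t-adj j ; k-bd = TJoin.t-bd j }

  fits⇒feasible : ∀ J → Join A J → Fits A V W J → Feasible G k
  fits⇒feasible J j (iso , le) = no-isolated , (λ a b → J (ι a) (ι b)) , proj₁ r ,
    ≤-trans (≤-reflexive (cong₂ _+_ (cong₂ _+_ (≡sym (pad-darts (adj G))) (≡sym (proj₂ r))) (≡sym (cong₂ _+_ k2-darts k2-darts))))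
      (≤-trans le (+-mono-≤ (≤-reflexive (cong₂ _+_ V-count V-count)) (+-mono-≤ small small)))
    where
    r : TJoin (adj G) (λ a b → J (ι a) (ι b)) × dartsOf J ≡ dartsOf (λ a b → J (ι a) (ι b))
    r = restrict (adj G) (join⇒ j)
    small : count W ≤ k
    small = ≤-trans (≤-reflexive W-count) (m⊓n≤m k N)
    no-isolated : ∀ u → ∃ λ x → adj G u x ≡ true
    no-isolated u = let x , h = iso (ι u) (<ᵇ-intro (ι-small u)) ; a , b , p , q , t = pad-elim (adj G) (ι u) x h
                    in b , subst (λ z → adj G z b ≡ true) (ι-inj p) t

  feasible⇒fits : ∀ J → Join A J → (∀ K → Join A K → dartCount J ≤ dartCount K) → Feasible G k → Fits A V W J
  feasible⇒fits J j least′ (no-isolated , K , jK , le) = iso ,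
    ≤-trans (≤-reflexive (cong₂ _+_ (cong (_+ dartCount J) (pad-darts (adj G))) (cong₂ _+_ k2-darts k2-darts)))
      (≤-trans bound (≤-reflexive (≡sym (cong₂ _+_ (cong₂ _+_ V-count V-count) (cong₂ _+_ W-count W-count)))))
    where
    iso : ∀ v → V v ≡ true → ∃ λ u → A v u ≡ true
    iso v h with a , refl ← inside v (true-<ᵇ (toℕ v) (n G) h) = let x , t = no-isolated a in ι x , trans (pad-ι (adj G) a x) t
    dJ≤dK : dartCount J ≤ dartsOf K
    dJ≤dK = ≤-trans (least′ (pad K) (join⇐ (extend (adj G) jK))) (≤-reflexive (pad-darts K))
    dA dS : ℕ
    dA = dartsOf (adj G)
    dS = dartsOf (single (adj G))
    bound : (dA + dartCount J) + (dS + dS) ≤ (n G + n G) + (k ⊓ N + k ⊓ N)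
    bound with ≤-total k N
    ... | inj₁ l = ≤-trans (+-monoˡ-≤ (dS + dS) (+-monoʳ-≤ dA dJ≤dK)) (≤-trans le (≤-reflexive (cong (λ x → (n G + n G) + (x + x)) (≡sym (m≤n⇒m⊓n≡m l)))))
    -- If k is at least the word length, the formula sees only N in place of k. The inequality then
    -- holds anyway: E and J have at most n² ≤ N darts each, and the K₂ components have at most n
    -- darts.
    ... | inj₂ l = ≤-trans (+-mono-≤ (+-mono-≤ (darts-bound (adj G)) (≤-trans dJ≤dK (darts-bound K))) (+-mono-≤ (single-bound (adj G)) (single-bound (adj G))))
                     (≤-trans (≤-reflexive (+-comm (n G * n G + n G * n G) (n G + n G))) (+-monoʳ-≤ (n G + n G)
                       (≤-trans (+-mono-≤ square square) (≤-reflexive (cong (λ x → x + x) (≡sym (m≥n⇒m⊓n≡n l)))))))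
      where
      square : n G * n G ≤ N
      square = ≤-trans n*n≤ (≤-trans (m≤m+n _ 2) long)

  Decided : Bool → Set
  Decided b = (b ≡ true → CGIVS G k) × (CGIVS G k → b ≡ true)

  decided : ∀ {b} → (∃ λ J → Join A J × (∀ K → Join A K → dartCount J ≤ dartCount K) × b ≡ finalB l f A V W J) → Decided b
  decided (J , j , least′ , eq) =
    (λ h → backward G k (fits⇒feasible J j (finalB-sound A V W J (trans (≡sym eq) h)))) ,
    (λ y → trans eq (finalB-complete A V W J (feasible⇒fits J j least′ (forward G k y))))

  decides : ∀ ρ Ξ r s → r ≡ 8 → s ≡ 21 → Decided (⟦ decideF ⟧ 0 0 ρ Ξ)
  decides ρ Ξ r s er es = subst Decided (decideB-def ρ Ξ) (decided (outcome A V W A-eq V-eq W-eq (pad-sym (adj G) (Graph.sym G)) A-irr A-l few ρ Ξ r s er es))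

Formula-machine : (∀ w → Semantics.Env w → Semantics.Rels w → Bool) → Set
Formula-machine F = Σ TM λ M → Σ ℕ λ c → Σ ℕ λ d → ∀ w → 1 ≤ length w → (ρ : Semantics.Env w) (Ξ : Semantics.Rels w) →
  Σ ℕ λ t → t ≤ c * length w ^ d + c × HaltsWith M w t (F w ρ Ξ)

-- Abstracting over the evaluation `F` keeps the decision formula folded while the answer is
-- assembled.
from-machine : ∀ F → Formula-machine F →
  (∀ G k → 1 ≤ k → ∀ s w′ → encode G k ≡ s ∷ w′ → ∀ ρ Ξ → (F (s ∷ w′) ρ Ξ ≡ true → CGIVS G k) × (CGIVS G k → F (s ∷ w′) ρ Ξ ≡ true)) →
  PolyTimeDecidable CGIVS
from-machine F (M , c , d , machine) correct = M , c , d , λ G k 1≤k → answer G k 1≤k (encode G k) refl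
  where
  answer : ∀ G k → 1 ≤ k → ∀ w → encode G k ≡ w →
    Σ ℕ λ t → Σ Bool λ b → t ≤ c * length w ^ d + c × HaltsWith M w t b × (b ≡ true → CGIVS G k) × (CGIVS G k → b ≡ true)
  answer G k 1≤k [] e with () ← ≤-trans (≤-trans (m≤n+m 2 _) (Encoding.word-length G k 1≤k)) (≤-reflexive (cong length e))
  answer G k 1≤k (s ∷ w′) e =
    let t , le , h = machine (s ∷ w′) (s≤s z≤n) (λ _ → zero) (λ _ _ → false)
        sound , complete = correct G k 1≤k s w′ e (λ _ → zero) (λ _ _ → false)
    in t , F (s ∷ w′) (λ _ → zero) (λ _ _ → false) , le , h , sound , complete

theorem6 : PolyTimeDecidable CGIVS
theorem6 = from-machine (λ w → Semantics.⟦_⟧ w decideF 0 0) (formula-polytime decideF decide-wf)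
  -- Eight variables repeat the sweep and 21 describe a choice; together they are the 29 variables
  -- of the outer iteration.
  (λ G k 1≤k s w′ e ρ Ξ → Reduction.decides G k 1≤k s w′ e ρ Ξ 8 21 refl refl)
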